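{- Let $\mathsf{M}$ be a paving matroid of rank $k$ on a ground set of cardinality $n$. Then \[\underline{\mathrm{H}}_{\mathsf{M}}(x)=\underline{\mathrm{H}}_{\mathsf{U}_{k,n}}(x)-\sum_{h\ge k}\lambda_h\Bigl(\underline{\mathrm{H}}_{\mathsf{U}_{k,h+1}}(x)-\underline{\mathrm{H}}_{\mathsf{U}_{k-1,h}\oplus\mathsf{U}_{1,1}}(x)\Bigr),\] \[\mathrm{H}_{\mathsf{M}}(x)=\mathrm{H}_{\mathsf{U}_{k,n}}(x)-\sum_{h\ge k}\lambda_h\Bigl(\mathrm{H}_{\mathsf{U}_{k,h+1}}(x)-\mathrm{H}_{\mathsf{U}_{k-1,h}\oplus\mathsf{U}_{1,1}}(x)\Bigr),\] where $\lambda_h$ denotes the number of stressed hyperplanes of size $h$ in $\mathsf{M}$.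
   Context: A matroid of rank $k$ is paving if all its circuits have size at least $k$. $\mathsf{U}_{a,b}$ is the uniform matroid of rank $a$ on $b$ elements, $\oplus$ the direct sum. A subset $A$ of the ground set is stressed if both the restriction $\mathsf{M}|_A$ and the contraction $\mathsf{M}/A$ are uniform matroids; a stressed hyperplane is a stressed subset that is a flat of rank $k-1$. For a loopless matroid $\mathsf{M}$ on $E$ with lattice of flats $\mathcal{L}(\mathsf{M})$: $\underline{\mathrm{H}}_{\mathsf{M}}$ is the Hilbert series of the Chow ring $\mathbb{Q}[x_F:F\in\mathcal{L}(\mathsf{M})\smallsetminus\{\varnothing,E\}]/(I+J)$ ($I$ generated by $x_{F_1}x_{F_2}$ for incomparable flats; $J$ by $\sum_{F\ni i}x_F-\sum_{F\ni j}x_F$), and $\mathrm{H}_{\mathsf{M}}$ is the Hilbert series of the augmented Chow ring $\mathbb{Q}[x_F,y_i:F\in\mathcal{L}(\mathsf{M})\smallsetminus\{E\},i\in E]/(I'+J')$ ($I'$ generated by $y_i-\sum_{F\not\ni i}x_F$; $J'$ by $x_{F_1}x_{F_2}$ for incomparable flats and $y_ix_F$ for $i\notin F$), all generators of degree 1. Conventions for matroids with loops: $\underline{\mathrm{H}}_{\mathsf{M}}(x):=0$ and $\mathrm{H}_{\mathsf{M}}(x):=\mathrm{H}_{\mathsf{M}\smallsetminus\{\text{loops}\}}(x)$. -}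

module Defs where

open import Data.Bool using (Bool; true; false; not; _∧_; _∨_; if_then_else_; T)
open import Data.Nat as ℕ using (ℕ; zero; suc; _≤_; _<_; _⊓_; _∸_; _≡ᵇ_)
open import Data.Integer as ℤ using (ℤ; +_)
open import Data.Rational as ℚ using (ℚ; 0ℚ; 1ℚ)
open import Data.Fin as Fin using (Fin; _↑ˡ_; _↑ʳ_)
open import Data.Fin.Subset using (Subset; ⊤; ⊥; ⁅_⁆; _∪_; _∩_; ∁; ∣_∣; _⊆_)
open import Data.List as List using (List; []; _∷_; _++_; filterᵇ; length; concat; concatMap; foldr)
open import Data.Vec as Vec using (Vec; lookup; tabulate; take; drop)
import Data.Vec.Properties as VecP
open import Data.Product using (Σ; _×_; _,_; proj₁; proj₂)
open import Relation.Nullary using (¬_; does)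
open import Relation.Binary.PropositionalEquality using (_≡_; _≢_)

RankFn : ℕ → Set
RankFn n = Subset n → ℕ

record Matroid (n : ℕ) : Set where
  field
    rank       : RankFn n
    rank-bound : ∀ S → rank S ≤ ∣ S ∣
    rank-mono  : ∀ {S T} → S ⊆ T → rank S ≤ rank T
    rank-submod : ∀ S T → rank (S ∪ T) ℕ.+ rank (S ∩ T) ≤ rank S ℕ.+ rank T

IsCircuit : ∀ {n} → Matroid n → Subset n → Set
IsCircuit M C = (rank C < ∣ C ∣) × (∀ D → D ⊆ C → D ≢ C → rank D ≡ ∣ D ∣)
  where open Matroid M

IsPavingOfRank : ∀ {n} → Matroid n → ℕ → Set
IsPavingOfRank M k = (Matroid.rank M ⊤ ≡ k) × (∀ C → IsCircuit M C → k ≤ ∣ C ∣)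

uniformRank : (a b : ℕ) → RankFn b
uniformRank a b S = a ⊓ ∣ S ∣

_⊕_ : ∀ {a b} → RankFn a → RankFn b → RankFn (a ℕ.+ b)
_⊕_ {a} {b} r₁ r₂ S = r₁ (take a S) ℕ.+ r₂ (drop a S)

allSubsets : ∀ n → List (Subset n)
allSubsets zero = Vec.[] ∷ []
allSubsets (suc n) = List.map (true Vec.∷_) (allSubsets n) ++ List.map (false Vec.∷_) (allSubsets n)

allᵇ : ∀ {A : Set} → (A → Bool) → List A → Bool
allᵇ p = foldr (λ x b → p x ∧ b) true

anyᵇ : ∀ {A : Set} → (A → Bool) → List A → Bool
anyᵇ p = foldr (λ x b → p x ∨ b) false

_=ˢ_ : ∀ {n} → Subset n → Subset n → Bool
S =ˢ T = does (VecP.≡-dec Data.Bool._≟_ S T)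
  where import Data.Bool

_⊆ᵇ_ : ∀ {n} → Subset n → Subset n → Bool
_⊆ᵇ_ {n} S T = allᵇ (λ i → not (lookup S i) ∨ lookup T i) (List.allFin n)

isUniformOn : ∀ {n} → RankFn n → Subset n → Bool
isUniformOn {n} rk E =
  allᵇ (λ S → not (S ⊆ᵇ E) ∨ (rk S ≡ᵇ (∣ S ∣ ⊓ rk E))) (allSubsets n)

-- rank function of the contraction M/A (on the ground set ∁ A)
contractRank : ∀ {n} → RankFn n → Subset n → RankFn n
contractRank rk A S = rk (S ∪ A) ∸ rk A

isFlatIn : ∀ {n} → RankFn n → Subset n → Subset n → Bool
isFlatIn {n} rk E F = (F ⊆ᵇ E) ∧
  allᵇ (λ i → not (lookup E i ∧ not (lookup F i)) ∨ not (rk (F ∪ ⁅ i ⁆) ≡ᵇ rk F))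
       (List.allFin n)

isStressed : ∀ {n} → RankFn n → Subset n → Bool
isStressed rk A = isUniformOn rk A ∧ isUniformOn (contractRank rk A) (∁ A)

isStressedHyperplane : ∀ {n} → RankFn n → Subset n → Bool
isStressedHyperplane rk A =
  isStressed rk A ∧ isFlatIn rk ⊤ A ∧ ((rk A ℕ.+ 1) ≡ᵇ rk ⊤)

numStressedHyperplanes : ∀ {n} → RankFn n → ℕ → ℕ
numStressedHyperplanes {n} rk h =
  length (filterᵇ (λ A → isStressedHyperplane rk A ∧ (∣ A ∣ ≡ᵇ h)) (allSubsets n))

isLoop : ∀ {n} → RankFn n → Fin n → Bool
isLoop rk i = rk ⁅ i ⁆ ≡ᵇ 0

hasLoop : ∀ {n} → RankFn n → Bool
hasLoop {n} rk = anyᵇ (isLoop rk) (List.allFin n)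

nonLoops : ∀ {n} → RankFn n → Subset n
nonLoops rk = tabulate (λ i → not (isLoop rk i))

-- Polynomials over ℚ in variables x₀ … x_{N-1}
-- (finite lists of terms; the polynomial is the sum of its terms)

Mono : ℕ → Set
Mono N = Vec ℕ N

Poly : ℕ → Set
Poly N = List (ℚ × Mono N)

coeff : ∀ {N} → Poly N → Mono N → ℚ
coeff p μ = foldr (λ t acc → if does (VecP.≡-dec ℕ._≟_ (proj₂ t) μ) then proj₁ t ℚ.+ acc else acc) 0ℚ p

var : ∀ {N} → Fin N → Poly N
var i = (1ℚ , tabulate (λ j → if does (i Fin.≟ j) then 1 else 0)) ∷ []

_+ᵖ_ : ∀ {N} → Poly N → Poly N → Poly N
p +ᵖ q = p ++ q

scaleᵖ : ∀ {N} → ℚ → Poly N → Poly N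
scaleᵖ c = List.map (λ t → (c ℚ.* proj₁ t , proj₂ t))

_-ᵖ_ : ∀ {N} → Poly N → Poly N → Poly N
p -ᵖ q = p ++ scaleᵖ (ℚ.- 1ℚ) q

_*ᵖ_ : ∀ {N} → Poly N → Poly N → Poly N
p *ᵖ q = concatMap (λ s → List.map (λ t → (proj₁ s ℚ.* proj₁ t , Vec.zipWith ℕ._+_ (proj₂ s) (proj₂ t))) q) p

sumᵖ : ∀ {N} → List (Poly N) → Poly N
sumᵖ = concat

Homogeneous : ∀ {N} → ℕ → Poly N → Set
Homogeneous d p = ∀ μ → coeff p μ ≢ 0ℚ → Vec.sum μ ≡ d

record Presentation : Set where
  constructor pres
  field
    nvars : ℕ
    gens  : List (Poly nvars)

module _ (P : Presentation) where
  open Presentation P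

  InIdeal : Poly nvars → Set
  InIdeal p = Σ (Vec (Poly nvars) (length gens)) λ cs →
    ∀ μ → coeff p μ ≡ coeff (sumᵖ (Vec.toList (Vec.zipWith _*ᵖ_ cs (Vec.fromList gens)))) μ

  linComb : ∀ {r} → Vec ℚ r → Vec (Poly nvars) r → Poly nvars
  linComb cs ps = sumᵖ (Vec.toList (Vec.zipWith scaleᵖ cs ps))

  IndependentMod : ∀ {r} → Vec (Poly nvars) r → Set
  IndependentMod {r} ps = ∀ (cs : Vec ℚ r) → InIdeal (linComb cs ps) → ∀ j → lookup cs j ≡ 0ℚ

  HilbertCoeff : ℕ → ℕ → Set
  HilbertCoeff d r =
    (Σ (Vec (Poly nvars) r) λ ps → (∀ j → Homogeneous d (lookup ps j)) × IndependentMod ps)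
    × (∀ (ps : Vec (Poly nvars) (suc r)) → (∀ j → Homogeneous d (lookup ps j)) → ¬ IndependentMod ps)

  IsHilbertSeries : (ℕ → ℕ) → Set
  IsHilbertSeries f = ∀ d → HilbertCoeff d (f d)

-- Chow ring of a loopless matroid (ground set Fin n)

module _ {n : ℕ} (rk : RankFn n) where

  chowFlats : List (Subset n)
  chowFlats = filterᵇ (λ F → isFlatIn rk ⊤ F ∧ not (F =ˢ ⊥) ∧ not (F =ˢ ⊤)) (allSubsets n)

  chowPresentation : Presentation
  chowPresentation = pres N (Igens ++ Jgens)
    where
    N = length chowFlats
    fl : Fin N → Subset n
    fl = List.lookup chowFlats
    incomparable : Subset n → Subset n → Bool
    incomparable F G = not (F ⊆ᵇ G) ∧ not (G ⊆ᵇ F)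
    Igens : List (Poly N)
    Igens = concatMap (λ p → List.map (λ q → var p *ᵖ var q)
              (filterᵇ (λ q → incomparable (fl p) (fl q)) (List.allFin N))) (List.allFin N)
    lin : Fin n → Poly N
    lin i = sumᵖ (List.map var (filterᵇ (λ p → lookup (fl p) i) (List.allFin N)))
    Jgens : List (Poly N)
    Jgens = concatMap (λ i → List.map (λ j → lin i -ᵖ lin j) (List.allFin n)) (List.allFin n)

-- augmented Chow ring of M|E (E = ground set, here the set of non-loops)
module _ {n : ℕ} (rk : RankFn n) (E : Subset n) where

  augFlats : List (Subset n)
  augFlats = filterᵇ (λ F → isFlatIn rk E F ∧ not (F =ˢ E)) (allSubsets n)

  groundList : List (Fin n)
  groundList = filterᵇ (lookup E) (List.allFin n)

  augPresentation : Presentation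
  augPresentation = pres (N' Data.Nat.+ m) (I'gens ++ J'gens)
    where
    import Data.Nat
    N' = length augFlats
    m  = length groundList
    fl : Fin N' → Subset n
    fl = List.lookup augFlats
    el : Fin m → Fin n
    el = List.lookup groundList
    x : Fin N' → Poly (N' Data.Nat.+ m)
    x p = var (p ↑ˡ m)
    y : Fin m → Poly (N' Data.Nat.+ m)
    y t = var (N' ↑ʳ t)
    incomparable : Subset n → Subset n → Bool
    incomparable F G = not (F ⊆ᵇ G) ∧ not (G ⊆ᵇ F)
    I'gens : List (Poly (N' Data.Nat.+ m))
    I'gens = List.map (λ t → y t -ᵖ sumᵖ (List.map x (filterᵇ (λ p → not (lookup (fl p) (el t))) (List.allFin N'))))
               (List.allFin m)
    J'gens : List (Poly (N' Data.Nat.+ m))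
    J'gens =
      concatMap (λ p → List.map (λ q → x p *ᵖ x q)
        (filterᵇ (λ q → incomparable (fl p) (fl q)) (List.allFin N'))) (List.allFin N')
      ++ concatMap (λ t → List.map (λ p → y t *ᵖ x p)
        (filterᵇ (λ p → not (lookup (fl p) (el t))) (List.allFin N'))) (List.allFin m)

-- The Hilbert series  H̲_M  and  H_M  (as coefficient sequences),
-- with the conventions for matroids with loops.

IsChowHilbertSeries : ∀ {n} → RankFn n → (ℕ → ℕ) → Set
IsChowHilbertSeries rk f =
  if hasLoop rk then (∀ d → f d ≡ 0) else IsHilbertSeries (chowPresentation rk) f

IsAugChowHilbertSeries : ∀ {n} → RankFn n → (ℕ → ℕ) → Set
IsAugChowHilbertSeries rk f = IsHilbertSeries (augPresentation rk (nonLoops rk)) f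

sumFromTo : ℕ → ℕ → (ℕ → ℤ) → ℤ
sumFromTo a b f = foldr (λ i acc → f (a ℕ.+ i) ℤ.+ acc) (+ 0) (List.upTo (suc b ∸ a))

{-# OPTIONS --safe #-}

-- Add a generator x_E to either Chow ring, normalised by Σ_{F ∋ i} x_F = 0 (Chow ring) respectively
-- Σ_F x_F = 0 (augmented Chow ring), and put h_S = Σ_{F ⊇ S} x_F for S ≠ ∅.  These elements generate, h_S
-- depends only on the closure of S, and (h_S - h_K)(h_T - h_K) = 0 for flats S, T with join K.  Call ρ the rank
-- in the Chow ring and the rank plus one on nonempty sets in the augmented ring.  Straightening with the
-- relations shows that the ring is spanned by the products Π h_{F_i}^{a_i} over chains of nonempty flats
-- F_1 ⊂ F_2 ⊂ ... with 0 < a_i < ρ(F_i) - ρ(F_{i-1}).  They are independent: for each such chain a Hall–Rado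
-- condition, imposed layer by layer on the numbers #{S ∈ m : S ⊆ U}, selects a set of monomials m in the h_S;
-- by an uncrossing argument its indicator function vanishes on the ideal, and on the spanning products these
-- functionals are triangular.  The Hilbert series therefore counts the standard chains.
--
-- In a paving matroid of rank k ≥ 2 the flats are the sets with at most k - 2 elements, the hyperplanes and E,
-- and since the gap from a hyperplane to E is 1, a standard chain through a hyperplane ends there.  The count is
-- therefore a number depending on k and n only, plus a sum over the hyperplanes H of a function of |H|.  As every
-- (k-1)-subset lies in exactly one hyperplane, this sum can be compared with the one for U_{k,n}, whose
-- hyperplanes are the (k-1)-subsets; the same count for U_{k,h+1} and U_{k-1,h} ⊕ U_{1,1} identifies the
-- contribution of a hyperplane of size h.
module Submission where

-- Functionals are defined on monomials in h_S for arbitrary subsets S, not only for flats. Hence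
-- the x_F can be recovered by Möbius inversion in the Boolean lattice: x_F goes to the alternating
-- sum of the h_S over S ⊇ F, and a non-flat contributes 0 because the functionals do not
-- distinguish S from its closure. The functionals compatible with all relations are stable under
-- multiplication by linear forms, so a presentation is tested on its finitely many generators.
--
-- Both rings are treated at once through a polymatroid whose points may have rank 2. The one
-- irregularity of the augmented ring is the jump by 2 from the empty set to a point; this is why so
-- many arguments single out the empty set.
--
-- The count of chains requires rank at least 2, so that the empty set is not a hyperplane. In ranks
-- 0 and 1 loops are possible, the conventions for loops decide the Chow series, and presentations
-- on a large ground set are compared with those of a single point or of the empty matroid.

module ListSums where

  open import Algebra.Bundles using (CommutativeRing)
  open import Level using (0ℓ)
  open import Data.Bool using (Bool; true; false; if_then_else_)
  open import Data.List using (List; []; _∷_; _++_; map; concatMap; filterᵇ; allFin; lookup; length)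
  import Data.List.Properties as ListP
  open import Data.List.Membership.Propositional using (_∈_)
  open import Data.List.Relation.Unary.Any using (here; there)
  open import Data.List.Relation.Unary.All using (All; []; _∷_)
  open import Data.List.Relation.Unary.AllPairs using ([]; _∷_)
  import Data.List.Relation.Unary.All as All
  open import Data.List.Relation.Unary.Unique.Propositional using (Unique)
  open import Relation.Binary.PropositionalEquality as ≡ using (_≡_; _≢_)

  -- Finite sums over lists in a commutative ring

  module Sums (R : CommutativeRing 0ℓ 0ℓ) where
    open CommutativeRing R
    open import Relation.Binary.Reasoning.Setoid setoid

    ∑ : {A : Set} → List A → (A → Carrier) → Carrier
    ∑ []       f = 0#
    ∑ (x ∷ xs) f = f x + ∑ xs f

    when : Bool → Carrier → Carrier
    when b x = if b then x else 0#

    module _ {A : Set} where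

      ∑-cong-∈ : ∀ xs {f g : A → Carrier} → (∀ x → x ∈ xs → f x ≈ g x) → ∑ xs f ≈ ∑ xs g
      ∑-cong-∈ []       e = refl
      ∑-cong-∈ (x ∷ xs) e = +-cong (e x (here ≡.refl)) (∑-cong-∈ xs (λ y i → e y (there i)))

      ∑-cong : ∀ xs {f g : A → Carrier} → (∀ x → f x ≈ g x) → ∑ xs f ≈ ∑ xs g
      ∑-cong xs e = ∑-cong-∈ xs (λ x _ → e x)

      ∑-zero : ∀ xs {f : A → Carrier} → (∀ x → f x ≈ 0#) → ∑ xs f ≈ 0#
      ∑-zero []       e = refl
      ∑-zero (x ∷ xs) e = trans (+-cong (e x) (∑-zero xs e)) (+-identityˡ 0#)

      ∑-++ : ∀ xs ys (f : A → Carrier) → ∑ (xs ++ ys) f ≈ ∑ xs f + ∑ ys f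
      ∑-++ []       ys f = sym (+-identityˡ _)
      ∑-++ (x ∷ xs) ys f = trans (+-congˡ (∑-++ xs ys f)) (sym (+-assoc _ _ _))

      interchange : ∀ a b c d → (a + b) + (c + d) ≈ (a + c) + (b + d)
      interchange a b c d = begin
        (a + b) + (c + d) ≈⟨ +-assoc a b _ ⟩
        a + (b + (c + d)) ≈⟨ +-congˡ (trans (sym (+-assoc b c d)) (trans (+-congʳ (+-comm b c)) (+-assoc c b d))) ⟩
        a + (c + (b + d)) ≈⟨ +-assoc a c _ ⟨
        (a + c) + (b + d) ∎

      ∑-+ : ∀ xs (f g : A → Carrier) → ∑ xs (λ x → f x + g x) ≈ ∑ xs f + ∑ xs g
      ∑-+ []       f g = sym (+-identityˡ 0#)
      ∑-+ (x ∷ xs) f g = trans (+-congˡ (∑-+ xs f g)) (interchange _ _ _ _)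

      ∑-*ˡ : ∀ xs c (f : A → Carrier) → ∑ xs (λ x → c * f x) ≈ c * ∑ xs f
      ∑-*ˡ []       c f = sym (zeroʳ c)
      ∑-*ˡ (x ∷ xs) c f = trans (+-congˡ (∑-*ˡ xs c f)) (sym (distribˡ c _ _))

      ∑-*ʳ : ∀ xs c (f : A → Carrier) → ∑ xs (λ x → f x * c) ≈ ∑ xs f * c
      ∑-*ʳ xs c f = trans (∑-cong xs (λ x → *-comm _ c)) (trans (∑-*ˡ xs c f) (*-comm c _))

      ∑-neg : ∀ xs (f : A → Carrier) → ∑ xs (λ x → - f x) ≈ - ∑ xs f
      ∑-neg xs f = begin
        ∑ xs (λ x → - f x)        ≈⟨ ∑-cong xs (λ x → -1*x≈-x (f x)) ⟨
        ∑ xs (λ x → - 1# * f x)   ≈⟨ ∑-*ˡ xs (- 1#) f ⟩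
        - 1# * ∑ xs f             ≈⟨ -1*x≈-x _ ⟩
        - ∑ xs f                  ∎
        where open import Algebra.Properties.Ring ring using (-1*x≈-x)

      ∑-filter : ∀ (b : A → Bool) xs f → ∑ (filterᵇ b xs) f ≈ ∑ xs (λ x → when (b x) (f x))
      ∑-filter b []       f = refl
      ∑-filter b (x ∷ xs) f with b x
      ... | true  = +-congˡ (∑-filter b xs f)
      ... | false = trans (∑-filter b xs f) (sym (+-identityˡ _))

      ∑-unique : ∀ {x xs} (f : A → Carrier) → Unique xs → x ∈ xs → (∀ y → y ≢ x → f y ≈ 0#) → ∑ xs f ≈ f x
      ∑-unique {x} {y ∷ xs} f (ys ∷ u) (here ≡.refl) z =
        trans (+-congˡ (trans (∑-cong-∈ xs (λ w w∈ → z w (λ e → All.lookup ys w∈ (≡.sym e)))) (∑-zero xs (λ _ → refl))))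
              (+-identityʳ _)
      ∑-unique {x} {y ∷ xs} f (ys ∷ u) (there x∈) z =
        trans (+-cong (z y (All.lookup ys x∈)) (∑-unique f u x∈ z)) (+-identityˡ _)

    ∑-map : ∀ {A B : Set} (g : B → A) xs (f : A → Carrier) → ∑ (map g xs) f ≡ ∑ xs (λ x → f (g x))
    ∑-map g []       f = ≡.refl
    ∑-map g (x ∷ xs) f = ≡.cong (f (g x) +_) (∑-map g xs f)

    ∑-lookup : ∀ {A : Set} (xs : List A) f → ∑ (allFin (length xs)) (λ i → f (lookup xs i)) ≈ ∑ xs f
    ∑-lookup xs f = reflexive (≡.trans (≡.sym (∑-map (lookup xs) (allFin (length xs)) f))
      (≡.cong (λ ys → ∑ ys f) (≡.trans (ListP.map-tabulate (λ i → i) (lookup xs)) (ListP.tabulate-lookup xs))))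

    ∑-concatMap : ∀ {A B : Set} (g : B → List A) xs (f : A → Carrier) →
                  ∑ (concatMap g xs) f ≈ ∑ xs (λ x → ∑ (g x) f)
    ∑-concatMap g []       f = refl
    ∑-concatMap g (x ∷ xs) f = trans (∑-++ (g x) _ f) (+-congˡ (∑-concatMap g xs f))

    ∑-swap : ∀ {A B : Set} xs ys (f : A → B → Carrier) →
             ∑ xs (λ x → ∑ ys (f x)) ≈ ∑ ys (λ y → ∑ xs (λ x → f x y))
    ∑-swap []       ys f = sym (∑-zero ys (λ _ → refl))
    ∑-swap (x ∷ xs) ys f = trans (+-congˡ (∑-swap xs ys f)) (sym (∑-+ ys (f x) _))

-- Quotient of a commutative ring by an ideal

module QuotientRing where

  open import Algebra.Bundles using (CommutativeRing)
  open import Level using (0ℓ)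

  module Quotient (R : CommutativeRing 0ℓ 0ℓ) (I : CommutativeRing.Carrier R → Set)
    (I-resp : ∀ {x y} → CommutativeRing._≈_ R x y → I x → I y)
    (I-0 : I (CommutativeRing.0# R))
    (I-+ : ∀ {x y} → I x → I y → I (CommutativeRing._+_ R x y))
    (I-* : ∀ r {x} → I x → I (CommutativeRing._*_ R r x)) where

    open CommutativeRing R
    open import Algebra.Properties.Ring ring
    open import Relation.Binary.Reasoning.Setoid setoid

    infix 4 _∼_
    -- A record rather than the bare condition `I (x - y)`, so that unification recovers `x` and `y`
    -- from a proof.
    record _∼_ (x y : Carrier) : Set where
      constructor mk∼
      field difference : I (x - y)

    open _∼_ public

    ≈⇒∼ : ∀ {x y} → x ≈ y → x ∼ y
    ≈⇒∼ {x} {y} e = mk∼ (I-resp (sym (trans (+-congʳ e) (-‿inverseʳ y))) I-0)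

    I⇒∼0 : ∀ {x} → I x → x ∼ 0#
    I⇒∼0 {x} i = mk∼ (I-resp (sym (trans (+-congˡ -0#≈0#) (+-identityʳ x))) i)

    telescope : ∀ x y z → (x - y) + (y - z) ≈ x - z
    telescope x y z = begin
      (x - y) + (y - z)     ≈⟨ +-assoc x _ _ ⟩
      x + (- y + (y - z))   ≈⟨ +-congˡ (+-assoc _ _ _) ⟨
      x + ((- y + y) - z)   ≈⟨ +-congˡ (+-congʳ (-‿inverseˡ y)) ⟩
      x + (0# - z)          ≈⟨ +-congˡ (+-identityˡ _) ⟩
      x - z                 ∎

    ∼-trans : ∀ {x y z} → x ∼ y → y ∼ z → x ∼ z
    ∼-trans {x} {y} {z} (mk∼ p) (mk∼ q) = mk∼ (I-resp (telescope x y z) (I-+ p q))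

    I-neg : ∀ {x} → I x → I (- x)
    I-neg {x} i = I-resp (-1*x≈-x x) (I-* (- 1#) i)

    ∼-sym : ∀ {x y} → x ∼ y → y ∼ x
    ∼-sym {x} {y} (mk∼ p) = mk∼ (I-resp eq (I-neg p))
      where
      eq : - (x - y) ≈ y - x
      eq = begin
        - (x - y)     ≈⟨ -‿+-comm x (- y) ⟨
        - x - - y     ≈⟨ +-congˡ (-‿involutive y) ⟩
        - x + y       ≈⟨ +-comm _ _ ⟩
        y - x         ∎

    +-interchange : ∀ a b c d → (a + b) + (c + d) ≈ (a + c) + (b + d)
    +-interchange a b c d = begin
      (a + b) + (c + d) ≈⟨ +-assoc a b _ ⟩
      a + (b + (c + d)) ≈⟨ +-congˡ (trans (sym (+-assoc b c d)) (trans (+-congʳ (+-comm b c)) (+-assoc c b d))) ⟩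
      a + (c + (b + d)) ≈⟨ +-assoc a c _ ⟨
      (a + c) + (b + d) ∎

    ∼-+ : ∀ {x x′ y y′} → x ∼ x′ → y ∼ y′ → x + y ∼ x′ + y′
    ∼-+ {x} {x′} {y} {y′} (mk∼ p) (mk∼ q) = mk∼ (I-resp eq (I-+ p q))
      where
      eq : (x - x′) + (y - y′) ≈ (x + y) - (x′ + y′)
      eq = trans (+-interchange x (- x′) y (- y′)) (+-congˡ (-‿+-comm x′ y′))

    ∼-* : ∀ {x x′ y y′} → x ∼ x′ → y ∼ y′ → x * y ∼ x′ * y′
    ∼-* {x} {x′} {y} {y′} (mk∼ p) (mk∼ q) = mk∼ (I-resp eq (I-+ (I-* y p) (I-* x′ q)))
      where
      eq : y * (x - x′) + x′ * (y - y′) ≈ x * y - x′ * y′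
      eq = begin
        y * (x - x′) + x′ * (y - y′)                 ≈⟨ +-cong (x[y-z]≈xy-xz y x x′) (x[y-z]≈xy-xz x′ y y′) ⟩
        (y * x - y * x′) + (x′ * y - x′ * y′)        ≈⟨ +-cong (+-cong (*-comm y x) (-‿cong (*-comm y x′))) refl ⟩
        (x * y - x′ * y) + (x′ * y - x′ * y′)        ≈⟨ telescope _ _ _ ⟩
        x * y - x′ * y′                              ∎

    ∼-neg : ∀ {x y} → x ∼ y → - x ∼ - y
    ∼-neg {x} {y} (mk∼ p) = mk∼ (I-resp (sym (-‿+-comm x (- y))) (I-neg p))

    quotientRing : CommutativeRing 0ℓ 0ℓ
    quotientRing = record
      { Carrier = Carrier ; _≈_ = _∼_ ; _+_ = _+_ ; _*_ = _*_ ; -_ = -_ ; 0# = 0# ; 1# = 1#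
      ; isCommutativeRing = record
        { isRing = record
          { +-isAbelianGroup = record
            { isGroup = record
              { isMonoid = record
                { isSemigroup = record
                  { isMagma = record
                    { isEquivalence = record { refl = ≈⇒∼ refl ; sym = ∼-sym ; trans = ∼-trans }
                    ; ∙-cong = ∼-+ }
                  ; assoc = λ x y z → ≈⇒∼ (+-assoc x y z) }
                ; identity = (λ x → ≈⇒∼ (+-identityˡ x)) , (λ x → ≈⇒∼ (+-identityʳ x)) }
              ; inverse = (λ x → ≈⇒∼ (-‿inverseˡ x)) , (λ x → ≈⇒∼ (-‿inverseʳ x))
              ; ⁻¹-cong = ∼-neg }
            ; comm = λ x y → ≈⇒∼ (+-comm x y) }
          ; *-cong = ∼-*
          ; *-assoc = λ x y z → ≈⇒∼ (*-assoc x y z)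
          ; *-identity = (λ x → ≈⇒∼ (*-identityˡ x)) , (λ x → ≈⇒∼ (*-identityʳ x))
          ; distrib = (λ x y z → ≈⇒∼ (distribˡ x y z)) , (λ x y z → ≈⇒∼ (distribʳ x y z)) }
        ; *-comm = λ x y → ≈⇒∼ (*-comm x y) } }
      where open import Data.Product using (_,_)

-- Polynomials as formal sums and their commutative ring

module PolyRing where

  open import Defs
  open ListSums
  open QuotientRing
  open import Algebra.Bundles using (CommutativeRing)
  open import Level using (0ℓ)
  open import Data.Bool using (true; false; if_then_else_)
  open import Data.Nat as ℕ using (ℕ)
  import Data.Nat.Properties as ℕP
  open import Data.Rational as ℚ using (ℚ; 0ℚ; 1ℚ)
  import Data.Rational.Properties as ℚP
  open import Data.List as List using (List; []; _∷_; _++_; deduplicate)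
  open import Data.List.Membership.Propositional using (_∈_)
  open import Data.List.Membership.Propositional.Properties using (∈-map⁺; ∈-++⁺ˡ; ∈-++⁺ʳ; ∈-deduplicate⁺)
  open import Data.List.Relation.Unary.Unique.DecPropositional.Properties using (deduplicate-!)
  open import Data.List.Relation.Unary.Unique.Propositional using (Unique)
  open import Data.Product using (_×_; _,_; proj₁; proj₂)
  open import Data.Vec as Vec using (Vec; []; _∷_)
  import Data.Vec.Properties as VecP
  open import Relation.Nullary using (does)
  open import Relation.Nullary.Decidable using (dec-true; dec-false)
  open import Relation.Binary.PropositionalEquality

  open Sums ℚP.+-*-commutativeRing public using () renaming (∑ to ∑ℚ)
  module ∑ℚ = Sums ℚP.+-*-commutativeRing

  -- The linear functional with values `f` on the basis, evaluated at a formal sum. Lists of terms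
  -- are not normalised; pairing makes the order and repetition of terms irrelevant.
  ⟪_,_⟫ : {A : Set} → List (ℚ × A) → (A → ℚ) → ℚ
  ⟪ p , f ⟫ = ∑ℚ p (λ t → proj₁ t ℚ.* f (proj₂ t))

  *-left-comm : ∀ x y z → x ℚ.* (y ℚ.* z) ≡ y ℚ.* (x ℚ.* z)
  *-left-comm x y z = trans (sym (ℚP.*-assoc x y z)) (trans (cong (ℚ._* z) (ℚP.*-comm x y)) (ℚP.*-assoc y x z))

  module _ {A : Set} where

    ⟪⟫-cong : ∀ (p : List (ℚ × A)) {f g} → (∀ a → f a ≡ g a) → ⟪ p , f ⟫ ≡ ⟪ p , g ⟫
    ⟪⟫-cong p e = ∑ℚ.∑-cong p (λ t → cong (proj₁ t ℚ.*_) (e (proj₂ t)))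

    ⟪⟫-++ : ∀ (p q : List (ℚ × A)) f → ⟪ p ++ q , f ⟫ ≡ ⟪ p , f ⟫ ℚ.+ ⟪ q , f ⟫
    ⟪⟫-++ p q f = ∑ℚ.∑-++ p q _

    ⟪⟫-scale : ∀ c (p : List (ℚ × A)) f → ⟪ List.map (λ t → (c ℚ.* proj₁ t , proj₂ t)) p , f ⟫ ≡ c ℚ.* ⟪ p , f ⟫
    ⟪⟫-scale c p f = trans (∑ℚ.∑-map _ p _)
      (trans (∑ℚ.∑-cong p (λ t → ℚP.*-assoc c _ _)) (∑ℚ.∑-*ˡ p c _))

    ⟪⟫-neg : ∀ (p : List (ℚ × A)) f → ⟪ List.map (λ t → ((ℚ.- 1ℚ) ℚ.* proj₁ t , proj₂ t)) p , f ⟫ ≡ ℚ.- ⟪ p , f ⟫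
    ⟪⟫-neg p f = trans (⟪⟫-scale (ℚ.- 1ℚ) p f) (-1*x≈-x _)
      where open import Algebra.Properties.Ring ℚP.+-*-ring using (-1*x≈-x)

    ⟪⟫-0 : ∀ (p : List (ℚ × A)) {f} → (∀ a → f a ≡ 0ℚ) → ⟪ p , f ⟫ ≡ 0ℚ
    ⟪⟫-0 p e = ∑ℚ.∑-zero p (λ t → trans (cong (proj₁ t ℚ.*_) (e (proj₂ t))) (ℚP.*-zeroʳ (proj₁ t)))

    ⟪⟫-∑ : ∀ {B : Set} (p : List (ℚ × A)) (ys : List B) (f : B → A → ℚ) →
           ⟪ p , (λ a → ∑ℚ ys (λ b → f b a)) ⟫ ≡ ∑ℚ ys (λ b → ⟪ p , f b ⟫)
    ⟪⟫-∑ p ys f = trans (∑ℚ.∑-cong p (λ t → sym (∑ℚ.∑-*ˡ ys (proj₁ t) _))) (∑ℚ.∑-swap p ys _)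

    ⟪⟫-swap : ∀ {B : Set} (p : List (ℚ × A)) (q : List (ℚ × B)) (f : A → B → ℚ) →
              ⟪ p , (λ a → ⟪ q , f a ⟫) ⟫ ≡ ⟪ q , (λ b → ⟪ p , (λ a → f a b) ⟫) ⟫
    ⟪⟫-swap p q f = trans (⟪⟫-∑ p q (λ t a → proj₁ t ℚ.* f a (proj₂ t)))
      (∑ℚ.∑-cong q (λ t → trans
        (∑ℚ.∑-cong p (λ s → *-left-comm (proj₁ s) (proj₁ t) (f (proj₂ s) (proj₂ t))))
        (∑ℚ.∑-*ˡ p (proj₁ t) _)))

  module _ {N : ℕ} where

    _≟ᵐ_ : (μ ν : Mono N) → _
    _≟ᵐ_ = VecP.≡-dec ℕ._≟_

    δ : Mono N → Mono N → ℚ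
    δ μ ν = if does (ν ≟ᵐ μ) then 1ℚ else 0ℚ

    coeff-⟪⟫ : ∀ (p : Poly N) μ → coeff p μ ≡ ⟪ p , δ μ ⟫
    coeff-⟪⟫ [] μ = refl
    coeff-⟪⟫ ((c , ν) ∷ p) μ with does (ν ≟ᵐ μ)
    ... | true  = cong₂ ℚ._+_ (sym (ℚP.*-identityʳ c)) (coeff-⟪⟫ p μ)
    ... | false = trans (coeff-⟪⟫ p μ) (trans (sym (ℚP.+-identityˡ _)) (cong (ℚ._+ _) (sym (ℚP.*-zeroʳ c))))

    infix 4 _≈ᵖ_
    -- Equality under all linear functionals. In this form the ring axioms are exchanges of finite
    -- sums; `coeff⇒≈` and `≈⇒coeff` show that it is equality of coefficients.
    record _≈ᵖ_ (p q : Poly N) : Set where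
      constructor mk≈
      field pairing : ∀ f → ⟪ p , f ⟫ ≡ ⟪ q , f ⟫

    open _≈ᵖ_ public

    -- Over a duplicate-free list s containing the monomials of p, ⟪ p , f ⟫ = Σ_{μ ∈ s} f μ · coeff p μ.
    ⟪⟫-support : ∀ (s : List (Mono N)) → Unique s →
                 ∀ p → (∀ {t} → t ∈ p → proj₂ t ∈ s) → ∀ f →
                 ⟪ p , f ⟫ ≡ ∑ℚ s (λ μ → f μ ℚ.* coeff p μ)
    ⟪⟫-support s u p p⊆s f = begin
      ⟪ p , f ⟫                                     ≡⟨ ∑ℚ.∑-cong-∈ p (λ t t∈ → cong (proj₁ t ℚ.*_) (expand (p⊆s t∈))) ⟩
      ⟪ p , (λ ν → ∑ℚ s (λ μ → f μ ℚ.* δ μ ν)) ⟫    ≡⟨ ⟪⟫-∑ p s (λ μ ν → f μ ℚ.* δ μ ν) ⟩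
      ∑ℚ s (λ μ → ⟪ p , (λ ν → f μ ℚ.* δ μ ν) ⟫)    ≡⟨ ∑ℚ.∑-cong s (λ μ → pull μ) ⟩
      ∑ℚ s (λ μ → f μ ℚ.* coeff p μ)                ∎
      where
      open ≡-Reasoning
      expand : ∀ {ν} → ν ∈ s → f ν ≡ ∑ℚ s (λ μ → f μ ℚ.* δ μ ν)
      expand {ν} ν∈s = sym (trans
        (∑ℚ.∑-unique (λ μ → f μ ℚ.* δ μ ν) u ν∈s
           (λ μ μ≢ν → trans (cong (λ b → f μ ℚ.* (if b then 1ℚ else 0ℚ)) (dec-false (ν ≟ᵐ μ) (λ e → μ≢ν (sym e)))) (ℚP.*-zeroʳ (f μ))))
        (trans (cong (λ b → f ν ℚ.* (if b then 1ℚ else 0ℚ)) (dec-true (ν ≟ᵐ ν) refl)) (ℚP.*-identityʳ (f ν))))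
      pull : ∀ μ → ⟪ p , (λ ν → f μ ℚ.* δ μ ν) ⟫ ≡ f μ ℚ.* coeff p μ
      pull μ = trans (∑ℚ.∑-cong p (λ t → *-left-comm (proj₁ t) (f μ) (δ μ (proj₂ t))))
                     (trans (∑ℚ.∑-*ˡ p (f μ) _) (cong (f μ ℚ.*_) (sym (coeff-⟪⟫ p μ))))

    -- The monomials of `p` and `q` together, with repetitions removed, form a common support over
    -- which both pairings are determined by the coefficients.
    coeff⇒≈ : ∀ {p q : Poly N} → (∀ μ → coeff p μ ≡ coeff q μ) → p ≈ᵖ q
    coeff⇒≈ {p} {q} e = mk≈ λ f → trans (⟪⟫-support s u p (λ t∈ → mem (∈-++⁺ˡ t∈)) f)
        (trans (∑ℚ.∑-cong s (λ μ → cong (f μ ℚ.*_) (e μ)))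
               (sym (⟪⟫-support s u q (λ t∈ → mem (∈-++⁺ʳ p t∈)) f)))
      where
      s = deduplicate _≟ᵐ_ (List.map proj₂ (p ++ q))
      u = deduplicate-! _≟ᵐ_ (List.map proj₂ (p ++ q))
      mem : ∀ {t} → t ∈ p ++ q → proj₂ t ∈ s
      mem t∈ = ∈-deduplicate⁺ _≟ᵐ_ (∈-map⁺ proj₂ t∈)

    ≈⇒coeff : ∀ {p q : Poly N} → p ≈ᵖ q → ∀ μ → coeff p μ ≡ coeff q μ
    ≈⇒coeff {p} {q} (mk≈ e) μ = trans (coeff-⟪⟫ p μ) (trans (e (δ μ)) (sym (coeff-⟪⟫ q μ)))

    _+ᵐ_ : Mono N → Mono N → Mono N
    _+ᵐ_ = Vec.zipWith ℕ._+_

    0ᵐ : Mono N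
    0ᵐ = Vec.replicate N 0

    1ᵖ : Poly N
    1ᵖ = (1ℚ , 0ᵐ) ∷ []

    -ᵖ_ : Poly N → Poly N
    -ᵖ_ = scaleᵖ (ℚ.- 1ℚ)

    ⟪⟫-* : ∀ (p q : Poly N) f → ⟪ p *ᵖ q , f ⟫ ≡ ⟪ p , (λ μ → ⟪ q , (λ ν → f (μ +ᵐ ν)) ⟫) ⟫
    ⟪⟫-* p q f = trans (∑ℚ.∑-concatMap _ p _) (∑ℚ.∑-cong p (λ s →
      trans (∑ℚ.∑-map _ q _) (trans (∑ℚ.∑-cong q (λ t → ℚP.*-assoc (proj₁ s) (proj₁ t) _)) (∑ℚ.∑-*ˡ q (proj₁ s) _))))

    private
      ⟪1⟫ : ∀ f → ⟪ 1ᵖ , f ⟫ ≡ f 0ᵐ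
      ⟪1⟫ f = trans (ℚP.+-identityʳ (1ℚ ℚ.* f 0ᵐ)) (ℚP.*-identityˡ (f 0ᵐ))

      ⟪*⟫-cong : ∀ {p p′ q q′ : Poly N} → p ≈ᵖ p′ → q ≈ᵖ q′ → p *ᵖ q ≈ᵖ p′ *ᵖ q′
      ⟪*⟫-cong {p} {p′} {q} {q′} (mk≈ e) (mk≈ e′) = mk≈ λ f → trans (⟪⟫-* p q f)
        (trans (e _) (trans (⟪⟫-cong p′ (λ μ → e′ _)) (sym (⟪⟫-* p′ q′ f))))

      *ᵖ-assoc : ∀ (p q r : Poly N) → (p *ᵖ q) *ᵖ r ≈ᵖ p *ᵖ (q *ᵖ r)
      *ᵖ-assoc p q r = mk≈ λ f → begin
        ⟪ (p *ᵖ q) *ᵖ r , f ⟫ ≡⟨ ⟪⟫-* (p *ᵖ q) r f ⟩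
        ⟪ p *ᵖ q , (λ μ → ⟪ r , (λ κ → f (μ +ᵐ κ)) ⟫) ⟫ ≡⟨ ⟪⟫-* p q _ ⟩
        ⟪ p , (λ μ → ⟪ q , (λ ν → ⟪ r , (λ κ → f ((μ +ᵐ ν) +ᵐ κ)) ⟫) ⟫) ⟫
          ≡⟨ ⟪⟫-cong p (λ μ → ⟪⟫-cong q (λ ν → ⟪⟫-cong r (λ κ → cong f (VecP.zipWith-assoc ℕP.+-assoc μ ν κ)))) ⟩
        ⟪ p , (λ μ → ⟪ q , (λ ν → ⟪ r , (λ κ → f (μ +ᵐ (ν +ᵐ κ))) ⟫) ⟫) ⟫
          ≡⟨ ⟪⟫-cong p (λ μ → ⟪⟫-* q r _) ⟨
        ⟪ p , (λ μ → ⟪ q *ᵖ r , (λ ν → f (μ +ᵐ ν)) ⟫) ⟫ ≡⟨ ⟪⟫-* p (q *ᵖ r) f ⟨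
        ⟪ p *ᵖ (q *ᵖ r) , f ⟫ ∎
        where open ≡-Reasoning

      *ᵖ-comm : ∀ (p q : Poly N) → p *ᵖ q ≈ᵖ q *ᵖ p
      *ᵖ-comm p q = mk≈ λ f → trans (⟪⟫-* p q f) (trans (⟪⟫-swap p q _)
        (trans (⟪⟫-cong q (λ ν → ⟪⟫-cong p (λ μ → cong f (VecP.zipWith-comm ℕP.+-comm μ ν)))) (sym (⟪⟫-* q p f))))

      *ᵖ-identityˡ : ∀ (p : Poly N) → 1ᵖ *ᵖ p ≈ᵖ p
      *ᵖ-identityˡ p = mk≈ λ f → trans (⟪⟫-* 1ᵖ p f) (trans (⟪1⟫ (λ μ → ⟪ p , (λ ν → f (μ +ᵐ ν)) ⟫))
        (⟪⟫-cong p (λ ν → cong f (VecP.zipWith-identityˡ {f = ℕ._+_} {e = 0} ℕP.+-identityˡ ν))))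

      *ᵖ-distribˡ : ∀ (p q r : Poly N) → p *ᵖ (q ++ r) ≈ᵖ (p *ᵖ q) ++ (p *ᵖ r)
      *ᵖ-distribˡ p q r = mk≈ λ f → begin
        ⟪ p *ᵖ (q ++ r) , f ⟫ ≡⟨ ⟪⟫-* p (q ++ r) f ⟩
        ⟪ p , (λ μ → ⟪ q ++ r , (λ ν → f (μ +ᵐ ν)) ⟫) ⟫ ≡⟨ ⟪⟫-cong p (λ μ → ⟪⟫-++ q r _) ⟩
        ⟪ p , (λ μ → ⟪ q , (λ ν → f (μ +ᵐ ν)) ⟫ ℚ.+ ⟪ r , (λ ν → f (μ +ᵐ ν)) ⟫) ⟫
          ≡⟨ ∑ℚ.∑-cong p (λ t → ℚP.*-distribˡ-+ (proj₁ t) _ _) ⟩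
        _ ≡⟨ ∑ℚ.∑-+ p _ _ ⟩
        ⟪ p , (λ μ → ⟪ q , (λ ν → f (μ +ᵐ ν)) ⟫) ⟫ ℚ.+ ⟪ p , (λ μ → ⟪ r , (λ ν → f (μ +ᵐ ν)) ⟫) ⟫
          ≡⟨ cong₂ ℚ._+_ (⟪⟫-* p q f) (⟪⟫-* p r f) ⟨
        ⟪ p *ᵖ q , f ⟫ ℚ.+ ⟪ p *ᵖ r , f ⟫ ≡⟨ ⟪⟫-++ (p *ᵖ q) (p *ᵖ r) f ⟨
        ⟪ (p *ᵖ q) ++ (p *ᵖ r) , f ⟫ ∎
        where open ≡-Reasoning

      ≈ᵖ-trans : ∀ {p q r : Poly N} → p ≈ᵖ q → q ≈ᵖ r → p ≈ᵖ r
      ≈ᵖ-trans (mk≈ e) (mk≈ e′) = mk≈ λ f → trans (e f) (e′ f)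

      ++-congᵖ : ∀ {p p′ q q′ : Poly N} → p ≈ᵖ p′ → q ≈ᵖ q′ → p ++ q ≈ᵖ p′ ++ q′
      ++-congᵖ {p} {p′} {q} {q′} (mk≈ e) (mk≈ e′) = mk≈ λ f →
        trans (⟪⟫-++ p q f) (trans (cong₂ ℚ._+_ (e f) (e′ f)) (sym (⟪⟫-++ p′ q′ f)))

      ++-commᵖ : ∀ (p q : Poly N) → p ++ q ≈ᵖ q ++ p
      ++-commᵖ p q = mk≈ λ f → trans (⟪⟫-++ p q f) (trans (ℚP.+-comm ⟪ p , f ⟫ ⟪ q , f ⟫) (sym (⟪⟫-++ q p f)))

      -ᵖ-inverseˡ : ∀ (p : Poly N) → (-ᵖ p) ++ p ≈ᵖ []
      -ᵖ-inverseˡ p = mk≈ λ f → trans (⟪⟫-++ (-ᵖ p) p f)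
        (trans (cong (ℚ._+ ⟪ p , f ⟫) (⟪⟫-neg p f)) (ℚP.+-inverseˡ ⟪ p , f ⟫))

    polyRing : CommutativeRing 0ℓ 0ℓ
    polyRing = record
      { Carrier = Poly N ; _≈_ = _≈ᵖ_ ; _+_ = _+ᵖ_ ; _*_ = _*ᵖ_ ; -_ = -ᵖ_ ; 0# = [] ; 1# = 1ᵖ
      ; isCommutativeRing = record
        { isRing = record
          { +-isAbelianGroup = record
            { isGroup = record
              { isMonoid = record
                { isSemigroup = record
                  { isMagma = record
                    { isEquivalence = record
                      { refl = mk≈ λ f → refl ; sym = λ e → mk≈ λ f → sym (pairing e f) ; trans = ≈ᵖ-trans }
                    ; ∙-cong = ++-congᵖ }
                  ; assoc = λ p q r → mk≈ λ f → cong (λ s → ⟪ s , f ⟫) (++-assoc p q r) }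
                ; identity = (λ p → mk≈ λ f → refl) , (λ p → mk≈ λ f → cong (λ s → ⟪ s , f ⟫) (++-identityʳ p)) }
              ; inverse = -ᵖ-inverseˡ , (λ p → ≈ᵖ-trans (++-commᵖ p (-ᵖ p)) (-ᵖ-inverseˡ p))
              ; ⁻¹-cong = λ {p} {q} e → mk≈ λ f → trans (⟪⟫-neg p f) (trans (cong ℚ.-_ (pairing e f)) (sym (⟪⟫-neg q f))) }
            ; comm = ++-commᵖ }
          ; *-cong = ⟪*⟫-cong
          ; *-assoc = *ᵖ-assoc
          ; *-identity = *ᵖ-identityˡ , (λ p → ≈ᵖ-trans (*ᵖ-comm p 1ᵖ) (*ᵖ-identityˡ p))
          ; distrib = *ᵖ-distribˡ , (λ p q r → ≈ᵖ-trans (*ᵖ-comm (q ++ r) p) (≈ᵖ-trans (*ᵖ-distribˡ p q r) (++-congᵖ (*ᵖ-comm p q) (*ᵖ-comm p r)))) }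
        ; *-comm = *ᵖ-comm } }
      where open import Data.List.Properties using (++-assoc; ++-identityʳ)

    -- Scalars act as constant polynomials, so ideals are closed under them and congruences can be
    -- scaled.
    scale-as-* : ∀ c (p : Poly N) → scaleᵖ c p ≈ᵖ ((c , 0ᵐ) ∷ []) *ᵖ p
    scale-as-* c p = mk≈ λ f → trans (⟪⟫-scale c p f) (sym (trans (⟪⟫-* ((c , 0ᵐ) ∷ []) p f)
      (trans (ℚP.+-identityʳ _) (cong (c ℚ.*_) (⟪⟫-cong p (λ ν → cong f (VecP.zipWith-identityˡ {f = ℕ._+_} {e = 0} ℕP.+-identityˡ ν)))))))

-- Linear algebra behind Hilbert coefficients

module HilbertCoefficients where

  open import Defs
  open QuotientRing
  open PolyRing
  open import Algebra.Bundles using (CommutativeRing)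
  open import Data.Fin using (Fin; zero; suc; punchIn)
  open import Data.Fin.Properties using (any?)
  open import Data.Nat using (ℕ; zero; suc)
  open import Data.Rational as ℚ using (ℚ; 0ℚ; 1ℚ)
  import Data.Rational.Properties as ℚP
  open import Data.Rational.Solver using (module +-*-Solver)
  open import Data.List as List using (List; []; _∷_; _++_; length)
  open import Data.List.Membership.Propositional using (_∈_)
  open import Data.List.Relation.Unary.Any using (here; there)
  open import Data.Product using (Σ; ∃; _×_; _,_; proj₁; proj₂)
  open import Data.Vec as Vec using (Vec; []; _∷_; lookup; tabulate)
  import Data.Vec.Properties as VecP
  open import Data.Vec.Functional using (insertAt)
  open import Data.Vec.Functional.Properties using (insertAt-lookup; insertAt-punchIn)
  open import Relation.Nullary using (¬_; yes; no)
  open import Relation.Nullary.Decidable using (¬?; decidable-stable)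
  open import Relation.Binary.PropositionalEquality
  open import Algebra.Properties.Semiring.Sum (CommutativeRing.semiring ℚP.+-*-commutativeRing)
    using (sum; sum-cong-≗; sum-remove; ∑-distrib-+; ∑-comm; *-distribˡ-sum; *-distribʳ-sum)

  sum-0 : ∀ {m} {f : Fin m → ℚ} → (∀ i → f i ≡ 0ℚ) → sum f ≡ 0ℚ
  sum-0 {zero}  e = refl
  sum-0 {suc m} e = cong₂ ℚ._+_ (e zero) (sum-0 (λ i → e (suc i)))

  -- Gaussian elimination on the first column, by induction on the number of columns. If that column
  -- is zero, one row is dropped; otherwise a pivot row clears it from the other rows and receives
  -- the coefficient that compensates for this.
  linear-dependence : ∀ r (A : Fin (suc r) → Fin r → ℚ) →
    Σ (Fin (suc r) → ℚ) λ c → (∃ λ j → c j ≢ 0ℚ) × (∀ i → sum (λ j → c j ℚ.* A j i) ≡ 0ℚ)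
  linear-dependence zero A = (λ _ → 1ℚ) , (zero , λ ()) , λ ()
  linear-dependence (suc r) A with any? (λ j → ¬? (A j zero ℚP.≟ 0ℚ))
  ... | no none = c , (suc (proj₁ nz) , proj₂ nz) , zeros
    where
    ih = linear-dependence r (λ j i → A (suc j) (suc i))
    c′ = proj₁ ih
    nz = proj₁ (proj₂ ih)
    c : Fin (suc (suc r)) → ℚ
    c zero    = 0ℚ
    c (suc j) = c′ j
    column₀ : ∀ j → A j zero ≡ 0ℚ
    column₀ j = decidable-stable (A j zero ℚP.≟ 0ℚ) (λ ne → none (j , ne))
    zeros : ∀ i → sum (λ j → c j ℚ.* A j i) ≡ 0ℚ
    zeros zero    = sum-0 (λ j → trans (cong (c j ℚ.*_) (column₀ j)) (ℚP.*-zeroʳ (c j)))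
    zeros (suc i) = trans (cong₂ ℚ._+_ (ℚP.*-zeroˡ (A zero (suc i))) (proj₂ (proj₂ ih) i)) (ℚP.+-identityʳ 0ℚ)
  ... | yes (p , Ap≢0) = c , (punchIn p (proj₁ nz) , λ e → proj₂ nz (trans (sym (insertAt-punchIn c′ p v (proj₁ nz))) e)) , zeros
    where
    instance _ = ℚ.≢-nonZero Ap≢0
    inv = ℚ.1/ (A p zero)
    t : Fin (suc r) → ℚ
    t k = A (punchIn p k) zero ℚ.* inv
    ih = linear-dependence r (λ k i → A (punchIn p k) (suc i) ℚ.- t k ℚ.* A p (suc i))
    c′ = proj₁ ih
    nz = proj₁ (proj₂ ih)
    -- All multiples of row `p` subtracted during the elimination, collected in one coefficient; by
    -- `push` the combination of the original rows equals that of the reduced ones.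
    v = ℚ.- sum (λ k → c′ k ℚ.* t k)
    c : Fin (suc (suc r)) → ℚ
    c = insertAt c′ p v
    split : ∀ i → sum (λ j → c j ℚ.* A j i) ≡ v ℚ.* A p i ℚ.+ sum (λ k → c′ k ℚ.* A (punchIn p k) i)
    split i = trans (sum-remove {i = p} (λ j → c j ℚ.* A j i)) (cong₂ ℚ._+_
      (cong (ℚ._* A p i) (insertAt-lookup c′ p v))
      (sum-cong-≗ (λ k → cong (ℚ._* A (punchIn p k) i) (insertAt-punchIn c′ p v k))))
    push : ∀ i → v ℚ.* A p i ℚ.+ sum (λ k → c′ k ℚ.* A (punchIn p k) i)
               ≡ sum (λ k → c′ k ℚ.* (A (punchIn p k) i ℚ.- t k ℚ.* A p i))
    push i = begin
      v ℚ.* a ℚ.+ sum g                              ≡⟨ cong (ℚ._+ sum g) (solve 2 (λ s a → (:- s) :* a := s :* (:- a)) refl (sum (λ k → c′ k ℚ.* t k)) a) ⟩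
      sum (λ k → c′ k ℚ.* t k) ℚ.* (ℚ.- a) ℚ.+ sum g  ≡⟨ cong (ℚ._+ sum g) (*-distribʳ-sum (ℚ.- a) (λ k → c′ k ℚ.* t k)) ⟩
      sum (λ k → c′ k ℚ.* t k ℚ.* (ℚ.- a)) ℚ.+ sum g  ≡⟨ ∑-distrib-+ (λ k → c′ k ℚ.* t k ℚ.* (ℚ.- a)) g ⟨
      sum (λ k → c′ k ℚ.* t k ℚ.* (ℚ.- a) ℚ.+ g k)
        ≡⟨ sum-cong-≗ (λ k → solve 4 (λ x y z w → x :* y :* (:- z) :+ x :* w := x :* (w :- y :* z)) refl (c′ k) (t k) a (A (punchIn p k) i)) ⟩
      _ ∎
      where
      open ≡-Reasoning
      open +-*-Solver
      a = A p i
      g = λ k → c′ k ℚ.* A (punchIn p k) i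
    cancel : ∀ k → A (punchIn p k) zero ℚ.- t k ℚ.* A p zero ≡ 0ℚ
    cancel k = trans (cong (λ z → b ℚ.- z) (trans (ℚP.*-assoc b inv (A p zero))
        (trans (cong (b ℚ.*_) (ℚP.*-inverseˡ (A p zero))) (ℚP.*-identityʳ b)))) (ℚP.+-inverseʳ b)
      where b = A (punchIn p k) zero
    zeros : ∀ i → sum (λ j → c j ℚ.* A j i) ≡ 0ℚ
    zeros zero    = trans (split zero) (trans (push zero)
      (sum-0 (λ k → trans (cong (c′ k ℚ.*_) (cancel k)) (ℚP.*-zeroʳ (c′ k)))))
    zeros (suc i) = trans (split (suc i)) (trans (push (suc i)) (proj₂ (proj₂ ih) i))

  module _ {N : ℕ} where
    open CommutativeRing (polyRing {N}) using (setoid; +-cong; *-comm; *-identityˡ; distribˡ; zeroʳ)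
      renaming (refl to ≈-refl; sym to ≈-sym; trans to ≈-trans; reflexive to ≈-reflexive)

    combination : (gs : List (Poly N)) → Vec (Poly N) (length gs) → Poly N
    combination gs cs = sumᵖ (Vec.toList (Vec.zipWith _*ᵖ_ cs (Vec.fromList gs)))

    combination-0 : ∀ gs → combination gs (Vec.replicate (length gs) []) ≡ []
    combination-0 []       = refl
    combination-0 (g ∷ gs) = combination-0 gs

    combination-+ : ∀ gs cs ds → combination gs (Vec.zipWith _++_ cs ds) ≈ᵖ combination gs cs ++ combination gs ds
    combination-+ []       []       []       = ≈-refl
    combination-+ (g ∷ gs) (c ∷ cs) (d ∷ ds) = ≈-trans (+-cong (distribʳ g c d) (combination-+ gs cs ds))
      (+-interchange (c *ᵖ g) (d *ᵖ g) (combination gs cs) (combination gs ds))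
      where
      open CommutativeRing (polyRing {N}) using (distribʳ; +-commutativeSemigroup)
      open import Algebra.Properties.CommutativeSemigroup +-commutativeSemigroup using () renaming (interchange to +-interchange)

    combination-* : ∀ gs r cs → combination gs (Vec.map (r *ᵖ_) cs) ≈ᵖ r *ᵖ combination gs cs
    combination-* []       r []       = ≈-sym (zeroʳ r)
    combination-* (g ∷ gs) r (c ∷ cs) = ≈-trans (+-cong (*-assoc r c g) (combination-* gs r cs)) (≈-sym (distribˡ r (c *ᵖ g) _))
      where open CommutativeRing (polyRing {N}) using (*-assoc)

    combination-gen : ∀ gs {g} → g ∈ gs → ∃ λ cs → combination gs cs ≈ᵖ g
    combination-gen (g ∷ gs) (here refl) = 1ᵖ ∷ Vec.replicate _ [] ,
      ≈-trans (+-cong (*-identityˡ g) (≈-reflexive (combination-0 gs))) (≈-reflexive (++-identityʳ g))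
      where open import Data.List.Properties using (++-identityʳ)
    combination-gen (g ∷ gs) (there g∈) = [] ∷ proj₁ ih , proj₂ ih
      where ih = combination-gen gs g∈

  module Ideal (P : Presentation) where
    open Presentation P
    open CommutativeRing (polyRing {nvars}) using () renaming (refl to ≈-refl; sym to ≈-sym; trans to ≈-trans; +-cong to ≈-+-cong; *-congˡ to ≈-*-congˡ)

    -- `InIdeal` with `≈ᵖ` in place of the comparison of coefficients, so that closure under the
    -- ring operations is a calculation in the polynomial ring.
    record I (p : Poly nvars) : Set where
      constructor mkI
      field
        coefficients : Vec (Poly nvars) (length gens)
        expansion    : p ≈ᵖ combination gens coefficients

    open I

    I⇒InIdeal : ∀ {p} → I p → InIdeal P p
    I⇒InIdeal (mkI cs e) = cs , ≈⇒coeff e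

    InIdeal⇒I : ∀ {p} → InIdeal P p → I p
    InIdeal⇒I (cs , e) = mkI cs (coeff⇒≈ e)

    I-resp : ∀ {p q} → p ≈ᵖ q → I p → I q
    I-resp e (mkI cs e′) = mkI cs (≈-trans (≈-sym e) e′)

    I-0 : I []
    I-0 = mkI (Vec.replicate _ []) (mk≈ λ f → cong (λ s → ⟪ s , f ⟫) (sym (combination-0 gens)))

    I-+ : ∀ {p q} → I p → I q → I (p ++ q)
    I-+ (mkI cs e) (mkI ds e′) = mkI (Vec.zipWith _++_ cs ds)
      (≈-trans (≈-+-cong e e′) (≈-sym (combination-+ gens cs ds)))

    I-* : ∀ r {p} → I p → I (r *ᵖ p)
    I-* r (mkI cs e) = mkI (Vec.map (r *ᵖ_) cs)
      (≈-trans (≈-*-congˡ {r} e) (≈-sym (combination-* gens r cs)))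

    I-gen : ∀ {g} → g ∈ gens → I g
    I-gen g∈ = mkI (proj₁ c) (≈-sym (proj₂ c))
      where c = combination-gen gens g∈

    I-scale : ∀ c {p} → I p → I (scaleᵖ c p)
    I-scale c {p} i = I-resp (≈-sym (scale-as-* c p)) (I-* ((c , 0ᵐ) ∷ []) i)

    -- This is how functionals bound the ideal from above: an element on which such an `E` is
    -- nonzero does not lie in it.
    annihilates : ∀ (E : Mono nvars → ℚ) → (∀ {g} → g ∈ gens → ∀ r → ⟪ r *ᵖ g , E ⟫ ≡ 0ℚ) →
                  ∀ {p} → I p → ⟪ p , E ⟫ ≡ 0ℚ
    annihilates E kill (mkI cs e) = trans (pairing e E) (go gens (λ m → m) cs)
      where
      go : ∀ gs → (∀ {g} → g ∈ gs → g ∈ gens) → ∀ cs → ⟪ combination gs cs , E ⟫ ≡ 0ℚ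
      go []       sub []       = refl
      go (g ∷ gs) sub (c ∷ cs) = trans (⟪⟫-++ (c *ᵖ g) (combination gs cs) E)
        (cong₂ ℚ._+_ (kill (sub (here refl)) c) (go gs (λ m → sub (there m)) cs))

    open Quotient polyRing I I-resp I-0 I-+ I-* public

    ⟪linComb⟫ : ∀ {r} (cs : Vec ℚ r) ps f → ⟪ linComb P cs ps , f ⟫ ≡ sum (λ j → lookup cs j ℚ.* ⟪ lookup ps j , f ⟫)
    ⟪linComb⟫ []       []       f = refl
    ⟪linComb⟫ (c ∷ cs) (p ∷ ps) f = trans (⟪⟫-++ (scaleᵖ c p) (linComb P cs ps) f)
      (cong₂ ℚ._+_ (⟪⟫-scale c p f) (⟪linComb⟫ cs ps f))

    I-linComb : ∀ {r} (cs : Vec ℚ r) ps → (∀ j → I (lookup ps j)) → I (linComb P cs ps)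
    I-linComb []       []       i = I-0
    I-linComb (c ∷ cs) (p ∷ ps) i = I-+ (I-scale c (i zero)) (I-linComb cs ps (λ j → i (suc j)))

    record GradedBasis (d : ℕ) {r} (us : Vec (Poly nvars) r) : Set where
      field
        homogeneous : ∀ j → Homogeneous d (lookup us j)
        independent : IndependentMod P us
        spanning    : ∀ p → Homogeneous d p → ∃ λ cs → p ∼ linComb P cs us

    -- The coordinate vectors of `suc r` homogeneous elements in a basis of size `r` are linearly
    -- dependent, and the same coefficients relate the elements modulo the ideal.
    hilbertCoeff : ∀ {d r} (us : Vec (Poly nvars) r) → GradedBasis d us → HilbertCoeff P d r
    hilbertCoeff {d} {r} us basis = (us , homogeneous , independent) , dependent
      where
      open GradedBasis basis
      dependent : (ps : Vec (Poly nvars) (suc r)) → (∀ j → Homogeneous d (lookup ps j)) → ¬ IndependentMod P ps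
      dependent ps hom indep = proj₂ nz (trans (sym (VecP.lookup∘tabulate c (proj₁ nz))) (indep (tabulate c) inI (proj₁ nz)))
        where
        A : Fin (suc r) → Vec ℚ r
        A j = proj₁ (spanning (lookup ps j) (hom j))
        dep = linear-dependence r (λ j i → lookup (A j) i)
        c = proj₁ dep
        nz = proj₁ (proj₂ dep)
        qs : Vec (Poly nvars) (suc r)
        qs = tabulate (λ j → lookup ps j -ᵖ linComb P (A j) us)
        qs∈I : ∀ j → I (lookup qs j)
        qs∈I j = subst I (sym (VecP.lookup∘tabulate (λ j → lookup ps j -ᵖ linComb P (A j) us) j))
                   (difference (proj₂ (spanning (lookup ps j) (hom j))))
        module _ (f : Mono nvars → ℚ) where
          open ≡-Reasoning
          u : Fin r → ℚ
          u i = ⟪ lookup us i , f ⟫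
          -- The contribution of `us` cancels identically and not only modulo the ideal. So the
          -- combination of `ps` is, as a polynomial, a combination of the differences `qs`, which
          -- lie in the ideal.
          vanish : sum (λ j → c j ℚ.* ⟪ linComb P (A j) us , f ⟫) ≡ 0ℚ
          vanish = begin
            sum (λ j → c j ℚ.* ⟪ linComb P (A j) us , f ⟫)
              ≡⟨ sum-cong-≗ (λ j → cong (c j ℚ.*_) (⟪linComb⟫ (A j) us f)) ⟩
            sum (λ j → c j ℚ.* sum (λ i → lookup (A j) i ℚ.* u i))
              ≡⟨ sum-cong-≗ (λ j → *-distribˡ-sum (c j) (λ i → lookup (A j) i ℚ.* u i)) ⟩
            sum (λ j → sum (λ i → c j ℚ.* (lookup (A j) i ℚ.* u i)))
              ≡⟨ ∑-comm (λ j i → c j ℚ.* (lookup (A j) i ℚ.* u i)) ⟩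
            sum (λ i → sum (λ j → c j ℚ.* (lookup (A j) i ℚ.* u i)))
              ≡⟨ sum-cong-≗ (λ i → sum-cong-≗ (λ j → ℚP.*-assoc (c j) (lookup (A j) i) (u i))) ⟨
            sum (λ i → sum (λ j → c j ℚ.* lookup (A j) i ℚ.* u i))
              ≡⟨ sum-cong-≗ (λ i → *-distribʳ-sum (u i) (λ j → c j ℚ.* lookup (A j) i)) ⟨
            sum (λ i → sum (λ j → c j ℚ.* lookup (A j) i) ℚ.* u i)
              ≡⟨ sum-0 (λ i → trans (cong (ℚ._* u i) (proj₂ (proj₂ dep) i)) (ℚP.*-zeroˡ (u i))) ⟩
            0ℚ ∎
          agree : ⟪ linComb P (tabulate c) qs , f ⟫ ≡ ⟪ linComb P (tabulate c) ps , f ⟫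
          agree = begin
            ⟪ linComb P (tabulate c) qs , f ⟫ ≡⟨ ⟪linComb⟫ (tabulate c) qs f ⟩
            sum (λ j → lookup (tabulate c) j ℚ.* ⟪ lookup qs j , f ⟫)
              ≡⟨ sum-cong-≗ (λ j → cong₂ ℚ._*_ (VecP.lookup∘tabulate c j)
                   (cong (λ q → ⟪ q , f ⟫) (VecP.lookup∘tabulate (λ j → lookup ps j -ᵖ linComb P (A j) us) j))) ⟩
            sum (λ j → c j ℚ.* ⟪ lookup ps j -ᵖ linComb P (A j) us , f ⟫)
              ≡⟨ sum-cong-≗ (λ j → trans (cong (c j ℚ.*_) (trans (⟪⟫-++ (lookup ps j) (-ᵖ linComb P (A j) us) f) (cong (⟪ lookup ps j , f ⟫ ℚ.+_) (⟪⟫-neg (linComb P (A j) us) f))))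
                   (solve 3 (λ x y z → x :* (y :+ :- z) := x :* y :+ (:- con 1ℚ) :* (x :* z)) refl (c j) ⟪ lookup ps j , f ⟫ ⟪ linComb P (A j) us , f ⟫)) ⟩
            sum (λ j → c j ℚ.* ⟪ lookup ps j , f ⟫ ℚ.+ (ℚ.- 1ℚ) ℚ.* (c j ℚ.* ⟪ linComb P (A j) us , f ⟫))
              ≡⟨ ∑-distrib-+ (λ j → c j ℚ.* ⟪ lookup ps j , f ⟫) (λ j → (ℚ.- 1ℚ) ℚ.* (c j ℚ.* ⟪ linComb P (A j) us , f ⟫)) ⟩
            sum (λ j → c j ℚ.* ⟪ lookup ps j , f ⟫) ℚ.+ sum (λ j → (ℚ.- 1ℚ) ℚ.* (c j ℚ.* ⟪ linComb P (A j) us , f ⟫))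
              ≡⟨ cong (sum (λ j → c j ℚ.* ⟪ lookup ps j , f ⟫) ℚ.+_) (trans (sym (*-distribˡ-sum (ℚ.- 1ℚ) (λ j → c j ℚ.* ⟪ linComb P (A j) us , f ⟫))) (cong ((ℚ.- 1ℚ) ℚ.*_) vanish)) ⟩
            sum (λ j → c j ℚ.* ⟪ lookup ps j , f ⟫) ℚ.+ 0ℚ ≡⟨ ℚP.+-identityʳ _ ⟩
            sum (λ j → c j ℚ.* ⟪ lookup ps j , f ⟫)
              ≡⟨ sum-cong-≗ (λ j → cong (ℚ._* ⟪ lookup ps j , f ⟫) (VecP.lookup∘tabulate c j)) ⟨
            sum (λ j → lookup (tabulate c) j ℚ.* ⟪ lookup ps j , f ⟫) ≡⟨ ⟪linComb⟫ (tabulate c) ps f ⟨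
            ⟪ linComb P (tabulate c) ps , f ⟫ ∎
            where open +-*-Solver
        inI : InIdeal P (linComb P (tabulate c) ps)
        inI = I⇒InIdeal {linComb P (tabulate c) ps} (I-resp (mk≈ agree) (I-linComb (tabulate c) qs qs∈I))

-- Polymatroids and the admissibility condition along a chain of flats

module ChainFunctionals where

  open import Data.Bool using (if_then_else_)
  open import Data.Empty using (⊥-elim)
  open import Data.Fin using (Fin)
  import Data.Fin.Properties as FinP
  open import Data.Fin.Subset as Sub using (Subset; _∈_; _∉_; _⊆_; ⁅_⁆; _∪_; _∩_)
  import Data.Fin.Subset.Properties as SubP
  open import Data.Nat using (ℕ; suc; _+_; _≤_; _<_; z≤n; s≤s; _≤?_; _<?_)
  open import Data.Nat.Properties
  open import Data.Nat.Tactic.RingSolver using (solve-∀)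
  open import Data.List using (List; []; _∷_; _++_; replicate)
  open import Data.Product using (∃; _×_; _,_; proj₁; proj₂)
  open import Data.Sum using (_⊎_; inj₁; inj₂)
  open import Data.Vec.Properties using (≡-dec)
  import Data.Bool.Properties as BoolP
  open import Function using (_⇔_; mk⇔; Equivalence)
  open import Relation.Nullary using (¬_; Dec; yes; no; does; contradiction)
  open import Relation.Nullary.Decidable using (_×-dec_; ¬?; decidable-stable; _→-dec_)
  open import Relation.Binary.PropositionalEquality

  open Equivalence using (to; from)

  ⊥ₛ : ∀ {n} → Subset n
  ⊥ₛ = Sub.⊥

  -- Covers the rank of a loopless matroid (points of rank 1) and that rank raised by one on
  -- nonempty sets (points of rank 2). In the second case a single element can raise the rank by 2,
  -- but only from the empty set; hence the restriction in `ρ-step`.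
  record Polymatroid (n : ℕ) : Set where
    field
      ρ        : Subset n → ℕ
      ρ-⊥      : ρ ⊥ₛ ≡ 0
      ρ-mono   : ∀ {S T} → S ⊆ T → ρ S ≤ ρ T
      ρ-submod : ∀ S T → ρ (S ∪ T) + ρ (S ∩ T) ≤ ρ S + ρ T
      ρ-point≥ : ∀ i → 1 ≤ ρ ⁅ i ⁆
      ρ-point≤ : ∀ i → ρ ⁅ i ⁆ ≤ 2
      ρ-step   : ∀ S i → S ≢ ⊥ₛ → ρ (S ∪ ⁅ i ⁆) ≤ suc (ρ S)

  _≟ₛ_ : ∀ {n} (S T : Subset n) → Dec (S ≡ T)
  _≟ₛ_ = ≡-dec BoolP._≟_

  ⟦_⟧ : ∀ {P : Set} → Dec P → ℕ
  ⟦ d ⟧ = if does d then 1 else 0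

  ⟦⟧-yes : ∀ {P : Set} (d : Dec P) → P → ⟦ d ⟧ ≡ 1
  ⟦⟧-yes (yes _) p = refl
  ⟦⟧-yes (no ¬p) p = contradiction p ¬p

  ⟦⟧-no : ∀ {P : Set} (d : Dec P) → ¬ P → ⟦ d ⟧ ≡ 0
  ⟦⟧-no (yes p) ¬p = contradiction p ¬p
  ⟦⟧-no (no _)  ¬p = refl

  ⟦⟧-mono : ∀ {P Q : Set} (d : Dec P) (e : Dec Q) → (P → Q) → ⟦ d ⟧ ≤ ⟦ e ⟧
  ⟦⟧-mono (yes p) (yes q) f = ≤-refl
  ⟦⟧-mono (yes p) (no ¬q) f = contradiction (f p) ¬q
  ⟦⟧-mono (no ¬p) e       f = z≤n

  ⟦⟧-cong : ∀ {P Q : Set} (d : Dec P) (e : Dec Q) → (P → Q) → (Q → P) → ⟦ d ⟧ ≡ ⟦ e ⟧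
  ⟦⟧-cong d e f g = ≤-antisym (⟦⟧-mono d e f) (⟦⟧-mono e d g)

  ⟦⟧≤1 : ∀ {P : Set} (d : Dec P) → ⟦ d ⟧ ≤ 1
  ⟦⟧≤1 (yes _) = ≤-refl
  ⟦⟧≤1 (no _)  = z≤n

  ∪-lub : ∀ {n} {S T U : Subset n} → S ⊆ U → T ⊆ U → S ∪ T ⊆ U
  ∪-lub {S = S} {T} s t x∈ with SubP.x∈p∪q⁻ S T x∈
  ... | inj₁ x∈S = s x∈S
  ... | inj₂ x∈T = t x∈T

  ⁅⁆-⊆ : ∀ {n} {i : Fin n} {U} → i ∈ U → ⁅ i ⁆ ⊆ U
  ⁅⁆-⊆ {i = i} {U} i∈ x∈ = subst (_∈ U) (sym (SubP.x∈⁅y⁆⇒x≡y i x∈)) i∈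

  ⊆⊥⇒≡⊥ : ∀ {n} {S : Subset n} → S ⊆ ⊥ₛ → S ≡ ⊥ₛ
  ⊆⊥⇒≡⊥ S⊆ = SubP.Empty-unique (λ (x , x∈) → SubP.∉⊥ (S⊆ x∈))

  module _ {n : ℕ} where

    add : Subset n → (Subset n → ℕ) → Subset n → ℕ
    add S c U = ⟦ S SubP.⊆? U ⟧ + c U

    count : List (Subset n) → Subset n → ℕ
    count []      U = 0
    count (S ∷ m) U = add S (count m) U

    -- The number of factors inside a set is supermodular whereas rank is submodular; uncrossing
    -- rests on this contrast.
    record IsCount (c : Subset n → ℕ) : Set where
      field
        c-mono     : ∀ {U V} → U ⊆ V → c U ≤ c V
        c-supermod : ∀ U V → c U + c V ≤ c (U ∪ V) + c (U ∩ V)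

    isCount : ∀ m → IsCount (count m)
    isCount []      = record { c-mono = λ _ → ≤-refl ; c-supermod = λ _ _ → ≤-refl }
    isCount (S ∷ m) = record
      { c-mono     = λ {U} {V} U⊆V → +-mono-≤ (⟦⟧-mono (S SubP.⊆? U) (S SubP.⊆? V) (λ S⊆U x∈ → U⊆V (S⊆U x∈))) (c-mono U⊆V)
      ; c-supermod = λ U V → subst₂ _≤_ (rearrange ⟦ S SubP.⊆? U ⟧ ⟦ S SubP.⊆? V ⟧ (count m U) (count m V))
                                       (rearrange ⟦ S SubP.⊆? (U ∪ V) ⟧ ⟦ S SubP.⊆? (U ∩ V) ⟧ (count m (U ∪ V)) (count m (U ∩ V)))
                                       (+-mono-≤ (super U V) (c-supermod U V)) }
      where
      open IsCount (isCount m)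
      rearrange : ∀ a b x y → (a + b) + (x + y) ≡ (a + x) + (b + y)
      rearrange = solve-∀
      super : ∀ U V → ⟦ S SubP.⊆? U ⟧ + ⟦ S SubP.⊆? V ⟧ ≤ ⟦ S SubP.⊆? (U ∪ V) ⟧ + ⟦ S SubP.⊆? (U ∩ V) ⟧
      super U V with S SubP.⊆? U | S SubP.⊆? V
      ... | no _    | no _    = z≤n
      ... | yes S⊆U | no _    = subst (1 ≤_) (cong (_+ ⟦ S SubP.⊆? (U ∩ V) ⟧) (sym (⟦⟧-yes (S SubP.⊆? (U ∪ V)) (λ x∈ → SubP.p⊆p∪q V (S⊆U x∈))))) (s≤s z≤n)
      ... | no _    | yes S⊆V = subst (1 ≤_) (cong (_+ ⟦ S SubP.⊆? (U ∩ V) ⟧) (sym (⟦⟧-yes (S SubP.⊆? (U ∪ V)) (λ x∈ → SubP.q⊆p∪q U V (S⊆V x∈))))) (s≤s z≤n)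
      ... | yes S⊆U | yes S⊆V = ≤-reflexive (sym (cong₂ _+_
            (⟦⟧-yes (S SubP.⊆? (U ∪ V)) (λ x∈ → SubP.p⊆p∪q V (S⊆U x∈)))
            (⟦⟧-yes (S SubP.⊆? (U ∩ V)) (λ x∈ → SubP.x∈p∩q⁺ (S⊆U x∈ , S⊆V x∈)))))

    Chain : Set
    Chain = List (Subset n × ℕ)

    top : Chain → Subset n
    top []            = ⊥ₛ
    top ((F , _) ∷ _) = F

    total : Chain → ℕ
    total []            = 0
    total ((_ , a) ∷ C) = a + total C

    flatten : Chain → List (Subset n)
    flatten []            = []
    flatten ((F , a) ∷ C) = replicate a F ++ flatten C

  module Functional {n : ℕ} (M : Polymatroid n) where
    open Polymatroid M

    IsFlat : Subset n → Set
    IsFlat F = ∀ i → i ∉ F → ρ F < ρ (F ∪ ⁅ i ⁆)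

    isFlat? : ∀ F → Dec (IsFlat F)
    isFlat? F = FinP.all? (λ i → ¬? (i SubP.∈? F) →-dec (ρ F <? ρ (F ∪ ⁅ i ⁆)))

    -- Submodularity carries the equality of ranks from `S` up to `F`, and a flat gains rank from
    -- every element outside it.
    flat-absorbs : ∀ {F S} i → IsFlat F → ρ (S ∪ ⁅ i ⁆) ≡ ρ S → S ⊆ F → i ∈ F
    flat-absorbs {F} {S} i flat ρ≡ S⊆F with i SubP.∈? F
    ... | yes i∈ = i∈
    ... | no i∉ = contradiction (<-≤-trans (flat i i∉) (+-cancelʳ-≤ (ρ S) _ _ key)) (<-irrefl refl)
      where
      open ≤-Reasoning
      key : ρ (F ∪ ⁅ i ⁆) + ρ S ≤ ρ F + ρ S
      key = begin
        ρ (F ∪ ⁅ i ⁆) + ρ S  ≤⟨ +-mono-≤ (ρ-mono (∪-lub {S = F} (λ x∈ → SubP.p⊆p∪q (S ∪ ⁅ i ⁆) x∈) (λ x∈ → SubP.q⊆p∪q F _ (SubP.q⊆p∪q S _ x∈))))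
                                        (ρ-mono {S} {F ∩ (S ∪ ⁅ i ⁆)} (λ x∈ → SubP.x∈p∩q⁺ (S⊆F x∈ , SubP.p⊆p∪q ⁅ i ⁆ x∈))) ⟩
        ρ (F ∪ (S ∪ ⁅ i ⁆)) + ρ (F ∩ (S ∪ ⁅ i ⁆)) ≤⟨ ρ-submod F (S ∪ ⁅ i ⁆) ⟩
        ρ F + ρ (S ∪ ⁅ i ⁆)  ≡⟨ cong (ρ F +_) ρ≡ ⟩
        ρ F + ρ S            ∎

    ρ-absorb : ∀ {S U} i → ρ (S ∪ ⁅ i ⁆) ≡ ρ S → S ⊆ U → ρ (U ∪ ⁅ i ⁆) ≡ ρ U
    ρ-absorb {S} {U} i ρ≡ S⊆U = ≤-antisym (+-cancelʳ-≤ (ρ S) _ _ key) (ρ-mono {U} (SubP.p⊆p∪q ⁅ i ⁆))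
      where
      open ≤-Reasoning
      key : ρ (U ∪ ⁅ i ⁆) + ρ S ≤ ρ U + ρ S
      key = begin
        ρ (U ∪ ⁅ i ⁆) + ρ S  ≤⟨ +-mono-≤ (ρ-mono (∪-lub {S = U} (λ x∈ → SubP.p⊆p∪q (S ∪ ⁅ i ⁆) x∈) (λ x∈ → SubP.q⊆p∪q U _ (SubP.q⊆p∪q S _ x∈))))
                                        (ρ-mono {S} {U ∩ (S ∪ ⁅ i ⁆)} (λ x∈ → SubP.x∈p∩q⁺ (S⊆U x∈ , SubP.p⊆p∪q ⁅ i ⁆ x∈))) ⟩
        ρ (U ∪ (S ∪ ⁅ i ⁆)) + ρ (U ∩ (S ∪ ⁅ i ⁆)) ≤⟨ ρ-submod U (S ∪ ⁅ i ⁆) ⟩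
        ρ U + ρ (S ∪ ⁅ i ⁆)  ≡⟨ cong (ρ U +_) ρ≡ ⟩
        ρ U + ρ S            ∎

    -- The strict (dragon) form of the Hall-Rado condition in the minor above `G`: if `U` contains
    -- factors beyond the `A` ones counted at `G`, their number is less than `ρ U - ρ G`. It is
    -- written additively because subtraction on ℕ truncates.
    Bound : Subset n → ℕ → (Subset n → ℕ) → Subset n → Set
    Bound G A c U = c U ≤ A ⊎ suc (c U + ρ G) ≤ A + ρ U

    record Layer (G : Subset n) (A : ℕ) (F : Subset n) (B : ℕ) (c : Subset n → ℕ) : Set where
      constructor layer
      field
        total≡ : c F ≡ B
        bound  : ∀ U → G ⊆ U → U ⊆ F → Bound G A c U

    open Layer

    -- Hall–Rado type condition, layer by layer along the chain (a layer is the minor between consecutive flats).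
    Admissible : Chain → (Subset n → ℕ) → Set
    Admissible []            c = c ⊥ₛ ≡ 0
    Admissible ((F , a) ∷ C) c = Admissible C c × Layer (top C) (total C) F (a + total C) c

    -- Inclusions may be equalities and exponents are arbitrary, so that a chain stays a flag when
    -- the full set with exponent 0 is put on top of it, even if it already ends there.
    data Flag : Chain {n} → Set where
      []   : Flag []
      cons : ∀ {F a C} → IsFlat F → top C ⊆ F → Flag C → Flag ((F , a) ∷ C)

    flag-top : ∀ {C} → Flag C → IsFlat (top C)
    flag-top []             i i∉ = subst (_< ρ (⊥ₛ ∪ ⁅ i ⁆)) (sym ρ-⊥) (≤-trans (ρ-point≥ i) (ρ-mono {⁅ i ⁆} (SubP.q⊆p∪q ⊥ₛ ⁅ i ⁆)))
    flag-top (cons flat _ _) = flat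

    admissible-top : ∀ C {c} → Admissible C c → c (top C) ≡ total C
    admissible-top []      p       = p
    admissible-top (_ ∷ C) (_ , l) = total≡ l

    bound-mono : ∀ {G A c c′} U → c′ U ≤ c U → Bound G A c U → Bound G A c′ U
    bound-mono U le (inj₁ x) = inj₁ (≤-trans le x)
    bound-mono U le (inj₂ y) = inj₂ (≤-trans (s≤s (+-monoˡ-≤ _ le)) y)

    layer-mono : ∀ {G A F B c c′} → c′ F ≡ c F → (∀ U → G ⊆ U → U ⊆ F → c′ U ≤ c U) → Layer G A F B c → Layer G A F B c′
    layer-mono {G} {A} {c = c} {c′} e le l = layer (trans e (total≡ l))
      (λ U G⊆U U⊆F → bound-mono {G} {A} {c} {c′} U (le U G⊆U U⊆F) (bound l U G⊆U U⊆F))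

    layer-cong : ∀ {G A F B c c′} → G ⊆ F → (∀ U → G ⊆ U → U ⊆ F → c U ≡ c′ U) → Layer G A F B c → Layer G A F B c′
    layer-cong {F = F} G⊆F e = layer-mono (sym (e F G⊆F (λ x → x))) (λ U p q → ≤-reflexive (sym (e U p q)))

    admissible-local : ∀ {C c c′} → Flag C → (∀ U → U ⊆ top C → c U ≡ c′ U) → Admissible C c → Admissible C c′
    admissible-local [] e p = trans (sym (e ⊥ₛ (λ x → x))) p
    admissible-local (cons flat G⊆F fl) e (p , l) =
      admissible-local fl (λ U U⊆G → e U (λ x∈ → G⊆F (U⊆G x∈))) p , layer-cong G⊆F (λ U _ U⊆F → e U U⊆F) l

    Bad : Subset n → ℕ → Subset n → (Subset n → ℕ) → Subset n → Set
    Bad G A F c U = G ⊆ U × U ⊆ F × ¬ (c U ≤ A) × ¬ (suc (c U + ρ G) ≤ A + ρ U)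

    -- Uncrossing needs an actual violating set, not just the failure of the universal statement; a
    -- finite search provides it.
    search : ∀ G A F c → ∃ (Bad G A F c) ⊎ (∀ U → G ⊆ U → U ⊆ F → Bound G A c U)
    search G A F c with SubP.anySubset? (λ U → (G SubP.⊆? U) ×-dec (U SubP.⊆? F) ×-dec ¬? (c U ≤? A) ×-dec ¬? (suc (c U + ρ G) ≤? A + ρ U))
    ... | yes bad = inj₁ bad
    ... | no none = inj₂ ok
      where
      ok : ∀ U → G ⊆ U → U ⊆ F → Bound G A c U
      ok U G⊆U U⊆F with c U ≤? A | suc (c U + ρ G) ≤? A + ρ U
      ... | yes p | _     = inj₁ p
      ... | no _  | yes q = inj₂ q
      ... | no ¬p | no ¬q = ⊥-elim (none (U , (λ x → G⊆U x) , (λ x → U⊆F x) , ¬p , ¬q))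

    not-bad : ∀ {G A F c U} → Bad G A F c U → ¬ Bound G A c U
    not-bad (_ , _ , ¬p , ¬q) (inj₁ p) = ¬p p
    not-bad (_ , _ , ¬p , ¬q) (inj₂ q) = ¬q q

    layer? : ∀ G A F B c → Dec (Layer G A F B c)
    layer? G A F B c with c F ≟ B | search G A F c
    ... | no ne | _               = no (λ l → ne (total≡ l))
    ... | yes e | inj₂ ok         = yes (layer e ok)
    ... | yes e | inj₁ (U , bad)  = no (λ l → not-bad {c = c} {U = U} bad (bound l U (proj₁ bad) (proj₁ (proj₂ bad))))

    admissible? : ∀ C c → Dec (Admissible C c)
    admissible? []            c = c ⊥ₛ ≟ 0
    admissible? ((F , a) ∷ C) c = admissible? C c ×-dec layer? (top C) (total C) F (a + total C) c

    -- The empty set lies in every `U`, hence it is counted already at the bottom of the chain,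
    -- where the count has to be 0.
    admissible-⊥ : ∀ C m → Flag C → ¬ Admissible C (count (⊥ₛ ∷ m))
    admissible-⊥ [] m fl p = contradiction (trans (sym (cong (_+ count m ⊥ₛ) (⟦⟧-yes (⊥ₛ {n} SubP.⊆? ⊥ₛ) (λ x → x)))) p) λ ()
    admissible-⊥ (_ ∷ C) m (cons _ _ fl) (p , _) = admissible-⊥ C m fl p

    add-yes : ∀ {S U : Subset n} c → S ⊆ U → add S c U ≡ suc (c U)
    add-yes {S} {U} c S⊆U = cong (_+ c U) (⟦⟧-yes (S SubP.⊆? U) S⊆U)

    add-no : ∀ {S U : Subset n} c → ¬ S ⊆ U → add S c U ≡ c U
    add-no {S} {U} c S⊈U = cong (_+ c U) (⟦⟧-no (S SubP.⊆? U) S⊈U)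

    -- A flat contains `S` exactly if it contains `S ∪ ⁅ i ⁆`, so all prescribed totals agree. A
    -- bound can change only at a set `U` that contains `S` but not `i`; there it follows from the
    -- bound at `U ∪ ⁅ i ⁆`, which has the same rank and at least as many factors.
    admissible-closed : ∀ C m {S} i → Flag C → ρ (S ∪ ⁅ i ⁆) ≡ ρ S →
                        Admissible C (count (S ∷ m)) ⇔ Admissible C (count (S ∪ ⁅ i ⁆ ∷ m))
    admissible-closed C m {S} i fl ρ≡ = mk⇔ (go₁ C fl) (go₂ C fl)
      where
      c = count m
      open IsCount (isCount m)
      S⁺ = S ∪ ⁅ i ⁆
      shrink : ∀ {U} → S⁺ ⊆ U → S ⊆ U
      shrink S⁺⊆U x∈ = S⁺⊆U (SubP.p⊆p∪q ⁅ i ⁆ x∈)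
      same : ∀ {F} → IsFlat F → add S c F ≡ add S⁺ c F
      same {F} flat = cong (_+ c F) (⟦⟧-cong (S SubP.⊆? F) (S⁺ SubP.⊆? F)
        (λ S⊆F → ∪-lub S⊆F (⁅⁆-⊆ (flat-absorbs {F} {S} i flat ρ≡ S⊆F))) (shrink {F}))
      less : ∀ U → add S⁺ c U ≤ add S c U
      less U = +-monoˡ-≤ (c U) (⟦⟧-mono (S⁺ SubP.⊆? U) (S SubP.⊆? U) (shrink {U}))
      go₁ : ∀ C → Flag C → Admissible C (add S c) → Admissible C (add S⁺ c)
      go₁ [] fl p = trans (sym (same (flag-top []))) p
      go₁ ((F , a) ∷ D) (cons flat G⊆F fl) (p , l) = go₁ D fl p , layer-mono (sym (same flat)) (λ U _ _ → less U) l
      go₂ : ∀ C → Flag C → Admissible C (add S⁺ c) → Admissible C (add S c)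
      go₂ [] fl p = trans (same (flag-top [])) p
      go₂ ((F , a) ∷ D) (cons flat G⊆F fl) (p , l) = go₂ D fl p , layer (trans (same flat) (total≡ l)) bnd
        where
        G = top D
        A = total D
        bnd : ∀ U → G ⊆ U → U ⊆ F → Bound G A (add S c) U
        bnd U G⊆U U⊆F with S SubP.⊆? U
        ... | no S⊈U = bound-mono {G} {A} {add S⁺ c} {c} U (m≤n+m (c U) ⟦ S⁺ SubP.⊆? U ⟧) (bound l U G⊆U U⊆F)
        ... | yes S⊆U with bound l (U ∪ ⁅ i ⁆) (λ x∈ → SubP.p⊆p∪q ⁅ i ⁆ (G⊆U x∈)) (∪-lub U⊆F (⁅⁆-⊆ (flat-absorbs {F} {S} i flat ρ≡ (λ x∈ → U⊆F (S⊆U x∈)))))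
        ...   | inj₁ le = inj₁ (≤-trans grow le)
          where
          grow : suc (c U) ≤ add S⁺ c (U ∪ ⁅ i ⁆)
          grow = subst (suc (c U) ≤_) (sym (add-yes c (∪-lub (λ x∈ → SubP.p⊆p∪q ⁅ i ⁆ (S⊆U x∈)) (SubP.q⊆p∪q U ⁅ i ⁆)))) (s≤s (c-mono {U} (SubP.p⊆p∪q ⁅ i ⁆)))
        ...   | inj₂ le = inj₂ (≤-trans (s≤s (+-monoˡ-≤ (ρ G) grow)) (subst (λ r → suc (add S⁺ c (U ∪ ⁅ i ⁆) + ρ G) ≤ A + r) (ρ-absorb i ρ≡ S⊆U) le))
          where
          grow : suc (c U) ≤ add S⁺ c (U ∪ ⁅ i ⁆)
          grow = subst (suc (c U) ≤_) (sym (add-yes c (∪-lub (λ x∈ → SubP.p⊆p∪q ⁅ i ⁆ (S⊆U x∈)) (SubP.q⊆p∪q U ⁅ i ⁆)))) (s≤s (c-mono {U} (SubP.p⊆p∪q ⁅ i ⁆)))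

    -- There is no room at the first step of the layer: because the bound is strict, `suc e` new
    -- factors at `G ∪ ⁅ i ⁆` demand a rank increase of more than `suc e`.
    layer-overfull : ∀ {G A F B c} i e → Layer G A F B c → G ⊆ F → i ∈ F → c G ≡ A →
                     suc e + A ≤ c (G ∪ ⁅ i ⁆) → ¬ ρ (G ∪ ⁅ i ⁆) ≤ suc e + ρ G
    layer-overfull {G} {A} {F} {B} {c} i e l G⊆F i∈F cG≡A big small with bound l (G ∪ ⁅ i ⁆) (SubP.p⊆p∪q ⁅ i ⁆) (∪-lub G⊆F (⁅⁆-⊆ i∈F))
    ... | inj₁ le = <-irrefl refl (≤-trans (s≤s (m≤n+m A e)) (≤-trans big le))
    ... | inj₂ le = <-irrefl (rearr (suc e) A (ρ G)) (≤-trans (s≤s (+-monoˡ-≤ (ρ G) big)) (≤-trans le (+-monoʳ-≤ A small)))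
      where
      rearr : ∀ e A r → e + A + r ≡ A + (e + r)
      rearr = solve-∀

    add-point : ∀ {i} {U} c → i ∈ U → add ⁅ i ⁆ c U ≡ suc (c U)
    add-point c i∈ = add-yes c (⁅⁆-⊆ i∈)

    add-nonpoint : ∀ {i} {U} c → i ∉ U → add ⁅ i ⁆ c U ≡ c U
    add-nonpoint {i} c i∉ = add-no c (λ sub → i∉ (sub (SubP.x∈⁅x⁆ i)))

    i∈∪⁅i⁆ : ∀ (G : Subset n) i → i ∈ G ∪ ⁅ i ⁆
    i∈∪⁅i⁆ G i = SubP.q⊆p∪q G ⁅ i ⁆ (SubP.x∈⁅x⁆ i)

    -- In the layer where `i` first appears, the factor `⁅ i ⁆` is new in `G ∪ ⁅ i ⁆` while the rank
    -- grows by at most 1.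
    admissible-point : ∀ C m i → Flag C → i ∈ top C → ρ ⁅ i ⁆ ≡ 1 → ¬ Admissible C (count (⁅ i ⁆ ∷ m))
    admissible-point [] m i fl i∈ ρ≡ p = SubP.∉⊥ i∈
    admissible-point ((F , a) ∷ D) m i (cons flat G⊆F fl) i∈F ρ≡ (p , l) with i SubP.∈? top D
    ... | yes i∈G = admissible-point D m i fl i∈G ρ≡ p
    ... | no i∉G = layer-overfull i 0 l G⊆F i∈F (admissible-top D p) big small
      where
      G = top D
      c = count m
      open IsCount (isCount m)
      cG : c G ≡ total D
      cG = trans (sym (add-nonpoint c i∉G)) (admissible-top D p)
      big : suc (total D) ≤ add ⁅ i ⁆ c (G ∪ ⁅ i ⁆)
      big = subst₂ _≤_ (cong suc cG) (sym (add-point c (i∈∪⁅i⁆ G i))) (s≤s (c-mono {G} (SubP.p⊆p∪q ⁅ i ⁆)))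
      small : ρ (G ∪ ⁅ i ⁆) ≤ suc (ρ G)
      small = +-cancelʳ-≤ (ρ (G ∩ ⁅ i ⁆)) _ _ (≤-trans (ρ-submod G ⁅ i ⁆)
                (≤-trans (≤-reflexive (trans (cong (ρ G +_) ρ≡) (+-comm (ρ G) 1))) (m≤m+n _ _)))

    admissible-point² : ∀ C m i → Flag C → i ∈ top C → ¬ Admissible C (count (⁅ i ⁆ ∷ ⁅ i ⁆ ∷ m))
    admissible-point² [] m i fl i∈ p = SubP.∉⊥ i∈
    admissible-point² ((F , a) ∷ D) m i (cons flat G⊆F fl) i∈F (p , l) with i SubP.∈? top D
    ... | yes i∈G = admissible-point² D m i fl i∈G p
    ... | no i∉G = layer-overfull i 1 l G⊆F i∈F (admissible-top D p) big small
      where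
      G = top D
      c = count m
      open IsCount (isCount m)
      cG : c G ≡ total D
      cG = trans (sym (trans (add-nonpoint (add ⁅ i ⁆ c) i∉G) (add-nonpoint c i∉G))) (admissible-top D p)
      big : suc (suc (total D)) ≤ add ⁅ i ⁆ (add ⁅ i ⁆ c) (G ∪ ⁅ i ⁆)
      big = subst₂ _≤_ (cong (λ x → suc (suc x)) cG)
        (sym (trans (add-point (add ⁅ i ⁆ c) (i∈∪⁅i⁆ G i)) (cong suc (add-point c (i∈∪⁅i⁆ G i)))))
        (s≤s (s≤s (c-mono {G} (SubP.p⊆p∪q ⁅ i ⁆))))
      small : ρ (G ∪ ⁅ i ⁆) ≤ suc (suc (ρ G))
      small = +-cancelʳ-≤ (ρ (G ∩ ⁅ i ⁆)) _ _ (≤-trans (ρ-submod G ⁅ i ⁆)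
                (≤-trans (≤-trans (+-monoʳ-≤ (ρ G) (ρ-point≤ i)) (≤-reflexive (+-comm (ρ G) 2))) (m≤m+n _ _)))

    -- The critical layer is the one where `i` first appears; above it every `U` contains `i` and
    -- the counts agree. If its lower flat `G` is nonempty, `⁅ i ⁆` alone overfills the layer and
    -- both sides are false. If `G` is empty, a set `U` that contains `S` but not `i` is compared
    -- with `U ∪ ⁅ i ⁆`, which has at least one more factor and at most one more rank.
    admissible-point-absorb : ∀ C m i S → Flag C → i ∈ top C →
      Admissible C (count (⁅ i ⁆ ∷ S ∷ m)) ⇔ Admissible C (count (⁅ i ⁆ ∷ S ∪ ⁅ i ⁆ ∷ m))
    admissible-point-absorb C m i S fl i∈ with S ≟ₛ ⊥ₛ
    ... | yes refl = mk⇔ (λ p → ⊥-elim (never-⊥ C fl p))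
                         (λ p → ⊥-elim (admissible-point² C m i fl i∈ (subst (λ T → Admissible C (count (⁅ i ⁆ ∷ T ∷ m))) (SubP.∪-identityˡ ⁅ i ⁆) p)))
      where
      never-⊥ : ∀ C → Flag C → ¬ Admissible C (count (⁅ i ⁆ ∷ ⊥ₛ ∷ m))
      never-⊥ [] _ p = contradiction (trans (sym (trans (add-nonpoint (add ⊥ₛ (count m)) (SubP.∉⊥ {x = i})) (add-yes (count m) (λ x → x)))) p) λ ()
      never-⊥ (_ ∷ C) (cons _ _ fl) (p , _) = never-⊥ C fl p
    ... | no S≢⊥ = mk⇔ (go₁ C fl i∈) (go₂ C fl i∈)
      where
      c = count m
      open IsCount (isCount m)
      S⁺ = S ∪ ⁅ i ⁆
      cS = add ⁅ i ⁆ (add S c)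
      cS⁺ = add ⁅ i ⁆ (add S⁺ c)
      S⊆S⁺ : S ⊆ S⁺
      S⊆S⁺ = SubP.p⊆p∪q ⁅ i ⁆
      same : ∀ {U} → i ∈ U → cS U ≡ cS⁺ U
      same {U} i∈U = cong (λ x → ⟦ ⁅ i ⁆ SubP.⊆? U ⟧ + (x + c U)) (⟦⟧-cong (S SubP.⊆? U) (S⁺ SubP.⊆? U)
        (λ S⊆U → ∪-lub S⊆U (⁅⁆-⊆ i∈U)) (λ S⁺⊆U x∈ → S⁺⊆U (S⊆S⁺ x∈)))
      same-⊥ : ∀ {U} → U ⊆ ⊥ₛ → cS U ≡ cS⁺ U
      same-⊥ {U} U⊆⊥ = cong (λ x → ⟦ ⁅ i ⁆ SubP.⊆? U ⟧ + (x + c U)) (trans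
        (⟦⟧-no (S SubP.⊆? U) (λ S⊆U → S≢⊥ (⊆⊥⇒≡⊥ (λ x∈ → U⊆⊥ (S⊆U x∈)))))
        (sym (⟦⟧-no (S⁺ SubP.⊆? U) (λ S⊆U → S≢⊥ (⊆⊥⇒≡⊥ (λ x∈ → U⊆⊥ (S⊆U (S⊆S⁺ x∈))))))))
      less : ∀ U → cS⁺ U ≤ cS U
      less U = +-monoʳ-≤ ⟦ ⁅ i ⁆ SubP.⊆? U ⟧ (+-monoˡ-≤ (c U) (⟦⟧-mono (S⁺ SubP.⊆? U) (S SubP.⊆? U) (λ S⁺⊆U x∈ → S⁺⊆U (S⊆S⁺ x∈))))
      overfull : ∀ {D F a} X → top D ⊆ F → i ∈ F → i ∉ top D → top D ≢ ⊥ₛ → ¬ Admissible ((F , a) ∷ D) (add ⁅ i ⁆ (add X c))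
      overfull {D} X G⊆F i∈F i∉G G≢⊥ (p , l) = layer-overfull i 0 l G⊆F i∈F (admissible-top D p) big (ρ-step (top D) i G≢⊥)
        where
        G = top D
        module X = IsCount (isCount (X ∷ m))
        cG : add X c G ≡ total D
        cG = trans (sym (add-nonpoint (add X c) i∉G)) (admissible-top D p)
        big : suc (total D) ≤ add ⁅ i ⁆ (add X c) (G ∪ ⁅ i ⁆)
        big = subst₂ _≤_ (cong suc cG) (sym (add-point (add X c) (i∈∪⁅i⁆ G i))) (s≤s (X.c-mono {G} (SubP.p⊆p∪q ⁅ i ⁆)))
      go₁ : ∀ C → Flag C → i ∈ top C → Admissible C cS → Admissible C cS⁺
      go₁ [] fl i∈ p = ⊥-elim (SubP.∉⊥ i∈)
      go₁ ((F , a) ∷ D) (cons flat G⊆F fl) i∈F (p , l) with i SubP.∈? top D | top D ≟ₛ ⊥ₛ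
      ... | yes i∈G | _       = go₁ D fl i∈G p , layer-cong G⊆F (λ U G⊆U _ → same {U} (G⊆U i∈G)) l
      ... | no i∉G  | no G≢⊥  = ⊥-elim (overfull {D} {F} {a} S G⊆F i∈F i∉G G≢⊥ (p , l))
      ... | no i∉G  | yes G≡⊥ = admissible-local fl (λ U U⊆G → same-⊥ {U} (λ x∈ → subst (_ ∈_) G≡⊥ (U⊆G x∈))) p ,
                                layer-mono (sym (same {F} i∈F)) (λ U _ _ → less U) l
      go₂ : ∀ C → Flag C → i ∈ top C → Admissible C cS⁺ → Admissible C cS
      go₂ [] fl i∈ p = ⊥-elim (SubP.∉⊥ i∈)
      go₂ ((F , a) ∷ D) (cons flat G⊆F fl) i∈F (p , l) with i SubP.∈? top D | top D ≟ₛ ⊥ₛ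
      ... | yes i∈G | _       = go₂ D fl i∈G p , layer-cong G⊆F (λ U G⊆U _ → sym (same {U} (G⊆U i∈G))) l
      ... | no i∉G  | no G≢⊥  = ⊥-elim (overfull {D} {F} {a} S⁺ G⊆F i∈F i∉G G≢⊥ (p , l))
      ... | no i∉G  | yes G≡⊥ = admissible-local fl (λ U U⊆G → sym (same-⊥ {U} (λ x∈ → subst (_ ∈_) G≡⊥ (U⊆G x∈)))) p ,
                                layer (trans (same {F} i∈F) (total≡ l)) bnd
        where
        G = top D
        A = total D
        bnd : ∀ U → G ⊆ U → U ⊆ F → Bound G A cS U
        bnd U G⊆U U⊆F = cases (i SubP.∈? U) (S SubP.⊆? U)
         where
         cases : Dec (i ∈ U) → Dec (S ⊆ U) → Bound G A cS U
         cases (yes i∈U) _ = bound-mono {G} {A} {cS⁺} {cS} U (≤-reflexive (same {U} i∈U)) (bound l U G⊆U U⊆F)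
         cases (no i∉U) (no S⊈U) = bound-mono {G} {A} {cS⁺} {cS} U (≤-trans (≤-reflexive eq) (≤-trans (m≤n+m (c U) ⟦ S⁺ SubP.⊆? U ⟧) (m≤n+m _ ⟦ ⁅ i ⁆ SubP.⊆? U ⟧))) (bound l U G⊆U U⊆F)
          where
          eq : cS U ≡ c U
          eq = trans (add-nonpoint (add S c) i∉U) (add-no c S⊈U)
         cases (no i∉U) (yes S⊆U) = go (bound l (U ∪ ⁅ i ⁆) (λ x∈ → SubP.p⊆p∪q ⁅ i ⁆ (G⊆U x∈)) (∪-lub U⊆F (⁅⁆-⊆ i∈F)))
          where
          U≢⊥ : U ≢ ⊥ₛ
          U≢⊥ e = S≢⊥ (⊆⊥⇒≡⊥ (λ x∈ → subst (_ ∈_) e (S⊆U x∈)))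
          grow : suc (cS U) ≤ cS⁺ (U ∪ ⁅ i ⁆)
          grow = subst₂ _≤_ (cong suc (sym (trans (add-nonpoint (add S c) i∉U) (add-yes c S⊆U))))
            (sym (trans (add-point (add S⁺ c) (i∈∪⁅i⁆ U i)) (cong suc (add-yes c (∪-lub (λ x∈ → SubP.p⊆p∪q ⁅ i ⁆ (S⊆U x∈)) (SubP.q⊆p∪q U ⁅ i ⁆))))))
            (s≤s (s≤s (c-mono {U} (SubP.p⊆p∪q ⁅ i ⁆))))
          go : Bound G A cS⁺ (U ∪ ⁅ i ⁆) → Bound G A cS U
          go (inj₁ le) = inj₁ (≤-trans (n≤1+n _) (≤-trans grow le))
          go (inj₂ le) = inj₂ (≤-pred (≤-trans (s≤s (+-monoˡ-≤ (ρ G) grow)) (≤-trans le (≤-trans (+-monoʳ-≤ A (ρ-step U i U≢⊥)) (≤-reflexive (+-suc A (ρ U)))))))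

    -- How the four admissibility conditions fit together so that 1_{ST} + 1_{KK} = 1_{SK} + 1_{TK}.
    data Exchange (ST KK SK TK : Set) : Set where
      swap₁   : ST ⇔ SK → TK ⇔ KK → Exchange ST KK SK TK
      swap₂   : ST ⇔ TK → SK ⇔ KK → Exchange ST KK SK TK
      lattice : (ST → SK × TK) → (SK → KK) → (TK → KK) → (SK → TK → ST) → (KK → SK ⊎ TK) → Exchange ST KK SK TK

    -- Strips off a layer whose condition `L` is the same for all four monomials.
    exchange-× : ∀ {ST KK SK TK ST′ KK′ SK′ TK′ L : Set} →
      (ST′ ⇔ (ST × L)) → (KK′ ⇔ (KK × L)) → (SK′ ⇔ (SK × L)) → (TK′ ⇔ (TK × L)) →
      Exchange ST KK SK TK → Exchange ST′ KK′ SK′ TK′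
    exchange-× st kk sk tk (swap₁ e f) = swap₁
      (mk⇔ (λ p → let (x , l) = to st p in from sk (to e x , l)) (λ p → let (x , l) = to sk p in from st (from e x , l)))
      (mk⇔ (λ p → let (x , l) = to tk p in from kk (to f x , l)) (λ p → let (x , l) = to kk p in from tk (from f x , l)))
    exchange-× st kk sk tk (swap₂ e f) = swap₂
      (mk⇔ (λ p → let (x , l) = to st p in from tk (to e x , l)) (λ p → let (x , l) = to tk p in from st (from e x , l)))
      (mk⇔ (λ p → let (x , l) = to sk p in from kk (to f x , l)) (λ p → let (x , l) = to kk p in from sk (from f x , l)))
    exchange-× st kk sk tk (lattice a b c d e) = lattice
      (λ p → let (x , l) = to st p in from sk (proj₁ (a x) , l) , from tk (proj₂ (a x) , l))
      (λ p → let (x , l) = to sk p in from kk (b x , l))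
      (λ p → let (x , l) = to tk p in from kk (c x , l))
      (λ p q → let (x , l) = to sk p in let (y , _) = to tk q in from st (d x y , l))
      (λ p → let (x , l) = to kk p in choose l (e x))
      where
      choose : _ → _ → _
      choose l (inj₁ x) = inj₁ (from sk (x , l))
      choose l (inj₂ y) = inj₂ (from tk (y , l))

    -- Adding up near-tightness of two sets (`h₃`, `h₄`), submodularity (`h₂`), supermodularity
    -- (`h₅`) and the bound at the union, where two more factors are counted (`h₁`), gives
    -- `suc (A + w) ≤ cW + g`. This contradicts both alternatives of the bound at the intersection,
    -- the first of them by `h₇`.
    uncrossing-arith : ∀ {A g v w u₁ u₂ cV cW c₁ c₂} →
      suc (suc (suc cV) + g) ≤ A + v → v + w ≤ u₁ + u₂ → A + u₁ ≤ suc (c₁ + g) → A + u₂ ≤ suc (c₂ + g) →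
      c₁ + c₂ ≤ cV + cW → g ≤ w → ¬ (cW ≤ A ⊎ suc (cW + g) ≤ A + w)
    uncrossing-arith {A} {g} {v} {w} {u₁} {u₂} {cV} {cW} {c₁} {c₂} h₁ h₂ h₃ h₄ h₅ h₇ (inj₁ h₆) =
      <-irrefl refl (≤-trans (≤-reflexive (eq A g v w u₁ u₂ cV cW c₁ c₂))
        (+-mono-≤ h₁ (+-mono-≤ h₂ (+-mono-≤ h₃ (+-mono-≤ h₄ (+-mono-≤ h₅ (+-mono-≤ h₆ h₇)))))))
      where
      eq : ∀ A g v w u₁ u₂ cV cW c₁ c₂ →
        suc (A + v + (u₁ + u₂ + (suc (c₁ + g) + (suc (c₂ + g) + (cV + cW + (A + w)))))) ≡
        suc (suc (suc cV) + g) + (v + w + (A + u₁ + (A + u₂ + (c₁ + c₂ + (cW + g)))))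
      eq = solve-∀
    uncrossing-arith {A} {g} {v} {w} {u₁} {u₂} {cV} {cW} {c₁} {c₂} h₁ h₂ h₃ h₄ h₅ h₇ (inj₂ h₆) =
      <-irrefl refl (≤-trans (n≤1+n _) (≤-trans (≤-reflexive (eq A g v w u₁ u₂ cV cW c₁ c₂))
        (+-mono-≤ h₁ (+-mono-≤ h₂ (+-mono-≤ h₃ (+-mono-≤ h₄ (+-mono-≤ h₅ h₆)))))))
      where
      eq : ∀ A g v w u₁ u₂ cV cW c₁ c₂ →
        suc (suc (A + v + (u₁ + u₂ + (suc (c₁ + g) + (suc (c₂ + g) + (cV + cW + (A + w))))))) ≡
        suc (suc (suc cV) + g) + (v + w + (A + u₁ + (A + u₂ + (c₁ + c₂ + suc (cW + g)))))
      eq = solve-∀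

    module Pair (m : List (Subset n)) (S T : Subset n) where
      private
        c = count m
        K = S ∪ T
      open IsCount (isCount m)

      cc : Subset n → Subset n → Subset n → ℕ
      cc X Y = add X (add Y c)

      private
        S⊆K : ∀ {U} → K ⊆ U → S ⊆ U
        S⊆K K⊆U x∈ = K⊆U (SubP.p⊆p∪q T x∈)
        T⊆K : ∀ {U} → K ⊆ U → T ⊆ U
        T⊆K K⊆U x∈ = K⊆U (SubP.q⊆p∪q S T x∈)

        cc-cong : ∀ {X Y X′ Y′} U → ⟦ X SubP.⊆? U ⟧ ≡ ⟦ X′ SubP.⊆? U ⟧ → ⟦ Y SubP.⊆? U ⟧ ≡ ⟦ Y′ SubP.⊆? U ⟧ → cc X Y U ≡ cc X′ Y′ U
        cc-cong U e f = cong₂ (λ a b → a + (b + c U)) e f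

        cc-none : ∀ {X Y} U → ¬ X ⊆ U → ¬ Y ⊆ U → cc X Y U ≡ c U
        cc-none {X} {Y} U ¬X ¬Y = trans (add-no (add Y c) ¬X) (add-no c ¬Y)

        cc-both : ∀ {X Y} U → X ⊆ U → Y ⊆ U → cc X Y U ≡ suc (suc (c U))
        cc-both {X} {Y} U X⊆ Y⊆ = trans (add-yes (add Y c) X⊆) (cong suc (add-yes c Y⊆))

        T≡K : ∀ U → S ⊆ U → ⟦ T SubP.⊆? U ⟧ ≡ ⟦ K SubP.⊆? U ⟧
        T≡K U S⊆U = ⟦⟧-cong (T SubP.⊆? U) (K SubP.⊆? U) (λ T⊆U → ∪-lub S⊆U T⊆U) (T⊆K {U})
        S≡K : ∀ U → T ⊆ U → ⟦ S SubP.⊆? U ⟧ ≡ ⟦ K SubP.⊆? U ⟧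
        S≡K U T⊆U = ⟦⟧-cong (S SubP.⊆? U) (K SubP.⊆? U) (λ S⊆U → ∪-lub S⊆U T⊆U) (S⊆K {U})
        T≡K′ : ∀ U → ¬ T ⊆ U → ⟦ T SubP.⊆? U ⟧ ≡ ⟦ K SubP.⊆? U ⟧
        T≡K′ U ¬T = trans (⟦⟧-no (T SubP.⊆? U) ¬T) (sym (⟦⟧-no (K SubP.⊆? U) (λ K⊆U → ¬T (T⊆K {U} K⊆U))))
        S≡K′ : ∀ U → ¬ S ⊆ U → ⟦ S SubP.⊆? U ⟧ ≡ ⟦ K SubP.⊆? U ⟧
        S≡K′ U ¬S = trans (⟦⟧-no (S SubP.⊆? U) ¬S) (sym (⟦⟧-no (K SubP.⊆? U) (λ K⊆U → ¬S (S⊆K {U} K⊆U))))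
        K≤S : ∀ U → ⟦ K SubP.⊆? U ⟧ ≤ ⟦ S SubP.⊆? U ⟧
        K≤S U = ⟦⟧-mono (K SubP.⊆? U) (S SubP.⊆? U) (S⊆K {U})
        K≤T : ∀ U → ⟦ K SubP.⊆? U ⟧ ≤ ⟦ T SubP.⊆? U ⟧
        K≤T U = ⟦⟧-mono (K SubP.⊆? U) (T SubP.⊆? U) (T⊆K {U})
        cc-mono : ∀ {X Y X′ Y′} U → ⟦ X SubP.⊆? U ⟧ ≤ ⟦ X′ SubP.⊆? U ⟧ → ⟦ Y SubP.⊆? U ⟧ ≤ ⟦ Y′ SubP.⊆? U ⟧ → cc X Y U ≤ cc X′ Y′ U
        cc-mono U e f = +-mono-≤ e (+-monoˡ-≤ (c U) f)
        cc-comm : ∀ X Y U → cc X Y U ≡ cc Y X U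
        cc-comm X Y U = trans (sym (+-assoc ⟦ X SubP.⊆? U ⟧ _ _)) (trans (cong (_+ c U) (+-comm ⟦ X SubP.⊆? U ⟧ _)) (+-assoc ⟦ Y SubP.⊆? U ⟧ _ _))

      local⇔ : ∀ X Y X′ Y′ {C} → Flag C → (∀ U → U ⊆ top C → cc X Y U ≡ cc X′ Y′ U) → Admissible C (cc X Y) ⇔ Admissible C (cc X′ Y′)
      local⇔ X Y X′ Y′ fl e = mk⇔ (admissible-local fl e) (admissible-local fl (λ U U⊆ → sym (e U U⊆)))

      cons⇔ : ∀ X Y X′ Y′ {F a D} → Flag D → top D ⊆ F →
        (∀ U → U ⊆ top D → cc X Y U ≡ cc X′ Y′ U) → (∀ U → top D ⊆ U → U ⊆ F → cc X Y U ≡ cc X′ Y′ U) →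
        Admissible ((F , a) ∷ D) (cc X Y) ⇔ Admissible ((F , a) ∷ D) (cc X′ Y′)
      cons⇔ X Y X′ Y′ fl G⊆F e f = mk⇔
        (λ (p , l) → admissible-local fl e p , layer-cong G⊆F f l)
        (λ (p , l) → admissible-local fl (λ U x → sym (e U x)) p , layer-cong G⊆F (λ U x y → sym (f U x y)) l)

      -- A set `U₁` that violates the bound for `S` and `K` contains `S` but not `K`, since
      -- otherwise its count is the one for `K` and `K`; likewise `U₂` contains `T` but not `K`.
      -- Their union contains `K`, their intersection does not, and the bounds for `K` and `K` at
      -- these two sets are incompatible with both violations.
      uncross : ∀ {G A F B} → ¬ S ⊆ G → ¬ T ⊆ G → S ⊆ F → T ⊆ F → c G ≡ A →
                Layer G A F B (cc K K) → Layer G A F B (cc S K) ⊎ Layer G A F B (cc T K)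
      uncross {G} {A} {F} {B} S⊈G T⊈G S⊆F T⊆F cG kk with search G A F (cc S K) | search G A F (cc T K)
      ... | inj₂ ok | _ = inj₁ (layer (trans (cc-cong {S} {K} {K} {K} F (S≡K F T⊆F) refl) (total≡ kk)) ok)
      ... | inj₁ _  | inj₂ ok = inj₂ (layer (trans (cc-cong {T} {K} {K} {K} F (T≡K F S⊆F) refl) (total≡ kk)) ok)
      ... | inj₁ (U₁ , bad₁@(G⊆U₁ , U₁⊆F , _ , ¬b₁)) | inj₁ (U₂ , bad₂@(G⊆U₂ , U₂⊆F , _ , ¬b₂)) =
            ⊥-elim (uncrossing-arith {A} {ρ G} {ρ V} {ρ W} {ρ U₁} {ρ U₂} {c V} {c W} {c U₁} {c U₂} atV (ρ-submod U₁ U₂)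
              (crowded S U₁ K⊈U₁ ¬b₁) (crowded T U₂ K⊈U₂ ¬b₂) (c-supermod U₁ U₂) (ρ-mono G⊆W) atW)
        where
        V = U₁ ∪ U₂
        W = U₁ ∩ U₂
        G⊆W : G ⊆ W
        G⊆W x∈ = SubP.x∈p∩q⁺ (G⊆U₁ x∈ , G⊆U₂ x∈)
        same-as-KK : ∀ {X} U → ⟦ X SubP.⊆? U ⟧ ≡ ⟦ K SubP.⊆? U ⟧ → G ⊆ U → U ⊆ F → ¬ Bad G A F (cc X K) U
        same-as-KK {X} U e G⊆U U⊆F bad = not-bad {c = cc X K} {U = U} bad
          (bound-mono {G} {A} {cc K K} {cc X K} U (≤-reflexive (cc-cong {X} {K} {K} {K} U e refl)) (bound kk U G⊆U U⊆F))
        S⊆U₁ : S ⊆ U₁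
        S⊆U₁ = decidable-stable (S SubP.⊆? U₁) (λ ¬S → same-as-KK {S} U₁ (S≡K′ U₁ ¬S) G⊆U₁ U₁⊆F bad₁)
        T⊆U₂ : T ⊆ U₂
        T⊆U₂ = decidable-stable (T SubP.⊆? U₂) (λ ¬T → same-as-KK {T} U₂ (T≡K′ U₂ ¬T) G⊆U₂ U₂⊆F bad₂)
        K⊈U₁ : ¬ K ⊆ U₁
        K⊈U₁ K⊆ = same-as-KK {S} U₁ (S≡K U₁ (T⊆K {U₁} K⊆)) G⊆U₁ U₁⊆F bad₁
        K⊈U₂ : ¬ K ⊆ U₂
        K⊈U₂ K⊆ = same-as-KK {T} U₂ (T≡K U₂ (S⊆K {U₂} K⊆)) G⊆U₂ U₂⊆F bad₂
        crowded : ∀ X U → ¬ K ⊆ U → ¬ (suc (cc X K U + ρ G) ≤ A + ρ U) → A + ρ U ≤ suc (c U + ρ G)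
        crowded X U ¬K ¬b = ≤-trans (≤-pred (≰⇒> ¬b)) (+-monoˡ-≤ (ρ G)
          (≤-trans (+-monoʳ-≤ ⟦ X SubP.⊆? U ⟧ (≤-reflexive (add-no c ¬K))) (+-monoˡ-≤ (c U) (⟦⟧≤1 (X SubP.⊆? U)))))
        K⊆V : K ⊆ V
        K⊆V = ∪-lub (λ x∈ → SubP.p⊆p∪q U₂ (S⊆U₁ x∈)) (λ x∈ → SubP.q⊆p∪q U₁ U₂ (T⊆U₂ x∈))
        G⊆V : G ⊆ V
        G⊆V x∈ = SubP.p⊆p∪q U₂ (G⊆U₁ x∈)
        atV : suc (suc (suc (c V)) + ρ G) ≤ A + ρ V
        atV with bound kk V G⊆V (∪-lub U₁⊆F U₂⊆F)
        -- The first alternative cannot occur: with two copies of `K` inside `V`, the count there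
        -- exceeds the count `A` at `G`.
        ... | inj₁ le = ⊥-elim (<-irrefl refl (≤-trans (s≤s (≤-trans (≤-reflexive (sym cG)) (≤-trans (c-mono {G} {V} G⊆V) (n≤1+n _)))) (subst (_≤ A) (cc-both {K} {K} V K⊆V K⊆V) le)))
        ... | inj₂ le = subst (λ x → suc (x + ρ G) ≤ A + ρ V) (cc-both {K} {K} V K⊆V K⊆V) le
        K⊈W : ¬ K ⊆ W
        K⊈W K⊆ = K⊈U₁ (λ x∈ → proj₁ (SubP.x∈p∩q⁻ U₁ U₂ (K⊆ x∈)))
        atW : Bound G A c W
        atW = bound-mono {G} {A} {cc K K} {c} W (≤-reflexive (sym (cc-none {K} {K} W K⊈W K⊈W)))
          (bound kk W G⊆W (λ x∈ → U₁⊆F (proj₁ (SubP.x∈p∩q⁻ U₁ U₂ x∈))))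

      -- If `S` or `T` is not inside the top flat, it cannot be told apart from `K`, and the
      -- conditions agree in pairs. Otherwise one descends to the layer where `S` and `T` are not
      -- both inside the lower flat. If one of them is, the other again behaves like `K`; if neither
      -- is, the four conditions form the lattice pattern and `uncross` supplies its only nontrivial
      -- implication.
      exchange : ∀ C → Flag C → Exchange (Admissible C (cc S T)) (Admissible C (cc K K)) (Admissible C (cc S K)) (Admissible C (cc T K))
      exchange C fl = cases (S SubP.⊆? top C) (T SubP.⊆? top C)
        where
        up : ∀ {X U V : Subset n} → ¬ X ⊆ V → U ⊆ V → ¬ X ⊆ U
        up ¬X U⊆V X⊆U = ¬X (λ x∈ → U⊆V (X⊆U x∈))
        below₁ : ∀ {V} → ¬ T ⊆ V → ∀ U → U ⊆ V → cc S T U ≡ cc S K U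
        below₁ ¬T U U⊆ = cc-cong {S} {T} {S} {K} U refl (T≡K′ U (up ¬T U⊆))
        below₂ : ∀ {V} → ¬ T ⊆ V → ∀ U → U ⊆ V → cc T K U ≡ cc K K U
        below₂ ¬T U U⊆ = cc-cong {T} {K} {K} {K} U (T≡K′ U (up ¬T U⊆)) refl
        below₃ : ∀ {V} → ¬ S ⊆ V → ∀ U → U ⊆ V → cc S T U ≡ cc T K U
        below₃ ¬S U U⊆ = trans (cc-cong {S} {T} {K} {T} U (S≡K′ U (up ¬S U⊆)) refl) (cc-comm K T U)
        below₄ : ∀ {V} → ¬ S ⊆ V → ∀ U → U ⊆ V → cc S K U ≡ cc K K U
        below₄ ¬S U U⊆ = cc-cong {S} {K} {K} {K} U (S≡K′ U (up ¬S U⊆)) refl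
        cases : Dec (S ⊆ top C) → Dec (T ⊆ top C) → _
        cases _ (no ¬T) = swap₁ (local⇔ S T S K fl (below₁ ¬T)) (local⇔ T K K K fl (below₂ ¬T))
        cases (no ¬S) _ = swap₂ (local⇔ S T T K fl (below₃ ¬S)) (local⇔ S K K K fl (below₄ ¬S))
        cases (yes S⊆F) (yes T⊆F) = inside C fl S⊆F T⊆F
          where
          inside : ∀ C → Flag C → S ⊆ top C → T ⊆ top C →
            Exchange (Admissible C (cc S T)) (Admissible C (cc K K)) (Admissible C (cc S K)) (Admissible C (cc T K))
          inside [] fl S⊆ T⊆ = swap₁ (local⇔ S T S K fl (λ U _ → cc-cong {S} {T} {S} {K} U refl (T≡K U (λ x∈ → ⊥-elim (SubP.∉⊥ (S⊆ x∈))))))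
                                     (local⇔ T K K K fl (λ U _ → cc-cong {T} {K} {K} {K} U (T≡K U (λ x∈ → ⊥-elim (SubP.∉⊥ (S⊆ x∈)))) refl))
          inside ((F , a) ∷ D) (cons flat G⊆F fl) S⊆F T⊆F = split (S SubP.⊆? top D) (T SubP.⊆? top D)
            where
            G = top D
            split : Dec (S ⊆ G) → Dec (T ⊆ G) → _
            split (yes S⊆G) (yes T⊆G) = exchange-× {L = Layer G (total D) F (a + total D) (λ U → suc (suc (c U)))}
                (common S T S⊆G T⊆G) (common K K K⊆G K⊆G) (common S K S⊆G K⊆G) (common T K T⊆G K⊆G)
                (inside D fl S⊆G T⊆G)
              where
              K⊆G : K ⊆ G
              K⊆G = ∪-lub S⊆G T⊆G
              common : ∀ X Y → X ⊆ G → Y ⊆ G → Admissible ((F , a) ∷ D) (cc X Y) ⇔ (Admissible D (cc X Y) × Layer G (total D) F (a + total D) (λ U → suc (suc (c U))))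
              common X Y X⊆ Y⊆ = mk⇔ (λ (p , l) → p , layer-cong G⊆F eq l) (λ (p , l) → p , layer-cong G⊆F (λ U x y → sym (eq U x y)) l)
                where
                eq : ∀ U → G ⊆ U → U ⊆ F → cc X Y U ≡ suc (suc (c U))
                eq U G⊆U _ = cc-both {X} {Y} U (λ x∈ → G⊆U (X⊆ x∈)) (λ x∈ → G⊆U (Y⊆ x∈))
            split (yes S⊆G) (no ¬T) = swap₁
              (cons⇔ S T S K fl G⊆F (below₁ ¬T) (λ U G⊆U _ → cc-cong {S} {T} {S} {K} U refl (T≡K U (λ x∈ → G⊆U (S⊆G x∈)))))
              (cons⇔ T K K K fl G⊆F (below₂ ¬T) (λ U G⊆U _ → cc-cong {T} {K} {K} {K} U (T≡K U (λ x∈ → G⊆U (S⊆G x∈))) refl))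
            split (no ¬S) (yes T⊆G) = swap₂
              (cons⇔ S T T K fl G⊆F (below₃ ¬S) (λ U G⊆U _ → trans (cc-cong {S} {T} {K} {T} U (S≡K U (λ x∈ → G⊆U (T⊆G x∈))) refl) (cc-comm K T U)))
              (cons⇔ S K K K fl G⊆F (below₄ ¬S) (λ U G⊆U _ → cc-cong {S} {K} {K} {K} U (S≡K U (λ x∈ → G⊆U (T⊆G x∈))) refl))
            split (no ¬S) (no ¬T) = lattice
                (λ (p , l) → (moveD {S} {T} {S} {K} ¬S ¬T ¬S ¬K p , layer-mono (totals {S} {K} {S} {T} S⊆F K⊆F S⊆F T⊆F) (λ U _ _ → cc-mono {S} {K} {S} {T} U ≤-refl (K≤T U)) l)
                           , (moveD {S} {T} {T} {K} ¬S ¬T ¬T ¬K p , layer-mono (totals {T} {K} {S} {T} T⊆F K⊆F S⊆F T⊆F) (λ U _ _ → ≤-trans (≤-reflexive (cc-comm T K U)) (cc-mono {K} {T} {S} {T} U (K≤S U) ≤-refl)) l))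
                (λ (p , l) → moveD {S} {K} {K} {K} ¬S ¬K ¬K ¬K p , layer-mono (totals {K} {K} {S} {K} K⊆F K⊆F S⊆F K⊆F) (λ U _ _ → cc-mono {K} {K} {S} {K} U (K≤S U) ≤-refl) l)
                (λ (p , l) → moveD {T} {K} {K} {K} ¬T ¬K ¬K ¬K p , layer-mono (totals {K} {K} {T} {K} K⊆F K⊆F T⊆F K⊆F) (λ U _ _ → cc-mono {K} {K} {T} {K} U (K≤T U) ≤-refl) l)
                (λ (p , l) (_ , l′) → moveD {S} {K} {S} {T} ¬S ¬K ¬S ¬T p , layer (trans (totals {S} {T} {S} {K} S⊆F T⊆F S⊆F K⊆F) (total≡ l)) (λ U G⊆U U⊆F → meet l l′ U G⊆U U⊆F (S SubP.⊆? U)))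
                (λ (p , l) → result p (uncross ¬S ¬T S⊆F T⊆F (trans (sym (cc-none {K} {K} G ¬K ¬K)) (admissible-top D p)) l))
              where
              K⊆F : K ⊆ F
              K⊆F = ∪-lub S⊆F T⊆F
              ¬K : ¬ K ⊆ G
              ¬K K⊆ = ¬S (S⊆K {G} K⊆)
              moveD : ∀ {X Y X′ Y′} → ¬ X ⊆ G → ¬ Y ⊆ G → ¬ X′ ⊆ G → ¬ Y′ ⊆ G → Admissible D (cc X Y) → Admissible D (cc X′ Y′)
              moveD {X} {Y} {X′} {Y′} x y x′ y′ = admissible-local fl (λ U U⊆ → trans (cc-none {X} {Y} U (up x U⊆) (up y U⊆)) (sym (cc-none {X′} {Y′} U (up x′ U⊆) (up y′ U⊆))))
              totals : ∀ {X Y X′ Y′} → X ⊆ F → Y ⊆ F → X′ ⊆ F → Y′ ⊆ F → cc X Y F ≡ cc X′ Y′ F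
              totals {X} {Y} {X′} {Y′} x y x′ y′ = trans (cc-both {X} {Y} F x y) (sym (cc-both {X′} {Y′} F x′ y′))
              -- At a set containing `S`, the factors `T` and `K` are counted alike; at a set that
              -- misses `S`, neither `S` nor `K` is counted and the bound for `T` and `K` is the
              -- required one.
              meet : ∀ {A B} → Layer G A F B (cc S K) → Layer G A F B (cc T K) → ∀ U → G ⊆ U → U ⊆ F → Dec (S ⊆ U) → Bound G A (cc S T) U
              meet {A} l l′ U G⊆U U⊆F (yes S⊆U) = bound-mono {G} {A} {cc S K} {cc S T} U (≤-reflexive (cc-cong {S} {T} {S} {K} U refl (T≡K U S⊆U))) (bound l U G⊆U U⊆F)
              meet {A} l l′ U G⊆U U⊆F (no S⊈U) = bound-mono {G} {A} {cc T K} {cc S T} U (≤-reflexive (below₃ {U} S⊈U U (λ x → x))) (bound l′ U G⊆U U⊆F)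
              result : Admissible D (cc K K) → _ → _
              result p (inj₁ l) = inj₁ (moveD {K} {K} {S} {K} ¬K ¬K ¬S ¬K p , l)
              result p (inj₂ l) = inj₂ (moveD {K} {K} {T} {K} ¬K ¬K ¬T ¬K p , l)

-- Standard chains and their dual functionals

module StandardChains where

  open ChainFunctionals
  open import Data.Bool using (if_then_else_)
  open import Data.Empty using (⊥-elim)
  open import Data.Fin.Subset using (Subset; _⊆_; ⁅_⁆; _∪_; ⊤)
  import Data.Fin.Subset.Properties as SubP
  open import Data.Nat using (ℕ; zero; suc; _+_; _≤_; _<_; z≤n)
  open import Data.Nat.Properties
  open import Data.List using (List; []; _∷_; _++_; replicate)
  open import Data.List.Relation.Binary.Permutation.Propositional using (_↭_; prep; swap) renaming (refl to ↭-refl′; trans to ↭-trans′)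
  open import Data.Rational as ℚ using (ℚ; 0ℚ; 1ℚ)
  import Data.Rational.Properties as ℚP
  open import Data.Product using (_,_; proj₁; proj₂)
  open import Data.Sum using (inj₁; inj₂)
  open import Function using (_⇔_; mk⇔; Equivalence)
  open import Relation.Nullary using (¬_; Dec; yes; no; does; contradiction)
  open import Relation.Binary.PropositionalEquality

  open Equivalence using (to; from)

  𝟙 : ∀ {P : Set} → Dec P → ℚ
  𝟙 d = if does d then 1ℚ else 0ℚ

  𝟙-yes : ∀ {P : Set} (d : Dec P) → P → 𝟙 d ≡ 1ℚ
  𝟙-yes (yes _) p = refl
  𝟙-yes (no ¬p) p = contradiction p ¬p

  𝟙-no : ∀ {P : Set} (d : Dec P) → ¬ P → 𝟙 d ≡ 0ℚ
  𝟙-no (yes p) ¬p = contradiction p ¬p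
  𝟙-no (no _)  ¬p = refl

  𝟙≢0 : ∀ {P : Set} (d : Dec P) → 𝟙 d ≢ 0ℚ → P
  𝟙≢0 (yes p) ne = p
  𝟙≢0 (no _)  ne = contradiction refl ne

  𝟙-cong : ∀ {P Q : Set} (d : Dec P) (e : Dec Q) → P ⇔ Q → 𝟙 d ≡ 𝟙 e
  𝟙-cong (yes p) e eq = sym (𝟙-yes e (to eq p))
  𝟙-cong (no ¬p) e eq = sym (𝟙-no e (λ q → ¬p (from eq q)))

  module _ {n : ℕ} where

    count-↭ : ∀ {m m′ : List (Subset n)} → m ↭ m′ → ∀ U → count m U ≡ count m′ U
    count-↭ ↭-refl′       U = refl
    count-↭ (prep S p)    U = cong (⟦ S SubP.⊆? U ⟧ +_) (count-↭ p U)
    count-↭ {m′ = _ ∷ _ ∷ m′} (swap S T p) U = trans (cong (λ x → ⟦ S SubP.⊆? U ⟧ + (⟦ T SubP.⊆? U ⟧ + x)) (count-↭ p U))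
      (trans (sym (+-assoc ⟦ S SubP.⊆? U ⟧ _ _)) (trans (cong (_+ count m′ U) (+-comm ⟦ S SubP.⊆? U ⟧ ⟦ T SubP.⊆? U ⟧)) (+-assoc ⟦ T SubP.⊆? U ⟧ _ _)))
    count-↭ (↭-trans′ p q) U = trans (count-↭ p U) (count-↭ q U)

    count-run-yes : ∀ a F m {U : Subset n} → F ⊆ U → count (replicate a F ++ m) U ≡ a + count m U
    count-run-yes zero    F m F⊆U = refl
    count-run-yes (suc a) F m {U} F⊆U = cong₂ _+_ (⟦⟧-yes (F SubP.⊆? U) F⊆U) (count-run-yes a F m F⊆U)

    count-run-no : ∀ a F m {U : Subset n} → ¬ F ⊆ U → count (replicate a F ++ m) U ≡ count m U
    count-run-no zero    F m F⊈U = refl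
    count-run-no (suc a) F m {U} F⊈U = cong₂ _+_ (⟦⟧-no (F SubP.⊆? U) F⊈U) (count-run-no a F m F⊈U)

  module Standard {n : ℕ} (M : Polymatroid n) where
    open Polymatroid M
    open Functional M public

    data Std : Chain {n} → Set where
      []   : Std []
      cons : ∀ {F a C} → IsFlat F → top C ⊆ F → 1 ≤ a → a + ρ (top C) < ρ F → Std C → Std ((F , a) ∷ C)

    std-flag : ∀ {C} → Std C → Flag C
    std-flag []                    = []
    std-flag (cons flat G⊆F _ _ s) = cons flat G⊆F (std-flag s)

    private
      not-below : ∀ {F a G} → a + ρ G < ρ F → ¬ F ⊆ G
      not-below {F} {a} {G} lt F⊆G = <-irrefl refl (<-≤-trans lt (≤-trans (ρ-mono F⊆G) (m≤n+m (ρ G) a)))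

    count-flatten-top : ∀ {C U} → Std C → top C ⊆ U → count (flatten C) U ≡ total C
    count-flatten-top [] _ = refl
    count-flatten-top {(F , a) ∷ C} (cons _ G⊆F _ _ s) F⊆U =
      trans (count-run-yes a F (flatten C) F⊆U) (cong (a +_) (count-flatten-top s (λ x∈ → F⊆U (G⊆F x∈))))

    count-flatten≤ : ∀ (C : Chain {n}) U → count (flatten C) U ≤ total C
    count-flatten≤ []            U = z≤n
    count-flatten≤ ((F , a) ∷ C) U with F SubP.⊆? U
    ... | yes F⊆U = ≤-trans (≤-reflexive (count-run-yes a F (flatten C) F⊆U)) (+-monoʳ-≤ a (count-flatten≤ C U))
    ... | no F⊈U  = ≤-trans (≤-reflexive (count-run-no a F (flatten C) F⊈U)) (≤-trans (count-flatten≤ C U) (m≤n+m (total C) a))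

    -- Inside the layer of `F`, a set that does not contain `F` has only the factors of the smaller
    -- flats. One that contains `F` has all factors, and there the gap condition on `a` is exactly
    -- the strict bound.
    admissible-diagonal : ∀ {C} c → Std C → (∀ U → U ⊆ top C → c U ≡ count (flatten C) U) → Admissible C c
    admissible-diagonal c [] e = e ⊥ₛ (λ x → x)
    admissible-diagonal {(F , a) ∷ D} c std@(cons flat G⊆F 1≤a lt s) e =
      admissible-diagonal c s (λ U U⊆G → trans (e U (λ x∈ → G⊆F (U⊆G x∈)))
        (count-run-no a F (flatten D) (λ F⊆U → not-below {F} {a} lt (λ x∈ → U⊆G (F⊆U x∈)))))
      , layer (trans (e F (λ x → x)) (count-flatten-top std (λ x → x))) (λ U G⊆U U⊆F → bnd U G⊆U U⊆F (F SubP.⊆? U))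
      where
      G = top D
      bnd : ∀ U → G ⊆ U → U ⊆ F → Dec (F ⊆ U) → Bound G (total D) c U
      bnd U G⊆U U⊆F (yes F⊆U) = inj₂ (begin
        suc (c U + ρ G)             ≡⟨ cong (λ x → suc (x + ρ G)) (trans (e U U⊆F) (count-flatten-top std F⊆U)) ⟩
        suc (a + total D + ρ G)     ≡⟨ cong (λ x → suc (x + ρ G)) (+-comm a (total D)) ⟩
        suc (total D + a + ρ G)     ≡⟨ cong suc (+-assoc (total D) a (ρ G)) ⟩
        suc (total D + (a + ρ G))   ≡⟨ +-suc (total D) (a + ρ G) ⟨
        total D + suc (a + ρ G)     ≤⟨ +-monoʳ-≤ (total D) lt ⟩
        total D + ρ F               ≤⟨ +-monoʳ-≤ (total D) (ρ-mono F⊆U) ⟩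
        total D + ρ U               ∎)
        where open ≤-Reasoning
      bnd U G⊆U U⊆F (no F⊈U) = inj₁ (≤-reflexive (trans (e U U⊆F)
        (trans (count-run-no a F (flatten D) F⊈U) (count-flatten-top s G⊆U))))

    -- Adds the requirement `c ⊤ ≡ total C`, by which all factors of the monomial lie inside
    -- `top C`. It also puts every point below the top set, as the lemmas on points demand.
    capped : Chain {n} → Chain {n}
    capped C = (⊤ , 0) ∷ C

    capped-flag : ∀ {C} → Std C → Flag (capped C)
    capped-flag s = cons (λ i i∉ → ⊥-elim (i∉ SubP.∈⊤)) SubP.⊆⊤ (std-flag s)

    capped-diagonal : ∀ {C} → Std C → Admissible (capped C) (count (flatten C))
    capped-diagonal {C} s = admissible-diagonal _ s (λ _ _ → refl) ,
      layer (count-flatten-top s SubP.⊆⊤) (λ U G⊆U _ → inj₁ (≤-reflexive (count-flatten-top s G⊆U)))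

    -- If `U` contains `F`, monotonicity and the total prescribed at `F` suffice; otherwise only the
    -- lower part of the chain is counted at `U`.
    admissible-count≥ : ∀ {C} c → Std C → IsCount c → Admissible C c → ∀ U → count (flatten C) U ≤ c U
    admissible-count≥ c [] ic p U = z≤n
    admissible-count≥ {(F , a) ∷ D} c std@(cons _ _ _ _ s) ic (p , l) U with F SubP.⊆? U
    ... | yes F⊆U = ≤-trans (≤-reflexive (trans (count-flatten-top std F⊆U) (sym (Layer.total≡ l)))) (IsCount.c-mono ic F⊆U)
    ... | no F⊈U  = ≤-trans (≤-reflexive (count-run-no a F (flatten D) F⊈U)) (admissible-count≥ c s ic p U)

    private
      top⊆ : ∀ {F a D F′ a′ D′} → Std ((F , a) ∷ D) → Std ((F′ , a′) ∷ D′) →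
             (∀ U → count (flatten ((F , a) ∷ D)) U ≡ count (flatten ((F′ , a′) ∷ D′)) U) → F′ ⊆ F
      top⊆ {F} {a} {D} {F′} {a′} {D′} s s′@(cons _ _ 1≤a′ _ _) e with F′ SubP.⊆? F
      ... | yes F′⊆F = F′⊆F
      ... | no F′⊈F = ⊥-elim (<-irrefl refl (begin-strict
        total D′                                ≡⟨⟩
        0 + total D′                            <⟨ +-monoˡ-< (total D′) 1≤a′ ⟩
        a′ + total D′                           ≡⟨ count-flatten-top s′ SubP.⊆⊤ ⟨
        count (flatten ((F′ , a′) ∷ D′)) ⊤      ≡⟨ e ⊤ ⟨
        count (flatten ((F , a) ∷ D)) ⊤         ≡⟨ trans (count-flatten-top s SubP.⊆⊤) (sym (count-flatten-top s (λ x → x))) ⟩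
        count (flatten ((F , a) ∷ D)) F         ≡⟨ e F ⟩
        count (flatten ((F′ , a′) ∷ D′)) F      ≡⟨ count-run-no a′ F′ (flatten D′) F′⊈F ⟩
        count (flatten D′) F                    ≤⟨ count-flatten≤ D′ F ⟩
        total D′                                ∎))
        where open ≤-Reasoning

      total≤ : ∀ {F a D a′ D′} → Std ((F , a) ∷ D) → Std ((F , a′) ∷ D′) →
               (∀ U → count (flatten ((F , a) ∷ D)) U ≡ count (flatten ((F , a′) ∷ D′)) U) → total D ≤ total D′
      total≤ {F} {a} {D} {a′} {D′} (cons _ _ _ lt s) (cons _ _ _ lt′ s′) e = begin
        total D                              ≡⟨ count-flatten-top s (λ x → x) ⟨
        count (flatten D) G                  ≡⟨ count-run-no a F (flatten D) (not-below {F} {a} lt) ⟨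
        count (flatten ((F , a) ∷ D)) G      ≡⟨ e G ⟩
        count (flatten ((F , a′) ∷ D′)) G    ≡⟨ count-run-no a′ F (flatten D′) (not-below {F} {a} lt) ⟩
        count (flatten D′) G                 ≤⟨ count-flatten≤ D′ G ⟩
        total D′                             ∎
        where
        open ≤-Reasoning
        G = top D

    -- The top flat is the smallest set at which the count is full, and the count at the next flat
    -- determines the exponent of the top one.
    count-injective : ∀ {C C′} → Std C → Std C′ → (∀ U → count (flatten C) U ≡ count (flatten C′) U) → C ≡ C′
    count-injective [] [] e = refl
    count-injective {C′ = (F′ , a′) ∷ D′} [] s′@(cons _ _ 1≤a′ _ _) e =
      contradiction (trans (e ⊤) (count-flatten-top s′ SubP.⊆⊤)) (<⇒≢ (≤-trans 1≤a′ (m≤m+n a′ (total D′))))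
    count-injective {C = (F , a) ∷ D} s@(cons _ _ 1≤a _ _) [] e =
      contradiction (trans (sym (e ⊤)) (count-flatten-top s SubP.⊆⊤)) (<⇒≢ (≤-trans 1≤a (m≤m+n a (total D))))
    count-injective {(F , a) ∷ D} {(F′ , a′) ∷ D′} s@(cons _ _ _ _ t) s′@(cons _ _ _ _ t′) e
      with SubP.⊆-antisym (top⊆ s′ s (λ U → sym (e U))) (top⊆ s s′ e)
    ... | refl = cong₂ (λ b E → (F , b) ∷ E) a≡a′ (count-injective t t′ tails)
      where
      totals : total D ≡ total D′
      totals = ≤-antisym (total≤ s s′ e) (total≤ s′ s (λ U → sym (e U)))
      a≡a′ : a ≡ a′
      a≡a′ = +-cancelʳ-≡ (total D) a a′ (trans (sym (count-flatten-top s SubP.⊆⊤))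
        (trans (e ⊤) (trans (count-flatten-top s′ SubP.⊆⊤) (cong (a′ +_) (sym totals)))))
      tails : ∀ U → count (flatten D) U ≡ count (flatten D′) U
      tails U with F SubP.⊆? U
      ... | yes F⊆U = +-cancelˡ-≡ a _ _ (trans (sym (count-run-yes a F (flatten D) F⊆U))
            (trans (e U) (trans (count-run-yes a′ F (flatten D′) F⊆U) (cong (_+ count (flatten D′) U) (sym a≡a′)))))
      ... | no F⊈U  = trans (sym (count-run-no a F (flatten D) F⊈U)) (trans (e U) (count-run-no a′ F (flatten D′) F⊈U))

    -- The relations between the h_S in transposed form. As `m` is arbitrary, each field says that
    -- the functional kills all monomial multiples of a relation; `φ-absorb` stands for h_i (h_S -
    -- h_T) = 0 with T = S ∪ i.
    record Dual (φ : List (Subset n) → ℚ) : Set where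
      field
        φ-↭     : ∀ {m m′} → m ↭ m′ → φ m ≡ φ m′
        φ-⊥     : ∀ m → φ (⊥ₛ ∷ m) ≡ 0ℚ
        φ-closed : ∀ S i m → ρ (S ∪ ⁅ i ⁆) ≡ ρ S → φ (S ∷ m) ≡ φ (S ∪ ⁅ i ⁆ ∷ m)
        φ-pair   : ∀ S T m → φ (S ∷ T ∷ m) ℚ.+ φ (S ∪ T ∷ S ∪ T ∷ m) ≡ φ (S ∷ S ∪ T ∷ m) ℚ.+ φ (T ∷ S ∪ T ∷ m)
        φ-point  : ∀ i m → ρ ⁅ i ⁆ ≡ 1 → φ (⁅ i ⁆ ∷ m) ≡ 0ℚ
        φ-point² : ∀ i m → φ (⁅ i ⁆ ∷ ⁅ i ⁆ ∷ m) ≡ 0ℚ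
        φ-absorb : ∀ i S m → φ (⁅ i ⁆ ∷ S ∷ m) ≡ φ (⁅ i ⁆ ∷ S ∪ ⁅ i ⁆ ∷ m)

    exchange-𝟙 : ∀ {A B C D : Set} → Exchange A B C D → (a : Dec A) (b : Dec B) (c : Dec C) (d : Dec D) →
                 𝟙 a ℚ.+ 𝟙 b ≡ 𝟙 c ℚ.+ 𝟙 d
    exchange-𝟙 (swap₁ e f) a b c d = cong₂ ℚ._+_ (𝟙-cong a c e) (sym (𝟙-cong d b f))
    exchange-𝟙 (swap₂ e f) a b c d = trans (cong₂ ℚ._+_ (𝟙-cong a d e) (sym (𝟙-cong c b f))) (ℚP.+-comm (𝟙 d) (𝟙 c))
    exchange-𝟙 (lattice st sk tk meet join) a b (yes c) (yes d) = cong₂ ℚ._+_ (𝟙-yes a (meet c d)) (𝟙-yes b (sk c))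
    exchange-𝟙 (lattice st sk tk meet join) a b (yes c) (no ¬d) = cong₂ ℚ._+_ (𝟙-no a (λ x → ¬d (proj₂ (st x)))) (𝟙-yes b (sk c))
    exchange-𝟙 (lattice st sk tk meet join) a b (no ¬c) (yes d) = cong₂ ℚ._+_ (𝟙-no a (λ x → ¬c (proj₁ (st x)))) (𝟙-yes b (tk d))
    exchange-𝟙 (lattice st sk tk meet join) a b (no ¬c) (no ¬d) = cong₂ ℚ._+_ (𝟙-no a (λ x → ¬c (proj₁ (st x)))) (𝟙-no b (λ x → neither (join x)))
      where
      neither : _ → _
      neither (inj₁ c) = ¬c c
      neither (inj₂ d) = ¬d d

    φ : Chain {n} → List (Subset n) → ℚ
    φ C m = 𝟙 (admissible? (capped C) (count m))

    φ-dual : ∀ {C} → Std C → Dual (φ C)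
    φ-dual {C} s = record
      { φ-↭      = λ {m} {m′} p → 𝟙-cong (adm m) (adm m′) (mk⇔
          (admissible-local fl (λ U _ → count-↭ p U)) (admissible-local fl (λ U _ → sym (count-↭ p U))))
      ; φ-⊥      = λ m → 𝟙-no (adm (⊥ₛ ∷ m)) (admissible-⊥ (capped C) m fl)
      ; φ-closed = λ S i m e → 𝟙-cong (adm (S ∷ m)) (adm (S ∪ ⁅ i ⁆ ∷ m)) (admissible-closed (capped C) m i fl e)
      ; φ-pair   = λ S T m → exchange-𝟙 (Pair.exchange m S T (capped C) fl)
          (adm (S ∷ T ∷ m)) (adm (S ∪ T ∷ S ∪ T ∷ m)) (adm (S ∷ S ∪ T ∷ m)) (adm (T ∷ S ∪ T ∷ m))
      ; φ-point  = λ i m e → 𝟙-no (adm (⁅ i ⁆ ∷ m)) (admissible-point (capped C) m i fl SubP.∈⊤ e)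
      ; φ-point² = λ i m → 𝟙-no (adm (⁅ i ⁆ ∷ ⁅ i ⁆ ∷ m)) (admissible-point² (capped C) m i fl SubP.∈⊤)
      ; φ-absorb = λ i S m → 𝟙-cong (adm (⁅ i ⁆ ∷ S ∷ m)) (adm (⁅ i ⁆ ∷ S ∪ ⁅ i ⁆ ∷ m)) (admissible-point-absorb (capped C) m i S fl SubP.∈⊤)
      }
      where
      fl = capped-flag s
      adm = λ m → admissible? (capped C) (count m)

    φ-diagonal : ∀ {C} → Std C → φ C (flatten C) ≡ 1ℚ
    φ-diagonal {C} s = 𝟙-yes (admissible? (capped C) (count (flatten C))) (capped-diagonal s)

    φ-triangular : ∀ {C C′ : Chain {n}} → Std C → φ C (flatten C′) ≢ 0ℚ → ∀ U → count (flatten C) U ≤ count (flatten C′) U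
    φ-triangular {C} {C′} s ne U = admissible-count≥ _ s (isCount (flatten C′))
      (proj₁ (𝟙≢0 (admissible? (capped C) (count (flatten C′))) ne)) U

-- Evaluation of polynomials on dual functionals and linear independence

module Evaluation where

  open import Algebra.Bundles using (CommutativeRing)
  open import Defs
  open ListSums
  open PolyRing
  open HilbertCoefficients
  open ChainFunctionals
  open StandardChains
  open import Data.Bool using (true; false; if_then_else_)
  open import Data.Fin as Fin using (Fin; zero; suc; punchIn)
  open import Data.Fin.Properties using (punchInᵢ≢i)
  open import Data.Fin.Subset using (Subset; _⊆_; ⁅_⁆; _∪_) renaming (_∈_ to _∈ₛ_; _∉_ to _∉ₛ_)
  import Data.Fin.Subset.Properties as SubP
  open import Data.Nat as ℕ using (ℕ; zero; suc; _≤_; _<_; z≤n)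
  import Data.Nat.Properties as ℕP
  import Data.Nat.ListAction as ListAction
  open import Data.Nat.Induction using (<-wellFounded)
  open import Induction.WellFounded using (Acc; acc)
  open import Data.List as List using (List; []; _∷_; _++_; length)
  open import Data.List.Membership.Propositional using (_∈_)
  open import Data.List.Membership.Propositional.Properties using (∈-++⁺ˡ; ∈-++⁺ʳ; ∈-map⁺; ∈-lookup)
  open import Data.List.Relation.Unary.Any using (here; there)
  open import Data.List.Relation.Unary.All as All using (All; []; _∷_)
  open import Data.List.Relation.Unary.AllPairs using ([]; _∷_)
  open import Data.List.Relation.Unary.Unique.Propositional using (Unique)
  open import Data.List.Relation.Binary.Permutation.Propositional using (_↭_; prep; swap; ↭-refl)
  open import Data.Rational as ℚ using (ℚ; 0ℚ; 1ℚ)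
  import Data.Rational.Properties as ℚP
  open import Data.Product using (_×_; _,_; proj₁; proj₂)
  open import Data.Sum using (_⊎_; inj₁; inj₂)
  open import Data.Vec as Vec using (Vec; []; _∷_; lookup; tabulate; here; there)
  import Data.Vec.Properties as VecP
  open import Function using (_∘_)
  open import Relation.Nullary using (yes; no; does; contradiction)
  open import Relation.Binary.PropositionalEquality
  open import Algebra.Properties.Semiring.Sum (CommutativeRing.semiring ℚP.+-*-commutativeRing)
    using (sum; sum-remove; sum-cong-≗)

  open ∑ℚ using (when)

  ⟪⟫-+ : ∀ {A : Set} (p : List (ℚ × A)) f g → ⟪ p , (λ a → f a ℚ.+ g a) ⟫ ≡ ⟪ p , f ⟫ ℚ.+ ⟪ p , g ⟫
  ⟪⟫-+ p f g = trans (∑ℚ.∑-cong p (λ t → ℚP.*-distribˡ-+ (proj₁ t) _ _)) (∑ℚ.∑-+ p _ _)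

  sum-single : ∀ {r} (f : Fin r → ℚ) j → (∀ i → i ≢ j → f i ≡ 0ℚ) → sum f ≡ f j
  sum-single {suc r} f j z = trans (sum-remove {i = j} f)
    (trans (cong (f j ℚ.+_) (sum-0 (λ i → z (punchIn j i) (λ e → punchInᵢ≢i j i e)))) (ℚP.+-identityʳ (f j)))

  unique-lookup : ∀ {A : Set} {xs : List A} → Unique xs → ∀ i j → List.lookup xs i ≡ List.lookup xs j → i ≡ j
  unique-lookup (_ ∷ _)  zero    zero    e = refl
  unique-lookup (ne ∷ _) zero    (suc j) e = contradiction e (All.lookup ne (∈-lookup j))
  unique-lookup (ne ∷ _) (suc i) zero    e = contradiction (sym e) (All.lookup ne (∈-lookup i))
  unique-lookup (_ ∷ u)  (suc i) (suc j) e = cong suc (unique-lookup u i j e)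

  ∈-allSubsets : ∀ {n} (S : Subset n) → S ∈ allSubsets n
  ∈-allSubsets []          = here refl
  ∈-allSubsets (true ∷ S)  = ∈-++⁺ˡ (∈-map⁺ (true ∷_) (∈-allSubsets S))
  ∈-allSubsets (false ∷ S) = ∈-++⁺ʳ (List.map (true ∷_) (allSubsets _)) (∈-map⁺ (false ∷_) (∈-allSubsets S))

  -- The sum of (-1)^(|S| - |A|) S over all S ⊇ A. It solves the equations h_S = Σ x_A (over A ⊇ S)
  -- for x_A in the Boolean lattice.
  möbius : ∀ {n} → Subset n → List (ℚ × Subset n)
  möbius []          = (1ℚ , []) ∷ []
  möbius (true ∷ A)  = List.map (λ t → proj₁ t , true ∷ proj₂ t) (möbius A)
  möbius (false ∷ A) = List.map (λ t → proj₁ t , false ∷ proj₂ t) (möbius A)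
                    ++ List.map (λ t → (ℚ.- 1ℚ) ℚ.* proj₁ t , proj₂ t) (List.map (λ t → proj₁ t , true ∷ proj₂ t) (möbius A))

  ⟪möbius⟫-true : ∀ {n} (A : Subset n) f → ⟪ möbius (true ∷ A) , f ⟫ ≡ ⟪ möbius A , (λ S → f (true ∷ S)) ⟫
  ⟪möbius⟫-true A f = ∑ℚ.∑-map _ (möbius A) _

  ⟪möbius⟫-false : ∀ {n} (A : Subset n) f →
    ⟪ möbius (false ∷ A) , f ⟫ ≡ ⟪ möbius A , (λ S → f (false ∷ S)) ⟫ ℚ.- ⟪ möbius A , (λ S → f (true ∷ S)) ⟫
  ⟪möbius⟫-false A f = trans (⟪⟫-++ (List.map (λ t → proj₁ t , false ∷ proj₂ t) (möbius A)) _ f)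
    (cong₂ ℚ._+_ (∑ℚ.∑-map _ (möbius A) _)
      (trans (⟪⟫-neg (List.map (λ t → proj₁ t , true ∷ proj₂ t) (möbius A)) f) (cong ℚ.-_ (∑ℚ.∑-map _ (möbius A) _))))

  möbius-inversion : ∀ {n} (f : Subset n → ℚ) S →
    ∑ℚ (allSubsets n) (λ A → when (does (S SubP.⊆? A)) ⟪ möbius A , f ⟫) ≡ f S
  möbius-inversion {zero} f [] = trans (ℚP.+-identityʳ _) (trans (ℚP.+-identityʳ _) (ℚP.*-identityˡ (f [])))
  möbius-inversion {suc n} f (s ∷ S) = trans (∑ℚ.∑-++ (List.map (true ∷_) (allSubsets n)) _ _)
    (trans (cong₂ ℚ._+_ (∑ℚ.∑-map _ (allSubsets n) _) (∑ℚ.∑-map _ (allSubsets n) _)) (parts s))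
    where
    f₁ = λ T → f (true ∷ T)
    f₀ = λ T → f (false ∷ T)
    cancel : ∀ x y → x ℚ.+ (y ℚ.+ ℚ.- x) ≡ y
    cancel x y = trans (cong (x ℚ.+_) (ℚP.+-comm y (ℚ.- x))) (trans (sym (ℚP.+-assoc x (ℚ.- x) y))
      (trans (cong (ℚ._+ y) (ℚP.+-inverseʳ x)) (ℚP.+-identityˡ y)))
    ifminus : ∀ b x y → when b (x ℚ.- y) ≡ when b x ℚ.- when b y
    ifminus true  x y = refl
    ifminus false x y = refl
    parts : ∀ s → ∑ℚ (allSubsets n) (λ A → when (does ((s ∷ S) SubP.⊆? (true ∷ A))) ⟪ möbius (true ∷ A) , f ⟫)
              ℚ.+ ∑ℚ (allSubsets n) (λ A → when (does ((s ∷ S) SubP.⊆? (false ∷ A))) ⟪ möbius (false ∷ A) , f ⟫) ≡ f (s ∷ S)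
    parts true = trans (cong₂ ℚ._+_
        (trans (∑ℚ.∑-cong (allSubsets n) (λ A → cong (when (does (S SubP.⊆? A))) (⟪möbius⟫-true A f))) (möbius-inversion f₁ S))
        (∑ℚ.∑-zero (allSubsets n) (λ A → refl)))
      (ℚP.+-identityʳ (f₁ S))
    parts false = trans (cong₂ ℚ._+_
        (trans (∑ℚ.∑-cong (allSubsets n) (λ A → cong (when (does (S SubP.⊆? A))) (⟪möbius⟫-true A f))) (möbius-inversion f₁ S))
        (trans (∑ℚ.∑-cong (allSubsets n) (λ A → trans (cong (when (does (S SubP.⊆? A))) (⟪möbius⟫-false A f)) (ifminus (does (S SubP.⊆? A)) ⟪ möbius A , f₀ ⟫ ⟪ möbius A , f₁ ⟫)))
          (trans (∑ℚ.∑-+ (allSubsets n) (λ A → when (does (S SubP.⊆? A)) ⟪ möbius A , f₀ ⟫) (λ A → ℚ.- (when (does (S SubP.⊆? A)) ⟪ möbius A , f₁ ⟫)))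
            (cong₂ ℚ._+_ (möbius-inversion f₀ S)
              (trans (∑ℚ.∑-neg (allSubsets n) (λ A → when (does (S SubP.⊆? A)) ⟪ möbius A , f₁ ⟫)) (cong ℚ.-_ (möbius-inversion f₁ S)))))))
      (cancel (f₁ S) (f₀ S))

  möbius-cong : ∀ {n} (A : Subset n) {f g} → (∀ S → A ⊆ S → f S ≡ g S) → ⟪ möbius A , f ⟫ ≡ ⟪ möbius A , g ⟫
  möbius-cong []          {f} {g} e = cong (λ x → 1ℚ ℚ.* x ℚ.+ 0ℚ) (e [] (λ x → x))
  möbius-cong (true ∷ A)  {f} {g} e = trans (⟪möbius⟫-true A f)
    (trans (möbius-cong A (λ S A⊆S → e (true ∷ S) (SubP.s⊆s A⊆S))) (sym (⟪möbius⟫-true A g)))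
  möbius-cong (false ∷ A) {f} {g} e = trans (⟪möbius⟫-false A f)
    (trans (cong₂ ℚ._-_ (möbius-cong A (λ S A⊆S → e (false ∷ S) (SubP.out⊆ A⊆S))) (möbius-cong A (λ S A⊆S → e (true ∷ S) (SubP.out⊆ A⊆S))))
      (sym (⟪möbius⟫-false A g)))

  -- The terms `S` and `S ∪ ⁅ i ⁆` have opposite signs. This cancellation serves for non-flats, for
  -- products of incomparable flats and for y_i x_F.
  möbius-vanishes : ∀ {n} (A : Subset n) {f} i → i ∉ₛ A → (∀ S → A ⊆ S → f (S ∪ ⁅ i ⁆) ≡ f S) → ⟪ möbius A , f ⟫ ≡ 0ℚ
  möbius-vanishes (true ∷ A)  zero    i∉ e = contradiction here i∉
  möbius-vanishes (false ∷ A) {f} zero i∉ e = trans (⟪möbius⟫-false A f)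
    (trans (cong (λ x → ⟪ möbius A , (λ S → f (false ∷ S)) ⟫ ℚ.- x)
      (möbius-cong A (λ S A⊆S → trans (cong (λ T → f (true ∷ T)) (sym (SubP.∪-identityʳ S))) (e (false ∷ S) (SubP.out⊆ A⊆S)))))
      (ℚP.+-inverseʳ ⟪ möbius A , (λ S → f (false ∷ S)) ⟫))
  möbius-vanishes (true ∷ A)  {f} (suc i) i∉ e = trans (⟪möbius⟫-true A f)
    (möbius-vanishes A i (λ i∈ → i∉ (there i∈)) (λ S A⊆S → e (true ∷ S) (SubP.s⊆s A⊆S)))
  möbius-vanishes (false ∷ A) {f} (suc i) i∉ e = trans (⟪möbius⟫-false A f) (cong₂ ℚ._-_
    (möbius-vanishes A i (λ i∈ → i∉ (there i∈)) (λ S A⊆S → e (false ∷ S) (SubP.out⊆ A⊆S)))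
    (möbius-vanishes A i (λ i∈ → i∉ (there i∈)) (λ S A⊆S → e (true ∷ S) (SubP.out⊆ A⊆S))))

  LinearForm : ℕ → Set
  LinearForm n = List (ℚ × Subset n)

  module _ {n : ℕ} where

    Φ : Set
    Φ = List (Subset n) → ℚ

    infix 4 _≐_
    _≐_ : Φ → Φ → Set
    φ ≐ ψ = ∀ m → φ m ≡ ψ m

    Symmetric : Φ → Set
    Symmetric φ = ∀ {m m′} → m ↭ m′ → φ m ≡ φ m′

    -- Transpose of multiplication by the linear form `ℓ`.
    op : LinearForm n → Φ → Φ
    op ℓ φ m = ⟪ ℓ , (λ S → φ (S ∷ m)) ⟫

    op-sym : ∀ ℓ {φ} → Symmetric φ → Symmetric (op ℓ φ)
    op-sym ℓ s p = ⟪⟫-cong ℓ (λ S → s (prep S p))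

    op-cong : ∀ ℓ {φ ψ} → φ ≐ ψ → op ℓ φ ≐ op ℓ ψ
    op-cong ℓ e m = ⟪⟫-cong ℓ (λ S → e (S ∷ m))

    op-comm : ∀ ℓ ℓ′ {φ} → Symmetric φ → op ℓ (op ℓ′ φ) ≐ op ℓ′ (op ℓ φ)
    op-comm ℓ ℓ′ {φ} s m = trans (⟪⟫-swap ℓ ℓ′ (λ S T → φ (T ∷ S ∷ m)))
      (⟪⟫-cong ℓ′ (λ T → ⟪⟫-cong ℓ (λ S → s (swap T S ↭-refl))))

    op-linear : ∀ ℓ {A : Set} (q : List (ℚ × A)) (ψ : A → Φ) → op ℓ (λ m → ⟪ q , (λ a → ψ a m) ⟫) ≐ (λ m → ⟪ q , (λ a → op ℓ (ψ a) m) ⟫)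
    op-linear ℓ q ψ m = ⟪⟫-swap ℓ q (λ S a → ψ a (S ∷ m))

    iterate : ℕ → LinearForm n → Φ → Φ
    iterate zero    ℓ φ = φ
    iterate (suc a) ℓ φ = op ℓ (iterate a ℓ φ)

    -- Transpose of multiplication by the monomial `μ` after `L i` has been substituted for the i-th
    -- variable.
    ev : ∀ {N} → (Fin N → LinearForm n) → Mono N → Φ → Φ
    ev L []      φ = φ
    ev L (a ∷ μ) φ = iterate a (L zero) (ev (L ∘ suc) μ φ)

    module _ (P : Φ → Set) (P-op : ∀ ℓ {φ} → P φ → P (op ℓ φ)) where
      ev-preserves : ∀ {N} (L : Fin N → LinearForm n) μ {φ} → P φ → P (ev L μ φ)
      ev-preserves L []      p = p
      ev-preserves L (a ∷ μ) p = go a (ev-preserves (L ∘ suc) μ p)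
        where
        go : ∀ a {φ} → P φ → P (iterate a (L zero) φ)
        go zero    p = p
        go (suc a) p = P-op (L zero) (go a p)

    iterate-cong : ∀ a ℓ {φ ψ} → φ ≐ ψ → iterate a ℓ φ ≐ iterate a ℓ ψ
    iterate-cong zero    ℓ e = e
    iterate-cong (suc a) ℓ e = op-cong ℓ (iterate-cong a ℓ e)

    iterate-sym : ∀ a ℓ {φ} → Symmetric φ → Symmetric (iterate a ℓ φ)
    iterate-sym zero    ℓ s = s
    iterate-sym (suc a) ℓ s = op-sym ℓ {iterate a ℓ _} (iterate-sym a ℓ s)

    ev-sym : ∀ {N} (L : Fin N → LinearForm n) μ {φ} → Symmetric φ → Symmetric (ev L μ φ)
    ev-sym L []      s = s
    ev-sym L (a ∷ μ) {φ} s = iterate-sym a (L zero) {ev (L ∘ suc) μ φ} (ev-sym (L ∘ suc) μ {φ} s)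

    ev-cong : ∀ {N} (L : Fin N → LinearForm n) μ {φ ψ} → φ ≐ ψ → ev L μ φ ≐ ev L μ ψ
    ev-cong L []      e = e
    ev-cong L (a ∷ μ) e = iterate-cong a (L zero) (ev-cong (L ∘ suc) μ e)

    iterate-op : ∀ a ℓ ℓ′ {φ} → Symmetric φ → iterate a ℓ (op ℓ′ φ) ≐ op ℓ′ (iterate a ℓ φ)
    iterate-op zero    ℓ ℓ′ s m = refl
    iterate-op (suc a) ℓ ℓ′ {φ} s m = trans (op-cong ℓ (iterate-op a ℓ ℓ′ {φ} s) m) (op-comm ℓ ℓ′ {iterate a ℓ φ} (iterate-sym a ℓ s) m)

    ev-op : ∀ {N} (L : Fin N → LinearForm n) μ ℓ {φ} → Symmetric φ → ev L μ (op ℓ φ) ≐ op ℓ (ev L μ φ)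
    ev-op L []      ℓ s m = refl
    ev-op L (a ∷ μ) ℓ {φ} s m = trans (iterate-cong a (L zero) (ev-op (L ∘ suc) μ ℓ {φ} s) m)
      (iterate-op a (L zero) ℓ {ev (L ∘ suc) μ φ} (ev-sym (L ∘ suc) μ {φ} s) m)

    ev-iterate : ∀ {N} (L : Fin N → LinearForm n) μ b ℓ {φ} → Symmetric φ → ev L μ (iterate b ℓ φ) ≐ iterate b ℓ (ev L μ φ)
    ev-iterate L μ zero    ℓ s m = refl
    ev-iterate L μ (suc b) ℓ {φ} s m = trans (ev-op L μ ℓ {iterate b ℓ φ} (iterate-sym b ℓ s) m) (op-cong ℓ (ev-iterate L μ b ℓ {φ} s) m)

    iterate-+ : ∀ a b ℓ φ m → iterate (a ℕ.+ b) ℓ φ m ≡ iterate a ℓ (iterate b ℓ φ) m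
    iterate-+ zero    b ℓ φ m = refl
    iterate-+ (suc a) b ℓ φ m = op-cong ℓ (iterate-+ a b ℓ φ) m

    ev-+ : ∀ {N} (L : Fin N → LinearForm n) μ ν {φ} → Symmetric φ → ev L (μ +ᵐ ν) φ ≐ ev L μ (ev L ν φ)
    ev-+ L []      []      s m = refl
    ev-+ L (a ∷ μ) (b ∷ ν) {φ} s m = trans (iterate-+ a b (L zero) (ev (L ∘ suc) (μ +ᵐ ν) φ) m)
      (iterate-cong a (L zero) (λ m → trans (iterate-cong b (L zero) (ev-+ (L ∘ suc) μ ν {φ} s) m)
        (sym (ev-iterate (L ∘ suc) μ b (L zero) {ev (L ∘ suc) ν φ} (ev-sym (L ∘ suc) ν {φ} s) m))) m)

    ev-linear : ∀ {N} (L : Fin N → LinearForm n) μ {A : Set} (q : List (ℚ × A)) (ψ : A → Φ) →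
                ev L μ (λ m → ⟪ q , (λ a → ψ a m) ⟫) ≐ (λ m → ⟪ q , (λ a → ev L μ (ψ a) m) ⟫)
    ev-linear L []      q ψ m = refl
    ev-linear L (a ∷ μ) q ψ m = trans (iterate-cong a (L zero) (ev-linear (L ∘ suc) μ q ψ) m) (go a m)
      where
      go : ∀ a → iterate a (L zero) (λ m → ⟪ q , (λ t → ev (L ∘ suc) μ (ψ t) m) ⟫) ≐ (λ m → ⟪ q , (λ t → iterate a (L zero) (ev (L ∘ suc) μ (ψ t)) m) ⟫)
      go zero    m = refl
      go (suc a) m = trans (op-cong (L zero) (go a) m) (op-linear (L zero) q (λ t → iterate a (L zero) (ev (L ∘ suc) μ (ψ t))) m)

    ev-0 : ∀ {N} (L : Fin N → LinearForm n) {z : Fin N → ℕ} → (∀ j → z j ≡ 0) → ∀ φ → ev L (tabulate z) φ ≐ φ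
    ev-0 {zero}  L z0 φ m = refl
    ev-0 {suc N} L {z} z0 φ m = trans (cong (λ a → iterate a (L zero) (ev (L ∘ suc) (tabulate (z ∘ suc)) φ) m) (z0 zero)) (ev-0 (L ∘ suc) (z0 ∘ suc) φ m)

    ev-var : ∀ {N} (L : Fin N → LinearForm n) i φ → ev L (tabulate (λ j → if does (i Fin.≟ j) then 1 else 0)) φ ≐ op (L i) φ
    ev-var L zero    φ m = op-cong (L zero) (ev-0 (L ∘ suc) (λ _ → refl) φ) m
    ev-var L (suc i) φ m = ev-var (L ∘ suc) i φ m

    -- For symmetric `φ`, the value of `φ` on `m` times the polynomial `p` evaluated at `L`.
    act : ∀ {N} → (Fin N → LinearForm n) → Poly N → Φ → Φ
    act L p φ m = ⟪ p , (λ μ → ev L μ φ m) ⟫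

    module _ {N : ℕ} (L : Fin N → LinearForm n) where

      act-cong : ∀ p {φ ψ} → φ ≐ ψ → act L p φ ≐ act L p ψ
      act-cong p e m = ⟪⟫-cong p (λ μ → ev-cong L μ e m)

      act-var : ∀ i φ → act L (var i) φ ≐ op (L i) φ
      act-var i φ m = trans (ℚP.+-identityʳ (1ℚ ℚ.* ev L μᵢ φ m)) (trans (ℚP.*-identityˡ (ev L μᵢ φ m)) (ev-var L i φ m))
        where μᵢ = tabulate (λ j → if does (i Fin.≟ j) then 1 else 0)

      act-1 : ∀ φ → act L 1ᵖ φ ≐ φ
      act-1 φ m = trans (ℚP.+-identityʳ (1ℚ ℚ.* ev L 0ᵐ φ m)) (trans (ℚP.*-identityˡ (ev L 0ᵐ φ m))
        (go L))
        where
        go : ∀ {N} (L : Fin N → LinearForm n) → ev L 0ᵐ φ m ≡ φ m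
        go {zero}  L = refl
        go {suc N} L = go (L ∘ suc)

      act-* : ∀ p q {φ} → Symmetric φ → act L (p *ᵖ q) φ ≐ act L q (act L p φ)
      act-* p q {φ} s m = begin
        ⟪ p *ᵖ q , (λ μ → ev L μ φ m) ⟫ ≡⟨ ⟪⟫-* p q _ ⟩
        ⟪ p , (λ μ → ⟪ q , (λ ν → ev L (μ +ᵐ ν) φ m) ⟫) ⟫
          ≡⟨ ⟪⟫-cong p (λ μ → ⟪⟫-cong q (λ ν → trans (cong (λ κ → ev L κ φ m) (VecP.zipWith-comm ℕP.+-comm μ ν)) (ev-+ L ν μ {φ} s m))) ⟩
        ⟪ p , (λ μ → ⟪ q , (λ ν → ev L ν (ev L μ φ) m) ⟫) ⟫ ≡⟨ ⟪⟫-swap p q _ ⟩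
        ⟪ q , (λ ν → ⟪ p , (λ μ → ev L ν (ev L μ φ) m) ⟫) ⟫ ≡⟨ ⟪⟫-cong q (λ ν → ev-linear L ν p (λ μ → ev L μ φ) m) ⟨
        ⟪ q , (λ ν → ev L ν (act L p φ) m) ⟫ ∎
        where open ≡-Reasoning

  module Independence {n : ℕ} (M : Polymatroid n) where
    open Polymatroid M
    open Standard M

    module _ {φ : Φ} (D : Dual φ) where
      open Dual D

      dual-∂ : ∀ X → Dual (λ m → φ (X ∷ m))
      dual-∂ X = record
        { φ-↭      = λ p → φ-↭ (prep X p)
        ; φ-⊥      = λ m → trans (s2 m) (φ-⊥ (X ∷ m))
        ; φ-closed = λ S i m e → trans (s2 m) (trans (φ-closed S i (X ∷ m) e) (sym (s2 m)))
        ; φ-pair   = λ S T m → trans (cong₂ ℚ._+_ (s3 m) (s3 m)) (trans (φ-pair S T (X ∷ m)) (sym (cong₂ ℚ._+_ (s3 m) (s3 m))))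
        ; φ-point  = λ i m e → trans (s2 m) (φ-point i (X ∷ m) e)
        ; φ-point² = λ i m → trans (s3 m) (φ-point² i (X ∷ m))
        ; φ-absorb = λ i S m → trans (s3 m) (trans (φ-absorb i S (X ∷ m)) (sym (s3 m)))
        }
        where
        s2 : ∀ {S} m → φ (X ∷ S ∷ m) ≡ φ (S ∷ X ∷ m)
        s2 m = φ-↭ (swap X _ ↭-refl)
        s3 : ∀ {S T} m → φ (X ∷ S ∷ T ∷ m) ≡ φ (S ∷ T ∷ X ∷ m)
        s3 {S} {T} m = trans (s2 (T ∷ m)) (φ-↭ (prep S (swap X T ↭-refl)))

    -- Compatibility passes to multiples by linear forms. Therefore an ideal is tested on its
    -- generators alone, and only against the empty monomial.
    dual-op : ∀ ℓ {φ} → Dual φ → Dual (op ℓ φ)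
    dual-op ℓ {φ} D = record
      { φ-↭      = λ p → ⟪⟫-cong ℓ (λ X → D.φ-↭ X p)
      ; φ-⊥      = λ m → ⟪⟫-0 ℓ (λ X → D.φ-⊥ X m)
      ; φ-closed = λ S i m e → ⟪⟫-cong ℓ (λ X → D.φ-closed X S i m e)
      ; φ-pair   = λ S T m → trans (sym (⟪⟫-+ ℓ _ _)) (trans (⟪⟫-cong ℓ (λ X → D.φ-pair X S T m)) (⟪⟫-+ ℓ _ _))
      ; φ-point  = λ i m e → ⟪⟫-0 ℓ (λ X → D.φ-point X i m e)
      ; φ-point² = λ i m → ⟪⟫-0 ℓ (λ X → D.φ-point² X i m)
      ; φ-absorb = λ i S m → ⟪⟫-cong ℓ (λ X → D.φ-absorb X i S m)
      }
      where module D X = Dual (dual-∂ D X)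

    -- Decreases strictly when the counts grow pointwise at fixed total; this turns the partial
    -- order behind triangularity into a well-founded recursion.
    deficit : Chain {n} → ℕ
    deficit C = ListAction.sum (List.map (λ U → total C ℕ.∸ count (flatten C) U) (allSubsets n))

    private
      sum-mono-< : ∀ {A : Set} (f g : A → ℕ) xs → (∀ x → f x ≤ g x) → ∀ {y} → y ∈ xs → f y < g y →
                   ListAction.sum (List.map f xs) < ListAction.sum (List.map g xs)
      sum-mono-≤ : ∀ {A : Set} (f g : A → ℕ) xs → (∀ x → f x ≤ g x) → ListAction.sum (List.map f xs) ≤ ListAction.sum (List.map g xs)
      sum-mono-≤ f g []       le = z≤n
      sum-mono-≤ f g (x ∷ xs) le = ℕP.+-mono-≤ (le x) (sum-mono-≤ f g xs le)
      sum-mono-< f g (x ∷ xs) le (here refl) lt = ℕP.+-mono-<-≤ lt (sum-mono-≤ f g xs le)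
      sum-mono-< f g (x ∷ xs) le (there y∈)  lt = ℕP.+-mono-≤-< (le x) (sum-mono-< f g xs le y∈ lt)

    φ-smaller : ∀ {C C′} → Std C → Std C′ → total C ≡ total C′ → φ C (flatten C′) ≢ 0ℚ → C ≡ C′ ⊎ deficit C′ < deficit C
    φ-smaller {C} {C′} s s′ t ne with SubP.anySubset? (λ U → count (flatten C) U ℕP.<? count (flatten C′) U)
    ... | no none = inj₁ (count-injective s s′ (λ U → ℕP.≤-antisym (φ-triangular {C} {C′} s ne U) (ℕP.≮⇒≥ (λ lt → none (U , lt)))))
    ... | yes (U , lt) = inj₂ (sum-mono-< _ _ (allSubsets n)
      (λ V → ℕP.≤-trans (ℕP.∸-monoʳ-≤ (total C′) (φ-triangular {C} {C′} s ne V)) (ℕP.≤-reflexive (cong (ℕ._∸ count (flatten C) V) (sym t))))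
      (∈-allSubsets U)
      (ℕP.<-≤-trans (ℕP.∸-monoʳ-< lt (count-flatten≤ C′ U)) (ℕP.≤-reflexive (cong (ℕ._∸ count (flatten C) U) (sym t)))))

    -- `L` replaces the variables by linear forms in the h_S, and `H` represents each h_S by a
    -- polynomial; by `L-H` the substitution recovers h_S from `H S`, as far as dual functionals can
    -- see.
    module Lower (P : Presentation)
      (L : Fin (Presentation.nvars P) → LinearForm n) (H : Subset n → Poly (Presentation.nvars P))
      (L-gens : ∀ {g} → g ∈ Presentation.gens P → ∀ {φ} → Dual φ → act L g φ [] ≡ 0ℚ)
      (L-H : ∀ S {φ} → Dual φ → ∀ m → act L (H S) φ m ≡ φ (S ∷ m))
      where

      open Presentation P
      open Ideal P

      monomial : List (Subset n) → Poly nvars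
      monomial []      = 1ᵖ
      monomial (S ∷ m) = H S *ᵖ monomial m

      act-monomial : ∀ m {φ} → Dual φ → act L (monomial m) φ [] ≡ φ m
      act-monomial []      {φ} D = act-1 L φ []
      act-monomial (S ∷ m) {φ} D = trans (act-* L (H S) (monomial m) {φ} (Dual.φ-↭ D) [])
        (trans (act-cong L (monomial m) (L-H S D) []) (act-monomial m (dual-∂ D S)))

      act-ideal : ∀ {φ} → Dual φ → ∀ {p} → I p → act L p φ [] ≡ 0ℚ
      act-ideal {φ} D = annihilates (λ μ → ev L μ φ []) kill
        where
        kill : ∀ {g} → g ∈ gens → ∀ r → ⟪ r *ᵖ g , (λ μ → ev L μ φ []) ⟫ ≡ 0ℚ
        kill {g} g∈ r = begin
          ⟪ r *ᵖ g , (λ μ → ev L μ φ []) ⟫ ≡⟨ ⟪⟫-* r g _ ⟩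
          ⟪ r , (λ μ → ⟪ g , (λ ν → ev L (μ +ᵐ ν) φ []) ⟫) ⟫
            ≡⟨ ⟪⟫-cong r (λ μ → ⟪⟫-cong g (λ ν → trans (cong (λ κ → ev L κ φ []) (VecP.zipWith-comm ℕP.+-comm μ ν)) (ev-+ L ν μ {φ} (Dual.φ-↭ D) []))) ⟩
          ⟪ r , (λ μ → act L g (ev L μ φ) []) ⟫ ≡⟨ ⟪⟫-0 r (λ μ → L-gens g∈ (ev-preserves Dual dual-op L μ D)) ⟩
          0ℚ ∎
          where open ≡-Reasoning

      module _ {d : ℕ} (Cs : List (Chain {n})) (std : ∀ {C} → C ∈ Cs → Std C) (deg : ∀ {C} → C ∈ Cs → total C ≡ d) (uniq : Unique Cs) where

        private
          r = length Cs
          C_ : Fin r → Chain {n}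
          C_ = List.lookup Cs
          C∈ : ∀ j → C_ j ∈ Cs
          C∈ j = ∈-lookup j

        basis : Vec (Poly nvars) r
        basis = Vec.map (λ C → monomial (flatten C)) (Vec.fromList Cs)

        lookup-basis : ∀ j → lookup basis j ≡ monomial (flatten (C_ j))
        lookup-basis j = trans (VecP.lookup-map j _ (Vec.fromList Cs)) (cong (λ C → monomial (flatten C)) (lookup-fromList Cs j))
          where
          lookup-fromList : ∀ (xs : List (Chain {n})) i → lookup (Vec.fromList xs) i ≡ List.lookup xs i
          lookup-fromList (x ∷ xs) zero    = refl
          lookup-fromList (x ∷ xs) (suc i) = lookup-fromList xs i

        -- The functional of a chain is 1 on its own monomial and vanishes on every other chain of
        -- the same degree except those of smaller deficit. So the coefficients of a relation vanish
        -- one after the other, by recursion on the deficit.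
        basis-independent : IndependentMod P basis
        basis-independent cs inI j = go j (<-wellFounded _)
          where
          relation : ∀ j → sum (λ i → lookup cs i ℚ.* φ (C_ j) (flatten (C_ i))) ≡ 0ℚ
          relation j = trans (sum-cong-≗ (λ i → cong (lookup cs i ℚ.*_)
              (sym (trans (cong (λ p → ⟪ p , E ⟫) (lookup-basis i)) (act-monomial (flatten (C_ i)) D)))))
            (trans (sym (⟪linComb⟫ cs basis E)) (act-ideal D (InIdeal⇒I {linComb P cs basis} inI)))
            where
            D = φ-dual (std (C∈ j))
            E = λ μ → ev L μ (φ (C_ j)) []
          go : ∀ j → Acc _<_ (deficit (C_ j)) → lookup cs j ≡ 0ℚ
          go j (acc rec) = begin
            lookup cs j                                     ≡⟨ ℚP.*-identityʳ (lookup cs j) ⟨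
            lookup cs j ℚ.* 1ℚ                              ≡⟨ cong (lookup cs j ℚ.*_) (φ-diagonal (std (C∈ j))) ⟨
            lookup cs j ℚ.* φ (C_ j) (flatten (C_ j))       ≡⟨ sum-single (λ i → lookup cs i ℚ.* φ (C_ j) (flatten (C_ i))) j others ⟨
            sum (λ i → lookup cs i ℚ.* φ (C_ j) (flatten (C_ i))) ≡⟨ relation j ⟩
            0ℚ ∎
            where
            open ≡-Reasoning
            others : ∀ i → i ≢ j → lookup cs i ℚ.* φ (C_ j) (flatten (C_ i)) ≡ 0ℚ
            others i i≢j with φ (C_ j) (flatten (C_ i)) ℚP.≟ 0ℚ
            ... | yes z = trans (cong (lookup cs i ℚ.*_) z) (ℚP.*-zeroʳ (lookup cs i))
            ... | no ne with φ-smaller (std (C∈ j)) (std (C∈ i)) (trans (deg (C∈ j)) (sym (deg (C∈ i)))) ne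
            ...   | inj₁ same = contradiction (sym (unique-lookup uniq _ _ same)) i≢j
            ...   | inj₂ lt = trans (cong (ℚ._* φ (C_ j) (flatten (C_ i))) (go i (rec lt))) (ℚP.*-zeroˡ (φ (C_ j) (flatten (C_ i))))

-- Straightening of monomials into standard ones

module Straightenings where

  open ChainFunctionals hiding (add)
  open StandardChains
  open import Algebra.Bundles using (CommutativeRing)
  open import Level using (0ℓ)
  open import Data.Empty using (⊥-elim)
  open import Data.Fin using (Fin)
  import Data.Fin.Properties as FinP
  open import Data.Fin.Subset using (Subset; _∈_; _⊆_; ⁅_⁆; _∪_; ∣_∣)
  import Data.Fin.Subset.Properties as SubP
  open import Data.Nat using (ℕ; zero; suc; _+_; _∸_; _≤_; _<_; z≤n; s≤s; _≤?_; _<?_)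
  open import Data.Nat.Properties using (≤-refl; ≤-trans; ≤-reflexive; ≤-pred; <-irrefl; <-≤-trans; ≤-<-trans; ≤-antisym; ≤∧≢⇒<; ≮⇒≥; m≤n+m; _≟_; ∸-monoʳ-<; +-monoʳ-<; +-monoˡ-<; +-mono-<; +-mono-<-≤)
  import Data.Nat.Properties as ℕP
  open import Data.Nat.Induction using (<-wellFounded)
  open import Data.Nat.ListAction using (sum)
  open import Data.Nat.ListAction.Properties using (sum-↭)
  open import Induction.WellFounded using (Acc; acc)
  open import Data.List using (List; []; _∷_; _++_; replicate; length; map; foldr; filter; allFin)
  open import Data.List.Properties using (length-++; length-replicate)
  open import Data.List.Membership.Propositional using () renaming (_∈_ to _∈ₗ_)
  open import Data.List.Membership.Propositional.Properties using (∈-filter⁺; ∈-filter⁻; ∈-allFin)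
  open import Data.List.Relation.Unary.Any using (here; there)
  open import Data.List.Relation.Binary.Permutation.Propositional using (_↭_; ↭-refl; ↭-sym; ↭-trans; prep; swap) renaming (refl to ↭-refl′; trans to ↭-trans′)
  open import Data.List.Relation.Binary.Permutation.Propositional.Properties using (↭-length; ++⁺ˡ; shift) renaming (map⁺ to ↭-map⁺)
  open import Data.Product using (∃; _×_; _,_; proj₂)
  open import Data.Sum using (_⊎_; inj₁; inj₂)
  open import Data.Rational using (ℚ)
  open import Relation.Nullary using (¬_; yes; no; contradiction)
  open import Relation.Nullary.Decidable using (¬?; _×-dec_; decidable-stable)
  open import Relation.Binary.PropositionalEquality as ≡ using (_≡_; _≢_)

  -- A path of one-element extensions, where `i` may already belong to `G`. The ring relations
  -- concern a single element; paths extend them to arbitrary inclusions.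
  data Reach {n : ℕ} (F : Subset n) : Subset n → Set where
    start : Reach F F
    step  : ∀ {G} i → Reach F G → Reach F (G ∪ ⁅ i ⁆)

  reach-⊆ : ∀ {n} {F G : Subset n} → Reach F G → F ⊆ G
  reach-⊆ start      x∈ = x∈
  reach-⊆ (step i r) x∈ = SubP.p⊆p∪q ⁅ i ⁆ (reach-⊆ r x∈)

  reach : ∀ {n} {F G : Subset n} → F ⊆ G → Reach F G
  reach {n} {F} {G} F⊆G = ≡.subst (Reach F) (SubP.⊆-antisym (build⊆ elements (λ i∈ → proj₂ (∈-filter⁻ (SubP._∈? G) {xs = allFin n} i∈)))
      (λ {x} x∈ → ⊆build elements (∈-filter⁺ (SubP._∈? G) (∈-allFin x) x∈))) (go elements)
    where
    build : List (Fin n) → Subset n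
    build = foldr (λ i T → T ∪ ⁅ i ⁆) F
    elements = filter (SubP._∈? G) (allFin n)
    go : ∀ is → Reach F (build is)
    go []       = start
    go (i ∷ is) = step i (go is)
    build⊆ : ∀ is → (∀ {i} → i ∈ₗ is → i ∈ G) → build is ⊆ G
    build⊆ []       sub x∈ = F⊆G x∈
    build⊆ (i ∷ is) sub x∈ = ∪-lub {S = build is} (build⊆ is (λ j∈ → sub (there j∈))) (⁅⁆-⊆ (sub (here ≡.refl))) x∈
    ⊆build : ∀ is {x} → x ∈ₗ is → x ∈ build is
    ⊆build (i ∷ is) (here ≡.refl) = SubP.q⊆p∪q (build is) ⁅ i ⁆ (SubP.x∈⁅x⁆ i)
    ⊆build (i ∷ is) (there x∈)    = SubP.p⊆p∪q ⁅ i ⁆ (⊆build is x∈)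

  ⊆∧≢⇒∣∣< : ∀ {n} {S T : Subset n} → S ⊆ T → S ≢ T → ∣ S ∣ < ∣ T ∣
  ⊆∧≢⇒∣∣< {S = S} {T} S⊆T S≢T with S SubP.⊂? T
  ... | yes S⊂T = SubP.p⊂q⇒∣p∣<∣q∣ S⊂T
  ... | no S⊄T = ⊥-elim (S≢T (SubP.⊆-antisym S⊆T (λ {x} x∈T → decidable-stable (x SubP.∈? S) (λ x∉S → S⊄T ((λ y → S⊆T y) , x , x∈T , x∉S)))))

  module _ {n : ℕ} where

    codim : Subset n → ℕ
    codim S = n ∸ ∣ S ∣

    codim-< : ∀ {S T} → S ⊆ T → S ≢ T → codim T < codim S
    codim-< {S} {T} S⊆T S≢T = ∸-monoʳ-< (⊆∧≢⇒∣∣< S⊆T S≢T) (SubP.∣p∣≤n T)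

    -- Termination measure: straightening replaces factors by larger sets.
    weight : List (Subset n) → ℕ
    weight m = sum (map codim m)

    weight-↭ : ∀ {m m′} → m ↭ m′ → weight m ≡ weight m′
    weight-↭ p = sum-↭ (↭-map⁺ codim p)

    total-length : ∀ (C : Chain {n}) → length (flatten C) ≡ total C
    total-length []            = ≡.refl
    total-length ((F , a) ∷ C) = ≡.trans (length-++ (replicate a F)) (≡.cong₂ _+_ (length-replicate a) (total-length C))

  module Product {n : ℕ} (R : CommutativeRing 0ℓ 0ℓ) (H : Subset n → CommutativeRing.Carrier R) where
    open CommutativeRing R hiding (zero; _+_)
    open CommutativeRing R using () renaming (_+_ to _⊹_)

    product : List (Subset n) → Carrier
    product []      = 1#
    product (S ∷ m) = H S * product m

    pow : Carrier → ℕ → Carrier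
    pow x zero    = 1#
    pow x (suc e) = x * pow x e

    record Relations (M : Polymatroid n) : Set where
      open Polymatroid M
      field
        H-⊥      : H ⊥ₛ ≈ 0#
        H-closed : ∀ S i → ρ (S ∪ ⁅ i ⁆) ≡ ρ S → H S ≈ H (S ∪ ⁅ i ⁆)
        H-step   : ∀ S i → S ≢ ⊥ₛ → H S * H (S ∪ ⁅ i ⁆) ≈ H (S ∪ ⁅ i ⁆) * H (S ∪ ⁅ i ⁆)
        H-point  : ∀ i e → ρ ⁅ i ⁆ ≤ e → pow (H ⁅ i ⁆) e ≈ 0#
        H-pair   : ∀ S T → H S * H T ≈ (H S * H (S ∪ T) ⊹ H T * H (S ∪ T)) - H (S ∪ T) * H (S ∪ T)

    -- An inductive span lets straightening proceed without tracking coefficients; they are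
    -- extracted once, at the end, with respect to the standard monomials. `κ` embeds the scalars.
    data Span (κ : ℚ → Carrier) (Q : List (Subset n) → Set) : Carrier → Set where
      base  : ∀ {m} → Q m → Span κ Q (product m)
      zero  : Span κ Q 0#
      add   : ∀ {x y} → Span κ Q x → Span κ Q y → Span κ Q (x ⊹ y)
      neg   : ∀ {x} → Span κ Q x → Span κ Q (- x)
      scale : ∀ c {x} → Span κ Q x → Span κ Q (κ c * x)
      resp  : ∀ {x y} → x ≈ y → Span κ Q x → Span κ Q y

    span-bind : ∀ {κ Q Q′ x} → (∀ {m} → Q m → Span κ Q′ (product m)) → Span κ Q x → Span κ Q′ x
    span-bind f (base q)    = f q
    span-bind f zero        = zero
    span-bind f (add s t)   = add (span-bind f s) (span-bind f t)
    span-bind f (neg s)     = neg (span-bind f s)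
    span-bind f (scale c s) = scale c (span-bind f s)
    span-bind f (resp e s)  = resp e (span-bind f s)

  module Straightening {n : ℕ} (M : Polymatroid n) (R : CommutativeRing 0ℓ 0ℓ) (H : Subset n → CommutativeRing.Carrier R)
    (κ : ℚ → CommutativeRing.Carrier R) (rel : Product.Relations R H M) where

    open CommutativeRing R hiding (zero; _+_)
    open CommutativeRing R using () renaming (_+_ to _⊹_)
    open Product R H
    open Relations rel
    open Polymatroid M
    open Standard M
    open import Relation.Binary.Reasoning.Setoid setoid
    open import Algebra.Properties.Ring ring using (-‿distribʳ-*)

    x*yz≈y*xz : ∀ x y z → x * (y * z) ≈ y * (x * z)
    x*yz≈y*xz x y z = trans (sym (*-assoc x y z)) (trans (*-congʳ (*-comm x y)) (*-assoc y x z))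

    product-↭ : ∀ {m m′} → m ↭ m′ → product m ≈ product m′
    product-↭ ↭-refl′        = refl
    product-↭ (prep S p)     = *-congˡ (product-↭ p)
    product-↭ (swap S T p)   = trans (x*yz≈y*xz _ _ _) (*-congˡ (*-congˡ (product-↭ p)))
    product-↭ (↭-trans′ p q) = trans (product-↭ p) (product-↭ q)

    product-run : ∀ a F m → product (replicate a F ++ m) ≈ pow (H F) a * product m
    product-run zero    F m = sym (*-identityˡ _)
    product-run (suc a) F m = trans (*-congˡ (product-run a F m)) (sym (*-assoc _ _ _))

    pow-cong : ∀ {x y} e → x ≈ y → pow x e ≈ pow y e
    pow-cong zero    eq = refl
    pow-cong (suc e) eq = *-cong eq (pow-cong e eq)

    reach-≢⊥ : ∀ {F G : Subset n} → F ≢ ⊥ₛ → Reach F G → G ≢ ⊥ₛ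
    reach-≢⊥ F≢⊥ r ≡.refl = F≢⊥ (⊆⊥⇒≡⊥ (reach-⊆ r))

    slide : ∀ G i e → G ≢ ⊥ₛ → H (G ∪ ⁅ i ⁆) * pow (H G) e ≈ H (G ∪ ⁅ i ⁆) * pow (H (G ∪ ⁅ i ⁆)) e
    slide G i zero    G≢⊥ = refl
    slide G i (suc e) G≢⊥ = begin
      K * (H G * pow (H G) e)   ≈⟨ x*yz≈y*xz _ _ _ ⟩
      H G * (K * pow (H G) e)   ≈⟨ *-congˡ (slide G i e G≢⊥) ⟩
      H G * (K * pow K e)       ≈⟨ *-assoc _ _ _ ⟨
      (H G * K) * pow K e       ≈⟨ *-congʳ (H-step G i G≢⊥) ⟩
      (K * K) * pow K e         ≈⟨ *-assoc _ _ _ ⟩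
      K * (K * pow K e)         ∎
      where K = H (G ∪ ⁅ i ⁆)

    -- Induction along a path from `F` to `G`. An element of the closure changes nothing. An element
    -- that raises the rank uses up one factor: `slide` trades the others for the previous set,
    -- whose smaller rank allows the exponent to drop by one, and then trades them back.
    H-lift : ∀ {F G} → Reach F G → F ≢ ⊥ₛ → ∀ e → ρ G ≤ e + ρ F → H F * pow (H G) e ≈ pow (H G) (suc e)
    H-lift start F≢⊥ e le = refl
    H-lift {F} (step {G} i r) F≢⊥ e le with ρ (G ∪ ⁅ i ⁆) ≟ ρ G
    ... | yes eq = trans (*-congˡ (pow-cong e (sym G≈))) (trans (H-lift r F≢⊥ e (≤-trans (≤-reflexive (≡.sym eq)) le)) (pow-cong (suc e) G≈))
      where G≈ = H-closed G i eq
    ... | no ne = jump e le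
      where
      K = H (G ∪ ⁅ i ⁆)
      ρG< : ρ G < ρ (G ∪ ⁅ i ⁆)
      ρG< = ≤∧≢⇒< (ρ-mono {G} (SubP.p⊆p∪q ⁅ i ⁆)) (λ e → ne (≡.sym e))
      G≢⊥ = reach-≢⊥ F≢⊥ r
      jump : ∀ e → ρ (G ∪ ⁅ i ⁆) ≤ e + ρ F → H F * pow K e ≈ pow K (suc e)
      jump zero    le = ⊥-elim (<-irrefl ≡.refl (<-≤-trans ρG< (≤-trans le (ρ-mono (reach-⊆ r)))))
      jump (suc e) le = begin
        H F * (K * pow K e)          ≈⟨ *-congˡ (slide G i e G≢⊥) ⟨
        H F * (K * pow (H G) e)      ≈⟨ x*yz≈y*xz _ _ _ ⟩
        K * (H F * pow (H G) e)      ≈⟨ *-congˡ (H-lift r F≢⊥ e (≤-pred (≤-trans ρG< le))) ⟩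
        K * pow (H G) (suc e)        ≈⟨ slide G i (suc e) G≢⊥ ⟩
        K * pow K (suc e)            ∎

    -- The descent of `H-lift`, ending at a point, where the power vanishes by `H-point`.
    H-nilpotent : ∀ {i G} → Reach ⁅ i ⁆ G → ∀ e → ρ G ≤ e → pow (H G) e ≈ 0#
    H-nilpotent {i} start e le = H-point i e le
    H-nilpotent {j} (step {G} i r) e le with ρ (G ∪ ⁅ i ⁆) ≟ ρ G
    ... | yes eq = trans (pow-cong e (sym (H-closed G i eq))) (H-nilpotent r e (≤-trans (≤-reflexive (≡.sym eq)) le))
    ... | no ne = jump e le
      where
      ρG< : ρ G < ρ (G ∪ ⁅ i ⁆)
      ρG< = ≤∧≢⇒< (ρ-mono {G} (SubP.p⊆p∪q ⁅ i ⁆)) (λ e → ne (≡.sym e))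
      G≢⊥ = reach-≢⊥ (λ eq → SubP.∉⊥ (≡.subst (j ∈_) eq (SubP.x∈⁅x⁆ j))) r
      jump : ∀ e → ρ (G ∪ ⁅ i ⁆) ≤ e → pow (H (G ∪ ⁅ i ⁆)) e ≈ 0#
      jump zero    le = contradiction (<-≤-trans ρG< le) λ ()
      jump (suc e) le = trans (sym (slide G i e G≢⊥)) (trans (*-congˡ (H-nilpotent r e (≤-pred (≤-trans ρG< le)))) (zeroʳ _))

    Smaller : List (Subset n) → List (Subset n) → Set
    Smaller m m′ = length m′ ≡ length m × weight m′ < weight m

    Reducible : List (Subset n) → Set
    Reducible m = Span κ (Smaller m) (product m)

    span-cons : ∀ S {Q Q′ x} → (∀ {m} → Q m → Q′ (S ∷ m)) → Span κ Q x → Span κ Q′ (H S * x)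
    span-cons S f (base q)    = base (f q)
    span-cons S f zero        = resp (sym (zeroʳ (H S))) zero
    span-cons S f (add s t)   = resp (sym (distribˡ (H S) _ _)) (add (span-cons S f s) (span-cons S f t))
    span-cons S f (neg s)     = resp (-‿distribʳ-* (H S) _) (neg (span-cons S f s))
    span-cons S f (scale c s) = resp (x*yz≈y*xz _ _ _) (scale c (span-cons S f s))
    span-cons S f (resp e s)  = resp (*-congˡ e) (span-cons S f s)

    reducible-cons : ∀ S m → Reducible m → Reducible (S ∷ m)
    reducible-cons S m = span-cons S (λ (l , w) → ≡.cong suc l , +-monoʳ-< (codim S) w)

    reducible-++ : ∀ m′ m → Reducible m → Reducible (m′ ++ m)
    reducible-++ []       m r = r
    reducible-++ (S ∷ m′) m r = reducible-cons S (m′ ++ m) (reducible-++ m′ m r)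

    reducible-↭ : ∀ {m m′} → m ↭ m′ → Reducible m′ → Reducible m
    reducible-↭ p r = resp (product-↭ (↭-sym p)) (span-bind (λ {m″} (l , w) → base {m = m″} (≡.trans l (≡.sym (↭-length p)) , <-≤-trans w (≤-reflexive (≡.sym (weight-↭ p))))) r)

    reducible-⊥ : ∀ m → Reducible (⊥ₛ ∷ m)
    reducible-⊥ m = resp (sym (trans (*-congʳ H-⊥) (zeroˡ _))) zero

    reducible-nonflat : ∀ S m → ¬ IsFlat S → Reducible (S ∷ m)
    reducible-nonflat S m ¬flat with FinP.any? (λ i → ¬? (i SubP.∈? S) ×-dec ¬? (ρ S <? ρ (S ∪ ⁅ i ⁆)))
    ... | no none = ⊥-elim (¬flat (λ i i∉ → decidable-stable (ρ S <? ρ (S ∪ ⁅ i ⁆)) (λ ¬lt → none (i , i∉ , ¬lt))))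
    ... | yes (i , i∉ , ¬lt) = resp (*-congʳ (sym (H-closed S i ρ≡)))
        (base {m = S ∪ ⁅ i ⁆ ∷ m} (≡.refl , +-monoˡ-< (weight m) (codim-< (SubP.p⊆p∪q ⁅ i ⁆) (λ e → i∉ (≡.subst (i ∈_) (≡.sym e) (i∈∪⁅i⁆ S i))))))
      where
      ρ≡ : ρ (S ∪ ⁅ i ⁆) ≡ ρ S
      ρ≡ = ≤-antisym (≮⇒≥ ¬lt) (ρ-mono {S} (SubP.p⊆p∪q ⁅ i ⁆))

    reducible-incomparable : ∀ S T m → ¬ S ⊆ T → ¬ T ⊆ S → Reducible (S ∷ T ∷ m)
    reducible-incomparable S T m S⊈T T⊈S = resp expand
        (add (add (base {m = S ∷ K ∷ m} (≡.refl , +-monoʳ-< (codim S) (+-monoˡ-< (weight m) T<)))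
                  (base {m = T ∷ K ∷ m} (≡.refl , ≤-trans (≤-reflexive (≡.cong suc (swap+ (codim T) (codim K) (weight m)))) (+-mono-<-≤ S< ≤-refl))))
             (neg (base {m = K ∷ K ∷ m} (≡.refl , +-mono-< S< (+-monoˡ-< (weight m) T<)))))
      where
      K = S ∪ T
      S< : codim K < codim S
      S< = codim-< (SubP.p⊆p∪q T) (λ e → T⊈S (≡.subst (T ⊆_) (≡.sym e) (SubP.q⊆p∪q S T)))
      T< : codim K < codim T
      T< = codim-< (SubP.q⊆p∪q S T) (λ e → S⊈T (≡.subst (S ⊆_) (≡.sym e) (SubP.p⊆p∪q T)))
      swap+ : ∀ a b c → a + (b + c) ≡ b + (a + c)
      swap+ a b c = ≡.trans (≡.sym (ℕP.+-assoc a b c)) (≡.trans (≡.cong (_+ c) (ℕP.+-comm a b)) (ℕP.+-assoc b a c))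
      x = product m
      expand : ((H S * (H K * x)) ⊹ (H T * (H K * x))) - (H K * (H K * x)) ≈ H S * (H T * x)
      expand = begin
        ((H S * (H K * x)) ⊹ (H T * (H K * x))) - (H K * (H K * x))
          ≈⟨ +-cong (+-cong (sym (*-assoc _ _ _)) (sym (*-assoc _ _ _))) (-‿cong (sym (*-assoc _ _ _))) ⟩
        ((H S * H K) * x ⊹ (H T * H K) * x) - (H K * H K) * x   ≈⟨ +-cong (sym (distribʳ x _ _)) (-‿distribˡ-* _ _) ⟩
        (H S * H K ⊹ H T * H K) * x ⊹ (- (H K * H K)) * x       ≈⟨ distribʳ x _ _ ⟨
        ((H S * H K ⊹ H T * H K) - H K * H K) * x               ≈⟨ *-congʳ (H-pair S T) ⟨
        (H S * H T) * x                                         ≈⟨ *-assoc _ _ _ ⟩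
        H S * (H T * x)                                         ∎
        where open import Algebra.Properties.Ring ring using (-‿distribˡ-*)

    -- If the exponent is too large for the gap, then either nothing lies below `F` and the power is
    -- zero, or one factor of the flat just below is turned into `F` by `H-lift`, which lowers the
    -- weight.
    extend : ∀ F a {D} → Std D → IsFlat F → top D ⊆ F → top D ≢ F → 1 ≤ a →
             Reducible (replicate a F ++ flatten D) ⊎ Std ((F , a) ∷ D)
    extend F a {D} s flat G⊆F G≢F 1≤a with suc (a + ρ (top D)) ≤? ρ F
    ... | yes lt = inj₂ (cons flat G⊆F 1≤a lt s)
    ... | no ¬lt = inj₁ (collapse D s G⊆F G≢F (≮⇒≥ ¬lt))
      where
      collapse : ∀ D → Std D → top D ⊆ F → top D ≢ F → ρ F ≤ a + ρ (top D) → Reducible (replicate a F ++ flatten D)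
      collapse [] s _ ⊥≢F le with SubP.nonempty? F
      ... | no empty = ⊥-elim (⊥≢F (≡.sym (SubP.Empty-unique empty)))
      ... | yes (i , i∈F) = resp (sym (trans (product-run a F []) (trans (*-congʳ (H-nilpotent (reach (⁅⁆-⊆ i∈F)) a
              (≤-trans le (≤-reflexive (≡.trans (≡.cong (a +_) ρ-⊥) (ℕP.+-identityʳ a)))))) (zeroˡ _)))) zero
      collapse ((G , zero) ∷ E) (cons _ _ () _ _) _ _ _
      collapse ((G , suc b) ∷ E) (cons _ _ _ lt _) G⊆F G≢F le = resp eq (base {m = replicate (suc a) F ++ rest} (len , wt))
        where
        rest = replicate b G ++ flatten E
        G≢⊥ : G ≢ ⊥ₛ
        G≢⊥ e = contradiction (<-≤-trans lt (≤-reflexive (≡.trans (≡.cong ρ e) ρ-⊥))) λ ()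
        eq : product (replicate (suc a) F ++ rest) ≈ product (replicate a F ++ G ∷ rest)
        eq = begin
          product (replicate (suc a) F ++ rest)         ≈⟨ product-run (suc a) F rest ⟩
          pow (H F) (suc a) * product rest              ≈⟨ *-congʳ (H-lift (reach G⊆F) G≢⊥ a le) ⟨
          (H G * pow (H F) a) * product rest            ≈⟨ trans (*-congʳ (*-comm _ _)) (*-assoc _ _ _) ⟩
          pow (H F) a * product (G ∷ rest)              ≈⟨ product-run a F (G ∷ rest) ⟨
          product (replicate a F ++ G ∷ rest)           ∎
        perm : replicate a F ++ G ∷ rest ↭ G ∷ replicate a F ++ rest
        perm = shift G (replicate a F) rest
        len : length (replicate (suc a) F ++ rest) ≡ length (replicate a F ++ G ∷ rest)
        len = ≡.sym (↭-length perm)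
        wt : weight (replicate (suc a) F ++ rest) < weight (replicate a F ++ G ∷ rest)
        wt = <-≤-trans (+-monoˡ-< (weight (replicate a F ++ rest)) (codim-< G⊆F G≢F)) (≤-reflexive (≡.sym (weight-↭ perm)))

    std-strict : ∀ {F a C} → Std ((F , a) ∷ C) → top C ≢ F
    std-strict {a = a} (cons _ _ _ lt _) ≡.refl = <-irrefl ≡.refl (≤-<-trans (m≤n+m _ a) lt)

    -- The last component records the new top, so that the flats above the place of insertion can be
    -- put back. Their gap may have shrunk in the meantime, which is why `extend` is applied again
    -- on the way up.
    insert : ∀ S {C} → IsFlat S → S ≢ ⊥ₛ → Std C →
             Reducible (S ∷ flatten C) ⊎ (∃ λ C′ → Std C′ × (S ∷ flatten C ↭ flatten C′) × (top C′ ≡ S ⊎ top C′ ≡ top C))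
    insert S {[]} flat S≢⊥ [] with extend S 1 [] flat SubP.⊥⊆ (λ e → S≢⊥ (≡.sym e)) ≤-refl
    ... | inj₁ r = inj₁ r
    ... | inj₂ s = inj₂ (_ , s , ↭-refl , inj₁ ≡.refl)
    insert S {(F , a) ∷ D} flat S≢⊥ std@(cons Fflat G⊆F 1≤a lt s) with S ≟ₛ F | F SubP.⊆? S | S SubP.⊆? F
    ... | yes ≡.refl | _ | _ with extend F (suc a) s flat G⊆F (std-strict std) (s≤s z≤n)
    ...   | inj₁ r = inj₁ r
    ...   | inj₂ s′ = inj₂ (_ , s′ , ↭-refl , inj₁ ≡.refl)
    insert S {(F , a) ∷ D} flat S≢⊥ std@(cons Fflat G⊆F 1≤a lt s) | no S≢F | yes F⊆S | _ with extend S 1 std flat F⊆S (λ e → S≢F (≡.sym e)) ≤-refl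
    ...   | inj₁ r = inj₁ r
    ...   | inj₂ s′ = inj₂ (_ , s′ , ↭-refl , inj₁ ≡.refl)
    insert S {(F , a) ∷ D} flat S≢⊥ std@(cons Fflat G⊆F 1≤a lt s) | no S≢F | no F⊈S | no S⊈F = inj₁ (incomparable a 1≤a)
      where
      incomparable : ∀ a → 1 ≤ a → Reducible (S ∷ replicate a F ++ flatten D)
      incomparable (suc b) _ = reducible-incomparable S F (replicate b F ++ flatten D) S⊈F F⊈S
    insert S {(F , a) ∷ D} flat S≢⊥ std@(cons Fflat G⊆F 1≤a lt s) | no S≢F | no F⊈S | yes S⊆F with insert S flat S≢⊥ s
    ...   | inj₁ r = inj₁ (reducible-↭ (↭-sym (shift S (replicate a F) (flatten D))) (reducible-++ (replicate a F) (S ∷ flatten D) r))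
    ...   | inj₂ (D′ , s′ , p , t) with extend F a s′ Fflat (top⊆ t) (top≢ t) 1≤a
      where
      top⊆ : top D′ ≡ S ⊎ top D′ ≡ top D → top D′ ⊆ F
      top⊆ (inj₁ e) = ≡.subst (_⊆ F) (≡.sym e) S⊆F
      top⊆ (inj₂ e) = ≡.subst (_⊆ F) (≡.sym e) G⊆F
      top≢ : top D′ ≡ S ⊎ top D′ ≡ top D → top D′ ≢ F
      top≢ (inj₁ e) e′ = S≢F (≡.trans (≡.sym e) e′)
      top≢ (inj₂ e) e′ = std-strict std (≡.trans (≡.sym e) e′)
    ...     | inj₁ r = inj₁ (reducible-↭ (perm p) r)
      where
      perm : S ∷ flatten D ↭ flatten D′ → S ∷ replicate a F ++ flatten D ↭ replicate a F ++ flatten D′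
      perm p = ↭-trans (↭-sym (shift S (replicate a F) (flatten D))) (++⁺ˡ (replicate a F) p)
    ...     | inj₂ s″ = inj₂ (_ , s″ , ↭-trans (↭-sym (shift S (replicate a F) (flatten D))) (++⁺ˡ (replicate a F) p) , inj₂ ≡.refl)

    sort : ∀ m → Reducible m ⊎ (∃ λ C → Std C × m ↭ flatten C)
    sort [] = inj₂ ([] , [] , ↭-refl)
    sort (S ∷ m) with isFlat? S | S ≟ₛ ⊥ₛ | sort m
    ... | no ¬flat | _          | _      = inj₁ (reducible-nonflat S m ¬flat)
    ... | yes _    | yes ≡.refl | _      = inj₁ (reducible-⊥ m)
    ... | yes _    | no _       | inj₁ r = inj₁ (reducible-cons S m r)
    ... | yes flat | no S≢⊥     | inj₂ (C , s , p) with insert S flat S≢⊥ s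
    ...   | inj₁ r                  = inj₁ (reducible-↭ (prep S p) r)
    ...   | inj₂ (C′ , s′ , p′ , _) = inj₂ (C′ , s′ , ↭-trans (prep S p) p′)

    StandardOfDegree : ℕ → List (Subset n) → Set
    StandardOfDegree d m = ∃ λ C → Std C × total C ≡ d × m ≡ flatten C

    straighten : ∀ m → Span κ (StandardOfDegree (length m)) (product m)
    straighten m = go m (<-wellFounded _)
      where
      go : ∀ m → Acc _<_ (weight m) → Span κ (StandardOfDegree (length m)) (product m)
      go m (acc rec) with sort m
      ... | inj₁ r = span-bind (λ {m′} (l , w) → ≡.subst (λ d → Span κ (StandardOfDegree d) (product m′)) l (go m′ (rec w))) r
      ... | inj₂ (C , s , p) = resp (product-↭ (↭-sym p)) (base (C , s , ≡.trans (≡.sym (total-length C)) (≡.sym (↭-length p)) , ≡.refl))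

-- Enumeration of the standard chains

module ChainEnumeration where

  open import Defs using (allSubsets)
  open ChainFunctionals
  open StandardChains
  open Evaluation using (∈-allSubsets)
  open import Data.Bool using (Bool; true; false; _∧_; T; if_then_else_)
  open import Data.Fin.Subset using (Subset; _⊆_)
  import Data.Fin.Subset.Properties as SubP
  open import Data.Nat using (ℕ; zero; suc; _+_; _∸_; _≤_; _<_; z≤n; s≤s; _≤ᵇ_; _≡ᵇ_)
  open import Data.Nat.Properties
  open import Data.List using (List; []; _∷_; map; concatMap; filterᵇ; upTo)
  open import Data.List.Membership.Propositional using (_∈_; find; lose)
  open import Data.List.Membership.Propositional.Properties using (∈-map⁺; ∈-map⁻; ∈-upTo⁺; ∈-upTo⁻; ∈-filter⁺; ∈-filter⁻; ∈-concatMap⁺; ∈-concatMap⁻)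
  open import Data.List.Relation.Unary.Any using (here)
  open import Data.List.Relation.Unary.All as All using (All; []; _∷_)
  open import Data.List.Relation.Unary.AllPairs using (AllPairs; []; _∷_)
  open import Data.List.Relation.Unary.Unique.Propositional using (Unique)
  open import Data.List.Relation.Binary.Disjoint.Propositional using (Disjoint)
  import Data.List.Relation.Unary.Unique.Propositional.Properties as UniqueP
  open import Data.Product using (∃; _×_; _,_; proj₁; proj₂)
  open import Data.Vec using ([]; _∷_)
  open import Function using (_∘_)
  open import Relation.Nullary using (¬_; Dec; yes; no; does; contradiction)
  open import Relation.Nullary.Decidable using (dec-true; T?)
  open import Relation.Binary.PropositionalEquality

  ∈-filterᵇ⁺ : ∀ {A : Set} (b : A → Bool) {x xs} → x ∈ xs → b x ≡ true → x ∈ filterᵇ b xs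
  ∈-filterᵇ⁺ b {x} x∈ e = ∈-filter⁺ (T? ∘ b) x∈ (subst T (sym e) _)

  ∈-filterᵇ⁻ : ∀ {A : Set} (b : A → Bool) {x} xs → x ∈ filterᵇ b xs → x ∈ xs × b x ≡ true
  ∈-filterᵇ⁻ b {x} xs x∈ with ∈-filter⁻ (T? ∘ b) {xs = xs} x∈
  ... | x∈xs , t = x∈xs , T⇒≡ (b x) t
    where
    T⇒≡ : ∀ b → T b → b ≡ true
    T⇒≡ true _ = refl

  does⇒ : ∀ {P : Set} (d : Dec P) → does d ≡ true → P
  does⇒ (yes p) _ = p

  unique-concatMap : ∀ {A B : Set} (g : A → List B) {xs} → Unique xs → (∀ x → Unique (g x)) →
                     (∀ {x x′ y} → y ∈ g x → y ∈ g x′ → x ≡ x′) → Unique (concatMap g xs)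
  unique-concatMap g {xs} u ug disj = UniqueP.concat⁺ (All.tabulate (λ {ys} ys∈ → uni ys∈)) (pairs u)
    where
    uni : ∀ {ys} → ys ∈ map g xs → Unique ys
    uni ys∈ with ∈-map⁻ g ys∈
    ... | x , _ , refl = ug x
    pairs : ∀ {xs} → Unique xs → AllPairs Disjoint (map g xs)
    pairs []       = []
    pairs (ne ∷ u) = All.tabulate (λ {ys} ys∈ {v} (y∈ , y∈′) → apart ne ys∈ y∈ y∈′) ∷ pairs u
      where
      apart : ∀ {x xs ys y} → All (x ≢_) xs → ys ∈ map g xs → y ∈ g x → ¬ y ∈ ys
      apart ne ys∈ y∈ y∈′ with ∈-map⁻ g ys∈
      ... | x′ , x′∈ , refl = All.lookup ne x′∈ (disj y∈ y∈′)

  unique-allSubsets : ∀ n → Unique (allSubsets n)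
  unique-allSubsets zero    = [] ∷ []
  unique-allSubsets (suc n) = UniqueP.++⁺ (UniqueP.map⁺ (λ { refl → refl }) (unique-allSubsets n)) (UniqueP.map⁺ (λ { refl → refl }) (unique-allSubsets n)) disj
    where
    disj : ∀ {S} → ¬ (S ∈ map (true ∷_) (allSubsets n) × S ∈ map (false ∷_) (allSubsets n))
    disj (p , q) with ∈-map⁻ (true ∷_) p | ∈-map⁻ (false ∷_) q
    ... | _ , _ , refl | _ , _ , ()

  module Enumeration {n : ℕ} (M : Polymatroid n) where
    open Polymatroid M
    open Standard M

    flatᵇ : Subset n → Bool
    flatᵇ F = does (isFlat? F)

    -- Exponents minus one: the exponent itself is `suc a`, with `suc a < ρ F - ρ G`. The filter
    -- `suc a ≤ d` keeps the remaining degree `d ∸ suc a` from being truncated.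
    exponents : ℕ → Subset n → Subset n → List ℕ
    exponents d G F = filterᵇ (λ a → suc a ≤ᵇ d) (upTo (ρ F ∸ suc (ρ G)))

    flatsBelow : Subset n → List (Subset n)
    flatsBelow F = filterᵇ (λ G → flatᵇ G ∧ does (G SubP.⊆? F)) (allSubsets n)

    -- The first argument bounds the recursion; any value ≥ d does.
    chainsTo : ℕ → ℕ → Subset n → List (Chain {n})
    extensions : ℕ → ℕ → Subset n → List (Chain {n})

    chainsTo f d F = if does (F ≟ₛ ⊥ₛ) then (if d ≡ᵇ 0 then [] ∷ [] else []) else extensions f d F
    extensions zero    d F = []
    extensions (suc f) d F = concatMap (λ G → concatMap (λ a → map ((F , suc a) ∷_) (chainsTo f (d ∸ suc a) G)) (exponents d G F)) (flatsBelow F)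

    standardChains : ℕ → List (Chain {n})
    standardChains d = concatMap (chainsTo d d) (filterᵇ flatᵇ (allSubsets n))

    -- Flatness of `F` is an assumption of `std` because `chainsTo` tests only the flats below `F`;
    -- the outermost flat is tested in `standardChains`.
    record Sound (F : Subset n) (d : ℕ) (C : Chain {n}) : Set where
      field
        std   : IsFlat F → Std C
        top≡  : top C ≡ F
        deg≡  : total C ≡ d

    open Sound

    chainsTo-sound : ∀ f d F {C} → C ∈ chainsTo f d F → Sound F d C
    extensions-sound : ∀ f d F {C} → C ∈ extensions f d F → Sound F d C

    chainsTo-sound f d F C∈ with F ≟ₛ ⊥ₛ
    chainsTo-sound f zero F (here refl) | yes refl = record { std = λ _ → [] ; top≡ = refl ; deg≡ = refl }
    chainsTo-sound f (suc d) F () | yes refl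
    ... | no _ = extensions-sound f d F C∈

    private
      unpack : ∀ f d F {C} → C ∈ extensions (suc f) d F →
        ∃ λ G → ∃ λ a → ∃ λ D → (G ∈ flatsBelow F) × (a ∈ exponents d G F) × (D ∈ chainsTo f (d ∸ suc a) G) × C ≡ (F , suc a) ∷ D
      unpack f d F C∈ with find (∈-concatMap⁻ (λ G → concatMap (λ a → map ((F , suc a) ∷_) (chainsTo f (d ∸ suc a) G)) (exponents d G F)) {xs = flatsBelow F} C∈)
      ... | G , G∈ , C∈G with find (∈-concatMap⁻ (λ a → map ((F , suc a) ∷_) (chainsTo f (d ∸ suc a) G)) {xs = exponents d G F} C∈G)
      ...   | a , a∈ , C∈a with ∈-map⁻ ((F , suc a) ∷_) C∈a
      ...     | D , D∈ , e = G , a , D , G∈ , a∈ , D∈ , e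

    ∧-true : ∀ {a b} → a ∧ b ≡ true → a ≡ true × b ≡ true
    ∧-true {true} {true} e = refl , refl

    extensions-sound (suc f) d F C∈ with unpack f d F C∈
    ... | G , a , D , G∈ , a∈ , D∈ , refl = record
      { std  = λ flat → cons flat (subst (_⊆ F) (sym (top≡ ih)) G⊆F) (s≤s z≤n) (subst (λ X → suc a + ρ X < ρ F) (sym (top≡ ih)) lt) (std ih Gflat)
      ; top≡ = refl
      ; deg≡ = trans (cong (suc a +_) (deg≡ ih)) (m+[n∸m]≡n le) }
      where
      ih = chainsTo-sound f (d ∸ suc a) G D∈
      G-props = ∧-true (proj₂ (∈-filterᵇ⁻ (λ G → flatᵇ G ∧ does (G SubP.⊆? F)) (allSubsets n) G∈))
      Gflat = does⇒ (isFlat? G) (proj₁ G-props)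
      G⊆F : G ⊆ F
      G⊆F = does⇒ (G SubP.⊆? F) (proj₂ G-props)
      a-props = ∈-filterᵇ⁻ (λ a → suc a ≤ᵇ d) (upTo (ρ F ∸ suc (ρ G))) a∈
      le : suc a ≤ d
      le = ≤ᵇ⇒≤ (suc a) d (subst T (sym (proj₂ a-props)) _)
      lt : suc a + ρ G < ρ F
      lt = subst (_≤ ρ F) (cong suc (+-suc a (ρ G))) (m≤o∸n⇒m+n≤o (suc a) (<⇒≤ (m∸n≢0⇒n<m (λ e → contradiction (subst (a <_) e a<) λ ()))) a<)
        where a< = ∈-upTo⁻ (proj₁ a-props)

    chainsTo-complete : ∀ f {C} → Std C → total C ≤ f → C ∈ chainsTo f (total C) (top C)
    chainsTo-complete f [] le with does (⊥ₛ {n} ≟ₛ ⊥ₛ) | dec-true (⊥ₛ {n} ≟ₛ ⊥ₛ) refl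
    ... | .true | refl = here refl
    chainsTo-complete f {(F , a) ∷ D} std@(cons _ _ _ lt _) le with F ≟ₛ ⊥ₛ
    ... | yes refl = contradiction (<-≤-trans lt (≤-reflexive ρ-⊥)) λ ()
    chainsTo-complete zero {(F , suc a) ∷ D} std le | no _ = contradiction le λ ()
    chainsTo-complete f {(F , zero) ∷ D} (cons _ _ () _ _) le | no _
    chainsTo-complete (suc f) {(F , suc a) ∷ D} (cons flat G⊆F _ lt s) (s≤s le) | no _ =
      ∈-concatMap⁺ (λ G → concatMap (λ a → map ((F , suc a) ∷_) (chainsTo f (d ∸ suc a) G)) (exponents d G F)) (lose G∈
        (∈-concatMap⁺ (λ a → map ((F , suc a) ∷_) (chainsTo f (d ∸ suc a) (top D))) (lose a∈ (∈-map⁺ ((F , suc a) ∷_)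
          (subst (λ e → D ∈ chainsTo f e (top D)) (sym (m+n∸m≡n (suc a) (total D))) (chainsTo-complete f s (≤-trans (m≤n+m (total D) a) le)))))))
      where
      d = suc a + total D
      G∈ : top D ∈ flatsBelow F
      G∈ = ∈-filterᵇ⁺ (λ G → flatᵇ G ∧ does (G SubP.⊆? F)) (∈-allSubsets (top D))
        (cong₂ _∧_ (dec-true (isFlat? (top D)) (flag-top (std-flag s))) (dec-true (top D SubP.⊆? F) G⊆F))
      a∈ : a ∈ exponents d (top D) F
      a∈ = ∈-filterᵇ⁺ (λ a → suc a ≤ᵇ d) (∈-upTo⁺ (m+n≤o⇒m≤o∸n (suc a) (subst (_≤ ρ F) (cong suc (sym (+-suc a (ρ (top D))))) lt)))
        (T⇒≡ (≤⇒≤ᵇ (m≤m+n (suc a) (total D))))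
        where
        T⇒≡ : ∀ {b} → T b → b ≡ true
        T⇒≡ {true} _ = refl

    chainsTo-unique : ∀ f d F → Unique (chainsTo f d F)
    extensions-unique : ∀ f d F → Unique (extensions f d F)
    chainsTo-unique f d F with does (F ≟ₛ ⊥ₛ)
    chainsTo-unique f zero    F | true = [] ∷ []
    chainsTo-unique f (suc d) F | true = []
    ... | false = extensions-unique f d F
    extensions-unique zero    d F = []
    extensions-unique (suc f) d F = unique-concatMap _ (UniqueP.filter⁺ _ (unique-allSubsets n))
      (λ G → unique-concatMap _ (UniqueP.filter⁺ _ (UniqueP.upTo⁺ (ρ F ∸ suc (ρ G)))) (λ a → UniqueP.map⁺ (λ { refl → refl }) (chainsTo-unique f (d ∸ suc a) G)) (same-a {G}))
      same-G
      where
      inner : Subset n → ℕ → List (Chain {n})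
      inner G a = map ((F , suc a) ∷_) (chainsTo f (d ∸ suc a) G)
      same-a : ∀ {G a a′ C} → C ∈ inner G a → C ∈ inner G a′ → a ≡ a′
      same-a {G} {a} {a′} p q with ∈-map⁻ ((F , suc a) ∷_) p | ∈-map⁻ ((F , suc a′) ∷_) q
      ... | D , _ , refl | D′ , _ , refl = refl
      same-G : ∀ {G G′ C} → C ∈ concatMap (inner G) (exponents d G F) → C ∈ concatMap (inner G′) (exponents d G′ F) → G ≡ G′
      same-G {G} {G′} p q with find (∈-concatMap⁻ (inner G) {xs = exponents d G F} p) | find (∈-concatMap⁻ (inner G′) {xs = exponents d G′ F} q)
      ... | a , _ , p′ | a′ , _ , q′ with ∈-map⁻ ((F , suc a) ∷_) p′ | ∈-map⁻ ((F , suc a′) ∷_) q′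
      ...   | D , D∈ , refl | .D , D∈′ , refl = trans (sym (top≡ (chainsTo-sound f _ G D∈))) (top≡ (chainsTo-sound f _ G′ D∈′))

    standardChains-sound : ∀ d {C} → C ∈ standardChains d → Std C × total C ≡ d
    standardChains-sound d C∈ with find (∈-concatMap⁻ (chainsTo d d) {xs = filterᵇ flatᵇ (allSubsets n)} C∈)
    ... | F , F∈ , C∈F = std s (does⇒ (isFlat? F) (proj₂ (∈-filterᵇ⁻ flatᵇ (allSubsets n) F∈))) , deg≡ s
      where s = chainsTo-sound d d F C∈F

    standardChains-complete : ∀ {C} → Std C → C ∈ standardChains (total C)
    standardChains-complete {C} s = ∈-concatMap⁺ (chainsTo (total C) (total C))
      (lose (∈-filterᵇ⁺ flatᵇ (∈-allSubsets (top C)) (dec-true (isFlat? (top C)) (flag-top (std-flag s)))) (chainsTo-complete (total C) s ≤-refl))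

    standardChains-unique : ∀ d → Unique (standardChains d)
    standardChains-unique d = unique-concatMap (chainsTo d d) (UniqueP.filter⁺ _ (unique-allSubsets n)) (chainsTo-unique d d)
      (λ {F} {F′} p q → trans (sym (top≡ (chainsTo-sound d d F p))) (top≡ (chainsTo-sound d d F′ q)))

-- From functionals and straightening to the Hilbert series

module Realizations where

  open import Defs
  open PolyRing
  open HilbertCoefficients
  open ChainFunctionals hiding (add)
  open StandardChains
  open Evaluation
  open Straightenings
  open ChainEnumeration
  open import Algebra.Bundles using (CommutativeRing)
  open import Data.Bool using (true; false; if_then_else_; T)
  open import Data.Fin as Fin using (Fin; zero; suc)
  open import Data.Fin.Subset using (Subset)
  open import Data.Nat using (ℕ; zero; suc; _+_; _≡ᵇ_)
  import Data.Nat.Properties as ℕP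
  open import Data.List as List using (List; []; _∷_; _++_; length; filterᵇ)
  open import Data.List.Properties using (length-++)
  open import Data.List.Membership.Propositional using (_∈_)
  open import Data.List.Relation.Unary.Any using (index)
  open import Data.List.Relation.Unary.Any.Properties using (lookup-index)
  open import Data.List.Relation.Unary.All as All using (All; []; _∷_)
  import Data.List.Relation.Unary.All.Properties as AllP
  open import Data.Rational as ℚ using (ℚ; 0ℚ; 1ℚ)
  import Data.Rational.Properties as ℚP
  open import Data.Product using (∃; _×_; _,_; proj₁; proj₂)
  open import Data.Vec as Vec using (Vec; []; _∷_; lookup; tabulate)
  import Data.Vec.Properties as VecP
  open import Relation.Nullary using (Dec; yes; no; does; contradiction)
  open import Relation.Nullary.Decidable using (dec-true; dec-false; decidable-stable)
  open import Relation.Binary.PropositionalEquality hiding (resp)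
  open import Algebra.Properties.Semiring.Sum (CommutativeRing.semiring ℚP.+-*-commutativeRing)
    using (sum; sum-cong-≗; ∑-distrib-+; *-distribˡ-sum)

  module _ {N : ℕ} where

    -- Homogeneity of the list of terms, stronger than `Homogeneous`, which permits terms of other
    -- degrees that cancel. `restrict` leads from the latter to the former.
    OfDegree : ℕ → Poly N → Set
    OfDegree d = All (λ t → Vec.sum (proj₂ t) ≡ d)

    sum-+ᵐ : ∀ {N} (μ ν : Mono N) → Vec.sum (μ +ᵐ ν) ≡ Vec.sum μ + Vec.sum ν
    sum-+ᵐ []      []      = refl
    sum-+ᵐ (a ∷ μ) (b ∷ ν) = trans (cong (a + b +_) (sum-+ᵐ μ ν)) (interchange a b (Vec.sum μ) (Vec.sum ν))
      where open import Algebra.Properties.CommutativeSemigroup ℕP.+-commutativeSemigroup using (interchange)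

    ofDegree-* : ∀ {d e} {p q : Poly N} → OfDegree d p → OfDegree e q → OfDegree (d + e) (p *ᵖ q)
    ofDegree-* []       hq = []
    ofDegree-* {d} {e} {(c , μ) ∷ p} {q} (h ∷ hp) hq = AllP.++⁺ (AllP.map⁺ (All.map (λ {t} h′ → trans (sum-+ᵐ μ (proj₂ t)) (cong₂ _+_ h h′)) hq)) (ofDegree-* hp hq)

    ofDegree-scale : ∀ {d} c {p : Poly N} → OfDegree d p → OfDegree d (scaleᵖ c p)
    ofDegree-scale c h = AllP.map⁺ h

    coeff-outside : ∀ {d} (p : Poly N) → OfDegree d p → ∀ μ → Vec.sum μ ≢ d → coeff p μ ≡ 0ℚ
    coeff-outside []            []      μ ne = refl
    coeff-outside ((c , ν) ∷ p) (h ∷ hp) μ ne with ν ≟ᵐ μ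
    ... | yes refl = contradiction h ne
    ... | no _     = coeff-outside p hp μ ne

    ofDegree⇒homogeneous : ∀ {d} (p : Poly N) → OfDegree d p → Homogeneous d p
    ofDegree⇒homogeneous {d} p h μ ne = decidable-stable (Vec.sum μ ℕP.≟ d) (λ ≢d → ne (coeff-outside p h μ ≢d))

    restrict : ℕ → Poly N → Poly N
    restrict d = filterᵇ (λ t → Vec.sum (proj₂ t) ≡ᵇ d)

    restrict-ofDegree : ∀ d p → OfDegree d (restrict d p)
    restrict-ofDegree d p = All.tabulate (λ {t} t∈ → ℕP.≡ᵇ⇒≡ _ d (subst T (sym (proj₂ (∈-filterᵇ⁻ (λ t → Vec.sum (proj₂ t) ≡ᵇ d) p t∈))) _))

    restrict-≈ : ∀ d p → Homogeneous d p → p ≈ᵖ restrict d p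
    restrict-≈ d p hom = coeff⇒≈ λ μ → go μ (Vec.sum μ ℕP.≟ d)
      where
      same : ∀ p μ → Vec.sum μ ≡ d → coeff p μ ≡ coeff (restrict d p) μ
      same []            μ e = refl
      same ((c , ν) ∷ p) μ e with ν ≟ᵐ μ | Vec.sum ν ≡ᵇ d in eq
      ... | yes refl | false = contradiction (subst T eq (ℕP.≡⇒≡ᵇ (Vec.sum ν) d e)) λ ()
      ... | yes refl | true  = trans (cong (c ℚ.+_) (same p ν e)) (sym (cong (λ b → if b then c ℚ.+ coeff (restrict d p) ν else coeff (restrict d p) ν) (dec-true (ν ≟ᵐ ν) refl)))
      ... | no _     | false = same p μ e
      ... | no ne    | true  = trans (same p μ e) (sym (cong (λ b → if b then c ℚ.+ coeff (restrict d p) μ else coeff (restrict d p) μ) (dec-false (ν ≟ᵐ μ) ne)))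
      go : ∀ μ → Dec (Vec.sum μ ≡ d) → coeff p μ ≡ coeff (restrict d p) μ
      go μ (yes e) = same p μ e
      go μ (no ne) = trans (decidable-stable (coeff p μ ℚP.≟ 0ℚ) (λ c≢0 → ne (hom μ c≢0))) (sym (coeff-outside _ (restrict-ofDegree d p) μ ne))

  unitᵐ : ∀ {N} → Fin N → Mono N
  unitᵐ i = tabulate (λ j → if does (i Fin.≟ j) then 1 else 0)

  split-monomial : ∀ {N d} (μ : Mono N) → Vec.sum μ ≡ suc d → ∃ λ i → ∃ λ μ′ → μ ≡ unitᵐ i +ᵐ μ′ × Vec.sum μ′ ≡ d
  split-monomial (zero ∷ μ)  e with split-monomial μ e
  ... | i , μ′ , eq , e′ = suc i , zero ∷ μ′ , cong (zero ∷_) eq , e′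
  split-monomial (suc a ∷ μ) e = zero , a ∷ μ , cong (suc a ∷_) (sym (zeros μ)) , ℕP.suc-injective e
    where
    zeros : ∀ {N} (μ : Mono N) → tabulate (λ _ → 0) +ᵐ μ ≡ μ
    zeros []      = refl
    zeros (a ∷ μ) = cong (a ∷_) (zeros μ)

  sum≡0 : ∀ {N} (μ : Mono N) → Vec.sum μ ≡ 0 → μ ≡ 0ᵐ
  sum≡0 []         e = refl
  sum≡0 (zero ∷ μ) e = cong (zero ∷_) (sum≡0 μ e)

  -- What a presentation has to provide: a substitution under which dual functionals kill its
  -- generators, for independence, and elements `H S` that satisfy the relations and express every
  -- variable linearly, for spanning.
  module Realization {n : ℕ} (M : Polymatroid n) (P : Presentation)
    (L : Fin (Presentation.nvars P) → LinearForm n) (H : Subset n → Poly (Presentation.nvars P))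
    (L-gens : ∀ {g} → g ∈ Presentation.gens P → ∀ {φ} → Standard.Dual M φ → act L g φ [] ≡ 0ℚ)
    (L-H : ∀ S {φ} → Standard.Dual M φ → ∀ m → act L (H S) φ m ≡ φ (S ∷ m))
    (H-degree : ∀ S → OfDegree 1 (H S))
    (relations : Product.Relations (Ideal.quotientRing P) H M)
    (H-vars : ∀ i → Product.Span (Ideal.quotientRing P) H (λ c → (c , 0ᵐ) ∷ []) (λ m → length m ≡ 1) (var i))
    where

    open Presentation P
    open Ideal P
    open Standard M
    open Enumeration M
    open Independence M
    open Lower P L H L-gens L-H
    open Product quotientRing H
    private
      κ : ℚ → Poly nvars
      κ c = (c , 0ᵐ) ∷ []
      module R = CommutativeRing quotientRing
      module Rᵖ = CommutativeRing (polyRing {nvars})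
    open Straightening M quotientRing H κ relations

    monomial≡product : ∀ m → monomial m ≡ product m
    monomial≡product []      = refl
    monomial≡product (S ∷ m) = cong (H S *ᵖ_) (monomial≡product m)

    monomial-degree : ∀ m → OfDegree (length m) (monomial m)
    monomial-degree []      = zeros nvars ∷ []
      where
      zeros : ∀ N → Vec.sum (Vec.replicate N 0) ≡ 0
      zeros zero    = refl
      zeros (suc N) = zeros N
    monomial-degree (S ∷ m) = ofDegree-* (H-degree S) (monomial-degree m)

    span-* : ∀ {Q Q′ Q″ x y} → (∀ {m m′} → Q m → Q′ m′ → Q″ (m ++ m′)) → Span κ Q x → Span κ Q′ y → Span κ Q″ (x *ᵖ y)
    span-* {Q} {Q′} {Q″} {y = y} f (base {m} q) t = go m (λ q′ → f q q′) t
      where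
      go : ∀ {Q″} m {y} → (∀ {m′} → Q′ m′ → Q″ (m ++ m′)) → Span κ Q′ y → Span κ Q″ (product m *ᵖ y)
      go []      {y} f t = resp (R.sym (R.*-identityˡ y)) (span-bind (λ q → base (f q)) t)
      go (S ∷ m) {y} f t = resp (R.sym (R.*-assoc (H S) (product m) y)) (span-cons S {λ m″ → ∃ λ m′ → Q′ m′ × m″ ≡ m ++ m′} (λ { (m′ , q , refl) → f q }) (go m (λ q → _ , q , refl) t))
    span-* {y = y} f zero        t = resp (R.sym (R.zeroˡ y)) zero
    span-* {y = y} f (add {x} {x′} s s′) t = resp (R.sym (R.distribʳ y x x′)) (add (span-* f s t) (span-* f s′ t))
    span-* {y = y} f (neg {x} s) t = resp (-‿distribˡ-* x y) (neg (span-* f s t))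
      where open import Algebra.Properties.Ring R.ring using (-‿distribˡ-*)
    span-* {y = y} f (scale c {x} s) t = resp (R.sym (R.*-assoc (κ c) x y)) (scale c (span-* f s t))
    span-* {y = y} f (resp e s)  t = resp (R.*-congʳ {y} e) (span-* f s t)

    term-span : ∀ d μ → Vec.sum μ ≡ d → Span κ (λ m → length m ≡ d) ((1ℚ , μ) ∷ [])
    term-span zero    μ e = subst (λ ν → Span κ (λ m → length m ≡ 0) ((1ℚ , ν) ∷ [])) (sym (sum≡0 μ e)) (base {m = []} refl)
    term-span (suc d) μ e with split-monomial μ e
    ... | i , μ′ , refl , e′ = span-* (λ {m} {m′} q q′ → trans (length-++ m) (cong₂ _+_ q q′)) (H-vars i) (term-span d μ′ e′)

    poly-span : ∀ d p → OfDegree d p → Span κ (λ m → length m ≡ d) p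
    poly-span d []            []       = zero
    poly-span d ((c , μ) ∷ p) (h ∷ hp) = add {x = (c , μ) ∷ []} (resp (≈⇒∼ eq) (scale c (term-span d μ h))) (poly-span d p hp)
      where
      eq : κ c *ᵖ ((1ℚ , μ) ∷ []) ≈ᵖ (c , μ) ∷ []
      eq = mk≈ λ f → trans (sym (pairing (scale-as-* c ((1ℚ , μ) ∷ [])) f)) (cong (λ x → x ℚ.* f μ ℚ.+ 0ℚ) (ℚP.*-identityʳ c))

    module Degree (d : ℕ) where
      Cs = standardChains d
      us = basis Cs (λ C∈ → proj₁ (standardChains-sound d C∈)) (λ C∈ → proj₂ (standardChains-sound d C∈)) (standardChains-unique d)

      lookup-us : ∀ j → lookup us j ≡ monomial (flatten (List.lookup Cs j))
      lookup-us = lookup-basis Cs (λ C∈ → proj₁ (standardChains-sound d C∈)) (λ C∈ → proj₂ (standardChains-sound d C∈)) (standardChains-unique d)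

      r = length Cs

      LC : Poly nvars → Set
      LC x = ∃ λ (cs : Vec ℚ r) → x ∼ linComb P cs us

      lc-≈ : ∀ {p} (cs : Vec ℚ r) → (∀ f → ⟪ p , f ⟫ ≡ sum (λ j → lookup cs j ℚ.* ⟪ lookup us j , f ⟫)) → p ≈ᵖ linComb P cs us
      lc-≈ cs e = mk≈ λ f → trans (e f) (sym (⟪linComb⟫ cs us f))

      lc-0 : LC []
      lc-0 = Vec.replicate r 0ℚ , ≈⇒∼ (lc-≈ (Vec.replicate r 0ℚ) (λ f → sym (sum-0 (λ j → trans (cong (ℚ._* ⟪ lookup us j , f ⟫) (VecP.lookup-replicate j 0ℚ)) (ℚP.*-zeroˡ ⟪ lookup us j , f ⟫)))))

      lc-+ : ∀ {x y} → LC x → LC y → LC (x ++ y)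
      lc-+ {x} {y} (cs , e) (ds , e′) = Vec.zipWith ℚ._+_ cs ds , R.trans (R.+-cong e e′) (≈⇒∼ (lc-≈ (Vec.zipWith ℚ._+_ cs ds) eq))
        where
        eq : ∀ f → ⟪ linComb P cs us ++ linComb P ds us , f ⟫ ≡ sum (λ j → lookup (Vec.zipWith ℚ._+_ cs ds) j ℚ.* ⟪ lookup us j , f ⟫)
        eq f = begin
          ⟪ linComb P cs us ++ linComb P ds us , f ⟫                   ≡⟨ ⟪⟫-++ (linComb P cs us) (linComb P ds us) f ⟩
          ⟪ linComb P cs us , f ⟫ ℚ.+ ⟪ linComb P ds us , f ⟫          ≡⟨ cong₂ ℚ._+_ (⟪linComb⟫ cs us f) (⟪linComb⟫ ds us f) ⟩
          sum (λ j → lookup cs j ℚ.* u j) ℚ.+ sum (λ j → lookup ds j ℚ.* u j) ≡⟨ ∑-distrib-+ (λ j → lookup cs j ℚ.* u j) (λ j → lookup ds j ℚ.* u j) ⟨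
          sum (λ j → lookup cs j ℚ.* u j ℚ.+ lookup ds j ℚ.* u j)
            ≡⟨ sum-cong-≗ (λ j → trans (sym (ℚP.*-distribʳ-+ (u j) (lookup cs j) (lookup ds j))) (cong (ℚ._* u j) (sym (VecP.lookup-zipWith ℚ._+_ j cs ds)))) ⟩
          sum (λ j → lookup (Vec.zipWith ℚ._+_ cs ds) j ℚ.* u j) ∎
          where
          open ≡-Reasoning
          u = λ j → ⟪ lookup us j , f ⟫

      lc-scale : ∀ c {x} → LC x → LC (scaleᵖ c x)
      lc-scale c {x} (cs , e) = Vec.map (c ℚ.*_) cs , R.trans (scale-cong e) (≈⇒∼ (lc-≈ (Vec.map (c ℚ.*_) cs) eq))
        where
        scale-cong : ∀ {p q} → p ∼ q → scaleᵖ c p ∼ scaleᵖ c q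
        scale-cong {p} {q} e = R.trans (≈⇒∼ (scale-as-* c p)) (R.trans (R.*-congˡ {κ c} e) (R.sym (≈⇒∼ (scale-as-* c q))))
        eq : ∀ f → ⟪ scaleᵖ c (linComb P cs us) , f ⟫ ≡ sum (λ j → lookup (Vec.map (c ℚ.*_) cs) j ℚ.* ⟪ lookup us j , f ⟫)
        eq f = trans (⟪⟫-scale c (linComb P cs us) f) (trans (cong (c ℚ.*_) (⟪linComb⟫ cs us f))
          (trans (*-distribˡ-sum c (λ j → lookup cs j ℚ.* ⟪ lookup us j , f ⟫))
            (sum-cong-≗ (λ j → trans (sym (ℚP.*-assoc c (lookup cs j) ⟪ lookup us j , f ⟫)) (cong (ℚ._* ⟪ lookup us j , f ⟫) (sym (VecP.lookup-map j (c ℚ.*_) cs)))))))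

      lc-base : ∀ {C} → C ∈ Cs → LC (monomial (flatten C))
      lc-base {C} C∈ = tabulate e , ≈⇒∼ (lc-≈ (tabulate e) eq)
        where
        i = index C∈
        e : Fin r → ℚ
        e j = if does (i Fin.≟ j) then 1ℚ else 0ℚ
        eq : ∀ f → ⟪ monomial (flatten C) , f ⟫ ≡ sum (λ j → lookup (tabulate e) j ℚ.* ⟪ lookup us j , f ⟫)
        eq f = sym (begin
          sum (λ j → lookup (tabulate e) j ℚ.* ⟪ lookup us j , f ⟫)
            ≡⟨ sum-single (λ j → lookup (tabulate e) j ℚ.* ⟪ lookup us j , f ⟫) i (λ j j≢i → trans (cong (ℚ._* ⟪ lookup us j , f ⟫)
                 (trans (VecP.lookup∘tabulate e j) (cong (λ b → if b then 1ℚ else 0ℚ) (dec-false (i Fin.≟ j) (λ e → j≢i (sym e)))))) (ℚP.*-zeroˡ ⟪ lookup us j , f ⟫)) ⟩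
          lookup (tabulate e) i ℚ.* ⟪ lookup us i , f ⟫
            ≡⟨ cong (ℚ._* ⟪ lookup us i , f ⟫) (trans (VecP.lookup∘tabulate e i) (cong (λ b → if b then 1ℚ else 0ℚ) (dec-true (i Fin.≟ i) refl))) ⟩
          1ℚ ℚ.* ⟪ lookup us i , f ⟫    ≡⟨ ℚP.*-identityˡ ⟪ lookup us i , f ⟫ ⟩
          ⟪ lookup us i , f ⟫           ≡⟨ cong (λ p → ⟪ p , f ⟫) (trans (lookup-us i) (cong (λ C → monomial (flatten C)) (sym (lookup-index C∈)))) ⟩
          ⟪ monomial (flatten C) , f ⟫  ∎)
          where open ≡-Reasoning

      span⇒lc : ∀ {x} → Span κ (StandardOfDegree d) x → LC x
      span⇒lc (base (C , s , refl , refl)) = subst LC (monomial≡product (flatten C)) (lc-base (standardChains-complete s))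
      span⇒lc zero        = lc-0
      span⇒lc (add s t)   = lc-+ (span⇒lc s) (span⇒lc t)
      -- Negation of polynomials is by definition scaling by -1.
      span⇒lc (neg s)     = lc-scale (ℚ.- 1ℚ) (span⇒lc s)
      span⇒lc (scale c {x} s) = proj₁ ih , R.trans (R.sym (≈⇒∼ (scale-as-* c x))) (proj₂ ih)
        where ih = lc-scale c (span⇒lc s)
      span⇒lc (resp e s)  = proj₁ ih , R.trans (R.sym e) (proj₂ ih)
        where ih = span⇒lc s

      gradedBasis : GradedBasis d us
      gradedBasis = record
        { homogeneous = λ j → subst (Homogeneous d) (sym (lookup-us j))
            (ofDegree⇒homogeneous _ (subst (λ e → OfDegree e (monomial (flatten (List.lookup Cs j))))
              (trans (total-length (List.lookup Cs j)) (proj₂ (standardChains-sound d (∈-lookup j)))) (monomial-degree (flatten (List.lookup Cs j)))))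
        ; independent = basis-independent Cs (λ C∈ → proj₁ (standardChains-sound d C∈)) (λ C∈ → proj₂ (standardChains-sound d C∈)) (standardChains-unique d)
        -- Cancelling terms of other degrees are dropped, the variables are expressed through the
        -- `H S`, and the resulting products are straightened within their degree.
        ; spanning = λ p hom → span⇒lc (resp (R.sym (≈⇒∼ (restrict-≈ d p hom)))
            (span-bind (λ { {m} refl → straighten m }) (poly-span d (restrict d p) (restrict-ofDegree d p)))) }
        where open import Data.List.Membership.Propositional.Properties using (∈-lookup)

    hilbertSeries : IsHilbertSeries P (λ d → length (standardChains d))
    hilbertSeries d = hilbertCoeff (Degree.us d) (Degree.gradedBasis d)

-- Relations between the h_S in a ring generated by flats

module FlatRingRelations where

  open ListSums
  open ChainFunctionals hiding (add)
  open StandardChains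
  open Straightenings
  open ChainEnumeration
  open import Algebra.Bundles using (CommutativeRing)
  open import Level using (0ℓ)
  open import Data.Bool using (Bool; true; false; if_then_else_; T; not; _∧_)
  open import Data.Fin using (Fin; zero; suc)
  open import Data.Fin.Subset using (Subset; _⊆_; ⁅_⁆; _∪_; ⊤) renaming (_∈_ to _∈ₛ_; _∉_ to _∉ₛ_)
  import Data.Fin.Subset.Properties as SubP
  open import Data.Nat using (ℕ; zero; suc; _+_; _≤_; _<_)
  import Data.Nat.Properties as ℕP
  open import Induction.WellFounded using (Acc; acc)
  open import Data.List using (List; []; _∷_; length; allFin)
  open import Data.List.Membership.Propositional.Properties using (∈-allFin)
  open import Data.List.Relation.Unary.All using ([]; _∷_)
  import Data.List.Relation.Unary.Unique.Propositional.Properties as UniqueP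
  open import Data.Rational using (ℚ)
  open import Data.Product using (_×_; _,_; proj₁; proj₂)
  open import Data.Vec using ([]; _∷_)
  open import Relation.Nullary using (¬_; Dec; yes; no; does; contradiction)
  open import Relation.Nullary.Decidable using (dec-true; dec-false)
  import Data.Fin.Properties as FinP
  open import Relation.Binary.PropositionalEquality hiding (resp)

  module FlatRing {n : ℕ} (M : Polymatroid n) (R : CommutativeRing 0ℓ 0ℓ) {N : ℕ} (fl : Fin N → Subset n)
    (x : Fin N → CommutativeRing.Carrier R) (xE : CommutativeRing.Carrier R) (κ : ℚ → CommutativeRing.Carrier R) where

    open Polymatroid M
    open Standard M
    module ∑R = Sums R
    private module R = CommutativeRing R

    ps = allFin N

    upper : Subset n → R.Carrier
    upper S = ∑R.∑ ps (λ p → ∑R.when (does (S SubP.⊆? fl p)) (x p))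

    -- h_S, with `xE` in the role of x_E. The empty set receives 0 separately, since `upper ⊥ₛ + xE`
    -- need not vanish in the Chow ring, where the empty flat has no variable.
    H : Subset n → R.Carrier
    H S = if does (S ≟ₛ ⊥ₛ) then R.0# else upper S R.+ xE

    H-≢⊥ : ∀ {S} → S ≢ ⊥ₛ → H S ≡ upper S R.+ xE
    H-≢⊥ {S} S≢⊥ = cong (λ b → if b then R.0# else upper S R.+ xE) (dec-false (S ≟ₛ ⊥ₛ) S≢⊥)

    H-⊥≡ : H ⊥ₛ ≡ R.0#
    H-⊥≡ = cong (λ b → if b then R.0# else upper ⊥ₛ R.+ xE) (dec-true (⊥ₛ {n} ≟ₛ ⊥ₛ) refl)

    zero-*ˡ : ∀ a b → a R.≈ R.0# → a R.* b R.≈ R.0#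
    zero-*ˡ a b e = R.trans (R.*-congʳ e) (R.zeroˡ b)

    H-zero : ∀ S u → S ≢ ⊥ₛ → u R.≈ upper S → u R.+ xE R.≈ R.0# → H S R.≈ R.0#
    H-zero S u S≢⊥ e z = R.trans (R.reflexive (H-≢⊥ S≢⊥)) (R.trans (R.+-congʳ (R.sym e)) z)

    module _ where
      open import Algebra.Properties.Ring R.ring using (-‿+-comm; -‿involutive; -‿distribˡ-*; -‿distribʳ-*; -0#≈0#)

      H-from-difference : ∀ S y → S ≢ ⊥ₛ → xE R.≈ R.- upper ⊥ₛ → y R.≈ upper ⊥ₛ R.- upper S → H S R.≈ R.- y
      H-from-difference S y S≢⊥ e d = R.trans (R.reflexive (H-≢⊥ S≢⊥)) (R.trans (R.+-congˡ e) (R.sym (R.trans (R.-‿cong d)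
        (R.trans (R.sym (-‿+-comm (upper ⊥ₛ) (R.- upper S))) (R.trans (R.+-congˡ (-‿involutive (upper S))) (R.+-comm _ _))))))

      neg-zero-* : ∀ h y z → h R.≈ R.- y → y R.* z R.≈ R.0# → h R.* z R.≈ R.0#
      neg-zero-* h y z e yz = R.trans (R.*-congʳ e) (R.trans (R.sym (-‿distribˡ-* y z)) (R.trans (R.-‿cong yz) -0#≈0#))

      neg-zero-² : ∀ h y → h R.≈ R.- y → y R.* y R.≈ R.0# → h R.* h R.≈ R.0#
      neg-zero-² h y e yy = neg-zero-* h y h e (R.trans (R.*-congˡ e) (R.trans (R.sym (-‿distribʳ-* y y)) (R.trans (R.-‿cong yy) -0#≈0#)))

      neg-swap : ∀ h y → h R.≈ R.- y → y R.≈ R.- h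
      neg-swap h y e = R.sym (R.trans (R.-‿cong e) (-‿involutive y))

      upper+xE : xE R.≈ R.- upper ⊥ₛ → upper ⊥ₛ R.+ xE R.≈ R.0#
      upper+xE e = R.trans (R.+-congˡ e) (R.-‿inverseʳ (upper ⊥ₛ))

      complement : ∀ S (m : Fin N → Bool) → (∀ p → m p ≡ does (S SubP.⊆? fl p)) →
                   ∑R.∑ ps (λ p → ∑R.when (not (m p)) (x p)) R.≈ upper ⊥ₛ R.- upper S
      complement S m e = R.trans (∑R.∑-cong ps (λ p → pointwise p (dec-true (⊥ₛ SubP.⊆? fl p) SubP.⊥⊆) (e p)))
          (R.trans (∑R.∑-+ ps _ _) (R.+-congˡ (∑R.∑-neg ps _)))
        where
        pointwise : ∀ p {z a b} → z ≡ true → a ≡ b → ∑R.when (not a) (x p) R.≈ ∑R.when z (x p) R.- ∑R.when b (x p)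
        pointwise p {a = true}  refl refl = R.sym (R.-‿inverseʳ (x p))
        pointwise p {a = false} refl refl = R.sym (R.trans (R.+-congˡ -0#≈0#) (R.+-identityʳ (x p)))

    square-zero : ∀ y (b : Fin N → Bool) → y R.≈ ∑R.∑ ps (λ p → ∑R.when (b p) (x p)) → (∀ p → b p ≡ true → y R.* x p R.≈ R.0#) → y R.* y R.≈ R.0#
    square-zero y b e z = R.trans (R.*-congˡ e) (R.trans (R.sym (∑R.∑-*ˡ ps y _)) (∑R.∑-zero ps (λ p → go p (b p) refl)))
      where
      go : ∀ p c → b p ≡ c → y R.* ∑R.when c (x p) R.≈ R.0#
      go p true  e = z p e
      go p false e = R.zeroʳ y

    -- The common part of both rings. `H-point²` and `H-point-x` hold in the Chow ring because h_i =
    -- 0, and in the augmented ring because h_i = -y_i.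
    record FlatRelations : Set where
      field
        fl-injective : ∀ {p q} → fl p ≡ fl q → p ≡ q
        fl-flat      : ∀ p → IsFlat (fl p)
        fl-≢⊤        : ∀ p → fl p ≢ ⊤
        xx≈0         : ∀ {p q} → ¬ fl p ⊆ fl q → ¬ fl q ⊆ fl p → x p R.* x q R.≈ R.0#
        H-point≈0    : ∀ i → ρ ⁅ i ⁆ ≡ 1 → H ⁅ i ⁆ R.≈ R.0#
        H-point²     : ∀ i → H ⁅ i ⁆ R.* H ⁅ i ⁆ R.≈ R.0#
        H-point-x    : ∀ i p → i ∉ₛ fl p → H ⁅ i ⁆ R.* x p R.≈ R.0#
        upper-⊥      : ∀ p → fl p ≡ ⊥ₛ → upper ⊥ₛ R.+ xE R.≈ R.0#

    module Derived (rels : FlatRelations) where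
      open FlatRelations rels
      open Product R H using (Relations; Span; base; zero; add; neg; scale; resp; pow; span-bind)
      open import Relation.Binary.Reasoning.Setoid R.setoid
      open import Algebra.Properties.Ring R.ring using (x[y-z]≈xy-xz; [y-z]x≈yx-zx; -‿+-comm; -0#≈0#)

      Δ : Subset n → Subset n → R.Carrier
      Δ S K = ∑R.∑ ps (λ p → ∑R.when (does (S SubP.⊆? fl p) ∧ not (does (K SubP.⊆? fl p))) (x p))

      H-Δ : ∀ {S K} → S ≢ ⊥ₛ → K ≢ ⊥ₛ → S ⊆ K → H S R.- H K R.≈ Δ S K
      H-Δ {S} {K} S≢⊥ K≢⊥ S⊆K = begin
        H S R.- H K                             ≈⟨ R.reflexive (cong₂ R._-_ (H-≢⊥ S≢⊥) (H-≢⊥ K≢⊥)) ⟩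
        (upper S R.+ xE) R.- (upper K R.+ xE)   ≈⟨ cancel (upper S) (upper K) xE ⟩
        ∑R.∑ ps (λ p → ∑R.when (s p) (x p)) R.- ∑R.∑ ps (λ p → ∑R.when (k p) (x p))
          ≈⟨ R.+-congˡ (∑R.∑-neg ps _) ⟨
        ∑R.∑ ps (λ p → ∑R.when (s p) (x p)) R.+ ∑R.∑ ps (λ p → R.- ∑R.when (k p) (x p))
          ≈⟨ ∑R.∑-+ ps _ _ ⟨
        ∑R.∑ ps (λ p → ∑R.when (s p) (x p) R.- ∑R.when (k p) (x p))
          ≈⟨ ∑R.∑-cong ps (λ p → bool (s p) (k p) (x p) (λ kt → dec-true (S SubP.⊆? fl p) (λ y∈ → does⇒ (K SubP.⊆? fl p) kt (S⊆K y∈)))) ⟩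
        Δ S K ∎
        where
        s = λ p → does (S SubP.⊆? fl p)
        k = λ p → does (K SubP.⊆? fl p)
        cancel : ∀ a b c → (a R.+ c) R.- (b R.+ c) R.≈ a R.- b
        cancel a b c = begin
          (a R.+ c) R.- (b R.+ c)              ≈⟨ R.+-congˡ (-‿+-comm b c) ⟨
          (a R.+ c) R.+ (R.- b R.+ R.- c)      ≈⟨ R.+-assoc a c _ ⟩
          a R.+ (c R.+ (R.- b R.- c))          ≈⟨ R.+-congˡ (R.+-congˡ (R.+-comm _ _)) ⟩
          a R.+ (c R.+ (R.- c R.+ R.- b))      ≈⟨ R.+-congˡ (R.+-assoc c _ _) ⟨
          a R.+ ((c R.- c) R.+ R.- b)          ≈⟨ R.+-congˡ (R.+-congʳ (R.-‿inverseʳ c)) ⟩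
          a R.+ (R.0# R.+ R.- b)               ≈⟨ R.+-congˡ (R.+-identityˡ _) ⟩
          a R.- b                              ∎
        bool : ∀ s k z → (k ≡ true → s ≡ true) → ∑R.when s z R.- ∑R.when k z R.≈ ∑R.when (s ∧ not k) z
        bool true  true  z _ = R.-‿inverseʳ z
        bool true  false z _ = R.trans (R.+-congˡ -0#≈0#) (R.+-identityʳ z)
        bool false true  z f = contradiction (f refl) λ ()
        bool false false z _ = R.-‿inverseʳ R.0#

      Δ-term : ∀ {S K} p → (does (S SubP.⊆? fl p) ∧ not (does (K SubP.⊆? fl p))) ≡ true → S ⊆ fl p × ¬ K ⊆ fl p
      Δ-term {S} {K} p e with S SubP.⊆? fl p | K SubP.⊆? fl p
      ... | yes s | no ¬k = s , ¬k

      Δ-*-zero : ∀ {S K} y → (∀ p → S ⊆ fl p → ¬ K ⊆ fl p → x p R.* y R.≈ R.0#) → Δ S K R.* y R.≈ R.0#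
      Δ-*-zero {S} {K} y z = R.trans (R.sym (∑R.∑-*ʳ ps y _)) (∑R.∑-zero ps (λ p → go p (does (S SubP.⊆? fl p) ∧ not (does (K SubP.⊆? fl p))) (Δ-term {S} {K} p)))
        where
        go : ∀ p b → (b ≡ true → S ⊆ fl p × ¬ K ⊆ fl p) → ∑R.when b (x p) R.* y R.≈ R.0#
        go p true  f = z p (proj₁ (f refl)) (proj₂ (f refl))
        go p false f = R.zeroˡ y

      ∪-≢⊥ : ∀ {S : Subset n} T → S ≢ ⊥ₛ → S ∪ T ≢ ⊥ₛ
      ∪-≢⊥ {S} T S≢⊥ e = S≢⊥ (⊆⊥⇒≡⊥ (λ x∈ → subst (_ ∈ₛ_) e (SubP.p⊆p∪q T x∈)))

      -- A flat that contains `S` but not `S ∪ T` and a flat that contains `T` but not `S ∪ T` are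
      -- incomparable, so every product of terms is zero.
      Δ-Δ : ∀ S T → Δ S (S ∪ T) R.* Δ T (S ∪ T) R.≈ R.0#
      Δ-Δ S T = Δ-*-zero {S} {S ∪ T} (Δ T (S ∪ T)) (λ p S⊆p K⊈p →
        R.trans (R.*-comm (x p) _) (Δ-*-zero {T} {S ∪ T} (x p) (λ q T⊆q K⊈q →
          xx≈0 (λ q⊆p → K⊈p (∪-lub S⊆p (λ y∈ → q⊆p (T⊆q y∈)))) (λ p⊆q → K⊈q (∪-lub (λ y∈ → p⊆q (S⊆p y∈)) T⊆q)))))

      Δ-pair : ∀ S T → S ≢ ⊥ₛ → T ≢ ⊥ₛ → (H S R.- H (S ∪ T)) R.* (H T R.- H (S ∪ T)) R.≈ R.0#
      Δ-pair S T S≢⊥ T≢⊥ = R.trans (R.*-cong (H-Δ S≢⊥ (∪-≢⊥ T S≢⊥) (SubP.p⊆p∪q T)) (H-Δ T≢⊥ (∪-≢⊥ T S≢⊥) (SubP.q⊆p∪q S T))) (Δ-Δ S T)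

      private
        expand : ∀ a b k → (a R.- k) R.* (b R.- k) R.≈ a R.* b R.- ((a R.* k R.+ b R.* k) R.- k R.* k)
        expand a b k = begin
          (a R.- k) R.* (b R.- k)                                 ≈⟨ [y-z]x≈yx-zx (b R.- k) a k ⟩
          a R.* (b R.- k) R.- k R.* (b R.- k)                     ≈⟨ R.+-cong (x[y-z]≈xy-xz a b k) (R.-‿cong (x[y-z]≈xy-xz k b k)) ⟩
          (a R.* b R.- a R.* k) R.- (k R.* b R.- k R.* k)         ≈⟨ R.+-assoc _ _ _ ⟩
          a R.* b R.+ (R.- (a R.* k) R.- (k R.* b R.- k R.* k))   ≈⟨ R.+-congˡ (-‿+-comm _ _) ⟩
          a R.* b R.- (a R.* k R.+ (k R.* b R.- k R.* k))         ≈⟨ R.+-congˡ (R.-‿cong (R.+-congˡ (R.+-congʳ (R.*-comm k b)))) ⟩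
          a R.* b R.- (a R.* k R.+ (b R.* k R.- k R.* k))         ≈⟨ R.+-congˡ (R.-‿cong (R.+-assoc _ _ _)) ⟨
          a R.* b R.- ((a R.* k R.+ b R.* k) R.- k R.* k)         ∎

        minus-zero : ∀ a b → a R.- b R.≈ R.0# → a R.≈ b
        minus-zero a b e = begin
          a                       ≈⟨ R.+-identityʳ a ⟨
          a R.+ R.0#              ≈⟨ R.+-congˡ (R.-‿inverseˡ b) ⟨
          a R.+ (R.- b R.+ b)     ≈⟨ R.+-assoc a _ b ⟨
          (a R.- b) R.+ b         ≈⟨ R.+-congʳ e ⟩
          R.0# R.+ b              ≈⟨ R.+-identityˡ b ⟩
          b                       ∎

      H-⊥ : H ⊥ₛ R.≈ R.0#
      H-⊥ = R.reflexive H-⊥≡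

      H-pair : ∀ S T → H S R.* H T R.≈ (H S R.* H (S ∪ T) R.+ H T R.* H (S ∪ T)) R.- H (S ∪ T) R.* H (S ∪ T)
      H-pair S T = cases (S ≟ₛ ⊥ₛ) (T ≟ₛ ⊥ₛ)
        where
        degenerate : ∀ a b → a R.≈ R.0# → a R.* b R.≈ (a R.* b R.+ b R.* b) R.- b R.* b
        degenerate a b e = R.sym (R.trans (R.+-assoc _ _ _) (R.trans (R.+-congˡ (R.-‿inverseʳ _)) (R.+-identityʳ _)))
        cases : Dec (S ≡ ⊥ₛ) → Dec (T ≡ ⊥ₛ) → H S R.* H T R.≈ (H S R.* H (S ∪ T) R.+ H T R.* H (S ∪ T)) R.- H (S ∪ T) R.* H (S ∪ T)
        cases (yes refl) _ = subst (λ K → H ⊥ₛ R.* H T R.≈ (H ⊥ₛ R.* H K R.+ H T R.* H K) R.- H K R.* H K) (sym (SubP.∪-identityˡ T)) (degenerate (H ⊥ₛ) (H T) H-⊥)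
        cases (no _) (yes refl) = subst (λ K → H S R.* H ⊥ₛ R.≈ (H S R.* H K R.+ H ⊥ₛ R.* H K) R.- H K R.* H K) (sym (SubP.∪-identityʳ S))
          (R.trans (R.*-comm (H S) (H ⊥ₛ)) (R.trans (degenerate (H ⊥ₛ) (H S) H-⊥) (R.+-congʳ (R.+-comm _ _))))
        cases (no S≢⊥) (no T≢⊥) = minus-zero _ _ (R.trans (R.sym (expand (H S) (H T) (H (S ∪ T)))) (Δ-pair S T S≢⊥ T≢⊥))

      H-closed : ∀ S i → ρ (S ∪ ⁅ i ⁆) ≡ ρ S → H S R.≈ H (S ∪ ⁅ i ⁆)
      H-closed S i ρ≡ = begin
        H S                       ≈⟨ R.reflexive (H-≢⊥ S≢⊥) ⟩
        upper S R.+ xE            ≈⟨ R.+-congʳ (∑R.∑-cong ps (λ p → R.reflexive (cong (λ b → ∑R.when b (x p)) (same p)))) ⟩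
        upper (S ∪ ⁅ i ⁆) R.+ xE  ≈⟨ R.reflexive (H-≢⊥ (∪-≢⊥ ⁅ i ⁆ S≢⊥)) ⟨
        H (S ∪ ⁅ i ⁆)             ∎
        where
        S≢⊥ : S ≢ ⊥ₛ
        S≢⊥ refl = contradiction (subst (1 ≤_) (trans (cong ρ (sym (SubP.∪-identityˡ ⁅ i ⁆))) (trans ρ≡ ρ-⊥)) (ρ-point≥ i)) λ ()
        same : ∀ p → does (S SubP.⊆? fl p) ≡ does ((S ∪ ⁅ i ⁆) SubP.⊆? fl p)
        same p with S SubP.⊆? fl p
        ... | yes S⊆ = sym (dec-true ((S ∪ ⁅ i ⁆) SubP.⊆? fl p) (∪-lub S⊆ (⁅⁆-⊆ (flat-absorbs {fl p} {S} i (fl-flat p) ρ≡ S⊆))))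
        ... | no S⊈ = sym (dec-false ((S ∪ ⁅ i ⁆) SubP.⊆? fl p) (λ K⊆ → S⊈ (λ y∈ → K⊆ (SubP.p⊆p∪q ⁅ i ⁆ y∈))))

      point≢⊥ : ∀ i → ⁅ i ⁆ ≢ ⊥ₛ {n}
      point≢⊥ i e = SubP.∉⊥ (subst (i ∈ₛ_) e (SubP.x∈⁅x⁆ i))

      -- Let K be `S ∪ ⁅ i ⁆`. The difference h_S - h_K is killed by h_i - h_K, by the pair
      -- relation, and by h_i, as it involves only flats without `i`; hence it is killed by h_K.
      H-step : ∀ S i → S ≢ ⊥ₛ → H S R.* H (S ∪ ⁅ i ⁆) R.≈ H (S ∪ ⁅ i ⁆) R.* H (S ∪ ⁅ i ⁆)
      H-step S i S≢⊥ = minus-zero _ _ (begin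
        H S R.* K R.- K R.* K                   ≈⟨ [y-z]x≈yx-zx K (H S) K ⟨
        (H S R.- K) R.* K                       ≈⟨ minus-zero _ _ zeroed ⟨
        (H S R.- K) R.* H ⁅ i ⁆                 ≈⟨ R.*-congʳ (H-Δ S≢⊥ (∪-≢⊥ ⁅ i ⁆ S≢⊥) (SubP.p⊆p∪q ⁅ i ⁆)) ⟩
        Δ S (S ∪ ⁅ i ⁆) R.* H ⁅ i ⁆             ≈⟨ Δ-*-zero {S} {S ∪ ⁅ i ⁆} (H ⁅ i ⁆) (λ p S⊆ K⊈ → R.trans (R.*-comm (x p) _) (H-point-x i p (λ i∈ → K⊈ (∪-lub S⊆ (⁅⁆-⊆ i∈))))) ⟩
        R.0#                                    ∎)
        where
        K = H (S ∪ ⁅ i ⁆)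
        zeroed : (H S R.- K) R.* H ⁅ i ⁆ R.- (H S R.- K) R.* K R.≈ R.0#
        zeroed = R.trans (R.sym (x[y-z]≈xy-xz (H S R.- K) (H ⁅ i ⁆) K)) (Δ-pair S ⁅ i ⁆ S≢⊥ (point≢⊥ i))

      H-point : ∀ i e → ρ ⁅ i ⁆ ≤ e → pow (H ⁅ i ⁆) e R.≈ R.0#
      H-point i e le with ρ ⁅ i ⁆ ℕP.≟ 1
      H-point i zero le | _ = contradiction (ℕP.≤-trans (ρ-point≥ i) le) λ ()
      H-point i (suc e) le | yes ρ≡1 = R.trans (R.*-congʳ (H-point≈0 i ρ≡1)) (R.zeroˡ _)
      H-point i (suc zero) le | no ρ≢1 = contradiction (ℕP.≤-antisym le (ρ-point≥ i)) ρ≢1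
      H-point i (suc (suc e)) le | no _ = R.trans (R.sym (R.*-assoc (H ⁅ i ⁆) (H ⁅ i ⁆) _)) (R.trans (R.*-congʳ (H-point² i)) (R.zeroˡ _))

      relations : Relations M
      relations = record { H-⊥ = H-⊥ ; H-closed = H-closed ; H-step = H-step ; H-point = H-point ; H-pair = H-pair }

      Linear : R.Carrier → Set
      Linear = Span κ (λ m → length m ≡ 1)

      linear-H : ∀ S → Linear (H S)
      linear-H S = resp (R.*-identityʳ (H S)) (base {m = S ∷ []} refl)

      linear-∑ : ∀ (qs : List (Fin N)) {f} → (∀ q → Linear (f q)) → Linear (∑R.∑ qs f)
      linear-∑ []       h = zero
      linear-∑ (q ∷ qs) h = add (h q) (linear-∑ qs h)

      ⊤≢⊥ : ∀ p → ⊤ ≢ ⊥ₛ {n}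
      ⊤≢⊥ p e = fl-≢⊤ p (SubP.⊆-antisym SubP.⊆⊤ (subst (_⊆ fl p) (sym e) SubP.⊥⊆))

      H-⊤ : ∀ p → H ⊤ R.≈ xE
      H-⊤ p = R.trans (R.reflexive (H-≢⊥ (⊤≢⊥ p))) (R.trans (R.+-congʳ (∑R.∑-zero ps (λ q → R.reflexive (cong (λ b → ∑R.when b (x q)) (dec-false (⊤ SubP.⊆? fl q) (λ ⊤⊆ → fl-≢⊤ q (SubP.⊆-antisym SubP.⊆⊤ ⊤⊆))))))) (R.+-identityˡ xE))

      H-fl : ∀ p → H (fl p) R.≈ upper (fl p) R.+ xE
      H-fl p with fl p ≟ₛ ⊥ₛ
      ... | no _  = R.refl
      ... | yes e = R.sym (R.trans (R.+-congʳ (R.reflexive (cong upper e))) (upper-⊥ p e))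

      -- Triangularity: H (fl p) - H ⊤ is x p plus the x q of the flats strictly above fl p.
      linear-x : ∀ p → Acc _<_ (codim (fl p)) → Linear (x p)
      linear-x p (acc rec) = resp (R.sym solved) (add (add (linear-H (fl p)) (neg (linear-H ⊤)))
          (neg (linear-∑ ps (λ q → strictly-above q (fl p SubP.⊆? fl q) (q FinP.≟ p)))))
        where
        a = λ q → does (fl p SubP.⊆? fl q)
        above : Fin N → R.Carrier
        above q = if does (q FinP.≟ p) then R.0# else ∑R.when (a q) (x q)
        strictly-above : ∀ q (d : Dec (fl p ⊆ fl q)) (e : Dec (q ≡ p)) → Linear (if does e then R.0# else ∑R.when (does d) (x q))
        strictly-above q _        (yes _)  = zero
        strictly-above q (no _)   (no _)   = zero
        strictly-above q (yes p⊆q) (no q≢p) = linear-x q (rec (codim-< p⊆q (λ e → q≢p (fl-injective (sym e)))))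
        here-only : Fin N → R.Carrier
        here-only q = ∑R.when (does (q FinP.≟ p)) (x p)
        pointwise : ∀ q → ∑R.when (a q) (x q) R.≈ here-only q R.+ above q
        pointwise q with q FinP.≟ p
        ... | no _     = R.sym (R.+-identityˡ _)
        ... | yes refl = R.trans (R.reflexive (cong (λ b → ∑R.when b (x q)) (dec-true (fl q SubP.⊆? fl q) (λ y → y)))) (R.sym (R.+-identityʳ _))
        split : upper (fl p) R.≈ x p R.+ ∑R.∑ ps above
        split = begin
          upper (fl p)                          ≈⟨ ∑R.∑-cong ps pointwise ⟩
          ∑R.∑ ps (λ q → here-only q R.+ above q) ≈⟨ ∑R.∑-+ ps here-only above ⟩
          ∑R.∑ ps here-only R.+ ∑R.∑ ps above   ≈⟨ R.+-congʳ (∑R.∑-unique here-only (UniqueP.allFin⁺ N) (∈-allFin p) (λ q q≢p → R.reflexive (cong (λ b → ∑R.when b (x p)) (dec-false (q FinP.≟ p) q≢p)))) ⟩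
          here-only p R.+ ∑R.∑ ps above         ≈⟨ R.+-congʳ (R.reflexive (cong (λ b → ∑R.when b (x p)) (dec-true (p FinP.≟ p) refl))) ⟩
          x p R.+ ∑R.∑ ps above                 ∎
        solved : x p R.≈ (H (fl p) R.- H ⊤) R.- ∑R.∑ ps above
        solved = R.sym (begin
          (H (fl p) R.- H ⊤) R.- ∑R.∑ ps above            ≈⟨ R.+-congʳ (R.+-cong (H-fl p) (R.-‿cong (H-⊤ p))) ⟩
          ((upper (fl p) R.+ xE) R.- xE) R.- ∑R.∑ ps above ≈⟨ R.+-congʳ (undo (upper (fl p)) xE) ⟩
          upper (fl p) R.- ∑R.∑ ps above                  ≈⟨ R.+-congʳ split ⟩
          (x p R.+ ∑R.∑ ps above) R.- ∑R.∑ ps above       ≈⟨ undo (x p) _ ⟩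
          x p                                             ∎)
          where
          undo : ∀ u v → (u R.+ v) R.- v R.≈ u
          undo u v = R.trans (R.+-assoc u v _) (R.trans (R.+-congˡ (R.-‿inverseʳ v)) (R.+-identityʳ u))

-- Dual functionals on the variables of flats

module FlatModel where

  open import Defs
  open ListSums
  open PolyRing
  open HilbertCoefficients
  open ChainFunctionals hiding (add)
  open StandardChains
  open Evaluation
  open Straightenings
  open ChainEnumeration
  open Realizations
  open FlatRingRelations
  open import Algebra.Bundles using (CommutativeRing)
  open import Data.Bool using (Bool; true; false; T; not)
  open import Data.Empty using (⊥-elim)
  open import Data.Fin using (Fin; zero; suc)
  open import Data.Fin.Subset using (Subset; _⊆_; ⁅_⁆; _∪_; ⊤) renaming (_∈_ to _∈ₛ_; _∉_ to _∉ₛ_)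
  import Data.Fin.Subset.Properties as SubP
  open import Data.Nat using (ℕ; zero; suc; _+_)
  import Data.Nat.Properties as ℕP
  open import Data.Nat.Induction using (<-wellFounded)
  open import Data.List as List using (List; []; _∷_; _++_; length; filterᵇ; allFin)
  open import Data.List.Membership.Propositional using (_∈_)
  open import Data.List.Relation.Unary.All using ([]; _∷_)
  import Data.List.Relation.Unary.All.Properties as AllP
  open import Data.Rational as ℚ using (ℚ; 0ℚ; 1ℚ)
  import Data.Rational.Properties as ℚP
  open import Data.Product using (∃; _×_; _,_; proj₁; proj₂)
  open import Data.Sum using (_⊎_; inj₁; inj₂)
  open import Data.Vec as Vec using (Vec; []; _∷_; tabulate)
  open import Relation.Nullary using (¬_; Dec; yes; no; does; contradiction)
  open import Relation.Nullary.Decidable using (dec-true; dec-false; decidable-stable; ¬?; _×-dec_)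
  import Data.Fin.Properties as FinP
  open import Relation.Binary.PropositionalEquality hiding (resp)

  open ∑ℚ using (when)

  ¬⊆⇒∃ : ∀ {n} {A B : Subset n} → ¬ A ⊆ B → ∃ λ i → i ∈ₛ A × i ∉ₛ B
  ¬⊆⇒∃ {A = A} {B} A⊈B with FinP.any? (λ i → (i SubP.∈? A) ×-dec ¬? (i SubP.∈? B))
  ... | yes p = p
  ... | no none = ⊥-elim (A⊈B (λ {x} x∈ → decidable-stable (x SubP.∈? B) (λ x∉ → none (x , x∈ , x∉))))

  ∪-absorb : ∀ {n} {S : Subset n} T {i} → i ∈ₛ S → S ∪ (T ∪ ⁅ i ⁆) ≡ S ∪ T
  ∪-absorb {S = S} T {i} i∈S = SubP.⊆-antisym
    (∪-lub (SubP.p⊆p∪q T) (∪-lub (SubP.q⊆p∪q S T) (⁅⁆-⊆ (SubP.p⊆p∪q T i∈S))))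
    (∪-lub (SubP.p⊆p∪q _) (λ x∈ → SubP.q⊆p∪q S _ (SubP.p⊆p∪q ⁅ i ⁆ x∈)))

  ∪-absorbˡ : ∀ {n} (S : Subset n) {T} {i} → i ∈ₛ T → (S ∪ ⁅ i ⁆) ∪ T ≡ S ∪ T
  ∪-absorbˡ S {T} {i} i∈T = trans (SubP.∪-comm _ T) (trans (∪-absorb S i∈T) (SubP.∪-comm T S))

  sum-of-vars : ∀ {N K} (ps : List (Fin K)) (b : Fin K → Bool) (x : Fin K → Poly N) (E : Mono N → ℚ) →
    ⟪ sumᵖ (List.map x (filterᵇ b ps)) , E ⟫ ≡ ∑ℚ ps (λ p → when (b p) ⟪ x p , E ⟫)
  sum-of-vars ps b x E = trans (go (filterᵇ b ps)) (∑ℚ.∑-filter b ps (λ p → ⟪ x p , E ⟫))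
    where
    go : ∀ qs → ⟪ sumᵖ (List.map x qs) , E ⟫ ≡ ∑ℚ qs (λ p → ⟪ x p , E ⟫)
    go []       = refl
    go (q ∷ qs) = trans (⟪⟫-++ (x q) (sumᵖ (List.map x qs)) E) (cong (⟪ x q , E ⟫ ℚ.+_) (go qs))

  ∑-complement : ∀ {A : Set} (xs : List A) (v : A → ℚ) (m e z : A → Bool) → (∀ a → z a ≡ true) → (∀ a → m a ≡ e a) →
    ∑ℚ xs (λ a → when (not (m a)) (v a)) ≡ ∑ℚ xs (λ a → when (z a) (v a)) ℚ.- ∑ℚ xs (λ a → when (e a) (v a))
  ∑-complement xs v m e z zt me = trans (∑ℚ.∑-cong xs (λ a → pointwise (v a) (z a) (zt a) (m a) (e a) (me a)))
    (trans (∑ℚ.∑-+ xs (λ a → when (z a) (v a)) (λ a → ℚ.- when (e a) (v a)))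
      (cong (∑ℚ xs (λ a → when (z a) (v a)) ℚ.+_) (∑ℚ.∑-neg xs (λ a → when (e a) (v a)))))
    where
    pointwise : ∀ v z → z ≡ true → ∀ m e → m ≡ e → when (not m) v ≡ when z v ℚ.- when e v
    pointwise v .true refl true  .true  refl = sym (ℚP.+-inverseʳ v)
    pointwise v .true refl false .false refl = sym (ℚP.+-identityʳ v)

  regroup : ∀ s t a b a′ b′ → s ≡ t → t ≡ a′ ℚ.- b′ → a ≡ a′ → b ≡ b′ → s ≡ a ℚ.- b
  regroup _ _ _ _ _ _ refl refl refl refl = refl

  var-degree : ∀ {N} (i : Fin N) → OfDegree 1 (var i)
  var-degree i = unit-sum i ∷ []
    where
    zeros : ∀ {N} → Vec.sum (tabulate {n = N} (λ _ → 0)) ≡ 0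
    zeros {zero}  = refl
    zeros {suc N} = zeros {N}
    unit-sum : ∀ {N} (i : Fin N) → Vec.sum (unitᵐ i) ≡ 1
    unit-sum {suc N} zero = cong suc (zeros {N})
    unit-sum (suc i) = unit-sum i

  sum-degree : ∀ {N K d} (x : Fin K → Poly N) → (∀ p → OfDegree d (x p)) → ∀ ps → OfDegree d (sumᵖ (List.map x ps))
  sum-degree x h []       = []
  sum-degree x h (p ∷ ps) = AllP.++⁺ (h p) (sum-degree x h ps)

  module Flats {n : ℕ} (M : Polymatroid n) (P : Presentation) {N : ℕ} (em : Fin N → Fin (Presentation.nvars P))
    (fl : Fin N → Subset n) (xE : Poly (Presentation.nvars P)) where

    open Presentation P
    open Polymatroid M
    open Standard M
    open Ideal P

    x : Fin N → Poly nvars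
    x p = var (em p)

    κ : ℚ → Poly nvars
    κ c = (c , 0ᵐ) ∷ []

    open FlatRing M quotientRing fl x xE κ public

    -- Flats are indexed by subsets of the ground set of the polymatroid, which may be smaller than
    -- that of the presentation; matroids of rank at most one rely on this. `proper` and `fl-sum`
    -- turn sums over the index into sums over all subsets.
    record Model : Set where
      field
        rels         : FlatRelations
        proper       : Subset n → Bool
        proper⇒      : ∀ {A} → proper A ≡ true → IsFlat A × A ≢ ⊤
        ⇒proper      : ∀ {A} → IsFlat A → A ≢ ⊤ → A ≢ ⊥ₛ → proper A ≡ true
        fl-sum       : ∀ (g : Subset n → ℚ) → ∑ℚ (allFin N) (λ p → g (fl p)) ≡ ∑ℚ (allSubsets n) (λ A → when (proper A) (g A))
        xE-degree    : OfDegree 1 xE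
        H-other      : ∀ v → (∃ λ p → v ≡ em p) ⊎ (∃ λ S → var v ∼ -ᵖ H S)
        L            : Fin nvars → LinearForm n
        L-em         : ∀ p → L (em p) ≡ möbius (fl p)

    ⟪∑⟫ : ∀ (qs : List (Fin N)) (f : Fin N → Poly nvars) E → ⟪ ∑R.∑ qs f , E ⟫ ≡ ∑ℚ qs (λ q → ⟪ f q , E ⟫)
    ⟪∑⟫ []       f E = refl
    ⟪∑⟫ (q ∷ qs) f E = trans (⟪⟫-++ (f q) (∑R.∑ qs f) E) (cong (⟪ f q , E ⟫ ℚ.+_) (⟪∑⟫ qs f E))

    ⟪upper⟫ : ∀ S E → ⟪ upper S , E ⟫ ≡ ∑ℚ ps (λ p → when (does (S SubP.⊆? fl p)) ⟪ x p , E ⟫)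
    ⟪upper⟫ S E = trans (⟪∑⟫ ps _ E) (∑ℚ.∑-cong ps (λ p → go (does (S SubP.⊆? fl p)) p))
      where
      go : ∀ b p → ⟪ ∑R.when b (x p) , E ⟫ ≡ when b ⟪ x p , E ⟫
      go true  p = refl
      go false p = refl

    sum-filter : ∀ (b : Fin N → Bool) → sumᵖ (List.map x (filterᵇ b ps)) ∼ ∑R.∑ ps (λ p → ∑R.when (b p) (x p))
    sum-filter b = subst (_∼ ∑R.∑ ps (λ p → ∑R.when (b p) (x p))) (sym (go (filterᵇ b ps))) (∑R.∑-filter b ps x)
      where
      go : ∀ qs → sumᵖ (List.map x qs) ≡ ∑R.∑ qs x
      go []       = refl
      go (q ∷ qs) = cong (x q ++_) (go qs)

    upper-filter : ∀ S (b : Fin N → Bool) → (∀ p → b p ≡ does (S SubP.⊆? fl p)) → sumᵖ (List.map x (filterᵇ b ps)) ∼ upper S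
    upper-filter S b e = R.trans (sum-filter b) (∑R.∑-cong ps {λ p → ∑R.when (b p) (x p)} (λ p → R.reflexive (cong (λ c → ∑R.when c (x p)) (e p))))
      where module R = CommutativeRing quotientRing

    ⟪filter⟫ : ∀ S (b : Fin N → Bool) → (∀ p → b p ≡ does (S SubP.⊆? fl p)) → ∀ E → ⟪ sumᵖ (List.map x (filterᵇ b ps)) , E ⟫ ≡ ⟪ upper S , E ⟫
    ⟪filter⟫ S b e E = trans (sum-of-vars ps b x E) (trans (∑ℚ.∑-cong ps (λ p → cong (λ c → when c ⟪ x p , E ⟫) (e p))) (sym (⟪upper⟫ S E)))

    ⟪complement⟫ : ∀ S (m : Fin N → Bool) → (∀ p → m p ≡ does (S SubP.⊆? fl p)) → ∀ E →
      ⟪ sumᵖ (List.map x (filterᵇ (λ p → not (m p)) ps)) , E ⟫ ≡ ⟪ upper ⊥ₛ , E ⟫ ℚ.- ⟪ upper S , E ⟫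
    ⟪complement⟫ S m e E = regroup ⟪ sumᵖ (List.map x (filterᵇ (λ p → not (m p)) ps)) , E ⟫ (∑ℚ ps (λ p → when (not (m p)) ⟪ x p , E ⟫))
      ⟪ upper ⊥ₛ , E ⟫ ⟪ upper S , E ⟫ (∑ℚ ps (λ p → when (does (⊥ₛ SubP.⊆? fl p)) ⟪ x p , E ⟫)) (∑ℚ ps (λ p → when (does (S SubP.⊆? fl p)) ⟪ x p , E ⟫))
      (sum-of-vars ps (λ p → not (m p)) x E)
      (∑-complement ps (λ p → ⟪ x p , E ⟫) m (λ p → does (S SubP.⊆? fl p)) (λ p → does (⊥ₛ SubP.⊆? fl p)) (λ p → dec-true (⊥ₛ SubP.⊆? fl p) SubP.⊥⊆) e)
      (⟪upper⟫ ⊥ₛ E) (⟪upper⟫ S E)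

    module Theory (model : Model) where
      open Model model
      open Independence M
      open Derived rels
      open Product quotientRing H using (resp; neg)
      private module R = CommutativeRing quotientRing

      linear-vars : ∀ v → Linear (var v)
      linear-vars v with H-other v
      ... | inj₁ (p , refl) = linear-x p (<-wellFounded _)
      ... | inj₂ (S , e)    = resp (R.sym e) (neg (linear-H S))

      ∑-degree : ∀ (qs : List (Fin N)) {f : Fin N → Poly nvars} → (∀ q → OfDegree 1 (f q)) → OfDegree 1 (∑R.∑ qs f)
      ∑-degree []       h = []
      ∑-degree (q ∷ qs) h = AllP.++⁺ (h q) (∑-degree qs h)

      H-degree : ∀ S → OfDegree 1 (H S)
      H-degree S with does (S ≟ₛ ⊥ₛ)
      ... | true  = []
      ... | false = AllP.++⁺ (∑-degree ps (λ p → go (does (S SubP.⊆? fl p)) p)) xE-degree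
        where
        go : ∀ b p → OfDegree 1 (∑R.when b (x p))
        go true  p = var-degree (em p)
        go false p = []

      act-x : ∀ p φ m → act L (x p) φ m ≡ ⟪ möbius (fl p) , (λ S → φ (S ∷ m)) ⟫
      act-x p φ m = trans (act-var L (em p) φ m) (cong (λ ℓ → op ℓ φ m) (L-em p))

      -- Some `i` outside `A` lies in its closure, and adding it to a set above `A` does not change
      -- the value of `φ`.
      möbius-nonflat : ∀ {φ} → Dual φ → ∀ m A → ¬ IsFlat A → ⟪ möbius A , (λ S → φ (S ∷ m)) ⟫ ≡ 0ℚ
      möbius-nonflat {φ} D m A ¬flat with FinP.any? (λ i → ¬? (i SubP.∈? A) ×-dec ¬? (ρ A ℕP.<? ρ (A ∪ ⁅ i ⁆)))
      ... | no none = ⊥-elim (¬flat (λ i i∉ → decidable-stable (ρ A ℕP.<? ρ (A ∪ ⁅ i ⁆)) (λ ¬lt → none (i , i∉ , ¬lt))))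
      ... | yes (i , i∉ , ¬lt) = möbius-vanishes A i i∉ (λ S A⊆S → sym (Dual.φ-closed D S i m (ρ-absorb i ρ≡ A⊆S)))
        where
        ρ≡ : ρ (A ∪ ⁅ i ⁆) ≡ ρ A
        ρ≡ = ℕP.≤-antisym (ℕP.≮⇒≥ ¬lt) (ρ-mono {A} (SubP.p⊆p∪q ⁅ i ⁆))

      möbius-⊤ : ∀ {n} (f : Subset n → ℚ) → ⟪ möbius ⊤ , f ⟫ ≡ f ⊤
      möbius-⊤ {zero}  f = trans (ℚP.+-identityʳ (1ℚ ℚ.* f [])) (ℚP.*-identityˡ (f []))
      möbius-⊤ {suc n} f = trans (⟪möbius⟫-true ⊤ f) (möbius-⊤ (λ S → f (true ∷ S)))

      -- Möbius inversion over all sets containing `S` yields `φ (S ∷ m)`. Non-flats contribute 0,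
      -- and the full set, which has no variable, accounts for the subtracted term.
      act-upper : ∀ {φ} → Dual φ → ∀ S m → (∀ A → S ⊆ A → IsFlat A → A ≢ ⊤ → proper A ≡ true) →
                  act L (upper S) φ m ≡ φ (S ∷ m) ℚ.- φ (⊤ ∷ m)
      act-upper {φ} D S m complete = trans (⟪upper⟫ S (λ μ → ev L μ φ m))
        (trans (∑ℚ.∑-cong ps (λ p → cong (when (does (S SubP.⊆? fl p))) (act-x p φ m)))
          (trans (fl-sum (λ A → when (does (S SubP.⊆? A)) ⟪ möbius A , f ⟫)) (shift (trans (sym total≡) (möbius-inversion f S)))))
        where
        f = λ T → φ (T ∷ m)
        g = λ A → when (proper A) (when (does (S SubP.⊆? A)) ⟪ möbius A , f ⟫)
        atTop = λ A → when (does (A ≟ₛ ⊤)) (f ⊤)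
        pointwise : ∀ A → when (does (S SubP.⊆? A)) ⟪ möbius A , f ⟫ ≡ g A ℚ.+ atTop A
        pointwise A with A ≟ₛ ⊤
        ... | yes refl = trans (cong (λ b → when b ⟪ möbius ⊤ , f ⟫) (dec-true (S SubP.⊆? ⊤) SubP.⊆⊤)) (trans (möbius-⊤ f) (sym (trans (cong (ℚ._+ f ⊤) (not-proper (proper ⊤) refl)) (ℚP.+-identityˡ (f ⊤)))))
          where
          not-proper : ∀ b → proper ⊤ ≡ b → when b (when (does (S SubP.⊆? ⊤)) ⟪ möbius ⊤ , f ⟫) ≡ 0ℚ
          not-proper true  e = contradiction refl (proj₂ (proper⇒ e))
          not-proper false e = refl
        ... | no A≢⊤ = trans (cases (S SubP.⊆? A) (isFlat? A) (proper A) refl) (sym (ℚP.+-identityʳ _))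
          where
          cases : (d : Dec (S ⊆ A)) → Dec (IsFlat A) → ∀ b → proper A ≡ b → when (does d) ⟪ möbius A , f ⟫ ≡ when b (when (does d) ⟪ möbius A , f ⟫)
          cases _         _          true  e = refl
          cases (no _)    _          false e = refl
          cases (yes S⊆A) (no ¬flat) false e = möbius-nonflat D m A ¬flat
          cases (yes S⊆A) (yes flat) false e = contradiction (trans (sym e) (complete A S⊆A flat A≢⊤)) λ ()
        total≡ : ∑ℚ (allSubsets n) (λ A → when (does (S SubP.⊆? A)) ⟪ möbius A , f ⟫) ≡ ∑ℚ (allSubsets n) g ℚ.+ f ⊤
        total≡ = trans (∑ℚ.∑-cong (allSubsets n) pointwise) (trans (∑ℚ.∑-+ (allSubsets n) g atTop)
          (cong (∑ℚ (allSubsets n) g ℚ.+_) (trans (∑ℚ.∑-unique atTop (unique-allSubsets n) (∈-allSubsets ⊤)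
            (λ A A≢⊤ → cong (λ b → when b (f ⊤)) (dec-false (A ≟ₛ ⊤) A≢⊤))) (cong (λ b → when b (f ⊤)) (dec-true (⊤ {n} ≟ₛ ⊤) refl)))))
        shift : ∀ {a b c} → a ℚ.+ b ≡ c → a ≡ c ℚ.- b
        shift {a} {b} {c} e = sym (trans (cong (ℚ._- b) (sym e)) (trans (ℚP.+-assoc a b (ℚ.- b)) (trans (cong (a ℚ.+_) (ℚP.+-inverseʳ b)) (ℚP.+-identityʳ a))))

      complete-≢⊥ : ∀ {S} → S ≢ ⊥ₛ → ∀ A → S ⊆ A → IsFlat A → A ≢ ⊤ → proper A ≡ true
      complete-≢⊥ S≢⊥ A S⊆A flat A≢⊤ = ⇒proper flat A≢⊤ (λ { refl → S≢⊥ (⊆⊥⇒≡⊥ S⊆A) })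

      -- By `φ-pair` the value at `S` and `T` is `u S T + v S T`, where `u` depends on `T` only
      -- through `S ∪ T` and `v` on `S` only through `S ∪ T`. An element of one flat outside the
      -- other leaves this union unchanged, so each alternating double sum cancels.
      act-xx : ∀ p q → ¬ fl p ⊆ fl q → ¬ fl q ⊆ fl p → ∀ {φ} → Dual φ → act L (x p *ᵖ x q) φ [] ≡ 0ℚ
      act-xx p q p⊈q q⊈p {φ} D = begin′
        where
        A = fl p
        B = fl q
        i = proj₁ (¬⊆⇒∃ p⊈q)
        i∈A = proj₁ (proj₂ (¬⊆⇒∃ p⊈q))
        i∉B = proj₂ (proj₂ (¬⊆⇒∃ p⊈q))
        j = proj₁ (¬⊆⇒∃ q⊈p)
        j∈B = proj₁ (proj₂ (¬⊆⇒∃ q⊈p))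
        j∉A = proj₂ (proj₂ (¬⊆⇒∃ q⊈p))
        open Dual D
        u : Subset n → Subset n → ℚ
        u S T = φ (S ∷ S ∪ T ∷ [])
        v : Subset n → Subset n → ℚ
        v S T = φ (T ∷ S ∪ T ∷ []) ℚ.- φ (S ∪ T ∷ S ∪ T ∷ [])
        solve-pair : ∀ {a b c d} → a ℚ.+ b ≡ c ℚ.+ d → a ≡ c ℚ.+ (d ℚ.- b)
        solve-pair {a} {b} {c} {d} e = sym (trans (sym (ℚP.+-assoc c d (ℚ.- b))) (trans (cong (ℚ._- b) (sym e))
          (trans (ℚP.+-assoc a b (ℚ.- b)) (trans (cong (a ℚ.+_) (ℚP.+-inverseʳ b)) (ℚP.+-identityʳ a)))))
        first : ⟪ möbius B , (λ T → ⟪ möbius A , (λ S → u S T) ⟫) ⟫ ≡ 0ℚ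
        first = möbius-vanishes B i i∉B (λ T B⊆T → möbius-cong A (λ S A⊆S → cong (λ K → φ (S ∷ K ∷ [])) (∪-absorb T (A⊆S i∈A))))
        second : ⟪ möbius B , (λ T → ⟪ möbius A , (λ S → v S T) ⟫) ⟫ ≡ 0ℚ
        second = trans (möbius-cong B (λ T B⊆T → möbius-vanishes A j j∉A (λ S A⊆S → cong (λ K → φ (T ∷ K ∷ []) ℚ.- φ (K ∷ K ∷ [])) (∪-absorbˡ S (B⊆T j∈B)))))
          (⟪⟫-0 (möbius B) (λ _ → refl))
        begin′ : act L (x p *ᵖ x q) φ [] ≡ 0ℚ
        begin′ = trans (act-* L (x p) (x q) {φ} φ-↭ [])
          (trans (act-x q (act L (x p) φ) [])
          (trans (⟪⟫-cong (möbius B) (λ T → trans (act-x p φ (T ∷ [])) (trans (⟪⟫-cong (möbius A) (λ S → solve-pair {φ (S ∷ T ∷ [])} {φ (S ∪ T ∷ S ∪ T ∷ [])} {φ (S ∷ S ∪ T ∷ [])} {φ (T ∷ S ∪ T ∷ [])} (φ-pair S T []))) (⟪⟫-+ (möbius A) (λ S → u S T) (λ S → v S T)))))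
          (trans (⟪⟫-+ (möbius B) (λ T → ⟪ möbius A , (λ S → u S T) ⟫) (λ T → ⟪ möbius A , (λ S → v S T) ⟫))
          (trans (cong₂ ℚ._+_ first second) refl))))

      module _ (L-xE : ∀ {φ} → Dual φ → ∀ m → act L xE φ m ≡ φ (⊤ ∷ m))
               (L-gens : ∀ {g} → g ∈ gens → ∀ {φ} → Dual φ → act L g φ [] ≡ 0ℚ) where

        L-H : ∀ S {φ} → Dual φ → ∀ m → act L (H S) φ m ≡ φ (S ∷ m)
        L-H S {φ} D m = cases (S ≟ₛ ⊥ₛ)
          where
          cases : Dec (S ≡ ⊥ₛ) → act L (H S) φ m ≡ φ (S ∷ m)
          cases (yes refl) = trans (cong (λ h → act L h φ m) H-⊥≡) (sym (Dual.φ-⊥ D m))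
          cases (no S≢⊥) = trans (cong (λ h → act L h φ m) (H-≢⊥ S≢⊥)) (trans (⟪⟫-++ (upper S) xE _)
            (trans (cong₂ ℚ._+_ (act-upper D S m (complete-≢⊥ S≢⊥)) (L-xE D m))
              (trans (ℚP.+-assoc (φ (S ∷ m)) (ℚ.- φ (⊤ ∷ m)) (φ (⊤ ∷ m))) (trans (cong (φ (S ∷ m) ℚ.+_) (ℚP.+-inverseˡ (φ (⊤ ∷ m)))) (ℚP.+-identityʳ (φ (S ∷ m)))))))

        hilbertSeries : IsHilbertSeries P (λ d → length (Enumeration.standardChains M d))
        hilbertSeries = Realization.hilbertSeries M P L H L-gens L-H H-degree relations linear-vars

-- The Chow ring and the augmented Chow ring

module ChowPresentations where

  open import Defs
  open ListSums
  open PolyRing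
  open HilbertCoefficients
  open ChainFunctionals hiding (add)
  open StandardChains
  open Evaluation
  open Straightenings using (module Product)
  open ChainEnumeration
  open Realizations
  open FlatRingRelations
  open FlatModel
  open import Algebra.Bundles using (CommutativeRing)
  open import Data.Bool using (Bool; true; false; not)
  open import Data.Fin using (Fin; zero; suc; _↑ˡ_; _↑ʳ_; splitAt)
  import Data.Fin.Properties as FinP
  open import Data.Fin.Subset using (Subset; _⊆_; ⁅_⁆; _∪_; ⊤) renaming (_∈_ to _∈ₛ_; _∉_ to _∉ₛ_)
  import Data.Fin.Subset.Properties as SubP
  open import Data.Nat using (ℕ; zero; suc; _+_)
  open import Data.List as List using (List; []; _∷_; _++_; length; filterᵇ; allFin; concatMap)
  open import Data.List.Membership.Propositional using (_∈_; find; lose)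
  open import Data.List.Membership.Propositional.Properties using (∈-allFin; ∈-map⁺; ∈-map⁻; ∈-concatMap⁺; ∈-concatMap⁻; ∈-++⁺ˡ; ∈-++⁺ʳ; ∈-++⁻)
  open import Data.List.Relation.Unary.All using ([]; _∷_)
  open import Data.Rational as ℚ using (ℚ; 0ℚ; 1ℚ)
  import Data.Rational.Properties as ℚP
  open import Data.Product using (∃; _×_; _,_; proj₁; proj₂)
  open import Data.Sum using (_⊎_; inj₁; inj₂)
  open import Data.Vec using ([]; _∷_; lookup)
  open import Data.Vec.Properties using (lookup⇒[]=; []=⇒lookup)
  open import Relation.Nullary using (¬_; does; contradiction)
  open import Relation.Nullary.Decidable using (dec-true; dec-false)
  open import Relation.Binary.PropositionalEquality hiding ([_])

  open ∑ℚ using (when)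

  lookup≡⊆ : ∀ {n} (A : Subset n) i → lookup A i ≡ does (⁅ i ⁆ SubP.⊆? A)
  lookup≡⊆ A i with lookup A i in eq
  ... | true  = sym (dec-true (⁅ i ⁆ SubP.⊆? A) (⁅⁆-⊆ (lookup⇒[]= i A eq)))
  ... | false = sym (dec-false (⁅ i ⁆ SubP.⊆? A) (λ sub → contradiction (trans (sym eq) ([]=⇒lookup (sub (SubP.x∈⁅x⁆ i)))) λ ()))

  double-negative : ∀ a b c d → a ≡ ℚ.- b → b ≡ c → c ≡ ℚ.- d → a ≡ d
  double-negative _ _ _ d refl refl refl = -‿involutive d
    where open import Algebra.Properties.Ring ℚP.+-*-ring using (-‿involutive)

  difference-of-values : ∀ x a b t v → x ≡ a ℚ.- b → a ≡ ℚ.- t → b ≡ v ℚ.- t → x ≡ ℚ.- v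
  difference-of-values _ _ _ t v refl refl refl = solve 2 (λ t v → (:- t) :- (v :- t) := :- v) refl t v
    where
    open import Data.Rational.Solver using (module +-*-Solver)
    open +-*-Solver

  cancel-equal : ∀ s a b v → s ≡ a ℚ.+ (ℚ.- b) → a ≡ v → b ≡ v → s ≡ 0ℚ
  cancel-equal _ _ _ v refl refl refl = ℚP.+-inverseʳ v

  -- The shape in which the presentations list their quadratic generators, so that instances agree
  -- with them by computation.
  products : ∀ {A B : Set} {N} → (A → B → Bool) → List A → List B → (A → B → Poly N) → List (Poly N)
  products b as bs f = concatMap (λ p → List.map (f p) (filterᵇ (b p) bs)) as

  products⁻ : ∀ {A B : Set} {N} (b : A → B → Bool) as bs (f : A → B → Poly N) {g} → g ∈ products b as bs f → ∃ λ p → ∃ λ q → b p q ≡ true × g ≡ f p q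
  products⁻ b as bs f g∈ with find (∈-concatMap⁻ (λ p → List.map (f p) (filterᵇ (b p) bs)) {xs = as} g∈)
  ... | p , _ , g∈′ with ∈-map⁻ (f p) g∈′
  ...   | q , q∈ , e = p , q , proj₂ (∈-filterᵇ⁻ (b p) bs q∈) , e

  products⁺ : ∀ {A B : Set} {N} (b : A → B → Bool) {as bs} (f : A → B → Poly N) {p q} → p ∈ as → q ∈ bs → b p q ≡ true → f p q ∈ products b as bs f
  products⁺ b {bs = bs} f {p} p∈ q∈ e = ∈-concatMap⁺ (λ p → List.map (f p) (filterᵇ (b p) bs)) (lose p∈ (∈-map⁺ (f p) (∈-filterᵇ⁺ (b p) q∈ e)))

  module _ {n : ℕ} (M : Polymatroid n) where
    open Standard M

    record FlatIndex {N : ℕ} (fl : Fin N → Subset n) (inc : Fin N → Fin N → Bool) : Set where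
      field
        fl-injective : ∀ {p q} → fl p ≡ fl q → p ≡ q
        fl-flat      : ∀ p → IsFlat (fl p)
        fl-≢⊤        : ∀ p → fl p ≢ ⊤
        proper       : Subset n → Bool
        proper⇒      : ∀ {A} → proper A ≡ true → IsFlat A × A ≢ ⊤
        ⇒proper      : ∀ {A} → IsFlat A → A ≢ ⊤ → A ≢ ⊥ₛ → proper A ≡ true
        fl-sum       : ∀ (g : Subset n → ℚ) → ∑ℚ (allFin N) (λ p → g (fl p)) ≡ ∑ℚ (allSubsets n) (λ A → when (proper A) (g A))
        inc⇒         : ∀ {p q} → inc p q ≡ true → ¬ fl p ⊆ fl q × ¬ fl q ⊆ fl p
        ⇒inc         : ∀ {p q} → ¬ fl p ⊆ fl q → ¬ fl q ⊆ fl p → inc p q ≡ true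

  module _ {N g : ℕ} (inc : Fin N → Fin N → Bool) (mem : Fin N → Fin g → Bool) where

    chowLin : Fin g → Poly N
    chowLin i = sumᵖ (List.map var (filterᵇ (λ p → mem p i) (allFin N)))

    chowGens : List (Poly N)
    chowGens = products inc (allFin N) (allFin N) (λ p q → var p *ᵖ var q)
            ++ concatMap (λ i → List.map (λ j → chowLin i -ᵖ chowLin j) (allFin g)) (allFin g)

    augGens : List (Poly (N + g))
    augGens = List.map (λ t → var (N ↑ʳ t) -ᵖ sumᵖ (List.map (λ p → var (p ↑ˡ g)) (filterᵇ (λ p → not (mem p t)) (allFin N)))) (allFin g)
           ++ products inc (allFin N) (allFin N) (λ p q → var (p ↑ˡ g) *ᵖ var (q ↑ˡ g))
           ++ products (λ t p → not (mem p t)) (allFin g) (allFin N) (λ t p → var (N ↑ʳ t) *ᵖ var (p ↑ˡ g))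

  -- `el` maps the ground set of the presentation to that of the polymatroid and `pre` chooses
  -- preimages. As `el` need not be injective, a matroid of rank one can be modelled by a single
  -- point.
  module ChowModel {n : ℕ} (M : Polymatroid n) {N g : ℕ} (inc : Fin N → Fin N → Bool) (mem : Fin N → Fin g → Bool)
    (fl : Fin N → Subset n) (index : FlatIndex M fl inc) (fl-≢⊥ : ∀ p → fl p ≢ ⊥ₛ)
    (el : Fin g → Fin n) (pre : Fin n → Fin g) (el-pre : ∀ i → el (pre i) ≡ i)
    (mem≡ : ∀ p i → mem p i ≡ lookup (fl p) (el i))
    (ρ-point : ∀ i → Polymatroid.ρ M ⁅ i ⁆ ≡ 1) where

    open FlatIndex index
    open Standard M

    P : Presentation
    P = pres N (chowGens inc mem)

    open Ideal P
    private module R = CommutativeRing quotientRing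

    lin = chowLin inc mem

    -- x_E is minus the sum of the x_F over the flats containing one chosen element; by the linear
    -- relations another choice gives the same class. An empty ground set offers no element, and the
    -- value is 0.
    topElement : ∀ n → (Fin n → Fin g) → Poly N
    topElement zero    _   = []
    topElement (suc n) pre = -ᵖ lin (pre zero)

    xE : Poly N
    xE = topElement n pre

    open Flats M P {N} (λ p → p) fl xE

    lin∼upper : ∀ i → lin i ∼ upper ⁅ el i ⁆
    lin∼upper i = upper-filter ⁅ el i ⁆ (λ p → mem p i) (λ p → trans (mem≡ p i) (lookup≡⊆ (fl p) (el i)))

    lin-lin : ∀ i j → lin i -ᵖ lin j ∼ []
    lin-lin i j = I⇒∼0 (I-gen (∈-++⁺ʳ (products inc (allFin N) (allFin N) (λ p q → var p *ᵖ var q))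
      (∈-concatMap⁺ (λ i → List.map (λ j → lin i -ᵖ lin j) (allFin g)) (lose (∈-allFin i) (∈-map⁺ (λ j → lin i -ᵖ lin j) (∈-allFin j))))))

    private
      point : ∀ {n} (pre : Fin n → Fin g) (i : Fin n) → lin (pre i) ++ topElement n pre ∼ []
      point {suc n} pre i = lin-lin (pre i) (pre zero)

    point≢⊥ : ∀ i → ⁅ i ⁆ ≢ ⊥ₛ {n}
    point≢⊥ i e = SubP.∉⊥ (subst (i ∈ₛ_) e (SubP.x∈⁅x⁆ i))

    H-point∼0 : ∀ i → H ⁅ i ⁆ ∼ []
    H-point∼0 i = H-zero ⁅ i ⁆ (lin (pre i)) (point≢⊥ i) (subst (λ j → lin (pre i) ∼ upper ⁅ j ⁆) (el-pre i) (lin∼upper (pre i))) (point pre i)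

    model : Model
    model = record
      { rels = record
        { fl-injective = fl-injective ; fl-flat = fl-flat ; fl-≢⊤ = fl-≢⊤
        ; xx≈0      = λ {p} {q} p⊈q q⊈p → I⇒∼0 (I-gen (∈-++⁺ˡ (products⁺ inc (λ p q → var p *ᵖ var q) (∈-allFin p) (∈-allFin q) (⇒inc p⊈q q⊈p))))
        ; H-point≈0 = λ i _ → H-point∼0 i
        ; H-point²  = λ i → zero-*ˡ (H ⁅ i ⁆) (H ⁅ i ⁆) (H-point∼0 i)
        ; H-point-x = λ i p _ → zero-*ˡ (H ⁅ i ⁆) (x p) (H-point∼0 i)
        ; upper-⊥   = λ p e → contradiction e (fl-≢⊥ p) }
      ; proper = proper ; proper⇒ = proper⇒ ; ⇒proper = ⇒proper ; fl-sum = fl-sum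
      ; xE-degree = degree n pre
      ; H-other   = λ v → inj₁ (v , refl)
      ; L         = λ p → möbius (fl p)
      ; L-em      = λ p → refl }
      where
      degree : ∀ n (pre : Fin n → Fin g) → OfDegree 1 (topElement n pre)
      degree zero    pre = []
      degree (suc n) pre = ofDegree-scale (ℚ.- 1ℚ) (sum-degree var var-degree (filterᵇ (λ p → mem p (pre zero)) (allFin N)))

    open Theory model

    private
      L : Fin N → LinearForm n
      L p = möbius (fl p)

    act-difference : ∀ p q φ m → act L (p -ᵖ q) φ m ≡ act L p φ m ℚ.+ (ℚ.- act L q φ m)
    act-difference p q φ m = trans (⟪⟫-++ p (-ᵖ q) (λ μ → ev L μ φ m)) (cong (act L p φ m ℚ.+_) (⟪⟫-neg q (λ μ → ev L μ φ m)))

    act-lin-upper : ∀ φ i m → act L (lin i) φ m ≡ act L (upper ⁅ el i ⁆) φ m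
    act-lin-upper φ i m = ⟪filter⟫ ⁅ el i ⁆ (λ p → mem p i) (λ p → trans (mem≡ p i) (lookup≡⊆ (fl p) (el i))) (λ μ → ev L μ φ m)

    act-upper-point : ∀ {φ} → Dual φ → ∀ i m → act L (upper ⁅ i ⁆) φ m ≡ ℚ.- φ (⊤ ∷ m)
    act-upper-point {φ} D i m = trans (act-upper D ⁅ i ⁆ m (complete-≢⊥ (point≢⊥ i)))
      (trans (cong (ℚ._- φ (⊤ ∷ m)) (Dual.φ-point D i m (ρ-point i))) (ℚP.+-identityˡ (ℚ.- φ (⊤ ∷ m))))

    act-lin : ∀ {φ} → Dual φ → ∀ i m → act L (lin i) φ m ≡ ℚ.- φ (⊤ ∷ m)
    act-lin {φ} D i m = trans {j = act L (upper ⁅ el i ⁆) φ m} (act-lin-upper φ i m) (act-upper-point D (el i) m)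

    L-xE : ∀ {φ} → Dual φ → ∀ m → act L xE φ m ≡ φ (⊤ ∷ m)
    L-xE {φ} D m = go n pre refl
      where
      open import Algebra.Properties.Ring ℚP.+-*-ring using (-‿involutive)
      go : ∀ k (pre : Fin k → Fin g) → k ≡ n → act L (topElement k pre) φ m ≡ φ (⊤ ∷ m)
      -- On the empty ground set the full set is the empty set.
      go zero    pre refl = sym (Dual.φ-⊥ D m)
      go (suc k) pre refl = trans (⟪⟫-neg (lin (pre zero)) (λ μ → ev L μ φ m)) (trans (cong ℚ.-_ (act-lin D (pre zero) m)) (-‿involutive (φ (⊤ ∷ m))))

    L-gens : ∀ {f} → f ∈ chowGens inc mem → ∀ {φ} → Dual φ → act L f φ [] ≡ 0ℚ
    L-gens f∈ {φ} D with ∈-++⁻ (products inc (allFin N) (allFin N) (λ p q → var p *ᵖ var q)) f∈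
    ... | inj₁ f∈I with products⁻ inc (allFin N) (allFin N) (λ p q → var p *ᵖ var q) f∈I
    ...   | p , q , e , refl = act-xx p q (proj₁ (inc⇒ e)) (proj₂ (inc⇒ e)) D
    L-gens f∈ {φ} D | inj₂ f∈J with find (∈-concatMap⁻ (λ i → List.map (λ j → lin i -ᵖ lin j) (allFin g)) {xs = allFin g} f∈J)
    ...   | i , _ , f∈i with ∈-map⁻ (λ j → lin i -ᵖ lin j) f∈i
    ...     | j , _ , refl = cancel-equal (act L (lin i -ᵖ lin j) φ []) (act L (lin i) φ []) (act L (lin j) φ []) (ℚ.- φ (⊤ ∷ [])) (act-difference (lin i) (lin j) φ []) (act-lin D i []) (act-lin D j [])

    chowHilbertSeries : IsHilbertSeries P (λ d → length (Enumeration.standardChains M d))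
    chowHilbertSeries = hilbertSeries L-xE L-gens

  module AugModel {n : ℕ} (M : Polymatroid n) {N g : ℕ} (inc : Fin N → Fin N → Bool) (mem : Fin N → Fin g → Bool)
    (fl : Fin N → Subset n) (index : FlatIndex M fl inc)
    (complete : ∀ A → Standard.IsFlat M A → A ≢ ⊤ → FlatIndex.proper index A ≡ true)
    (el : Fin g → Fin n) (pre : Fin n → Fin g) (el-pre : ∀ i → el (pre i) ≡ i)
    (mem≡ : ∀ p i → mem p i ≡ lookup (fl p) (el i))
    (ρ-point : ∀ i → Polymatroid.ρ M ⁅ i ⁆ ≢ 1) where

    open FlatIndex index
    open Standard M

    P : Presentation
    P = pres (N + g) (augGens inc mem)

    open Ideal P
    private module R = CommutativeRing quotientRing

    xᵃ : Fin N → Poly (N + g)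
    xᵃ p = var (p ↑ˡ g)

    yᵃ : Fin g → Poly (N + g)
    yᵃ t = var (N ↑ʳ t)

    notAbove : Fin g → Poly (N + g)
    notAbove t = sumᵖ (List.map xᵃ (filterᵇ (λ p → not (mem p t)) (allFin N)))

    linGens quadGens : List (Poly (N + g))
    linGens  = List.map (λ t → yᵃ t -ᵖ notAbove t) (allFin g)
    quadGens = products inc (allFin N) (allFin N) (λ p q → xᵃ p *ᵖ xᵃ q)

    -- The trivial filter brings the sum into the form to which the lemmas on filtered sums apply.
    allX : Poly (N + g)
    allX = sumᵖ (List.map xᵃ (filterᵇ (λ p → true) (allFin N)))

    xE : Poly (N + g)
    xE = -ᵖ allX

    open Flats M P {N} (_↑ˡ g) fl xE

    true≡⊥⊆ : ∀ p → true ≡ does (⊥ₛ SubP.⊆? fl p)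
    true≡⊥⊆ p = sym (dec-true (⊥ₛ SubP.⊆? fl p) SubP.⊥⊆)

    xE∼ : xE ∼ -ᵖ upper ⊥ₛ
    xE∼ = ∼-neg {allX} {upper ⊥ₛ} (upper-filter ⊥ₛ (λ p → true) true≡⊥⊆)

    point≢⊥ : ∀ i → ⁅ i ⁆ ≢ ⊥ₛ {n}
    point≢⊥ i e = SubP.∉⊥ (subst (i ∈ₛ_) e (SubP.x∈⁅x⁆ i))

    y∼notAbove : ∀ t → yᵃ t ∼ notAbove t
    y∼notAbove t = mk∼ (I-gen (∈-++⁺ˡ (∈-map⁺ (λ t → yᵃ t -ᵖ notAbove t) (∈-allFin t))))

    notAbove∼∑ : ∀ t → notAbove t ∼ ∑R.∑ ps (λ p → ∑R.when (not (mem p t)) (x p))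
    notAbove∼∑ t = sum-filter (λ p → not (mem p t))

    y∼∑ : ∀ t → yᵃ t ∼ ∑R.∑ ps (λ p → ∑R.when (not (mem p t)) (x p))
    y∼∑ t = ∼-trans {yᵃ t} {notAbove t} {∑R.∑ ps (λ p → ∑R.when (not (mem p t)) (x p))} (y∼notAbove t) (notAbove∼∑ t)

    y∼difference : ∀ t → yᵃ t ∼ upper ⊥ₛ -ᵖ upper ⁅ el t ⁆
    y∼difference t = ∼-trans {yᵃ t} {∑R.∑ ps (λ p → ∑R.when (not (mem p t)) (x p))} {upper ⊥ₛ -ᵖ upper ⁅ el t ⁆} (y∼∑ t)
      (complement ⁅ el t ⁆ (λ p → mem p t) (λ p → trans (mem≡ p t) (lookup≡⊆ (fl p) (el t))))

    -- The x_F with `i` outside F add up to the sum of all x_F minus the sum over F containing `i`.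
    -- Since x_E is minus the sum of all x_F, this is -h_i.
    H-y : ∀ t → H ⁅ el t ⁆ ∼ -ᵖ yᵃ t
    H-y t = H-from-difference ⁅ el t ⁆ (yᵃ t) (point≢⊥ (el t)) xE∼ (y∼difference t)

    y∼-H : ∀ t → yᵃ t ∼ -ᵖ H ⁅ el t ⁆
    y∼-H t = neg-swap (H ⁅ el t ⁆) (yᵃ t) (H-y t)

    yx∼0 : ∀ t p → not (mem p t) ≡ true → yᵃ t *ᵖ xᵃ p ∼ []
    yx∼0 t p e = I⇒∼0 (I-gen (∈-++⁺ʳ linGens (∈-++⁺ʳ quadGens
      (products⁺ (λ t p → not (mem p t)) (λ t p → yᵃ t *ᵖ xᵃ p) (∈-allFin t) (∈-allFin p) e))))

    -- y_i is itself a sum of variables x_F with `i` outside F, and it kills each of them.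
    H-point²∼ : ∀ t → H ⁅ el t ⁆ *ᵖ H ⁅ el t ⁆ ∼ []
    H-point²∼ t = neg-zero-² (H ⁅ el t ⁆) (yᵃ t) (H-y t) (square-zero (yᵃ t) (λ p → not (mem p t)) (y∼∑ t) (yx∼0 t))

    H-point-x∼ : ∀ t p → el t ∉ₛ fl p → H ⁅ el t ⁆ *ᵖ x p ∼ []
    H-point-x∼ t p i∉ = neg-zero-* (H ⁅ el t ⁆) (yᵃ t) (x p) (H-y t) (yx∼0 t p (trans (cong not (mem≡ p t)) (outside (lookup (fl p) (el t)) refl)))
      where
      outside : ∀ b → lookup (fl p) (el t) ≡ b → not b ≡ true
      outside true  e = contradiction (lookup⇒[]= (el t) (fl p) e) i∉
      outside false e = refl

    private
      L′ : Fin N ⊎ Fin g → LinearForm n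
      L′ (inj₁ p) = möbius (fl p)
      -- y_i goes to -h_i, in accordance with `H-y`.
      L′ (inj₂ t) = (ℚ.- 1ℚ , ⁅ el t ⁆) ∷ []
      L : Fin (N + g) → LinearForm n
      L v = L′ (splitAt N v)

    model : Model
    model = record
      { rels = record
        { fl-injective = fl-injective ; fl-flat = fl-flat ; fl-≢⊤ = fl-≢⊤
        ; xx≈0      = λ {p} {q} p⊈q q⊈p → I⇒∼0 (I-gen (∈-++⁺ʳ linGens (∈-++⁺ˡ (products⁺ inc (λ p q → xᵃ p *ᵖ xᵃ q) (∈-allFin p) (∈-allFin q) (⇒inc p⊈q q⊈p)))))
        ; H-point≈0 = λ i e → contradiction e (ρ-point i)
        ; H-point²  = λ i → subst (λ j → H ⁅ j ⁆ *ᵖ H ⁅ j ⁆ ∼ []) (el-pre i) (H-point²∼ (pre i))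
        ; H-point-x = λ i p i∉ → subst (λ j → H ⁅ j ⁆ *ᵖ x p ∼ []) (el-pre i) (H-point-x∼ (pre i) p (subst (_∉ₛ fl p) (sym (el-pre i)) i∉))
        ; upper-⊥   = λ p _ → upper+xE xE∼ }
      ; proper = proper ; proper⇒ = proper⇒ ; ⇒proper = ⇒proper ; fl-sum = fl-sum
      ; xE-degree = ofDegree-scale (ℚ.- 1ℚ) (sum-degree xᵃ (λ p → var-degree (p ↑ˡ g)) (filterᵇ (λ p → true) (allFin N)))
      ; H-other   = other
      ; L         = L
      ; L-em      = λ p → cong L′ (FinP.splitAt-↑ˡ N p g) }
      where
      other′ : ∀ v s → splitAt N v ≡ s → (∃ λ p → v ≡ p ↑ˡ g) ⊎ (∃ λ S → var v ∼ -ᵖ H S)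
      other′ v (inj₁ p) eq = inj₁ (p , sym (FinP.splitAt⁻¹-↑ˡ eq))
      other′ v (inj₂ t) eq = inj₂ (⁅ el t ⁆ , subst (λ w → var w ∼ -ᵖ H ⁅ el t ⁆) (FinP.splitAt⁻¹-↑ʳ eq) (y∼-H t))
      other : ∀ v → (∃ λ p → v ≡ p ↑ˡ g) ⊎ (∃ λ S → var v ∼ -ᵖ H S)
      other v = other′ v (splitAt N v) refl

    open Theory model

    act-difference : ∀ p q φ m → act L (p -ᵖ q) φ m ≡ act L p φ m ℚ.+ (ℚ.- act L q φ m)
    act-difference p q φ m = trans (⟪⟫-++ p (-ᵖ q) (λ μ → ev L μ φ m)) (cong (act L p φ m ℚ.+_) (⟪⟫-neg q (λ μ → ev L μ φ m)))

    act-y : ∀ t φ m → act L (yᵃ t) φ m ≡ ℚ.- φ (⁅ el t ⁆ ∷ m)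
    act-y t φ m = trans (act-var L (N ↑ʳ t) φ m) (trans (cong (λ s → op (L′ s) φ m) (FinP.splitAt-↑ʳ N g t))
      (trans (ℚP.+-identityʳ (ℚ.- 1ℚ ℚ.* φ (⁅ el t ⁆ ∷ m))) (-1*x≈-x (φ (⁅ el t ⁆ ∷ m)))))
      where open import Algebra.Properties.Ring ℚP.+-*-ring using (-1*x≈-x)

    act-all : ∀ {φ} → Dual φ → ∀ m → act L (upper ⊥ₛ) φ m ≡ ℚ.- φ (⊤ ∷ m)
    act-all {φ} D m = trans (act-upper D ⊥ₛ m (λ A _ → complete A)) (trans (cong (ℚ._- φ (⊤ ∷ m)) (Dual.φ-⊥ D m)) (ℚP.+-identityˡ (ℚ.- φ (⊤ ∷ m))))

    act-xE : ∀ φ m → act L xE φ m ≡ ℚ.- act L allX φ m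
    act-xE φ m = ⟪⟫-neg allX (λ μ → ev L μ φ m)

    act-allX : ∀ φ m → act L allX φ m ≡ act L (upper ⊥ₛ) φ m
    act-allX φ m = ⟪filter⟫ ⊥ₛ (λ p → true) true≡⊥⊆ (λ μ → ev L μ φ m)

    L-xE : ∀ {φ} → Dual φ → ∀ m → act L xE φ m ≡ φ (⊤ ∷ m)
    L-xE {φ} D m = double-negative (act L xE φ m) (act L allX φ m) (act L (upper ⊥ₛ) φ m) (φ (⊤ ∷ m)) (act-xE φ m) (act-allX φ m) (act-all D m)

    act-notAbove-split : ∀ φ t m → act L (notAbove t) φ m ≡ act L (upper ⊥ₛ) φ m ℚ.- act L (upper ⁅ el t ⁆) φ m
    act-notAbove-split φ t m = ⟪complement⟫ ⁅ el t ⁆ (λ p → mem p t) (λ p → trans (mem≡ p t) (lookup≡⊆ (fl p) (el t))) (λ μ → ev L μ φ m)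

    act-point : ∀ {φ} → Dual φ → ∀ i m → act L (upper ⁅ i ⁆) φ m ≡ φ (⁅ i ⁆ ∷ m) ℚ.- φ (⊤ ∷ m)
    act-point D i m = act-upper D ⁅ i ⁆ m (λ A _ → complete A)

    act-notAbove : ∀ {φ} → Dual φ → ∀ t m → act L (notAbove t) φ m ≡ ℚ.- φ (⁅ el t ⁆ ∷ m)
    act-notAbove {φ} D t m = difference-of-values (act L (notAbove t) φ m) (act L (upper ⊥ₛ) φ m) (act L (upper ⁅ el t ⁆) φ m) (φ (⊤ ∷ m)) (φ (⁅ el t ⁆ ∷ m))
      (act-notAbove-split φ t m) (act-all D m) (act-point D (el t) m)

    -- By `φ-absorb` the value at h_i h_S does not change when `i` is added to `S`, so the
    -- alternating sum above a flat without `i` cancels.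
    act-yx : ∀ t p → mem p t ≡ false → ∀ {φ} → Dual φ → act L (yᵃ t *ᵖ xᵃ p) φ [] ≡ 0ℚ
    act-yx t p e {φ} D = trans (act-* L (yᵃ t) (xᵃ p) {φ} (Dual.φ-↭ D) []) (trans (act-x p (act L (yᵃ t) φ) [])
      (möbius-vanishes (fl p) (el t) i∉ (λ S _ → trans (act-y t φ (S ∪ ⁅ el t ⁆ ∷ [])) (trans (cong ℚ.-_ (sym (Dual.φ-absorb D (el t) S []))) (sym (act-y t φ (S ∷ [])))))))
      where
      i∉ : el t ∉ₛ fl p
      i∉ i∈ = contradiction (trans (sym ([]=⇒lookup i∈)) (trans (sym (mem≡ p t)) e)) λ ()

    L-gens : ∀ {f} → f ∈ augGens inc mem → ∀ {φ} → Dual φ → act L f φ [] ≡ 0ℚ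
    L-gens f∈ {φ} D with ∈-++⁻ linGens f∈
    ... | inj₁ f∈lin with ∈-map⁻ (λ t → yᵃ t -ᵖ notAbove t) f∈lin
    ...   | t , _ , refl = cancel-equal (act L (yᵃ t -ᵖ notAbove t) φ []) (act L (yᵃ t) φ []) (act L (notAbove t) φ []) (ℚ.- φ (⁅ el t ⁆ ∷ [])) (act-difference (yᵃ t) (notAbove t) φ []) (act-y t φ []) (act-notAbove D t [])
    L-gens f∈ {φ} D | inj₂ f∈′ with ∈-++⁻ quadGens f∈′
    ... | inj₁ f∈q with products⁻ inc (allFin N) (allFin N) (λ p q → xᵃ p *ᵖ xᵃ q) f∈q
    ...   | p , q , e , refl = act-xx p q (proj₁ (inc⇒ e)) (proj₂ (inc⇒ e)) D
    L-gens f∈ {φ} D | inj₂ f∈′ | inj₂ f∈yx with products⁻ (λ t p → not (mem p t)) (allFin g) (allFin N) (λ t p → yᵃ t *ᵖ xᵃ p) f∈yx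
    ...   | t , p , e , refl = act-yx t p (not-true (mem p t) e) D
      where
      not-true : ∀ b → not b ≡ true → b ≡ false
      not-true false _ = refl

    augHilbertSeries : IsHilbertSeries P (λ d → length (Enumeration.standardChains M d))
    augHilbertSeries = hilbertSeries L-xE L-gens

-- Loopless matroids as instances

module MatroidInstances where

  open import Defs
  open ListSums
  open PolyRing
  open ChainFunctionals hiding (add)
  open StandardChains
  open Evaluation
  open ChainEnumeration
  open ChowPresentations
  open import Data.Bool using (Bool; true; false; if_then_else_; T; not; _∧_; _∨_)
  import Data.Bool.Properties as BoolP
  open import Data.Empty using (⊥-elim)
  open import Data.Fin using (Fin; suc)
  open import Data.Fin.Subset using (Subset; _⊆_; ⁅_⁆; _∪_; _∩_; ⊤) renaming (_∈_ to _∈ₛ_; _∉_ to _∉ₛ_)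
  import Data.Fin.Subset.Properties as SubP
  open import Data.Nat using (ℕ; suc; _+_; _≤_; _<_; z≤n; s≤s; _≡ᵇ_)
  import Data.Nat.Properties as ℕP
  open import Data.List as List using (List; []; _∷_; length; filterᵇ; allFin)
  open import Data.List.Membership.Propositional using (_∈_)
  open import Data.List.Membership.Propositional.Properties using (∈-allFin; ∈-lookup)
  open import Data.List.Relation.Unary.Any using (here; there; index)
  open import Data.List.Relation.Unary.Any.Properties using (lookup-index)
  import Data.List.Relation.Unary.Unique.Propositional.Properties as UniqueP
  import Data.Rational as ℚ
  open import Data.Product using (_×_; _,_; proj₁; proj₂)
  open import Data.Vec using ([]; _∷_; lookup)
  open import Data.Vec.Properties using (lookup⇒[]=; []=⇒lookup; lookup-replicate; lookup∘tabulate)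
  open import Relation.Nullary using (¬_; Dec; yes; no; does; contradiction)
  open import Relation.Nullary.Decidable using (dec-true; dec-false)
  open import Relation.Binary.PropositionalEquality hiding ([_])

  open ∑ℚ using (when)

  T⇒≡true : ∀ {b} → T b → b ≡ true
  T⇒≡true {true} _ = refl

  ≡ᵇ-true⇒≡ : ∀ {a b} → (a ≡ᵇ b) ≡ true → a ≡ b
  ≡ᵇ-true⇒≡ {a} {b} e = ℕP.≡ᵇ⇒≡ a b (subst T (sym e) _)

  ≡⇒≡ᵇ-true : ∀ {a b} → a ≡ b → (a ≡ᵇ b) ≡ true
  ≡⇒≡ᵇ-true {a} {b} e = T⇒≡true (ℕP.≡⇒≡ᵇ a b e)

  ≢⇒≡ᵇ-false : ∀ {a b} → a ≢ b → (a ≡ᵇ b) ≡ false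
  ≢⇒≡ᵇ-false {a} {b} ne with a ≡ᵇ b in eq
  ... | true  = contradiction (≡ᵇ-true⇒≡ {a} {b} eq) ne
  ... | false = refl

  module _ {A : Set} (p : A → Bool) where

    allᵇ⁺ : ∀ xs → (∀ x → x ∈ xs → p x ≡ true) → allᵇ p xs ≡ true
    allᵇ⁺ []       h = refl
    allᵇ⁺ (x ∷ xs) h = cong₂ _∧_ (h x (here refl)) (allᵇ⁺ xs (λ y y∈ → h y (there y∈)))

    allᵇ⁻ : ∀ xs → allᵇ p xs ≡ true → ∀ {x} → x ∈ xs → p x ≡ true
    allᵇ⁻ (y ∷ xs) e (here refl) = proj₁ (∧-true {p y} e)
      where
      ∧-true : ∀ {a b} → a ∧ b ≡ true → a ≡ true × b ≡ true
      ∧-true {true} {true} _ = refl , refl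
    allᵇ⁻ (y ∷ xs) e (there x∈) with p y
    ... | true = allᵇ⁻ xs e x∈

    anyᵇ-false : ∀ xs → (∀ x → p x ≡ false) → anyᵇ p xs ≡ false
    anyᵇ-false []       h = refl
    anyᵇ-false (x ∷ xs) h = cong₂ _∨_ (h x) (anyᵇ-false xs h)

    anyᵇ-true : ∀ {xs x} → x ∈ xs → p x ≡ true → anyᵇ p xs ≡ true
    anyᵇ-true {y ∷ xs} (here refl) e = cong (_∨ anyᵇ p xs) e
    anyᵇ-true {y ∷ xs} (there x∈)  e = trans (cong (p y ∨_) (anyᵇ-true x∈ e)) (BoolP.∨-zeroʳ (p y))

  ∧-true⁻ : ∀ {a b} → a ∧ b ≡ true → a ≡ true × b ≡ true
  ∧-true⁻ {true} {true} _ = refl , refl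

  not-true⁻ : ∀ {a} → not a ≡ true → a ≡ false
  not-true⁻ {false} _ = refl

  ∈⇒lookup : ∀ {n} {S : Subset n} {i} → i ∈ₛ S → lookup S i ≡ true
  ∈⇒lookup = []=⇒lookup

  ∉⇒lookup : ∀ {n} {S : Subset n} {i} → i ∉ₛ S → lookup S i ≡ false
  ∉⇒lookup {S = S} {i} i∉ with lookup S i in eq
  ... | true  = contradiction (lookup⇒[]= i S eq) i∉
  ... | false = refl

  ⊆ᵇ-does : ∀ {n} (S T : Subset n) → (S ⊆ᵇ T) ≡ does (S SubP.⊆? T)
  ⊆ᵇ-does {n} S T with S SubP.⊆? T
  ... | yes S⊆T = allᵇ⁺ _ (allFin n) (λ i _ → ok i (i SubP.∈? S))
    where
    ok : ∀ i → Dec (i ∈ₛ S) → not (lookup S i) ∨ lookup T i ≡ true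
    ok i (yes i∈) = trans (cong (not (lookup S i) ∨_) (∈⇒lookup (S⊆T i∈))) (BoolP.∨-zeroʳ _)
    ok i (no i∉)  = cong (λ b → not b ∨ lookup T i) (∉⇒lookup i∉)
  ... | no S⊈T with S ⊆ᵇ T in eq
  ...   | false = refl
  ...   | true  = ⊥-elim (S⊈T (λ {i} i∈ → lookup⇒[]= i T (trans (cong (λ b → not b ∨ lookup T i) (sym (∈⇒lookup i∈))) (allᵇ⁻ _ (allFin n) eq (∈-allFin i)))))

  isFlatIn⁻ : ∀ {n} (rk : RankFn n) E F → isFlatIn rk E F ≡ true → F ⊆ E × (∀ i → i ∈ₛ E → i ∉ₛ F → rk (F ∪ ⁅ i ⁆) ≢ rk F)
  isFlatIn⁻ {n} rk E F e = does⇒ (F SubP.⊆? E) (trans (sym (⊆ᵇ-does F E)) (proj₁ (∧-true⁻ e))) , ne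
    where
    ne : ∀ i → i ∈ₛ E → i ∉ₛ F → rk (F ∪ ⁅ i ⁆) ≢ rk F
    ne i i∈ i∉ eq with allᵇ⁻ (λ i → not (lookup E i ∧ not (lookup F i)) ∨ not (rk (F ∪ ⁅ i ⁆) ≡ᵇ rk F)) (allFin n) (proj₂ (∧-true⁻ {F ⊆ᵇ E} e)) (∈-allFin i)
    ... | h rewrite ∈⇒lookup i∈ | ∉⇒lookup i∉ | ≡⇒≡ᵇ-true eq = contradiction h λ ()

  isFlatIn⁺ : ∀ {n} (rk : RankFn n) E F → F ⊆ E → (∀ i → i ∈ₛ E → i ∉ₛ F → rk (F ∪ ⁅ i ⁆) ≢ rk F) → isFlatIn rk E F ≡ true
  isFlatIn⁺ {n} rk E F F⊆E ne = cong₂ _∧_ (trans (⊆ᵇ-does F E) (dec-true (F SubP.⊆? E) F⊆E)) (allᵇ⁺ _ (allFin n) (λ i _ → ok i (i SubP.∈? E) (i SubP.∈? F)))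
    where
    ok : ∀ i → Dec (i ∈ₛ E) → Dec (i ∈ₛ F) → not (lookup E i ∧ not (lookup F i)) ∨ not (rk (F ∪ ⁅ i ⁆) ≡ᵇ rk F) ≡ true
    ok i (no i∉E)  _        rewrite ∉⇒lookup i∉E = refl
    ok i (yes i∈E) (yes i∈F) rewrite ∈⇒lookup i∈E | ∈⇒lookup i∈F = refl
    ok i (yes i∈E) (no i∉F)  rewrite ∈⇒lookup i∈E | ∉⇒lookup i∉F | ≢⇒≡ᵇ-false (ne i i∈E i∉F) = refl

  incomparableᵇ : ∀ {n} → Subset n → Subset n → Bool
  incomparableᵇ F G = not (F ⊆ᵇ G) ∧ not (G ⊆ᵇ F)

  incomparableᵇ⁻ : ∀ {n} {F G : Subset n} → incomparableᵇ F G ≡ true → ¬ F ⊆ G × ¬ G ⊆ F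
  incomparableᵇ⁻ {F = F} {G} e = neg F G (proj₁ (∧-true⁻ e)) , neg G F (proj₂ (∧-true⁻ {not (F ⊆ᵇ G)} e))
    where
    neg : ∀ F G → not (F ⊆ᵇ G) ≡ true → ¬ F ⊆ G
    neg F G e F⊆G = contradiction (trans (sym e) (cong not (trans (⊆ᵇ-does F G) (dec-true (F SubP.⊆? G) F⊆G)))) λ ()

  incomparableᵇ⁺ : ∀ {n} {F G : Subset n} → ¬ F ⊆ G → ¬ G ⊆ F → incomparableᵇ F G ≡ true
  incomparableᵇ⁺ {F = F} {G} ¬p ¬q = cong₂ _∧_ (cong not (trans (⊆ᵇ-does F G) (dec-false (F SubP.⊆? G) ¬p))) (cong not (trans (⊆ᵇ-does G F) (dec-false (G SubP.⊆? F) ¬q)))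

  Loopless : ∀ {n} → Matroid n → Set
  Loopless M = ∀ i → 1 ≤ Matroid.rank M ⁅ i ⁆

  module MatroidFacts {n : ℕ} (M : Matroid n) where
    open Matroid M

    rank-⊥ : rank ⊥ₛ ≡ 0
    rank-⊥ = ℕP.n≤0⇒n≡0 (ℕP.≤-trans (rank-bound ⊥ₛ) (ℕP.≤-reflexive (SubP.∣⊥∣≡0 n)))

    rank-point : ∀ i → rank ⁅ i ⁆ ≤ 1
    rank-point i = ℕP.≤-trans (rank-bound ⁅ i ⁆) (ℕP.≤-reflexive (SubP.∣⁅x⁆∣≡1 i))

    rank-step : ∀ S i → rank (S ∪ ⁅ i ⁆) ≤ suc (rank S)
    rank-step S i = ℕP.≤-trans (ℕP.m≤m+n _ _) (ℕP.≤-trans (rank-submod S ⁅ i ⁆) (ℕP.≤-trans (ℕP.+-monoʳ-≤ (rank S) (rank-point i)) (ℕP.≤-reflexive (ℕP.+-comm (rank S) 1))))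

  module Loopless-Polymatroids {n : ℕ} (M : Matroid n) (loopless : Loopless M) where
    open Matroid M
    open MatroidFacts M

    chowPolymatroid : Polymatroid n
    chowPolymatroid = record
      { ρ = rank ; ρ-⊥ = rank-⊥ ; ρ-mono = rank-mono ; ρ-submod = rank-submod
      ; ρ-point≥ = loopless ; ρ-point≤ = λ i → ℕP.≤-trans (rank-point i) (s≤s z≤n) ; ρ-step = λ S i _ → rank-step S i }

    augRank : Subset n → ℕ
    augRank S = if does (S ≟ₛ ⊥ₛ) then 0 else suc (rank S)

    augRank-⊥ : augRank ⊥ₛ ≡ 0
    augRank-⊥ = cong (λ b → if b then 0 else suc (rank ⊥ₛ)) (dec-true (⊥ₛ {n} ≟ₛ ⊥ₛ) refl)

    augRank-≢⊥ : ∀ {S} → S ≢ ⊥ₛ → augRank S ≡ suc (rank S)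
    augRank-≢⊥ {S} ne = cong (λ b → if b then 0 else suc (rank S)) (dec-false (S ≟ₛ ⊥ₛ) ne)

    point≢⊥ : ∀ (i : Fin n) → ⁅ i ⁆ ≢ ⊥ₛ
    point≢⊥ i e = SubP.∉⊥ (subst (i ∈ₛ_) e (SubP.x∈⁅x⁆ i))

    ∪-≢⊥ : ∀ {S : Subset n} T → S ≢ ⊥ₛ → S ∪ T ≢ ⊥ₛ
    ∪-≢⊥ {S} T S≢⊥ e = S≢⊥ (⊆⊥⇒≡⊥ (λ x∈ → subst (_ ∈ₛ_) e (SubP.p⊆p∪q T x∈)))

    augRank-mono : ∀ {S T} → S ⊆ T → augRank S ≤ augRank T
    augRank-mono {S} {T} S⊆T = go (S ≟ₛ ⊥ₛ)
      where
      go : Dec (S ≡ ⊥ₛ) → augRank S ≤ augRank T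
      go (yes refl) = ℕP.≤-trans (ℕP.≤-reflexive augRank-⊥) z≤n
      go (no S≢⊥) = subst₂ _≤_ (sym (augRank-≢⊥ S≢⊥)) (sym (augRank-≢⊥ (λ { refl → S≢⊥ (⊆⊥⇒≡⊥ S⊆T) }))) (s≤s (rank-mono S⊆T))

    augRank≤ : ∀ S → augRank S ≤ suc (rank S)
    augRank≤ S with does (S ≟ₛ ⊥ₛ)
    ... | true  = z≤n
    ... | false = ℕP.≤-refl

    -- For nonempty sets the right side gains 2 over the matroid ranks and the left side at most 2,
    -- with less for disjoint sets. If one set is empty, the two sides are equal.
    augRank-submod : ∀ S T → augRank (S ∪ T) + augRank (S ∩ T) ≤ augRank S + augRank T
    augRank-submod S T = go (S ≟ₛ ⊥ₛ) (T ≟ₛ ⊥ₛ)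
      where
      open ℕP.≤-Reasoning
      go : Dec (S ≡ ⊥ₛ) → Dec (T ≡ ⊥ₛ) → augRank (S ∪ T) + augRank (S ∩ T) ≤ augRank S + augRank T
      go (yes refl) _ = ℕP.≤-reflexive (trans (cong₂ (λ A B → augRank A + augRank B) (SubP.∪-identityˡ T) (SubP.∩-zeroˡ T)) (ℕP.+-comm (augRank T) _))
      go (no _) (yes refl) = ℕP.≤-reflexive (cong₂ (λ A B → augRank A + augRank B) (SubP.∪-identityʳ S) (SubP.∩-zeroʳ S))
      go (no S≢⊥) (no T≢⊥) = begin
        augRank (S ∪ T) + augRank (S ∩ T)        ≤⟨ ℕP.+-mono-≤ (augRank≤ (S ∪ T)) (augRank≤ (S ∩ T)) ⟩
        suc (rank (S ∪ T)) + suc (rank (S ∩ T))  ≡⟨ cong suc (ℕP.+-suc (rank (S ∪ T)) (rank (S ∩ T))) ⟩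
        suc (suc (rank (S ∪ T) + rank (S ∩ T)))  ≤⟨ s≤s (s≤s (rank-submod S T)) ⟩
        suc (suc (rank S + rank T))              ≡⟨ cong suc (ℕP.+-suc (rank S) (rank T)) ⟨
        suc (rank S) + suc (rank T)              ≡⟨ cong₂ _+_ (augRank-≢⊥ S≢⊥) (augRank-≢⊥ T≢⊥) ⟨
        augRank S + augRank T                    ∎

    augPolymatroid : Polymatroid n
    augPolymatroid = record
      { ρ = augRank ; ρ-⊥ = augRank-⊥ ; ρ-mono = augRank-mono ; ρ-submod = augRank-submod
      ; ρ-point≥ = λ i → subst (1 ≤_) (sym (augRank-≢⊥ (point≢⊥ i))) (s≤s z≤n)
      ; ρ-point≤ = λ i → ℕP.≤-trans (augRank≤ ⁅ i ⁆) (s≤s (rank-point i))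
      ; ρ-step = λ S i S≢⊥ → subst₂ _≤_ (sym (augRank-≢⊥ (∪-≢⊥ ⁅ i ⁆ S≢⊥))) (cong suc (sym (augRank-≢⊥ S≢⊥))) (s≤s (rank-step S i)) }

    RankFlat : Subset n → Set
    RankFlat F = ∀ i → i ∉ₛ F → rank (F ∪ ⁅ i ⁆) ≢ rank F

    chow-flat⁺ : ∀ {F} → RankFlat F → Standard.IsFlat chowPolymatroid F
    chow-flat⁺ {F} flat i i∉ = ℕP.≤∧≢⇒< (rank-mono {F} (SubP.p⊆p∪q ⁅ i ⁆)) (λ e → flat i i∉ (sym e))

    chow-flat⁻ : ∀ {F} → Standard.IsFlat chowPolymatroid F → RankFlat F
    chow-flat⁻ flat i i∉ e = ℕP.<⇒≢ (flat i i∉) (sym e)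

    aug-flat⁺ : ∀ {F} → RankFlat F → Standard.IsFlat augPolymatroid F
    aug-flat⁺ {F} flat i i∉ = go (F ≟ₛ ⊥ₛ)
      where
      go : Dec (F ≡ ⊥ₛ) → augRank F < augRank (F ∪ ⁅ i ⁆)
      go (yes refl) = subst₂ _<_ (sym augRank-⊥) (sym (trans (cong augRank (SubP.∪-identityˡ ⁅ i ⁆)) (augRank-≢⊥ (point≢⊥ i)))) (s≤s z≤n)
      go (no F≢⊥)   = subst₂ _<_ (sym (augRank-≢⊥ F≢⊥)) (sym (augRank-≢⊥ (∪-≢⊥ ⁅ i ⁆ F≢⊥))) (s≤s (chow-flat⁺ flat i i∉))

    -- The raised rank always makes the empty set a flat; that it is a flat of the matroid comes
    -- from looplessness.
    aug-flat⁻ : ∀ {F} → Standard.IsFlat augPolymatroid F → RankFlat F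
    aug-flat⁻ {F} flat i i∉ e = go (F ≟ₛ ⊥ₛ)
      where
      go : ¬ Dec (F ≡ ⊥ₛ)
      go (yes refl) = contradiction (subst (1 ≤_) (trans (cong rank (sym (SubP.∪-identityˡ ⁅ i ⁆))) (trans e rank-⊥)) (loopless i)) λ ()
      go (no F≢⊥)   = ℕP.<⇒≢ (flat i i∉) (trans (augRank-≢⊥ F≢⊥) (trans (cong suc (sym e)) (sym (augRank-≢⊥ (∪-≢⊥ ⁅ i ⁆ F≢⊥)))))

    rankFlat-isFlatIn : ∀ {F} → isFlatIn rank ⊤ F ≡ true → RankFlat F
    rankFlat-isFlatIn {F} e i i∉ = proj₂ (isFlatIn⁻ rank ⊤ F e) i SubP.∈⊤ i∉

    isFlatIn-rankFlat : ∀ {F} → RankFlat F → isFlatIn rank ⊤ F ≡ true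
    isFlatIn-rankFlat {F} flat = isFlatIn⁺ rank ⊤ F SubP.⊆⊤ (λ i _ i∉ → flat i i∉)

  not-=ˢ⁻ : ∀ {n} {S T : Subset n} → not (S =ˢ T) ≡ true → S ≢ T
  not-=ˢ⁻ {S = S} {T} e S≡T = contradiction (trans (sym (not-true⁻ e)) (dec-true (S ≟ₛ T) S≡T)) λ ()

  not-=ˢ⁺ : ∀ {n} {S T : Subset n} → S ≢ T → not (S =ˢ T) ≡ true
  not-=ˢ⁺ {S = S} {T} ne = cong not (dec-false (S ≟ₛ T) ne)

  module _ {n : ℕ} (M : Polymatroid n) (b : Subset n → Bool)
    (b⇒ : ∀ {A} → b A ≡ true → Standard.IsFlat M A × A ≢ ⊤)
    (⇒b : ∀ {A} → Standard.IsFlat M A → A ≢ ⊤ → A ≢ ⊥ₛ → b A ≡ true) where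

    listIndex : FlatIndex M (List.lookup (filterᵇ b (allSubsets n)))
                  (λ p q → incomparableᵇ (List.lookup (filterᵇ b (allSubsets n)) p) (List.lookup (filterᵇ b (allSubsets n)) q))
    listIndex = record
      { fl-injective = λ {p} {q} → unique-lookup (UniqueP.filter⁺ _ (unique-allSubsets n)) p q
      ; fl-flat      = λ p → proj₁ (b⇒ (member p))
      ; fl-≢⊤        = λ p → proj₂ (b⇒ (member p))
      ; proper       = b ; proper⇒ = b⇒ ; ⇒proper = ⇒b
      ; fl-sum       = λ g → trans (∑ℚ.∑-lookup fls g) (∑ℚ.∑-filter b (allSubsets n) g)
      ; inc⇒         = incomparableᵇ⁻
      ; ⇒inc         = incomparableᵇ⁺ }
      where
      fls = filterᵇ b (allSubsets n)
      member : ∀ p → b (List.lookup fls p) ≡ true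
      member p = proj₂ (∈-filterᵇ⁻ b (allSubsets n) (∈-lookup p))

  standardSeries : ∀ {n} → Polymatroid n → ℕ → ℕ
  standardSeries M d = length (Enumeration.standardChains M d)

  module LooplessSeries {n : ℕ} (M : Matroid n) (loopless : Loopless M) where
    open Matroid M
    open MatroidFacts M
    open Loopless-Polymatroids M loopless

    hasLoop-false : hasLoop rank ≡ false
    hasLoop-false = anyᵇ-false (isLoop rank) (allFin n) (λ i → ≢⇒≡ᵇ-false (λ e → contradiction (subst (1 ≤_) e (loopless i)) λ ()))

    chowSeries : IsChowHilbertSeries rank (standardSeries chowPolymatroid)
    chowSeries = subst (λ c → if c then (∀ d → standardSeries chowPolymatroid d ≡ 0) else IsHilbertSeries (chowPresentation rank) (standardSeries chowPolymatroid))
      (sym hasLoop-false) series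
      where
      b : Subset n → Bool
      b F = isFlatIn rank ⊤ F ∧ not (F =ˢ ⊥ₛ) ∧ not (F =ˢ ⊤)
      b⁻ : ∀ {A} → b A ≡ true → Standard.IsFlat chowPolymatroid A × A ≢ ⊤ × A ≢ ⊥ₛ
      b⁻ {A} e = chow-flat⁺ (rankFlat-isFlatIn (proj₁ (∧-true⁻ e))) , not-=ˢ⁻ (proj₂ e′) , not-=ˢ⁻ (proj₁ e′)
        where e′ = ∧-true⁻ {not (A =ˢ ⊥ₛ)} (proj₂ (∧-true⁻ {isFlatIn rank ⊤ A} e))
      idx = listIndex chowPolymatroid b (λ e → proj₁ (b⁻ e) , proj₁ (proj₂ (b⁻ e)))
        (λ flat ≢⊤ ≢⊥ → cong₂ _∧_ (isFlatIn-rankFlat (chow-flat⁻ flat)) (cong₂ _∧_ (not-=ˢ⁺ ≢⊥) (not-=ˢ⁺ ≢⊤)))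
      fls = filterᵇ b (allSubsets n)
      series : IsHilbertSeries (chowPresentation rank) (standardSeries chowPolymatroid)
      series = ChowModel.chowHilbertSeries chowPolymatroid
        (λ p q → incomparableᵇ (List.lookup fls p) (List.lookup fls q)) (λ p i → lookup (List.lookup fls p) i) (List.lookup fls) idx
        (λ p → proj₂ (proj₂ (b⁻ (proj₂ (∈-filterᵇ⁻ b (allSubsets n) (∈-lookup p))))))
        (λ i → i) (λ i → i) (λ i → refl) (λ p i → refl) (λ i → ℕP.≤-antisym (rank-point i) (loopless i))

    nonLoops≡⊤ : nonLoops rank ≡ ⊤
    nonLoops≡⊤ = SubP.⊆-antisym SubP.⊆⊤ (λ {i} _ → lookup⇒[]= i (nonLoops rank) (trans (lookup∘tabulate _ i)
      (cong not (≢⇒≡ᵇ-false (λ e → contradiction (subst (1 ≤_) e (loopless i)) λ ())))))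

    augSeries : IsAugChowHilbertSeries rank (standardSeries augPolymatroid)
    augSeries = subst (λ E → IsHilbertSeries (augPresentation rank E) (standardSeries augPolymatroid)) (sym nonLoops≡⊤) series
      where
      b : Subset n → Bool
      b F = isFlatIn rank ⊤ F ∧ not (F =ˢ ⊤)
      b⁻ : ∀ {A} → b A ≡ true → Standard.IsFlat augPolymatroid A × A ≢ ⊤
      b⁻ {A} e = aug-flat⁺ (rankFlat-isFlatIn (proj₁ (∧-true⁻ e))) , not-=ˢ⁻ (proj₂ (∧-true⁻ {isFlatIn rank ⊤ A} e))
      b⁺ : ∀ {A} → Standard.IsFlat augPolymatroid A → A ≢ ⊤ → b A ≡ true
      b⁺ flat ≢⊤ = cong₂ _∧_ (isFlatIn-rankFlat (aug-flat⁻ flat)) (not-=ˢ⁺ ≢⊤)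
      idx = listIndex augPolymatroid b b⁻ (λ flat ≢⊤ _ → b⁺ flat ≢⊤)
      fls = filterᵇ b (allSubsets n)
      ground = groundList rank ⊤
      ∈ground : ∀ i → i ∈ ground
      ∈ground i = ∈-filterᵇ⁺ (lookup ⊤) (∈-allFin i) (lookup-replicate i true)
      series : IsHilbertSeries (augPresentation rank ⊤) (standardSeries augPolymatroid)
      series = AugModel.augHilbertSeries augPolymatroid
        (λ p q → incomparableᵇ (List.lookup fls p) (List.lookup fls q)) (λ p t → lookup (List.lookup fls p) (List.lookup ground t)) (List.lookup fls) idx
        (λ A → b⁺) (List.lookup ground) (λ i → index (∈ground i)) (λ i → sym (lookup-index (∈ground i))) (λ p i → refl)
        (λ i e → contradiction (trans (sym e) (trans (augRank-≢⊥ (point≢⊥ i)) (cong suc (ℕP.≤-antisym (rank-point i) (loopless i))))) λ ())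

-- Uniform matroids, direct sums, and matroids of rank at most one

module SmallRank where

  open import Defs
  open ListSums
  open PolyRing
  open ChainFunctionals hiding (add)
  open StandardChains
  open Evaluation
  open ChainEnumeration
  open ChowPresentations
  open MatroidInstances
  open import Data.Bool using (Bool; true; false; if_then_else_; T; not; _∧_; _∨_)
  open import Data.Empty using (⊥; ⊥-elim)
  open import Data.Fin as Fin using (Fin; zero; suc)
  open import Data.Fin.Subset using (Subset; _⊆_; ⁅_⁆; _∪_; _∩_; ⊤; ∣_∣; inside; outside) renaming (_∈_ to _∈ₛ_; _∉_ to _∉ₛ_)
  import Data.Fin.Subset.Properties as SubP
  open import Data.Nat using (ℕ; zero; suc; _+_; _⊓_; _≤_; z≤n; s≤s)
  import Data.Nat.Properties as ℕP
  open import Data.List as List using (List; []; _∷_; length; allFin)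
  open import Data.List.Membership.Propositional using (_∈_)
  open import Data.List.Membership.Propositional.Properties using (∈-allFin; ∈-lookup)
  open import Data.List.Relation.Unary.Any using (here; there; index)
  import Data.List.Relation.Unary.Unique.Propositional.Properties as UniqueP
  open import Data.Rational as ℚ using (0ℚ)
  open import Data.Product using (∃; _×_; _,_; proj₁; proj₂)
  open import Data.Sum using (_⊎_; inj₁; inj₂)
  open import Data.Vec using ([]; _∷_; lookup; take; drop; here; there)
  open import Data.Vec.Properties using (lookup⇒[]=; []=⇒lookup; lookup-replicate; lookup∘tabulate)
  open import Relation.Nullary using (yes; no; does; contradiction)
  open import Relation.Nullary.Decidable using (dec-false; decidable-stable)
  open import Relation.Binary.PropositionalEquality hiding ([_])

  open ∑ℚ using (when)

  ∣∪∣+∣∩∣ : ∀ {n} (S T : Subset n) → ∣ S ∪ T ∣ + ∣ S ∩ T ∣ ≡ ∣ S ∣ + ∣ T ∣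
  ∣∪∣+∣∩∣ []            []            = refl
  ∣∪∣+∣∩∣ (outside ∷ S) (outside ∷ T) = ∣∪∣+∣∩∣ S T
  ∣∪∣+∣∩∣ (outside ∷ S) (inside ∷ T)  = trans (cong suc (∣∪∣+∣∩∣ S T)) (sym (ℕP.+-suc ∣ S ∣ ∣ T ∣))
  ∣∪∣+∣∩∣ (inside ∷ S)  (outside ∷ T) = cong suc (∣∪∣+∣∩∣ S T)
  ∣∪∣+∣∩∣ (inside ∷ S)  (inside ∷ T)  = cong suc (trans (ℕP.+-suc _ _) (trans (cong suc (∣∪∣+∣∩∣ S T)) (sym (ℕP.+-suc ∣ S ∣ ∣ T ∣))))

  -- Truncation at `a` is concave. If `a` is at most one of the middle values, that term has its
  -- maximum `a`; otherwise the right side is `y + z`, which equals `x + w`.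
  ⊓-concave : ∀ a {x y z w} → y ≤ x → z ≤ x → w ≤ y → w ≤ z → x + w ≡ y + z → a ⊓ x + a ⊓ w ≤ a ⊓ y + a ⊓ z
  ⊓-concave a {x} {y} {z} {w} y≤x z≤x w≤y w≤z e with ℕP.≤-total a y | ℕP.≤-total a z
  ... | inj₁ a≤y | _ = ℕP.+-mono-≤ (ℕP.≤-trans (ℕP.m⊓n≤m a x) (ℕP.≤-reflexive (sym (ℕP.m≤n⇒m⊓n≡m a≤y)))) (ℕP.⊓-monoʳ-≤ a w≤z)
  ... | inj₂ _ | inj₁ a≤z = ℕP.≤-trans (ℕP.≤-reflexive (ℕP.+-comm (a ⊓ x) (a ⊓ w)))
        (ℕP.+-mono-≤ (ℕP.⊓-monoʳ-≤ a w≤y) (ℕP.≤-trans (ℕP.m⊓n≤m a x) (ℕP.≤-reflexive (sym (ℕP.m≤n⇒m⊓n≡m a≤z)))))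
  ... | inj₂ y≤a | inj₂ z≤a = ℕP.≤-trans (ℕP.+-mono-≤ (ℕP.m⊓n≤n a x) (ℕP.m⊓n≤n a w))
        (ℕP.≤-reflexive (trans e (cong₂ _+_ (sym (ℕP.m≥n⇒m⊓n≡n y≤a)) (sym (ℕP.m≥n⇒m⊓n≡n z≤a)))))

  uniformMatroid : ∀ a b → Matroid b
  uniformMatroid a b = record
    { rank        = uniformRank a b
    ; rank-bound  = λ S → ℕP.m⊓n≤n a ∣ S ∣
    ; rank-mono   = λ S⊆T → ℕP.⊓-monoʳ-≤ a (SubP.p⊆q⇒∣p∣≤∣q∣ S⊆T)
    ; rank-submod = λ S T → ⊓-concave a (SubP.∣p∣≤∣p∪q∣ S T) (SubP.∣q∣≤∣p∪q∣ S T) (SubP.∣p∩q∣≤∣p∣ S T) (SubP.∣p∩q∣≤∣q∣ S T) (∣∪∣+∣∩∣ S T) }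

  module _ {b : ℕ} where

    take-⊆ : ∀ a {S T : Subset (a + b)} → S ⊆ T → take a S ⊆ take a T
    take-⊆ (suc a) {s ∷ S} {t ∷ T} S⊆T here with S⊆T here
    ... | here = here
    take-⊆ (suc a) {s ∷ S} {t ∷ T} S⊆T (there x∈) = there (take-⊆ a (SubP.drop-∷-⊆ S⊆T) x∈)

    drop-⊆ : ∀ a {S T : Subset (a + b)} → S ⊆ T → drop a S ⊆ drop a T
    drop-⊆ zero    S⊆T x∈ = S⊆T x∈
    drop-⊆ (suc a) {s ∷ S} {t ∷ T} S⊆T x∈ = drop-⊆ a (SubP.drop-∷-⊆ S⊆T) x∈

    take-∪ : ∀ a (S T : Subset (a + b)) → take a (S ∪ T) ≡ take a S ∪ take a T
    take-∪ zero    S T = refl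
    take-∪ (suc a) (s ∷ S) (t ∷ T) = cong ((s ∨ t) ∷_) (take-∪ a S T)

    take-∩ : ∀ a (S T : Subset (a + b)) → take a (S ∩ T) ≡ take a S ∩ take a T
    take-∩ zero    S T = refl
    take-∩ (suc a) (s ∷ S) (t ∷ T) = cong ((s ∧ t) ∷_) (take-∩ a S T)

    drop-∪ : ∀ a (S T : Subset (a + b)) → drop a (S ∪ T) ≡ drop a S ∪ drop a T
    drop-∪ zero    S T = refl
    drop-∪ (suc a) (s ∷ S) (t ∷ T) = drop-∪ a S T

    drop-∩ : ∀ a (S T : Subset (a + b)) → drop a (S ∩ T) ≡ drop a S ∩ drop a T
    drop-∩ zero    S T = refl
    drop-∩ (suc a) (s ∷ S) (t ∷ T) = drop-∩ a S T

    ∣take∣+∣drop∣ : ∀ a (S : Subset (a + b)) → ∣ take a S ∣ + ∣ drop a S ∣ ≡ ∣ S ∣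
    ∣take∣+∣drop∣ zero    S             = refl
    ∣take∣+∣drop∣ (suc a) (inside ∷ S)  = cong suc (∣take∣+∣drop∣ a S)
    ∣take∣+∣drop∣ (suc a) (outside ∷ S) = ∣take∣+∣drop∣ a S

  directSum : ∀ {a b} → Matroid a → Matroid b → Matroid (a + b)
  directSum {a} {b} M₁ M₂ = record
    { rank        = M₁.rank ⊕ M₂.rank
    ; rank-bound  = λ S → ℕP.≤-trans (ℕP.+-mono-≤ (M₁.rank-bound (take a S)) (M₂.rank-bound (drop a S))) (ℕP.≤-reflexive (∣take∣+∣drop∣ a S))
    ; rank-mono   = λ {S} {T} S⊆T → ℕP.+-mono-≤ (M₁.rank-mono (take-⊆ a S⊆T)) (M₂.rank-mono (drop-⊆ a S⊆T))
    ; rank-submod = submod }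
    where
    module M₁ = Matroid M₁
    module M₂ = Matroid M₂
    open import Algebra.Properties.CommutativeSemigroup ℕP.+-commutativeSemigroup using (interchange)
    submod : ∀ S T → (M₁.rank ⊕ M₂.rank) (S ∪ T) + (M₁.rank ⊕ M₂.rank) (S ∩ T) ≤ (M₁.rank ⊕ M₂.rank) S + (M₁.rank ⊕ M₂.rank) T
    submod S T rewrite take-∪ a S T | take-∩ a S T | drop-∪ a S T | drop-∩ a S T =
      subst₂ _≤_ (interchange (M₁.rank (S₁ ∪ T₁)) _ _ _) (interchange (M₁.rank S₁) _ _ _) (ℕP.+-mono-≤ (M₁.rank-submod S₁ T₁) (M₂.rank-submod S₂ T₂))
      where
      S₁ = take a S
      T₁ = take a T
      S₂ = drop a S
      T₂ = drop a T

  loopless-point : Loopless (uniformMatroid 1 1)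
  loopless-point zero = s≤s z≤n

  loopless-empty : Loopless (uniformMatroid 0 0)
  loopless-empty ()

  chowPoint augPoint : Polymatroid 1
  chowPoint = Loopless-Polymatroids.chowPolymatroid (uniformMatroid 1 1) loopless-point
  augPoint  = Loopless-Polymatroids.augPolymatroid (uniformMatroid 1 1) loopless-point

  augEmpty : Polymatroid 0
  augEmpty = Loopless-Polymatroids.augPolymatroid (uniformMatroid 0 0) loopless-empty

  ⊥-or-⊤ : (A : Subset 1) → A ≡ ⊥ₛ ⊎ A ≡ ⊤
  ⊥-or-⊤ (true ∷ [])  = inj₂ refl
  ⊥-or-⊤ (false ∷ []) = inj₁ refl

  rank≤ : ∀ {n} (M : Matroid n) S → Matroid.rank M S ≤ Matroid.rank M ⊤
  rank≤ M S = Matroid.rank-mono M SubP.⊆⊤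

  nonempty : ∀ {n} {S : Subset n} → S ≢ ⊥ₛ → ∃ λ i → i ∈ₛ S
  nonempty {S = S} ne with SubP.nonempty? S
  ... | yes p = p
  ... | no empty = contradiction (SubP.Empty-unique empty) ne

  -- Once loops are removed, the empty set is the only proper flat, so the presentations are
  -- modelled on a single point.
  module RankOne {n : ℕ} (M : Matroid n) (rank⊤ : Matroid.rank M ⊤ ≡ 1) where
    open Matroid M
    open MatroidFacts M

    rank≤1 : ∀ S → rank S ≤ 1
    rank≤1 S = ℕP.≤-trans (rank≤ M S) (ℕP.≤-reflexive rank⊤)

    nonloop-rank : ∀ {S i} → 1 ≤ rank ⁅ i ⁆ → i ∈ₛ S → rank S ≡ 1
    nonloop-rank {S} 1≤ i∈ = ℕP.≤-antisym (rank≤1 S) (ℕP.≤-trans 1≤ (rank-mono (⁅⁆-⊆ i∈)))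

    ⊤-rank : ∀ is → (∀ i → i ∈ is → rank ⁅ i ⁆ ≡ 0) → ∀ {S : Subset n} → rank S ≡ 0 → rank (List.foldr (λ i T → T ∪ ⁅ i ⁆) S is) ≡ 0
    ⊤-rank []       h e = e
    ⊤-rank (i ∷ is) h {S} e = ℕP.n≤0⇒n≡0 (ℕP.≤-trans (ℕP.m≤m+n _ _) (ℕP.≤-trans (rank-submod _ ⁅ i ⁆)
      (ℕP.≤-reflexive (cong₂ _+_ (⊤-rank is (λ j j∈ → h j (there j∈)) {S} e) (h i (here refl))))))

    ∈-foldr : ∀ {S : Subset n} {i} is → i ∈ is → i ∈ₛ List.foldr (λ i T → T ∪ ⁅ i ⁆) S is
    ∈-foldr (i ∷ is) (here refl) = SubP.q⊆p∪q _ ⁅ i ⁆ (SubP.x∈⁅x⁆ i)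
    ∈-foldr (j ∷ is) (there i∈)  = SubP.p⊆p∪q ⁅ j ⁆ (∈-foldr is i∈)

    -- If all points had rank 0, submodularity would give rank 0 to the whole ground set.
    nonloop : ∃ λ i → 1 ≤ rank ⁅ i ⁆
    nonloop with Data.Fin.Properties.any? (λ i → 1 ℕP.≤? rank ⁅ i ⁆)
      where import Data.Fin.Properties
    ... | yes p = p
    ... | no none = contradiction (trans (sym rank⊤) (trans (cong rank ⊤≡) (⊤-rank (allFin n) (λ i _ → ℕP.n<1⇒n≡0 (ℕP.≰⇒> (λ le → none (i , le)))) {⊥ₛ} rank-⊥))) λ ()
      where
      ⊤≡ : ⊤ ≡ List.foldr (λ i T → T ∪ ⁅ i ⁆) ⊥ₛ (allFin n)
      ⊤≡ = SubP.⊆-antisym (λ {i} _ → ∈-foldr (allFin n) (∈-allFin i)) SubP.⊆⊤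

    i₀ = proj₁ nonloop

    module _ (loopless : Loopless M) where
      -- A nonempty flat contains a non-loop, so it has full rank and is the whole ground set. The
      -- ring has no variables.
      no-flats : ∀ {F} → F ∈ chowFlats rank → ⊥
      no-flats {F} F∈ = not-=ˢ⁻ (proj₂ e₂) (SubP.⊆-antisym SubP.⊆⊤ (λ {i} _ → decidable-stable (i SubP.∈? F) (λ i∉ →
          proj₂ (isFlatIn⁻ rank ⊤ F (proj₁ e)) i SubP.∈⊤ i∉ (trans (nonloop-rank (loopless j) (SubP.p⊆p∪q ⁅ i ⁆ j∈)) (sym (nonloop-rank (loopless j) j∈))))))
        where
        e = ∧-true⁻ (proj₂ (∈-filterᵇ⁻ (λ F → isFlatIn rank ⊤ F ∧ not (F =ˢ ⊥ₛ) ∧ not (F =ˢ ⊤)) (allSubsets n) F∈))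
        e₂ = ∧-true⁻ {not (F =ˢ ⊥ₛ)} (proj₂ e)
        j = proj₁ (nonempty (not-=ˢ⁻ {S = F} (proj₁ e₂)))
        j∈ = proj₂ (nonempty (not-=ˢ⁻ {S = F} (proj₁ e₂)))

      chowSeries : IsChowHilbertSeries rank (standardSeries chowPoint)
      chowSeries = subst (λ c → if c then (∀ d → standardSeries chowPoint d ≡ 0) else IsHilbertSeries (chowPresentation rank) (standardSeries chowPoint))
        (sym (LooplessSeries.hasLoop-false M loopless)) series
        where
        fls = chowFlats rank
        absurd : Fin (length fls) → ⊥
        absurd p = no-flats (∈-lookup p)
        fl : Fin (length fls) → Subset 1
        fl p = ⊥-elim (absurd p)
        inc : Fin (length fls) → Fin (length fls) → Bool
        inc p q = incomparableᵇ (List.lookup fls p) (List.lookup fls q)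
        idx : FlatIndex chowPoint fl inc
        idx = record
          { fl-injective = λ {p} _ → ⊥-elim (absurd p) ; fl-flat = λ p → ⊥-elim (absurd p) ; fl-≢⊤ = λ p → ⊥-elim (absurd p)
          ; proper = λ _ → false ; proper⇒ = λ () ; ⇒proper = λ {A} _ ≢⊤ ≢⊥ → ⊥-elim (neither A ≢⊤ ≢⊥)
          ; fl-sum = λ g → trans (∑ℚ.∑-zero (allFin (length fls)) (λ p → ⊥-elim (absurd p))) (sym (∑ℚ.∑-zero (allSubsets 1) {λ _ → 0ℚ} (λ _ → refl)))
          ; inc⇒ = λ {p} _ → ⊥-elim (absurd p) ; ⇒inc = λ {p} _ _ → ⊥-elim (absurd p) }
          where
          neither : ∀ A → A ≢ ⊤ → A ≢ ⊥ₛ → ⊥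
          neither A ≢⊤ ≢⊥ with ⊥-or-⊤ A
          ... | inj₁ e = ≢⊥ e
          ... | inj₂ e = ≢⊤ e
        series : IsHilbertSeries (chowPresentation rank) (standardSeries chowPoint)
        series = ChowModel.chowHilbertSeries chowPoint inc (λ p i → lookup (List.lookup fls p) i) fl idx (λ p → ⊥-elim (absurd p))
          -- All elements are sent to the one point, and a non-loop serves as its preimage.
          (λ _ → zero) (λ _ → i₀) (λ { zero → refl }) (λ p → ⊥-elim (absurd p)) (λ { zero → refl })

    E = nonLoops rank

    ∈E⇒ : ∀ {i} → i ∈ₛ E → 1 ≤ rank ⁅ i ⁆
    ∈E⇒ {i} i∈ = ℕP.n≢0⇒n>0 (λ e → contradiction (trans (sym ([]=⇒lookup i∈)) (trans (lookup∘tabulate _ i) (cong not (≡⇒≡ᵇ-true e)))) λ ())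

    ⇒∈E : ∀ {i} → 1 ≤ rank ⁅ i ⁆ → i ∈ₛ E
    ⇒∈E {i} 1≤ = lookup⇒[]= i E (trans (lookup∘tabulate _ i) (cong not (≢⇒≡ᵇ-false (λ e → contradiction (subst (1 ≤_) e 1≤) λ ()))))

    augFlats-⊥ : ∀ {F} → F ∈ augFlats rank E → F ≡ ⊥ₛ
    augFlats-⊥ {F} F∈ = decidable-stable (F ≟ₛ ⊥ₛ) (λ F≢⊥ →
      let j , j∈ = nonempty F≢⊥
          F⊆E , flat = isFlatIn⁻ rank E F (proj₁ e)
          j≥ = ∈E⇒ (F⊆E j∈)
      in not-=ˢ⁻ (proj₂ e) (SubP.⊆-antisym F⊆E (λ {i} i∈E → decidable-stable (i SubP.∈? F) (λ i∉F →
           flat i i∈E i∉F (trans (nonloop-rank j≥ (SubP.p⊆p∪q ⁅ i ⁆ j∈)) (sym (nonloop-rank j≥ j∈)))))))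
      where e = ∧-true⁻ (proj₂ (∈-filterᵇ⁻ (λ F → isFlatIn rank E F ∧ not (F =ˢ E)) (allSubsets n) F∈))

    ⊥∈augFlats : ⊥ₛ ∈ augFlats rank E
    ⊥∈augFlats = ∈-filterᵇ⁺ (λ F → isFlatIn rank E F ∧ not (F =ˢ E)) (∈-allSubsets ⊥ₛ) (cong₂ _∧_
      (isFlatIn⁺ rank E ⊥ₛ SubP.⊥⊆ (λ i i∈E _ e → contradiction (subst (1 ≤_) (trans (trans (cong rank (sym (SubP.∪-identityˡ ⁅ i ⁆))) e) rank-⊥) (∈E⇒ i∈E)) λ ()))
      (not-=ˢ⁺ (λ e → SubP.∉⊥ (subst (i₀ ∈ₛ_) (sym e) (⇒∈E (proj₂ nonloop))))))

    augSeries : IsAugChowHilbertSeries rank (standardSeries augPoint)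
    augSeries = AugModel.augHilbertSeries augPoint inc (λ p t → lookup (List.lookup fls p) (List.lookup ground t)) (λ _ → ⊥ₛ) idx
        (λ A flat ≢⊤ → proper-A A ≢⊤) (λ _ → zero) (λ _ → index i₀∈) (λ { zero → refl })
        (λ p t → trans (cong (λ F → lookup F (List.lookup ground t)) (all-⊥ p)) (lookup-replicate (List.lookup ground t) false)) (λ { zero () })
      where
      fls = augFlats rank E
      ground = groundList rank E
      all-⊥ : ∀ p → List.lookup fls p ≡ ⊥ₛ
      all-⊥ p = augFlats-⊥ (∈-lookup p)
      inc : Fin (length fls) → Fin (length fls) → Bool
      inc p q = incomparableᵇ (List.lookup fls p) (List.lookup fls q)
      i₀∈ : i₀ ∈ ground
      i₀∈ = ∈-filterᵇ⁺ (lookup E) (∈-allFin i₀) ([]=⇒lookup (⇒∈E (proj₂ nonloop)))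
      p₀ : Fin (length fls)
      p₀ = index ⊥∈augFlats
      unique : ∀ p q → p ≡ q
      unique p q = unique-lookup (UniqueP.filter⁺ _ (unique-allSubsets n)) p q (trans (all-⊥ p) (sym (all-⊥ q)))
      proper : Subset 1 → Bool
      proper A = does (A ≟ₛ ⊥ₛ)
      proper-A : ∀ A → A ≢ ⊤ → proper A ≡ true
      proper-A A ≢⊤ with ⊥-or-⊤ A
      ... | inj₁ refl = refl
      ... | inj₂ e    = contradiction e ≢⊤
      ⊥-flat : Standard.IsFlat augPoint ⊥ₛ
      ⊥-flat zero _ = s≤s z≤n
      idx : FlatIndex augPoint (λ _ → ⊥ₛ) inc
      idx = record
        { fl-injective = λ {p} {q} _ → unique p q ; fl-flat = λ _ → ⊥-flat ; fl-≢⊤ = λ _ ()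
        ; proper = proper
        ; proper⇒ = λ {A} e → proper⇒ A e
        ; ⇒proper = λ {A} _ ≢⊤ _ → proper-A A ≢⊤
        ; fl-sum = λ g → trans (∑ℚ.∑-unique (λ _ → g ⊥ₛ) (UniqueP.allFin⁺ (length fls)) (∈-allFin p₀) (λ q q≢ → contradiction (unique q p₀) q≢))
            (sym (trans (∑ℚ.∑-unique (λ A → when (proper A) (g A)) (unique-allSubsets 1) (∈-allSubsets ⊥ₛ) (λ A A≢ → cong (λ b → when b (g A)) (dec-false (A ≟ₛ ⊥ₛ) A≢))) refl))
        ; inc⇒ = λ {p} {q} e → ⊥-elim (proj₁ (incomparableᵇ⁻ {F = List.lookup fls p} {List.lookup fls q} e) (subst₂ _⊆_ (sym (all-⊥ p)) (sym (all-⊥ q)) SubP.⊥⊆))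
        ; ⇒inc = λ ⊥⊈ _ → ⊥-elim (⊥⊈ SubP.⊥⊆) }
        where
        proper⇒ : ∀ A → proper A ≡ true → Standard.IsFlat augPoint A × A ≢ ⊤
        proper⇒ A e with does⇒ (A ≟ₛ ⊥ₛ) e
        ... | refl = ⊥-flat , λ ()

  -- All elements are loops, and after their removal the augmented ring is that of the empty
  -- matroid.
  module RankZero {n : ℕ} (M : Matroid n) (rank⊤ : Matroid.rank M ⊤ ≡ 0) where
    open Matroid M

    rank≡0 : ∀ S → rank S ≡ 0
    rank≡0 S = ℕP.n≤0⇒n≡0 (ℕP.≤-trans (rank≤ M S) (ℕP.≤-reflexive rank⊤))

    E = nonLoops rank

    ∉E : ∀ i → i ∉ₛ E
    ∉E i i∈ = contradiction (trans (sym ([]=⇒lookup i∈)) (trans (lookup∘tabulate _ i) (cong not (≡⇒≡ᵇ-true (rank≡0 ⁅ i ⁆))))) λ ()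

    augSeries : IsAugChowHilbertSeries rank (standardSeries augEmpty)
    augSeries = AugModel.augHilbertSeries augEmpty inc (λ p t → lookup (List.lookup fls p) (List.lookup ground t)) (λ p → ⊥-elim (absurd p)) idx
        (λ { [] _ ≢⊤ → contradiction refl ≢⊤ }) (λ t → ⊥-elim (no-ground t)) (λ ()) (λ ()) (λ p → ⊥-elim (absurd p)) (λ ())
      where
      fls = augFlats rank E
      ground = groundList rank E
      absurd : Fin (length fls) → ⊥
      absurd p = not-=ˢ⁻ (proj₂ e) (SubP.⊆-antisym (proj₁ (isFlatIn⁻ rank E _ (proj₁ e))) (λ {i} i∈ → ⊥-elim (∉E i i∈)))
        where e = ∧-true⁻ (proj₂ (∈-filterᵇ⁻ (λ F → isFlatIn rank E F ∧ not (F =ˢ E)) (allSubsets n) (∈-lookup p)))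
      no-ground : Fin (length ground) → ⊥
      no-ground t = ∉E (List.lookup ground t) (lookup⇒[]= _ E (proj₂ (∈-filterᵇ⁻ (lookup E) (allFin n) (∈-lookup t))))
      inc : Fin (length fls) → Fin (length fls) → Bool
      inc p q = incomparableᵇ (List.lookup fls p) (List.lookup fls q)
      idx : FlatIndex augEmpty (λ p → ⊥-elim (absurd p)) inc
      idx = record
        { fl-injective = λ {p} _ → ⊥-elim (absurd p) ; fl-flat = λ p → ⊥-elim (absurd p) ; fl-≢⊤ = λ p → ⊥-elim (absurd p)
        ; proper = λ _ → false ; proper⇒ = λ () ; ⇒proper = λ { {[]} _ ≢⊤ _ → contradiction refl ≢⊤ }
        ; fl-sum = λ g → trans (∑ℚ.∑-zero (allFin (length fls)) (λ p → ⊥-elim (absurd p))) (sym (∑ℚ.∑-zero (allSubsets 0) {λ _ → 0ℚ} (λ _ → refl)))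
        ; inc⇒ = λ {p} _ → ⊥-elim (absurd p) ; ⇒inc = λ {p} _ _ → ⊥-elim (absurd p) }

  -- Opaque, because the type checker would otherwise try to evaluate these closed enumerations.
  abstract
    emptyChow pointChow pointAug emptyAug : ℕ → ℕ
    emptyChow = standardSeries (Loopless-Polymatroids.chowPolymatroid (uniformMatroid 0 0) loopless-empty)
    pointChow = standardSeries chowPoint
    pointAug  = standardSeries augPoint
    emptyAug  = standardSeries augEmpty

    -- On the empty ground set the presentation does not depend on the rank function.
    emptyChow-series : ∀ (rk : RankFn 0) → IsChowHilbertSeries rk emptyChow
    emptyChow-series rk = LooplessSeries.chowSeries (uniformMatroid 0 0) loopless-empty

    pointChow-series : ∀ {n} (M : Matroid n) rk → Matroid.rank M ≡ rk → rk ⊤ ≡ 1 → Loopless M → IsChowHilbertSeries rk pointChow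
    pointChow-series M _ refl rank⊤ loopless = RankOne.chowSeries M rank⊤ loopless

    pointAug-series : ∀ {n} (M : Matroid n) rk → Matroid.rank M ≡ rk → rk ⊤ ≡ 1 → IsAugChowHilbertSeries rk pointAug
    pointAug-series M _ refl rank⊤ = RankOne.augSeries M rank⊤

    emptyAug-series : ∀ {n} (M : Matroid n) rk → Matroid.rank M ≡ rk → rk ⊤ ≡ 0 → IsAugChowHilbertSeries rk emptyAug
    emptyAug-series M _ refl rank⊤ = RankZero.augSeries M rank⊤

-- Counting standard chains in a paving matroid

module Counting where

  open import Defs
  open ListSums
  open ChainFunctionals hiding (add)
  open StandardChains
  open Straightenings using (Reach; start; step; reach; reach-⊆)
  open Evaluation using (∈-allSubsets)
  open ChainEnumeration
  open MatroidInstances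
  open import Data.Bool using (Bool; true; false; if_then_else_; T; _∧_)
  open import Data.Empty using (⊥-elim)
  open import Data.Fin using (zero; suc)
  open import Data.Fin.Subset using (Subset; _⊆_; ⁅_⁆; _∪_; ⊤; ∣_∣; inside; outside) renaming (_∈_ to _∈ₛ_; _∉_ to _∉ₛ_)
  import Data.Fin.Subset.Properties as SubP
  open import Data.Integer as ℤ using (ℤ; +_; 0ℤ; 1ℤ)
  import Data.Integer.Properties as ℤP
  open import Data.Integer.Tactic.RingSolver using (solve-∀)
  open import Data.Nat using (ℕ; zero; suc; _+_; _∸_; _≤_; _<_; z≤n; s≤s; _≡ᵇ_; _≤ᵇ_)
  import Data.Nat.Properties as ℕP
  open import Data.List as List using (List; []; _∷_; _++_; length; filterᵇ; concatMap; upTo)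
  import Data.List.Properties as ListP
  open import Data.Product using (∃; _×_; _,_; proj₁; proj₂)
  open import Data.Sum using (_⊎_; inj₁; inj₂)
  open import Data.Vec using ([]; _∷_; tabulate)
  open import Data.Vec.Properties using (lookup⇒[]=; []=⇒lookup; lookup∘tabulate)
  open import Relation.Nullary using (¬_; Dec; yes; no; does; contradiction)
  open import Relation.Nullary.Decidable using (dec-true; dec-false; decidable-stable)
  open import Relation.Binary.PropositionalEquality hiding ([_])

  module ∑ℤ = Sums ℤP.+-*-commutativeRing
  open ∑ℤ using (∑; when)

  length-++ℤ : ∀ {A : Set} (xs ys : List A) → + length (xs ++ ys) ≡ + length xs ℤ.+ + length ys
  length-++ℤ xs ys = trans (cong +_ (ListP.length-++ xs)) (ℤP.pos-+ (length xs) (length ys))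

  length-concatMap : ∀ {A B : Set} (g : A → List B) xs → + length (concatMap g xs) ≡ ∑ xs (λ x → + length (g x))
  length-concatMap g []       = refl
  length-concatMap g (x ∷ xs) = trans (length-++ℤ (g x) (concatMap g xs)) (cong (ℤ._+_ (+ length (g x))) (length-concatMap g xs))

  length-filter : ∀ {A : Set} (b : A → Bool) xs → + length (filterᵇ b xs) ≡ ∑ xs (λ x → when (b x) 1ℤ)
  length-filter b xs = trans (go (filterᵇ b xs)) (∑ℤ.∑-filter b xs (λ _ → 1ℤ))
    where
    go : ∀ {A : Set} (ys : List A) → + length ys ≡ ∑ ys (λ _ → 1ℤ)
    go []       = refl
    go (y ∷ ys) = cong (ℤ._+_ 1ℤ) (go ys)

  -- The sum of C(j, i) g(i) over all i. Pascal's rule as recursion mirrors the enumeration of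
  -- subsets element by element.
  binomialSum : ℕ → (ℕ → ℤ) → ℤ
  binomialSum zero    g = g 0
  binomialSum (suc j) g = binomialSum j (λ i → g (suc i)) ℤ.+ binomialSum j g

  binomialSum-top : ∀ j {g} → (∀ i → i < j → g i ≡ 0ℤ) → binomialSum j g ≡ g j
  binomialSum-top zero    e = refl
  binomialSum-top (suc j) {g} e = trans (cong₂ ℤ._+_ (binomialSum-top j {λ i → g (suc i)} (λ i i<j → e (suc i) (s≤s i<j)))
      (trans (binomialSum-top j {g} (λ i i<j → e i (ℕP.m≤n⇒m≤1+n i<j))) (e j ℕP.≤-refl))) (ℤP.+-identityʳ (g (suc j)))

  ∑-subsets : ∀ {n} (F : Subset n) g → ∑ (allSubsets n) (λ G → when (does (G SubP.⊆? F)) (g ∣ G ∣)) ≡ binomialSum ∣ F ∣ g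
  ∑-subsets []                    g = ℤP.+-identityʳ (g 0)
  ∑-subsets {suc n} (f ∷ F) g = trans (∑ℤ.∑-++ (List.map (true ∷_) (allSubsets n)) _ _)
    (trans (cong₂ ℤ._+_ (∑ℤ.∑-map (true ∷_) (allSubsets n) _) (∑ℤ.∑-map (false ∷_) (allSubsets n) _)) (parts f))
    where
    parts : ∀ f → ∑ (allSubsets n) (λ G → when (does ((true ∷ G) SubP.⊆? (f ∷ F))) (g (suc ∣ G ∣)))
            ℤ.+ ∑ (allSubsets n) (λ G → when (does ((false ∷ G) SubP.⊆? (f ∷ F))) (g ∣ G ∣)) ≡ binomialSum ∣ f ∷ F ∣ g
    parts true  = cong₂ ℤ._+_ (∑-subsets F (λ i → g (suc i))) (∑-subsets F g)
    parts false = trans (cong₂ ℤ._+_ (∑ℤ.∑-zero (allSubsets n) {λ _ → 0ℤ} (λ _ → refl)) (∑-subsets F g)) (ℤP.+-identityˡ _)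

  ∑-all : ∀ n g → ∑ (allSubsets n) (λ G → g ∣ G ∣) ≡ binomialSum n g
  ∑-all n g = trans (∑ℤ.∑-cong (allSubsets n) (λ G → sym (cong (λ b → when b (g ∣ G ∣)) (dec-true (G SubP.⊆? ⊤) SubP.⊆⊤))))
    (trans (∑-subsets (⊤ {n}) g) (cong (λ j → binomialSum j g) (SubP.∣⊤∣≡n n)))

  when-0 : ∀ b → when b 0ℤ ≡ 0ℤ
  when-0 true  = refl
  when-0 false = refl

  ≤⇒≤ᵇ-true : ∀ {a b} → a ≤ b → (a ≤ᵇ b) ≡ true
  ≤⇒≤ᵇ-true le = T⇒≡true (ℕP.≤⇒≤ᵇ le)

  ≰⇒≤ᵇ-false : ∀ {a b} → ¬ a ≤ b → (a ≤ᵇ b) ≡ false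
  ≰⇒≤ᵇ-false {a} {b} ¬le with a ≤ᵇ b in eq
  ... | true  = contradiction (ℕP.≤ᵇ⇒≤ a b (subst T (sym eq) _)) ¬le
  ... | false = refl

  subset-of-size : ∀ {n} (S : Subset n) j → j ≤ ∣ S ∣ → ∃ λ A → A ⊆ S × ∣ A ∣ ≡ j
  subset-of-size {n} S zero le = ⊥ₛ , SubP.⊥⊆ , SubP.∣⊥∣≡0 n
  subset-of-size (outside ∷ S) (suc j) le with subset-of-size S (suc j) le
  ... | A , A⊆S , e = outside ∷ A , SubP.out⊆ A⊆S , e
  subset-of-size (inside ∷ S) (suc j) (s≤s le) with subset-of-size S j le
  ... | A , A⊆S , e = inside ∷ A , SubP.in⊆in A⊆S , cong suc e

  exponentSum : ℕ → ℕ → (ℕ → ℤ) → ℤ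
  exponentSum d s f = ∑ (filterᵇ (λ a → suc a ≤ᵇ d) (upTo s)) f

  -- k′ + 2 is the rank; ε distinguishes the Chow ring (0) from the augmented one (1).
  module Numeric (k′ ε : ℕ) where

    -- The polymatroid rank of an independent set with `i` elements.
    height : ℕ → ℕ
    height zero    = 0
    height (suc i) = ε + suc i

    mutual
      -- Number of standard chains of degree `d` with given top: a set of size `i ≤ k′` here, a
      -- nonempty set of size `h` and polymatroid rank `s` in `topCount`. Sizes and ranks suffice
      -- because all sets of size at most `k′` are flats. `f` bounds the recursion as in `chainsTo`.
      smallCount : ℕ → ℕ → ℕ → ℤ
      smallCount f d zero    = when (d ≡ᵇ 0) 1ℤ
      smallCount f d (suc i) = topCount f d (ε + suc i) (suc i)

      topCount : ℕ → ℕ → ℕ → ℕ → ℤ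
      topCount zero    d s h = 0ℤ
      topCount (suc f) d s h = binomialSum h (λ i → when (i ≤ᵇ k′) (exponentSum d (s ∸ suc (height i)) (λ a → smallCount f (d ∸ suc a) i)))

    hyperplaneCount : ℕ → ℕ → ℤ
    hyperplaneCount d h = topCount d d (ε + suc k′) h

    -- Chains whose top is a small flat or the full set. As none of them passes through a
    -- hyperplane, for fixed rank their number depends only on `n` and the degree.
    base : ℕ → ℕ → ℤ
    base n d = binomialSum n (λ i → when (i ≤ᵇ k′) (smallCount d d i)) ℤ.+ topCount d d (ε + suc (suc k′)) n

    choose : ℕ → ℤ
    choose h = binomialSum h (λ i → when (i ≡ᵇ suc k′) 1ℤ)

    -- What is lost when a hyperplane of size `h` takes the place of its C(h, k-1) subsets of size
    -- k-1, each of which is a hyperplane in the uniform matroid.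
    excess : ℕ → ℕ → ℤ
    excess d h = choose h ℤ.* hyperplaneCount d (suc k′) ℤ.- hyperplaneCount d h

    uniformCount : ℕ → ℕ → ℤ
    uniformCount n d = base n d ℤ.+ choose n ℤ.* hyperplaneCount d (suc k′)

    choose-diagonal : choose (suc k′) ≡ 1ℤ
    choose-diagonal = trans (binomialSum-top (suc k′) {λ i → when (i ≡ᵇ suc k′) 1ℤ} (λ i i<k → cong (λ b → when b 1ℤ) (≢⇒≡ᵇ-false (ℕP.<⇒≢ i<k)))) (cong (λ b → when b 1ℤ) (≡⇒≡ᵇ-true {suc k′} refl))

    -- A hyperplane of size k-1 is its only subset of that size. This is why the correction involves
    -- only hyperplanes with at least `k` elements.
    excess-diagonal : ∀ d → excess d (suc k′) ≡ 0ℤ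
    excess-diagonal d = trans (cong (λ z → z ℤ.* hyperplaneCount d (suc k′) ℤ.- hyperplaneCount d (suc k′)) choose-diagonal)
      (trans (cong (ℤ._- hyperplaneCount d (suc k′)) (ℤP.*-identityˡ (hyperplaneCount d (suc k′)))) (ℤP.+-inverseʳ (hyperplaneCount d (suc k′))))

  record Paving {n : ℕ} (M : Matroid n) (k′ : ℕ) : Set where
    open Matroid M
    field
      rank-⊤      : rank ⊤ ≡ suc (suc k′)
      independent : ∀ S → ∣ S ∣ ≤ suc k′ → rank S ≡ ∣ S ∣

  module PavingFacts {n k′ : ℕ} (M : Matroid n) (paving : Paving M k′) where
    open Matroid M
    open MatroidFacts M
    open Paving paving

    loopless : Loopless M
    loopless i = ℕP.≤-reflexive (sym (trans (independent ⁅ i ⁆ (ℕP.≤-trans (ℕP.≤-reflexive (SubP.∣⁅x⁆∣≡1 i)) (s≤s z≤n))) (SubP.∣⁅x⁆∣≡1 i)))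

    open Loopless-Polymatroids M loopless public

    rank-large : ∀ S → ¬ ∣ S ∣ ≤ k′ → suc k′ ≤ rank S
    rank-large S big with subset-of-size S (suc k′) (ℕP.≰⇒> big)
    ... | A , A⊆S , e = ℕP.≤-trans (ℕP.≤-reflexive (sym (trans (independent A (ℕP.≤-reflexive e)) e))) (rank-mono A⊆S)

    ∣∪point∣ : ∀ {S : Subset n} {i} → i ∉ₛ S → ∣ S ∪ ⁅ i ⁆ ∣ ≡ suc ∣ S ∣
    ∣∪point∣ {S} {i} i∉ = ℕP.≤-antisym (upper S i) (SubP.p⊂q⇒∣p∣<∣q∣ (SubP.p⊆p∪q ⁅ i ⁆ , i , SubP.q⊆p∪q S ⁅ i ⁆ (SubP.x∈⁅x⁆ i) , i∉))
      where
      upper : ∀ {n} (S : Subset n) i → ∣ S ∪ ⁅ i ⁆ ∣ ≤ suc ∣ S ∣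
      upper (inside ∷ S)  zero    = ℕP.≤-trans (ℕP.≤-reflexive (cong (λ T → suc ∣ T ∣) (SubP.∪-identityʳ S))) (ℕP.n≤1+n _)
      upper (outside ∷ S) zero    = ℕP.≤-reflexive (cong (λ T → suc ∣ T ∣) (SubP.∪-identityʳ S))
      upper (inside ∷ S)  (suc i) = s≤s (upper S i)
      upper (outside ∷ S) (suc i) = upper S i

    small-flat : ∀ {F} → ∣ F ∣ ≤ k′ → RankFlat F
    small-flat {F} le i i∉ e = ℕP.1+n≢n (trans (sym (∣∪point∣ i∉)) (trans (sym (independent (F ∪ ⁅ i ⁆) (ℕP.≤-trans (ℕP.≤-reflexive (∣∪point∣ i∉)) (s≤s le))))
      (trans e (independent F (ℕP.m≤n⇒m≤1+n le)))))

    full-flat : ∀ {F} → RankFlat F → rank F ≡ rank ⊤ → F ≡ ⊤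
    full-flat {F} flat e = SubP.⊆-antisym SubP.⊆⊤ (λ {i} _ → decidable-stable (i SubP.∈? F) (λ i∉ →
      flat i i∉ (ℕP.≤-antisym (ℕP.≤-trans (rank-mono SubP.⊆⊤) (ℕP.≤-reflexive (sym e))) (rank-mono {F} (SubP.p⊆p∪q ⁅ i ⁆)))))

    hyperplaneᵇ : Subset n → Bool
    hyperplaneᵇ F = isFlatIn rank ⊤ F ∧ ((rank F + 1) ≡ᵇ rank ⊤)

    hyperplane⁻ : ∀ {F} → hyperplaneᵇ F ≡ true → RankFlat F × rank F ≡ suc k′
    hyperplane⁻ {F} e = rankFlat-isFlatIn (proj₁ (∧-true⁻ e)) , ℕP.suc-injective (trans (sym (ℕP.+-comm (rank F) 1)) (trans (≡ᵇ-true⇒≡ (proj₂ (∧-true⁻ {isFlatIn rank ⊤ F} e))) rank-⊤))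

    hyperplane⁺ : ∀ {F} → RankFlat F → rank F ≡ suc k′ → hyperplaneᵇ F ≡ true
    hyperplane⁺ {F} flat e = cong₂ _∧_ (isFlatIn-rankFlat flat) (≡⇒≡ᵇ-true (trans (ℕP.+-comm (rank F) 1) (trans (cong suc e) (sym rank-⊤))))

    hyperplane-size : ∀ {F} → hyperplaneᵇ F ≡ true → suc k′ ≤ ∣ F ∣
    hyperplane-size {F} e = ℕP.≤-trans (ℕP.≤-reflexive (sym (proj₂ (hyperplane⁻ {F} e)))) (rank-bound F)

    private
      module Q = Functional chowPolymatroid

    closure : Subset n → Subset n
    closure A = tabulate (λ i → rank (A ∪ ⁅ i ⁆) ≡ᵇ rank A)

    ∈closure⁻ : ∀ {A i} → i ∈ₛ closure A → rank (A ∪ ⁅ i ⁆) ≡ rank A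
    ∈closure⁻ {A} {i} i∈ = ≡ᵇ-true⇒≡ (trans (sym (lookup∘tabulate _ i)) ([]=⇒lookup i∈))

    ∈closure⁺ : ∀ {A i} → rank (A ∪ ⁅ i ⁆) ≡ rank A → i ∈ₛ closure A
    ∈closure⁺ {A} {i} e = lookup⇒[]= i (closure A) (trans (lookup∘tabulate _ i) (≡⇒≡ᵇ-true e))

    A⊆closure : ∀ A → A ⊆ closure A
    A⊆closure A {i} i∈ = ∈closure⁺ (cong rank (SubP.⊆-antisym (∪-lub (λ x → x) (⁅⁆-⊆ i∈)) (SubP.p⊆p∪q ⁅ i ⁆)))

    -- The elements of the closure are added one at a time; by submodularity each of them leaves the
    -- rank unchanged over larger sets, as it does over `A`.
    rank-closure : ∀ A → rank (closure A) ≡ rank A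
    rank-closure A = go (reach (A⊆closure A)) (λ x → x)
      where
      go : ∀ {G} → Reach A G → G ⊆ closure A → rank G ≡ rank A
      go start sub = refl
      go (step {G} i r) sub = trans (Q.ρ-absorb {A} {G} i (∈closure⁻ (sub (SubP.q⊆p∪q G ⁅ i ⁆ (SubP.x∈⁅x⁆ i)))) (reach-⊆ r))
        (go r (λ x∈ → sub (SubP.p⊆p∪q ⁅ i ⁆ x∈)))

    closure-flat : ∀ A → RankFlat (closure A)
    closure-flat A i i∉ e = i∉ (∈closure⁺ (ℕP.≤-antisym
      (ℕP.≤-trans (rank-mono (∪-lub (λ x∈ → SubP.p⊆p∪q ⁅ i ⁆ (A⊆closure A x∈)) (SubP.q⊆p∪q (closure A) ⁅ i ⁆))) (ℕP.≤-reflexive (trans e (rank-closure A))))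
      (rank-mono {A} (SubP.p⊆p∪q ⁅ i ⁆))))

    hyperplane-unique : ∀ {A H} → rank A ≡ suc k′ → hyperplaneᵇ H ≡ true → A ⊆ H → H ≡ closure A
    hyperplane-unique {A} {H} rA hyp A⊆H = SubP.⊆-antisym
      (λ {i} i∈ → ∈closure⁺ (ℕP.≤-antisym (ℕP.≤-trans (rank-mono (∪-lub A⊆H (⁅⁆-⊆ i∈))) (ℕP.≤-reflexive (trans (proj₂ (hyperplane⁻ hyp)) (sym rA)))) (rank-mono {A} (SubP.p⊆p∪q ⁅ i ⁆))))
      (λ {i} i∈ → Q.flat-absorbs {H} {A} i (chow-flat⁺ (proj₁ (hyperplane⁻ hyp))) (∈closure⁻ i∈) A⊆H)

    module _ where
      open Numeric k′ 0 using (choose)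

      -- A set of size k-1 is independent, so its closure is a hyperplane, and every hyperplane
      -- containing it equals that closure.
      hyperplanes-through : ∀ A → ∣ A ∣ ≡ suc k′ → ∑ (allSubsets n) (λ H → when (hyperplaneᵇ H) (when (does (A SubP.⊆? H)) 1ℤ)) ≡ 1ℤ
      hyperplanes-through A size = trans (∑ℤ.∑-unique (λ H → when (hyperplaneᵇ H) (when (does (A SubP.⊆? H)) 1ℤ)) (unique-allSubsets n) (∈-allSubsets (closure A)) (λ H H≢ → other H H≢ (A SubP.⊆? H) (hyperplaneᵇ H) refl))
          (trans (cong (λ b → when b (when (does (A SubP.⊆? closure A)) 1ℤ)) (hyperplane⁺ (closure-flat A) (trans (rank-closure A) rA))) (cong (λ b → when b 1ℤ) (dec-true (A SubP.⊆? closure A) (A⊆closure A))))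
        where
        rA : rank A ≡ suc k′
        rA = trans (independent A (ℕP.≤-reflexive size)) size
        other : ∀ H → H ≢ closure A → (d : Dec (A ⊆ H)) → ∀ b → hyperplaneᵇ H ≡ b → when b (when (does d) 1ℤ) ≡ 0ℤ
        other H H≢ _         false e = refl
        other H H≢ (no _)    true  e = refl
        other H H≢ (yes A⊆H) true  e = contradiction (hyperplane-unique rA e A⊆H) H≢

      -- Double counting: every (k-1)-subset lies in exactly one hyperplane.
      hyperplane-partition : ∑ (allSubsets n) (λ H → when (hyperplaneᵇ H) (choose ∣ H ∣)) ≡ choose n
      hyperplane-partition = begin
        ∑ (allSubsets n) (λ H → when (hyperplaneᵇ H) (choose ∣ H ∣))
          ≡⟨ ∑ℤ.∑-cong (allSubsets n) (λ H → trans (cong (when (hyperplaneᵇ H)) (sym (∑-subsets H (λ i → when (i ≡ᵇ suc k′) 1ℤ)))) (push (hyperplaneᵇ H) (allSubsets n))) ⟩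
        ∑ (allSubsets n) (λ H → ∑ (allSubsets n) (λ A → when (hyperplaneᵇ H) (when (does (A SubP.⊆? H)) (when (∣ A ∣ ≡ᵇ suc k′) 1ℤ))))
          ≡⟨ ∑ℤ.∑-swap (allSubsets n) (allSubsets n) _ ⟩
        ∑ (allSubsets n) (λ A → ∑ (allSubsets n) (λ H → when (hyperplaneᵇ H) (when (does (A SubP.⊆? H)) (when (∣ A ∣ ≡ᵇ suc k′) 1ℤ))))
          ≡⟨ ∑ℤ.∑-cong (allSubsets n) (λ A → each A (∣ A ∣ ≡ᵇ suc k′) refl) ⟩
        ∑ (allSubsets n) (λ A → when (∣ A ∣ ≡ᵇ suc k′) 1ℤ)
          ≡⟨ ∑-all n (λ i → when (i ≡ᵇ suc k′) 1ℤ) ⟩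
        choose n ∎
        where
        open ≡-Reasoning
        push : ∀ {B : Set} b (xs : List B) {f : B → ℤ} → when b (∑ xs f) ≡ ∑ xs (λ x → when b (f x))
        push true  xs = refl
        push false xs = sym (∑ℤ.∑-zero xs {λ _ → 0ℤ} (λ _ → refl))
        each : ∀ A b → (∣ A ∣ ≡ᵇ suc k′) ≡ b → ∑ (allSubsets n) (λ H → when (hyperplaneᵇ H) (when (does (A SubP.⊆? H)) (when b 1ℤ))) ≡ when b 1ℤ
        each A true  e = hyperplanes-through A (≡ᵇ-true⇒≡ e)
        each A false e = ∑ℤ.∑-zero (allSubsets n) (λ H → trans (cong (when (hyperplaneᵇ H)) (when-0 (does (A SubP.⊆? H)))) (when-0 (hyperplaneᵇ H)))

  module ChainCount {n k′ ε : ℕ} (M : Matroid n) (paving : Paving M k′) (Q : Polymatroid n)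
    (ρ≡ : ∀ S → S ≢ ⊥ₛ → Polymatroid.ρ Q S ≡ ε + Matroid.rank M S)
    (flat⁺ : ∀ {F} → Loopless-Polymatroids.RankFlat M (PavingFacts.loopless M paving) F → Standard.IsFlat Q F)
    (flat⁻ : ∀ {F} → Standard.IsFlat Q F → Loopless-Polymatroids.RankFlat M (PavingFacts.loopless M paving) F) where

    open Matroid M
    open Paving paving
    open PavingFacts M paving
    open Polymatroid Q
    open Standard Q
    open Enumeration Q
    open Numeric k′ ε

    ρ-small : ∀ S → ∣ S ∣ ≤ k′ → ρ S ≡ height ∣ S ∣
    ρ-small S le = go (S ≟ₛ ⊥ₛ)
      where
      go : Dec (S ≡ ⊥ₛ) → ρ S ≡ height ∣ S ∣
      go (yes refl) = trans ρ-⊥ (cong height (sym (SubP.∣⊥∣≡0 n)))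
      go (no S≢⊥) = trans (ρ≡ S S≢⊥) (trans (cong (λ r → ε + r) (independent S (ℕP.m≤n⇒m≤1+n le))) (positive ∣ S ∣ (λ e → S≢⊥ (empty S e))))
        where
        empty : ∀ {n} (S : Subset n) → ∣ S ∣ ≡ 0 → S ≡ ⊥ₛ
        empty []            e = refl
        empty (outside ∷ S) e = cong (outside ∷_) (empty S e)
        positive : ∀ j → j ≢ 0 → ε + j ≡ height j
        positive zero    ne = contradiction refl ne
        positive (suc j) ne = refl

    ρ-large : ∀ S → ¬ ∣ S ∣ ≤ k′ → ε + suc k′ ≤ ρ S
    ρ-large S big = ℕP.≤-trans (ℕP.+-monoʳ-≤ ε (rank-large S big)) (ℕP.≤-reflexive (sym (ρ≡ S (λ { refl → big (ℕP.≤-trans (ℕP.≤-reflexive (SubP.∣⊥∣≡0 n)) z≤n) }))))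

    flatᵇ-small : ∀ {F} → ∣ F ∣ ≤ k′ → flatᵇ F ≡ true
    flatᵇ-small {F} le = dec-true (isFlat? F) (flat⁺ (small-flat le))

    chainCount : ℕ → ℕ → Subset n → ℤ
    chainCount f d F = + length (chainsTo f d F)

    chainCount-⊥ : ∀ f d → chainCount f d ⊥ₛ ≡ when (d ≡ᵇ 0) 1ℤ
    chainCount-⊥ f d = trans (cong (λ b → + length (if b then (if d ≡ᵇ 0 then [] ∷ [] else []) else extensions f d ⊥ₛ)) (dec-true (⊥ₛ {n} ≟ₛ ⊥ₛ) refl)) (go (d ≡ᵇ 0))
      where
      go : ∀ b → + length (if b then _∷_ {A = Chain {n}} [] [] else []) ≡ when b 1ℤ
      go true  = refl
      go false = refl

    chainCount-≢⊥ : ∀ f d {F} → F ≢ ⊥ₛ → chainCount f d F ≡ + length (extensions f d F)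
    chainCount-≢⊥ f d {F} ne = cong (λ b → + length (if b then (if d ≡ᵇ 0 then [] ∷ [] else []) else extensions f d F)) (dec-false (F ≟ₛ ⊥ₛ) ne)

    extensions-count : ∀ f d F → + length (extensions (suc f) d F) ≡
      ∑ (allSubsets n) (λ G → when (flatᵇ G ∧ does (G SubP.⊆? F)) (exponentSum d (ρ F ∸ suc (ρ G)) (λ a → chainCount f (d ∸ suc a) G)))
    extensions-count f d F = trans (length-concatMap _ (flatsBelow F)) (trans (∑ℤ.∑-filter (λ G → flatᵇ G ∧ does (G SubP.⊆? F)) (allSubsets n) _)
      (∑ℤ.∑-cong (allSubsets n) (λ G → cong (when (flatᵇ G ∧ does (G SubP.⊆? F))) (trans (length-concatMap _ (exponents d G F))
        (∑ℤ.∑-cong (exponents d G F) (λ a → cong +_ (ListP.length-map ((F , suc a) ∷_) (chainsTo f (d ∸ suc a) G))))))))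

    smallCount-correct : ∀ f d F → ∣ F ∣ ≤ k′ → chainCount f d F ≡ smallCount f d ∣ F ∣
    -- A set `G` with more than `k′` elements has at least the rank of a hyperplane, so the gap up
    -- to `F` is at most 1 and admits no exponent. There remain the small sets below `F`, and all of
    -- them are flats.
    topCount-correct : ∀ f d F → F ≢ ⊥ₛ → ρ F ≤ ε + suc (suc k′) → chainCount f d F ≡ topCount f d (ρ F) ∣ F ∣

    smallCount-correct f d F le = go (F ≟ₛ ⊥ₛ)
      where
      go : Dec (F ≡ ⊥ₛ) → chainCount f d F ≡ smallCount f d ∣ F ∣
      go (yes refl) = trans (chainCount-⊥ f d) (cong (smallCount f d) (sym (SubP.∣⊥∣≡0 n)))
      go (no F≢⊥) = trans (topCount-correct f d F F≢⊥ bound) (positive ∣ F ∣ (ρ-small F le) (λ e → F≢⊥ (empty F e)))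
        where
        bound : ρ F ≤ ε + suc (suc k′)
        bound = ℕP.≤-trans (ℕP.≤-reflexive (ρ≡ F F≢⊥)) (ℕP.+-monoʳ-≤ ε (ℕP.≤-trans (rank-bound F) (ℕP.m≤n⇒m≤1+n (ℕP.m≤n⇒m≤1+n le))))
        empty : ∀ {n} (S : Subset n) → ∣ S ∣ ≡ 0 → S ≡ ⊥ₛ
        empty []            e = refl
        empty (outside ∷ S) e = cong (outside ∷_) (empty S e)
        positive : ∀ j → ρ F ≡ height j → j ≢ 0 → topCount f d (ρ F) j ≡ smallCount f d j
        positive zero    e ne = contradiction refl ne
        positive (suc j) e ne = cong (λ s → topCount f d s (suc j)) e

    topCount-correct zero    d F F≢⊥ le = chainCount-≢⊥ zero d F≢⊥
    topCount-correct (suc f) d F F≢⊥ le = trans (chainCount-≢⊥ (suc f) d F≢⊥) (trans (extensions-count f d F)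
        (trans (∑ℤ.∑-cong (allSubsets n) (λ G → each G (∣ G ∣ ℕP.≤? k′))) (∑-subsets F term)))
      where
      term : ℕ → ℤ
      term i = when (i ≤ᵇ k′) (exponentSum d (ρ F ∸ suc (height i)) (λ a → smallCount f (d ∸ suc a) i))
      each : ∀ G → Dec (∣ G ∣ ≤ k′) → when (flatᵇ G ∧ does (G SubP.⊆? F)) (exponentSum d (ρ F ∸ suc (ρ G)) (λ a → chainCount f (d ∸ suc a) G)) ≡ when (does (G SubP.⊆? F)) (term ∣ G ∣)
      each G (yes small) = trans (cong (λ b → when (b ∧ does (G SubP.⊆? F)) (exponentSum d (ρ F ∸ suc (ρ G)) (λ a → chainCount f (d ∸ suc a) G))) (flatᵇ-small small)) (cong (when (does (G SubP.⊆? F)))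
        (trans (cong (λ s → exponentSum d (ρ F ∸ suc s) (λ a → chainCount f (d ∸ suc a) G)) (ρ-small G small))
          (trans (∑ℤ.∑-cong (filterᵇ (λ a → suc a ≤ᵇ d) (upTo (ρ F ∸ suc (height ∣ G ∣)))) (λ a → smallCount-correct f (d ∸ suc a) G small))
            (sym (cong (λ b → when b (exponentSum d (ρ F ∸ suc (height ∣ G ∣)) (λ a → smallCount f (d ∸ suc a) ∣ G ∣))) (≤⇒≤ᵇ-true small))))))
      each G (no big) = trans (cong (λ s → when (flatᵇ G ∧ does (G SubP.⊆? F)) (exponentSum d s (λ a → chainCount f (d ∸ suc a) G))) gap≡0)
        (trans (when-0 (flatᵇ G ∧ does (G SubP.⊆? F))) (sym (trans (cong (λ b → when (does (G SubP.⊆? F)) (when b (exponentSum d (ρ F ∸ suc (height ∣ G ∣)) (λ a → smallCount f (d ∸ suc a) ∣ G ∣)))) (≰⇒≤ᵇ-false big)) (when-0 (does (G SubP.⊆? F))))))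
        where
        gap≡0 : ρ F ∸ suc (ρ G) ≡ 0
        gap≡0 = ℕP.m≤n⇒m∸n≡0 (ℕP.≤-trans le (ℕP.≤-trans (ℕP.≤-reflexive (ℕP.+-suc ε (suc k′))) (s≤s (ρ-large G big))))

    ⊤≢⊥ : ⊤ ≢ ⊥ₛ {n}
    ⊤≢⊥ e = contradiction (trans (sym rank-⊤) (trans (cong rank e) (MatroidFacts.rank-⊥ M))) λ ()

    -- The top of a standard chain is a set of size at most `k′`, the full set or a hyperplane;
    -- these cases exclude each other.
    count-decomposition : ∀ d → + standardSeries Q d ≡ base n d ℤ.+ ∑ (allSubsets n) (λ H → when (hyperplaneᵇ H) (hyperplaneCount d ∣ H ∣))
    count-decomposition d = begin
      + length (standardChains d)
        ≡⟨ trans (length-concatMap (chainsTo d d) (filterᵇ flatᵇ (allSubsets n))) (∑ℤ.∑-filter flatᵇ (allSubsets n) (chainCount d d)) ⟩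
      ∑ (allSubsets n) (λ F → when (flatᵇ F) (chainCount d d F))
        ≡⟨ ∑ℤ.∑-cong (allSubsets n) (λ F → pointwise F (∣ F ∣ ℕP.≤? k′) (isFlat? F)) ⟩
      ∑ (allSubsets n) (λ F → (small F ℤ.+ atTop F) ℤ.+ hyper F)
        ≡⟨ trans (∑ℤ.∑-+ (allSubsets n) (λ F → small F ℤ.+ atTop F) hyper) (cong (ℤ._+ ∑ (allSubsets n) hyper) (∑ℤ.∑-+ (allSubsets n) small atTop)) ⟩
      (∑ (allSubsets n) small ℤ.+ ∑ (allSubsets n) atTop) ℤ.+ ∑ (allSubsets n) hyper
        ≡⟨ cong (ℤ._+ ∑ (allSubsets n) hyper) (cong₂ ℤ._+_ (∑-all n (λ i → when (i ≤ᵇ k′) (smallCount d d i)))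
             (trans (∑ℤ.∑-unique atTop (unique-allSubsets n) (∈-allSubsets ⊤) (λ F F≢⊤ → cong (λ b → when b (topCount d d (ε + suc (suc k′)) n)) (dec-false (F ≟ₛ ⊤) F≢⊤)))
                    (cong (λ b → when b (topCount d d (ε + suc (suc k′)) n)) (dec-true (⊤ {n} ≟ₛ ⊤) refl)))) ⟩
      base n d ℤ.+ ∑ (allSubsets n) hyper ∎
      where
      open ≡-Reasoning
      small atTop hyper : Subset n → ℤ
      small F = when (∣ F ∣ ≤ᵇ k′) (smallCount d d ∣ F ∣)
      atTop F = when (does (F ≟ₛ ⊤)) (topCount d d (ε + suc (suc k′)) n)
      hyper H = when (hyperplaneᵇ H) (hyperplaneCount d ∣ H ∣)
      not-hyper : ∀ F → rank F ≢ suc k′ ⊎ ¬ RankFlat F → hyper F ≡ 0ℤ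
      not-hyper F why = go (hyperplaneᵇ F) refl why
        where
        go : ∀ b → hyperplaneᵇ F ≡ b → rank F ≢ suc k′ ⊎ ¬ RankFlat F → when b (hyperplaneCount d ∣ F ∣) ≡ 0ℤ
        go false e _ = refl
        go true  e (inj₁ ne)    = contradiction (proj₂ (hyperplane⁻ e)) ne
        go true  e (inj₂ ¬flat) = contradiction (proj₁ (hyperplane⁻ e)) ¬flat
      not-small : ∀ F → ¬ ∣ F ∣ ≤ k′ → small F ≡ 0ℤ
      not-small F big = cong (λ b → when b (smallCount d d ∣ F ∣)) (≰⇒≤ᵇ-false big)
      not-top : ∀ F → F ≢ ⊤ → atTop F ≡ 0ℤ
      not-top F ne = cong (λ b → when b (topCount d d (ε + suc (suc k′)) n)) (dec-false (F ≟ₛ ⊤) ne)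
      sum3 : ∀ {v a b c x y z} → a ≡ x → b ≡ y → c ≡ z → v ≡ (x ℤ.+ y) ℤ.+ z → v ≡ (a ℤ.+ b) ℤ.+ c
      sum3 refl refl refl e = e
      first : ∀ v → v ≡ (v ℤ.+ 0ℤ) ℤ.+ 0ℤ
      first = solve-∀
      second : ∀ v → v ≡ (0ℤ ℤ.+ v) ℤ.+ 0ℤ
      second = solve-∀
      third : ∀ v → v ≡ (0ℤ ℤ.+ 0ℤ) ℤ.+ v
      third = solve-∀
      pointwise : ∀ F → Dec (∣ F ∣ ≤ k′) → Dec (IsFlat F) → when (flatᵇ F) (chainCount d d F) ≡ (small F ℤ.+ atTop F) ℤ.+ hyper F
      pointwise F (yes le) _ = trans (cong (λ b → when b (chainCount d d F)) (flatᵇ-small le)) (sum3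
          (cong (λ b → when b (smallCount d d ∣ F ∣)) (≤⇒≤ᵇ-true le))
          (not-top F (λ F≡⊤ → ℕP.<⇒≢ (ℕP.m≤n⇒m≤1+n (s≤s le)) (trans (sym rF) (trans (cong rank F≡⊤) rank-⊤))))
          (not-hyper F (inj₁ (λ e → ℕP.<⇒≢ (s≤s le) (trans (sym rF) e))))
          (trans (smallCount-correct d d F le) (first (smallCount d d ∣ F ∣))))
        where
        rF : rank F ≡ ∣ F ∣
        rF = independent F (ℕP.m≤n⇒m≤1+n le)
      pointwise F (no big) (no ¬flat) = trans (cong (λ b → when b (chainCount d d F)) (dec-false (isFlat? F) ¬flat))
        (sum3 (not-small F big) (not-top F (λ { refl → ¬flat (λ i i∉ → ⊥-elim (i∉ SubP.∈⊤)) })) (not-hyper F (inj₂ (λ rf → ¬flat (flat⁺ rf)))) refl)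
      pointwise F (no big) (yes flat) = trans (cong (λ b → when b (chainCount d d F)) (dec-true (isFlat? F) flat)) (classify (F ≟ₛ ⊤))
        where
        F≢⊥ : F ≢ ⊥ₛ
        F≢⊥ refl = big (ℕP.≤-trans (ℕP.≤-reflexive (SubP.∣⊥∣≡0 n)) z≤n)
        classify : Dec (F ≡ ⊤) → chainCount d d F ≡ (small F ℤ.+ atTop F) ℤ.+ hyper F
        classify (yes refl) = sum3 (not-small ⊤ big) (cong (λ b → when b (topCount d d (ε + suc (suc k′)) n)) (dec-true (⊤ {n} ≟ₛ ⊤) refl))
          (not-hyper ⊤ (inj₁ (λ e → ℕP.1+n≢n (trans (sym rank-⊤) e))))
          (trans (topCount-correct d d ⊤ F≢⊥ (ℕP.≤-reflexive ρ⊤)) (trans (cong₂ (topCount d d) ρ⊤ (SubP.∣⊤∣≡n n)) (second _)))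
          where
          ρ⊤ : ρ ⊤ ≡ ε + suc (suc k′)
          ρ⊤ = trans (ρ≡ ⊤ F≢⊥) (cong (λ r → ε + r) rank-⊤)
        classify (no F≢⊤) = sum3 (not-small F big) (not-top F F≢⊤) (cong (λ b → when b (hyperplaneCount d ∣ F ∣)) (hyperplane⁺ (flat⁻ flat) rF))
          (trans (topCount-correct d d F F≢⊥ (ℕP.≤-trans (ℕP.≤-reflexive ρF) (ℕP.+-monoʳ-≤ ε (ℕP.n≤1+n (suc k′))))) (trans (cong (λ s → topCount d d s ∣ F ∣) ρF) (third _)))
          where
          rF : rank F ≡ suc k′
          rF = ℕP.≤-antisym (ℕP.≤-pred (ℕP.≤∧≢⇒< (ℕP.≤-trans (rank-mono SubP.⊆⊤) (ℕP.≤-reflexive rank-⊤)) (λ e → F≢⊤ (full-flat (flat⁻ flat) (trans e (sym rank-⊤)))))) (rank-large F big)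
          ρF : ρ F ≡ ε + suc k′
          ρF = trans (ρ≡ F F≢⊥) (cong (λ r → ε + r) rF)

    -- By double counting, the numbers C(|H|, k-1) add up to C(n, k-1) over all hyperplanes. Adding
    -- and subtracting this multiple of the count for size k-1 turns the sum over hyperplanes into
    -- the uniform count minus the excesses.
    count-formula : ∀ d → + standardSeries Q d ≡ uniformCount n d ℤ.- ∑ (allSubsets n) (λ H → when (hyperplaneᵇ H) (excess d ∣ H ∣))
    count-formula d = trans (count-decomposition d) (trans (arith (base n d) (choose n ℤ.* c₁) hyperTotal) (cong (λ z → uniformCount n d ℤ.- z) (sym excess-sum)))
      where
      c₁ = hyperplaneCount d (suc k′)
      hyperTotal = ∑ (allSubsets n) (λ H → when (hyperplaneᵇ H) (hyperplaneCount d ∣ H ∣))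
      arith : ∀ b u t → b ℤ.+ t ≡ (b ℤ.+ u) ℤ.- (u ℤ.- t)
      arith = solve-∀
      distribute : ∀ b x y z → when b (x ℤ.* y ℤ.- z) ≡ when b x ℤ.* y ℤ.+ ℤ.- when b z
      distribute true  x y z = refl
      distribute false x y z = refl
      excess-sum : ∑ (allSubsets n) (λ H → when (hyperplaneᵇ H) (excess d ∣ H ∣)) ≡ choose n ℤ.* c₁ ℤ.- hyperTotal
      excess-sum = trans (∑ℤ.∑-cong (allSubsets n) (λ H → distribute (hyperplaneᵇ H) (choose ∣ H ∣) c₁ (hyperplaneCount d ∣ H ∣)))
        (trans (∑ℤ.∑-+ (allSubsets n) (λ H → when (hyperplaneᵇ H) (choose ∣ H ∣) ℤ.* c₁) (λ H → ℤ.- when (hyperplaneᵇ H) (hyperplaneCount d ∣ H ∣)))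
        (cong₂ ℤ._+_ (trans (∑ℤ.∑-*ʳ (allSubsets n) c₁ (λ H → when (hyperplaneᵇ H) (choose ∣ H ∣))) (cong (ℤ._* c₁) hyperplane-partition)) (∑ℤ.∑-neg (allSubsets n) (λ H → when (hyperplaneᵇ H) (hyperplaneCount d ∣ H ∣)))))

-- The identities in all ranks

module Identities where

  open import Defs
  open ListSums
  open ChainFunctionals hiding (add)
  open StandardChains
  open Straightenings using (Reach; start; step; reach; ⊆∧≢⇒∣∣<)
  open Evaluation using (∈-allSubsets)
  open ChainEnumeration
  open MatroidInstances
  open SmallRank
  open Counting
  open import Data.Bool using (Bool; true; false; if_then_else_; T; not; _∧_; _∨_)
  import Data.Bool.Properties as BoolP
  open import Data.Fin using (zero; suc)
  import Data.Fin.Properties as FinP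
  open import Data.Fin.Subset using (Subset; _⊆_; ⁅_⁆; _∪_; ⊤; ∁; ∣_∣; inside; outside) renaming (_∈_ to _∈ₛ_; _∉_ to _∉ₛ_)
  import Data.Fin.Subset.Properties as SubP
  open import Data.Integer as ℤ using (ℤ; +_; 0ℤ; 1ℤ)
  import Data.Integer.Properties as ℤP
  open import Data.Nat using (ℕ; zero; suc; _+_; _∸_; _⊓_; _≤_; _<_; z≤n; s≤s; _≡ᵇ_)
  import Data.Nat.Properties as ℕP
  open import Data.Nat.Induction using (<-wellFounded)
  open import Induction.WellFounded using (Acc; acc)
  open import Data.List using ([]; _∷_; upTo; foldr)
  open import Data.List.Membership.Propositional.Properties using (∈-allFin; ∈-upTo⁺)
  import Data.List.Relation.Unary.Unique.Propositional.Properties as UniqueP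
  open import Data.Product using (Σ; ∃; _×_; _,_; proj₁; proj₂)
  open import Data.Sum using (_⊎_; inj₁; inj₂)
  open import Data.Vec using ([]; _∷_; tabulate; take; drop; here; there)
  open import Data.Vec.Properties using (lookup⇒[]=; []=⇒lookup; lookup∘tabulate)
  open import Relation.Nullary using (¬_; Dec; yes; no; contradiction)
  open import Relation.Nullary.Decidable using (dec-false; decidable-stable)
  open import Relation.Binary.PropositionalEquality hiding ([_])

  open ∑ℤ using (∑; when)

  sumFromTo-∑ : ∀ a b f → sumFromTo a b f ≡ ∑ (upTo (suc b ∸ a)) (λ i → f (a + i))
  sumFromTo-∑ a b f = go (upTo (suc b ∸ a))
    where
    go : ∀ xs → foldr (λ i acc → f (a + i) ℤ.+ acc) (+ 0) xs ≡ ∑ xs (λ i → f (a + i))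
    go []       = refl
    go (x ∷ xs) = cong (ℤ._+_ (f (a + x))) (go xs)

  sumFromTo-0 : ∀ a b {f} → (∀ h → a ≤ h → f h ≡ 0ℤ) → sumFromTo a b f ≡ 0ℤ
  sumFromTo-0 a b {f} z = trans (sumFromTo-∑ a b f) (∑ℤ.∑-zero (upTo (suc b ∸ a)) (λ i → z (a + i) (ℕP.m≤m+n a i)))

  stressedHyperplane⁻ : ∀ {n} (rk : RankFn n) A → isStressedHyperplane rk A ≡ true → isFlatIn rk ⊤ A ≡ true × rk A + 1 ≡ rk ⊤
  stressedHyperplane⁻ rk A e = proj₁ e′ , ≡ᵇ-true⇒≡ (proj₂ e′)
    where e′ = ∧-true⁻ {isFlatIn rk ⊤ A} (proj₂ (∧-true⁻ {isStressed rk A} e))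

  isUniformOn⁺ : ∀ {n} (rk : RankFn n) E → (∀ S → S ⊆ E → rk S ≡ ∣ S ∣ ⊓ rk E) → isUniformOn rk E ≡ true
  isUniformOn⁺ {n} rk E h = allᵇ⁺ _ (allSubsets n) (λ S _ → ok S (S SubP.⊆? E))
    where
    ok : ∀ S → Dec (S ⊆ E) → not (S ⊆ᵇ E) ∨ (rk S ≡ᵇ (∣ S ∣ ⊓ rk E)) ≡ true
    ok S (yes S⊆E) = trans (cong (not (S ⊆ᵇ E) ∨_) (≡⇒≡ᵇ-true (h S S⊆E))) (BoolP.∨-zeroʳ _)
    ok S (no S⊈E)  = cong (λ b → not b ∨ (rk S ≡ᵇ (∣ S ∣ ⊓ rk E))) (trans (⊆ᵇ-does S E) (dec-false (S SubP.⊆? E) S⊈E))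

  ∉∁⇒∈ : ∀ {n} {A : Subset n} {i} → i ∈ₛ ∁ A → i ∉ₛ A
  ∉∁⇒∈ i∈∁ i∈ = SubP.x∈p⇒x∉∁p i∈ i∈∁

  -- Contracting a hyperplane leaves a matroid of rank 1, which has no loops because the hyperplane
  -- is a flat; such a matroid is uniform.
  contraction-uniform : ∀ {n} (M : Matroid n) A → isFlatIn (Matroid.rank M) ⊤ A ≡ true → Matroid.rank M A + 1 ≡ Matroid.rank M ⊤ →
                        isUniformOn (contractRank (Matroid.rank M) A) (∁ A) ≡ true
  contraction-uniform {n} M A flat r = isUniformOn⁺ (contractRank rank A) (∁ A) (λ S S⊆ → trans (value S S⊆ (S ≟ₛ ⊥ₛ)) (cong (∣ S ∣ ⊓_) (sym whole)))
    where
    open Matroid M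
    whole : contractRank rank A (∁ A) ≡ 1
    whole = trans (cong (λ T → rank T ∸ rank A) (trans (SubP.∪-comm (∁ A) A) (SubP.p∪∁p≡⊤ A))) (trans (cong (_∸ rank A) (sym r)) (ℕP.m+n∸m≡n (rank A) 1))
    value : ∀ S → S ⊆ ∁ A → Dec (S ≡ ⊥ₛ) → rank (S ∪ A) ∸ rank A ≡ ∣ S ∣ ⊓ 1
    value S S⊆ (yes refl) = trans (cong (λ T → rank T ∸ rank A) (SubP.∪-identityˡ A)) (trans (ℕP.n∸n≡0 (rank A)) (cong (_⊓ 1) (sym (SubP.∣⊥∣≡0 n))))
    value S S⊆ (no S≢⊥) = trans (cong (_∸ rank A) rank-S∪A) (trans (ℕP.m+n∸m≡n (rank A) 1) (sym (ℕP.m≥n⇒m⊓n≡n size)))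
      where
      i = proj₁ (nonempty S≢⊥)
      i∈S = proj₂ (nonempty S≢⊥)
      size : 1 ≤ ∣ S ∣
      size = ℕP.≤-trans (ℕP.≤-reflexive (sym (SubP.∣⁅x⁆∣≡1 i))) (SubP.p⊆q⇒∣p∣≤∣q∣ (⁅⁆-⊆ i∈S))
      i∉A : i ∉ₛ A
      i∉A = ∉∁⇒∈ (S⊆ i∈S)
      bigger : rank A < rank (S ∪ A)
      bigger = ℕP.<-≤-trans (ℕP.≤∧≢⇒< (rank-mono {A} (SubP.p⊆p∪q ⁅ i ⁆)) (λ e → proj₂ (isFlatIn⁻ rank ⊤ A flat) i SubP.∈⊤ i∉A (sym e)))
        (rank-mono (∪-lub (SubP.q⊆p∪q S A) (⁅⁆-⊆ (SubP.p⊆p∪q A i∈S))))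
      rank-S∪A : rank (S ∪ A) ≡ rank A + 1
      rank-S∪A = ℕP.≤-antisym (ℕP.≤-trans (rank-mono SubP.⊆⊤) (ℕP.≤-reflexive (sym r))) (ℕP.≤-trans (ℕP.≤-reflexive (ℕP.+-comm (rank A) 1)) bigger)

  module _ {n : ℕ} (rk : RankFn n) where

    private
      sh : Subset n → Bool
      sh = isStressedHyperplane rk

    numStressed-0 : ∀ h → (∀ A → sh A ≡ true → ∣ A ∣ ≢ h) → + numStressedHyperplanes rk h ≡ 0ℤ
    numStressed-0 h none = trans (length-filter _ (allSubsets n)) (∑ℤ.∑-zero (allSubsets n) (λ A → go A (sh A) refl))
      where
      go : ∀ A b → sh A ≡ b → when (b ∧ (∣ A ∣ ≡ᵇ h)) 1ℤ ≡ 0ℤ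
      go A false e = refl
      go A true  e = cong (λ b → when b 1ℤ) (≢⇒≡ᵇ-false (none A e))

    -- Exchange of sums: instead of counting the sets of each size, each set contributes the value
    -- at its own size.
    regroup-by-size : ∀ a (v : ℕ → ℤ) → sumFromTo a n (λ h → + numStressedHyperplanes rk h ℤ.* v h) ≡
      ∑ (allSubsets n) (λ A → when (sh A) (∑ (upTo (suc n ∸ a)) (λ i → when (∣ A ∣ ≡ᵇ (a + i)) (v (a + i)))))
    regroup-by-size a v = begin
      sumFromTo a n (λ h → + numStressedHyperplanes rk h ℤ.* v h)      ≡⟨ sumFromTo-∑ a n (λ h → + numStressedHyperplanes rk h ℤ.* v h) ⟩
      ∑ is (λ i → + numStressedHyperplanes rk (a + i) ℤ.* v (a + i))
        ≡⟨ ∑ℤ.∑-cong is (λ i → trans (cong (ℤ._* v (a + i)) (length-filter _ (allSubsets n))) (sym (∑ℤ.∑-*ʳ (allSubsets n) (v (a + i)) _))) ⟩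
      ∑ is (λ i → ∑ (allSubsets n) (λ A → when (sh A ∧ (∣ A ∣ ≡ᵇ (a + i))) 1ℤ ℤ.* v (a + i)))  ≡⟨ ∑ℤ.∑-swap is (allSubsets n) _ ⟩
      ∑ (allSubsets n) (λ A → ∑ is (λ i → when (sh A ∧ (∣ A ∣ ≡ᵇ (a + i))) 1ℤ ℤ.* v (a + i)))
        ≡⟨ ∑ℤ.∑-cong (allSubsets n) (λ A → trans (∑ℤ.∑-cong is (λ i → pull (sh A) (∣ A ∣ ≡ᵇ (a + i)) (v (a + i)))) (out (sh A) _)) ⟩
      ∑ (allSubsets n) (λ A → when (sh A) (∑ is (λ i → when (∣ A ∣ ≡ᵇ (a + i)) (v (a + i))))) ∎
      where
      open ≡-Reasoning
      is = upTo (suc n ∸ a)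
      pull : ∀ b c x → when (b ∧ c) 1ℤ ℤ.* x ≡ when b (when c x)
      pull true  true  x = ℤP.*-identityˡ x
      pull true  false x = ℤP.*-zeroˡ x
      pull false c     x = ℤP.*-zeroˡ x
      out : ∀ b (f : ℕ → ℤ) → ∑ is (λ i → when b (f i)) ≡ when b (∑ is f)
      out true  f = refl
      out false f = ∑ℤ.∑-zero is {λ _ → 0ℤ} (λ _ → refl)

    size-in-range : ∀ a (v : ℕ → ℤ) (A : Subset n) → a ≤ ∣ A ∣ → ∑ (upTo (suc n ∸ a)) (λ i → when (∣ A ∣ ≡ᵇ (a + i)) (v (a + i))) ≡ v ∣ A ∣
    size-in-range a v A le = trans (∑ℤ.∑-unique f (UniqueP.upTo⁺ (suc n ∸ a)) (∈-upTo⁺ i<) other) (trans (cong (λ j → when (∣ A ∣ ≡ᵇ j) (v j)) (ℕP.m+[n∸m]≡n le)) (cong (λ b → when b (v ∣ A ∣)) (≡⇒≡ᵇ-true {∣ A ∣} refl)))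
      where
      f = λ i → when (∣ A ∣ ≡ᵇ (a + i)) (v (a + i))
      i₀ = ∣ A ∣ ∸ a
      i< : i₀ < suc n ∸ a
      i< = ℕP.≤-trans (s≤s (ℕP.∸-monoˡ-≤ a (SubP.∣p∣≤n A))) (ℕP.≤-reflexive (sym (ℕP.+-∸-assoc 1 (ℕP.≤-trans le (SubP.∣p∣≤n A)))))
      other : ∀ i → i ≢ i₀ → f i ≡ 0ℤ
      other i i≢ = cong (λ b → when b (v (a + i))) (≢⇒≡ᵇ-false (λ e → i≢ (sym (trans (cong (_∸ a) e) (ℕP.m+n∸m≡n a i)))))

    size-out-of-range : ∀ a (v : ℕ → ℤ) (A : Subset n) → ∣ A ∣ < a → ∑ (upTo (suc n ∸ a)) (λ i → when (∣ A ∣ ≡ᵇ (a + i)) (v (a + i))) ≡ 0ℤ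
    size-out-of-range a v A lt = ∑ℤ.∑-zero (upTo (suc n ∸ a)) (λ i → cong (λ b → when b (v (a + i))) (≢⇒≡ᵇ-false (ℕP.<⇒≢ (ℕP.<-≤-trans lt (ℕP.m≤m+n a i)))))

  sumFromTo-cong : ∀ a b {f g} → (∀ h → a ≤ h → f h ≡ g h) → sumFromTo a b f ≡ sumFromTo a b g
  sumFromTo-cong a b {f} {g} e = trans (sumFromTo-∑ a b f) (trans (∑ℤ.∑-cong (upTo (suc b ∸ a)) (λ i → e (a + i) (ℕP.m≤m+n a i))) (sym (sumFromTo-∑ a b g)))

  -- Induction on the size. If all proper subsets of `S` are independent and `S` is not, then `S` is
  -- a circuit with fewer than `k` elements.
  paving-independent : ∀ {n k} (M : Matroid n) → IsPavingOfRank M k → ∀ S → ∣ S ∣ < k → Matroid.rank M S ≡ ∣ S ∣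
  paving-independent {n} {k} M (_ , circuits) S lt = go S lt (<-wellFounded ∣ S ∣)
    where
    open Matroid M
    go : ∀ S → ∣ S ∣ < k → Acc _<_ ∣ S ∣ → rank S ≡ ∣ S ∣
    go S lt (acc rec) = decidable-stable (rank S ℕP.≟ ∣ S ∣) (λ ne → ℕP.<⇒≱ lt (circuits S (ℕP.≤∧≢⇒< (rank-bound S) ne , (λ D D⊆S D≢S →
      go D (ℕP.<-trans (⊆∧≢⇒∣∣< D⊆S D≢S) lt) (rec (⊆∧≢⇒∣∣< D⊆S D≢S))))))

  paving-record : ∀ {n k′} (M : Matroid n) → IsPavingOfRank M (suc (suc k′)) → Paving M k′
  paving-record M P = record { rank-⊤ = proj₁ P ; independent = λ S small → paving-independent M P S (s≤s small) }

  module _ {n k′ : ℕ} (M : Matroid n) (paving : Paving M k′) where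
    open Matroid M
    open Paving paving
    open PavingFacts M paving

    -- Inside a hyperplane, sets with at most k-1 elements are independent and larger ones have its
    -- full rank k-1, so the restriction is uniform. The contraction is uniform for any hyperplane.
    paving-stressed : ∀ A → isStressedHyperplane rank A ≡ hyperplaneᵇ A
    paving-stressed A = go (hyperplaneᵇ A) refl
      where
      go : ∀ b → hyperplaneᵇ A ≡ b → isStressed rank A ∧ b ≡ b
      go false e = BoolP.∧-zeroʳ _
      go true  e = cong (_∧ true) (cong₂ _∧_ (isUniformOn⁺ rank A uniform) (contraction-uniform M A (proj₁ e′) (≡ᵇ-true⇒≡ (proj₂ e′))))
        where
        e′ = ∧-true⁻ {isFlatIn rank ⊤ A} e
        rA = proj₂ (hyperplane⁻ {A} e)
        uniform : ∀ S → S ⊆ A → rank S ≡ ∣ S ∣ ⊓ rank A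
        uniform S S⊆A with ∣ S ∣ ℕP.≤? k′
        ... | yes le = trans (independent S (ℕP.m≤n⇒m≤1+n le)) (sym (ℕP.m≤n⇒m⊓n≡m (ℕP.≤-trans (ℕP.m≤n⇒m≤1+n le) (ℕP.≤-reflexive (sym rA)))))
        ... | no big = trans (ℕP.≤-antisym (rank-mono S⊆A) (ℕP.≤-trans (ℕP.≤-reflexive rA) (rank-large S big)))
                             (sym (ℕP.m≥n⇒m⊓n≡n (ℕP.≤-trans (ℕP.≤-reflexive rA) (ℕP.≰⇒> big))))

    -- Σ_h λ_h e(h) over h ≥ k is a sum over all hyperplanes because e(k - 1) = 0.
    stressed-sum : ∀ (e : ℕ → ℤ) → e (suc k′) ≡ 0ℤ →
      sumFromTo (suc (suc k′)) n (λ h → + numStressedHyperplanes rank h ℤ.* e h) ≡ ∑ (allSubsets n) (λ H → when (hyperplaneᵇ H) (e ∣ H ∣))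
    stressed-sum e e≡0 = trans (regroup-by-size rank (suc (suc k′)) e) (∑ℤ.∑-cong (allSubsets n) (λ A →
        trans (cong (λ b → when b _) (paving-stressed A)) (go A (hyperplaneᵇ A) refl)))
      where
      inner : Subset n → ℤ
      inner A = ∑ (upTo (suc n ∸ suc (suc k′))) (λ i → when (∣ A ∣ ≡ᵇ (suc (suc k′) + i)) (e (suc (suc k′) + i)))
      go : ∀ A b → hyperplaneᵇ A ≡ b → when b (inner A) ≡ when b (e ∣ A ∣)
      go A false h = refl
      go A true  h with suc (suc k′) ℕP.≤? ∣ A ∣
      ... | yes le = size-in-range rank (suc (suc k′)) e A le
      ... | no lt  = trans (size-out-of-range rank (suc (suc k′)) e A (ℕP.≰⇒> lt))
                       (sym (trans (cong e (ℕP.≤-antisym (ℕP.≤-pred (ℕP.≰⇒> lt)) (hyperplane-size {A} h))) e≡0))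

  uniform-paving : ∀ {n k′} → suc (suc k′) ≤ n → Paving (uniformMatroid (suc (suc k′)) n) k′
  uniform-paving {n} {k′} le = record
    { rank-⊤      = trans (cong (suc (suc k′) ⊓_) (SubP.∣⊤∣≡n n)) (ℕP.m≤n⇒m⊓n≡m le)
    ; independent = λ S small → ℕP.m≥n⇒m⊓n≡n (ℕP.m≤n⇒m≤1+n small) }

  uniform-loopless : ∀ k″ n → Loopless (uniformMatroid (suc k″) n)
  uniform-loopless k″ n i = subst (λ c → 1 ≤ suc k″ ⊓ c) (sym (SubP.∣⁅x⁆∣≡1 i)) (s≤s z≤n)

  uniform-hyperplane-size : ∀ {n k′} (le : suc (suc k′) ≤ n) H →
    PavingFacts.hyperplaneᵇ (uniformMatroid (suc (suc k′)) n) (uniform-paving le) H ≡ true → ∣ H ∣ ≡ suc k′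
  uniform-hyperplane-size {n} {k′} le H e = exact ∣ H ∣ (proj₂ (PavingFacts.hyperplane⁻ (uniformMatroid (suc (suc k′)) n) (uniform-paving le) {H} e))
    where
    exact : ∀ h → suc (suc k′) ⊓ h ≡ suc k′ → h ≡ suc k′
    exact h e with ℕP.≤-total (suc (suc k′)) h
    ... | inj₁ k≤h = contradiction (trans (sym (ℕP.m≤n⇒m⊓n≡m k≤h)) e) ℕP.1+n≢n
    ... | inj₂ h≤k = trans (sym (ℕP.m≥n⇒m⊓n≡n h≤k)) e

  coloopExtension : ∀ a h → Matroid (h + 1)
  coloopExtension a h = directSum (uniformMatroid a h) (uniformMatroid 1 1)

  -- The ground set of the first summand: everything but the coloop.
  summand : ∀ h → Subset (h + 1)
  summand zero    = outside ∷ []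
  summand (suc h) = inside ∷ summand h

  ∣summand∣ : ∀ h → ∣ summand h ∣ ≡ h
  ∣summand∣ zero    = refl
  ∣summand∣ (suc h) = cong suc (∣summand∣ h)

  ∣take-summand∣ : ∀ h → ∣ take h (summand h) ∣ ≡ h
  ∣take-summand∣ zero    = refl
  ∣take-summand∣ (suc h) = cong suc (∣take-summand∣ h)

  ∣drop-summand∣ : ∀ h → ∣ drop h (summand h) ∣ ≡ 0
  ∣drop-summand∣ zero    = refl
  ∣drop-summand∣ (suc h) = ∣drop-summand∣ h

  ⊆summand : ∀ h {S : Subset (h + 1)} → ∣ drop h S ∣ ≡ 0 → S ⊆ summand h
  ⊆summand zero    {outside ∷ []} e x∈ = x∈
  ⊆summand (suc h) {s ∷ S} e here       = here
  ⊆summand (suc h) {s ∷ S} e (there x∈) = there (⊆summand h e x∈)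

  ∣take-⊤∣ : ∀ h → ∣ take h (⊤ {h + 1}) ∣ ≡ h
  ∣take-⊤∣ zero    = refl
  ∣take-⊤∣ (suc h) = cong suc (∣take-⊤∣ h)

  ∣drop-⊤∣ : ∀ h → ∣ drop h (⊤ {h + 1}) ∣ ≡ 1
  ∣drop-⊤∣ zero    = refl
  ∣drop-⊤∣ (suc h) = ∣drop-⊤∣ h

  coloop-rank-⊤ : ∀ a h → a ≤ h → Matroid.rank (coloopExtension a h) ⊤ ≡ suc a
  coloop-rank-⊤ a h le = trans (cong₂ (λ x y → a ⊓ x + 1 ⊓ y) (∣take-⊤∣ h) (∣drop-⊤∣ h)) (trans (cong (_+ 1) (ℕP.m≤n⇒m⊓n≡m le)) (ℕP.+-comm a 1))

  coloop-loopless : ∀ k′ h → Loopless (coloopExtension (suc k′) h)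
  coloop-loopless k′ h i = go ∣ take h ⁅ i ⁆ ∣ ∣ drop h ⁅ i ⁆ ∣ (trans (∣take∣+∣drop∣ h ⁅ i ⁆) (SubP.∣⁅x⁆∣≡1 i))
    where
    go : ∀ x y → x + y ≡ 1 → 1 ≤ suc k′ ⊓ x + 1 ⊓ y
    go (suc x) y       e = s≤s z≤n
    go zero    (suc y) e = s≤s z≤n

  -- A paving matroid in which exactly one hyperplane has a size other than k-1, namely the first
  -- summand with its `h` elements. It isolates the excess of a single hyperplane of size `h`.
  module Coloop {k′ h : ℕ} (k≤h : suc (suc k′) ≤ h) where
    N = coloopExtension (suc k′) h
    open Matroid N

    coloop-paving : Paving N k′
    coloop-paving = record
      { rank-⊤      = coloop-rank-⊤ (suc k′) h (ℕP.≤-trans (ℕP.n≤1+n _) k≤h)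
      ; independent = λ S small → trans (cong₂ _+_ (ℕP.m≥n⇒m⊓n≡n (ℕP.≤-trans (ℕP.m≤m+n _ _) (ℕP.≤-trans (ℕP.≤-reflexive (∣take∣+∣drop∣ h S)) small))) (ℕP.m≥n⇒m⊓n≡n (SubP.∣p∣≤n (drop h S)))) (∣take∣+∣drop∣ h S) }

    open PavingFacts N coloop-paving

    rank-summand : rank (summand h) ≡ suc k′
    rank-summand = trans (cong₂ (λ x y → suc k′ ⊓ x + 1 ⊓ y) (∣take-summand∣ h) (∣drop-summand∣ h)) (trans (ℕP.+-identityʳ _) (ℕP.m≤n⇒m⊓n≡m (ℕP.≤-trans (ℕP.n≤1+n _) k≤h)))

    summand-hyperplane : hyperplaneᵇ (summand h) ≡ true
    summand-hyperplane = hyperplane⁺ flat rank-summand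
      where
      flat : RankFlat (summand h)
      flat i i∉ e = i∉ (⊆summand h {summand h ∪ ⁅ i ⁆} (no-coloop ∣ take h (summand h ∪ ⁅ i ⁆) ∣ ∣ drop h (summand h ∪ ⁅ i ⁆) ∣ big (trans e rank-summand)) (SubP.q⊆p∪q (summand h) ⁅ i ⁆ (SubP.x∈⁅x⁆ i)))
        where
        big : suc k′ ≤ ∣ take h (summand h ∪ ⁅ i ⁆) ∣
        big = ℕP.≤-trans (ℕP.≤-trans (ℕP.≤-trans (ℕP.n≤1+n _) k≤h) (ℕP.≤-reflexive (sym (∣take-summand∣ h)))) (SubP.p⊆q⇒∣p∣≤∣q∣ (take-⊆ h (SubP.p⊆p∪q {p = summand h} ⁅ i ⁆)))
        no-coloop : ∀ x y → suc k′ ≤ x → suc k′ ⊓ x + 1 ⊓ y ≡ suc k′ → y ≡ 0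
        no-coloop x zero    le e = refl
        no-coloop x (suc y) le e = contradiction (trans (sym (ℕP.+-comm (suc k′) 1)) (trans (cong (_+ 1) (sym (ℕP.m≤n⇒m⊓n≡m le))) e)) ℕP.1+n≢n

    -- Without the coloop, a hyperplane lies in the first summand and has the same rank, so it is
    -- equal to it. With the coloop, it has rank k-2 in the first summand, hence k-2 elements there.
    hyperplane-cases : ∀ H → hyperplaneᵇ H ≡ true → ∣ H ∣ ≡ suc k′ ⊎ H ≡ summand h
    hyperplane-cases H hyp = go ∣ drop h H ∣ refl
      where
      flat = proj₁ (hyperplane⁻ {H} hyp)
      rH = proj₂ (hyperplane⁻ {H} hyp)
      go : ∀ y → ∣ drop h H ∣ ≡ y → ∣ H ∣ ≡ suc k′ ⊎ H ≡ summand h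
      go zero e = inj₂ (SubP.⊆-antisym H⊆ (λ {i} i∈ → decidable-stable (i SubP.∈? H) (λ i∉ → flat i i∉ (ℕP.≤-antisym
          (ℕP.≤-trans (rank-mono (∪-lub H⊆ (⁅⁆-⊆ i∈))) (ℕP.≤-reflexive (trans rank-summand (sym rH)))) (rank-mono {H} (SubP.p⊆p∪q ⁅ i ⁆))))))
        where
        H⊆ : H ⊆ summand h
        H⊆ = ⊆summand h e
      go (suc y) e = inj₁ (trans (sym (∣take∣+∣drop∣ h H)) (trans (cong₂ _+_ (small ∣ take h H ∣ (ℕP.suc-injective (trans (ℕP.+-comm 1 _) (trans (cong (λ z → suc k′ ⊓ ∣ take h H ∣ + z) (sym one)) rH)))) drop≡1) (ℕP.+-comm k′ 1)))
        where
        drop≡1 : ∣ drop h H ∣ ≡ 1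
        drop≡1 = ℕP.≤-antisym (SubP.∣p∣≤n (drop h H)) (ℕP.≤-trans (s≤s z≤n) (ℕP.≤-reflexive (sym e)))
        one : 1 ⊓ ∣ drop h H ∣ ≡ 1
        one = cong (1 ⊓_) drop≡1
        small : ∀ x → suc k′ ⊓ x ≡ k′ → x ≡ k′
        small x e with ℕP.≤-total (suc k′) x
        ... | inj₁ le = contradiction (trans (sym (ℕP.m≤n⇒m⊓n≡m le)) e) ℕP.1+n≢n
        ... | inj₂ le = trans (sym (ℕP.m≥n⇒m⊓n≡n le)) e

    hyperplane-sum : ∀ (e : ℕ → ℤ) → e (suc k′) ≡ 0ℤ → ∑ (allSubsets (h + 1)) (λ H → when (hyperplaneᵇ H) (e ∣ H ∣)) ≡ e h
    hyperplane-sum e e≡0 = trans (∑ℤ.∑-unique (λ H → when (hyperplaneᵇ H) (e ∣ H ∣)) (unique-allSubsets (h + 1)) (∈-allSubsets (summand h)) (λ H H≢ → other H H≢ (hyperplaneᵇ H) refl))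
        (trans (cong (λ b → when b (e ∣ summand h ∣)) summand-hyperplane) (cong e (∣summand∣ h)))
      where
      other : ∀ H → H ≢ summand h → ∀ b → hyperplaneᵇ H ≡ b → when b (e ∣ H ∣) ≡ 0ℤ
      other H H≢ false hyp = refl
      other H H≢ true  hyp with hyperplane-cases H hyp
      ... | inj₁ size = trans (cong e size) e≡0
      ... | inj₂ same = contradiction same H≢

  -- Wrappers keep the type checker from unfolding the presentations when it compares two instances.
  record ChowSeries {n : ℕ} (rk : RankFn n) (f : ℕ → ℕ) : Set where
    constructor chowSeries
    field isChowSeries : IsChowHilbertSeries rk f

  record AugSeries {n : ℕ} (rk : RankFn n) (f : ℕ → ℕ) : Set where
    constructor augSeries
    field isAugSeries : IsAugChowHilbertSeries rk f

  SeriesIdentity : ∀ {n} → Matroid n → ℕ → (∀ {m} → RankFn m → (ℕ → ℕ) → Set) → Set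
  SeriesIdentity {n} M k Series =
    Σ (ℕ → ℕ) λ hM → Σ (ℕ → ℕ) λ hU → Σ (ℕ → ℕ → ℕ) λ hA → Σ (ℕ → ℕ → ℕ) λ hB →
      Series (Matroid.rank M) hM × Series (uniformRank k n) hU
      × (∀ h → k ≤ h → Series (uniformRank k (suc h)) (hA h) × Series (uniformRank (k ∸ 1) h ⊕ uniformRank 1 1) (hB h))
      × (∀ d → + hM d ≡ + hU d ℤ.- sumFromTo k n (λ h → + numStressedHyperplanes (Matroid.rank M) h ℤ.* (+ hA h d ℤ.- + hB h d)))

  -- One argument for both series: `ε` is 0 for the Chow ring and 1 for the augmented one.
  module General (k′ ε : ℕ) (Series : ∀ {m} → RankFn m → (ℕ → ℕ) → Set)
    (Q : ∀ {m} (M : Matroid m) → Loopless M → Polymatroid m)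
    (series : ∀ {m} (M : Matroid m) (l : Loopless M) → Series (Matroid.rank M) (standardSeries (Q M l)))
    (ρ≡ : ∀ {m} (M : Matroid m) (l : Loopless M) S → S ≢ ⊥ₛ → Polymatroid.ρ (Q M l) S ≡ ε + Matroid.rank M S)
    (flat⁺ : ∀ {m} (M : Matroid m) (l : Loopless M) {F} → Loopless-Polymatroids.RankFlat M l F → Standard.IsFlat (Q M l) F)
    (flat⁻ : ∀ {m} (M : Matroid m) (l : Loopless M) {F} → Standard.IsFlat (Q M l) F → Loopless-Polymatroids.RankFlat M l F) where

    open Numeric k′ ε
    k : ℕ
    k = suc (suc k′)

    formula : ∀ {m} (M : Matroid m) (l : Loopless M) (p : Paving M k′) d →
      + standardSeries (Q M l) d ≡ uniformCount m d ℤ.- ∑ (allSubsets m) (λ H → when (PavingFacts.hyperplaneᵇ M p H) (excess d ∣ H ∣))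
    formula M l p = ChainCount.count-formula {ε = ε} M p (Q M l) (ρ≡ M l) (λ {F} → flat⁺ M l {F}) (λ {F} → flat⁻ M l {F})

    uniform-series : ∀ m (l : Loopless (uniformMatroid k m)) → k ≤ m → ∀ d → + standardSeries (Q (uniformMatroid k m) l) d ≡ uniformCount m d
    uniform-series m l le d = trans (formula (uniformMatroid k m) l (uniform-paving le) d)
      (trans (cong (λ z → uniformCount m d ℤ.- z) (∑ℤ.∑-zero (allSubsets m) (λ H → go H (PavingFacts.hyperplaneᵇ (uniformMatroid k m) (uniform-paving le) H) refl))) (ℤP.+-identityʳ (uniformCount m d)))
      where
      go : ∀ H b → PavingFacts.hyperplaneᵇ (uniformMatroid k m) (uniform-paving le) H ≡ b → when b (excess d ∣ H ∣) ≡ 0ℤ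
      go H false e = refl
      go H true  e = trans (cong (excess d) (uniform-hyperplane-size le H e)) (excess-diagonal d)

    coloop-series : ∀ h (l : Loopless (coloopExtension (suc k′) h)) → k ≤ h → ∀ d → + standardSeries (Q (coloopExtension (suc k′) h) l) d ≡ uniformCount (suc h) d ℤ.- excess d h
    coloop-series h l le d = trans (formula (coloopExtension (suc k′) h) l (Coloop.coloop-paving le) d)
      (cong₂ (λ m z → uniformCount m d ℤ.- z) (ℕP.+-comm h 1) (Coloop.hyperplane-sum le (excess d) (excess-diagonal d)))

    identity : ∀ {n} (M : Matroid n) → Paving M k′ → SeriesIdentity M k Series
    identity {n} M p = hM , hU , hA , hB , series M lM , series (uniformMatroid k n) (lU n) ,
        (λ h _ → series (uniformMatroid k (suc h)) (lU (suc h)) , series (coloopExtension (suc k′) h) (coloop-loopless k′ h)) , equation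
      where
      lM = PavingFacts.loopless M p
      lU = uniform-loopless (suc k′)
      k≤n : k ≤ n
      k≤n = ℕP.≤-trans (ℕP.≤-reflexive (sym (Paving.rank-⊤ p))) (ℕP.≤-trans (Matroid.rank-bound M ⊤) (ℕP.≤-reflexive (SubP.∣⊤∣≡n n)))
      hM hU : ℕ → ℕ
      hM = standardSeries (Q M lM)
      hU = standardSeries (Q (uniformMatroid k n) (lU n))
      hA hB : ℕ → ℕ → ℕ
      hA h = standardSeries (Q (uniformMatroid k (suc h)) (lU (suc h)))
      hB h = standardSeries (Q (coloopExtension (suc k′) h) (coloop-loopless k′ h))
      -- The uniform counts on `suc h` elements cancel; what remains is the excess of the one large
      -- hyperplane.
      difference : ∀ d h → k ≤ h → + hA h d ℤ.- + hB h d ≡ excess d h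
      difference d h le = trans (cong₂ ℤ._-_ (uniform-series (suc h) (lU (suc h)) (ℕP.m≤n⇒m≤1+n le) d) (coloop-series h (coloop-loopless k′ h) le d)) (arith (uniformCount (suc h) d) (excess d h))
        where
        open import Data.Integer.Tactic.RingSolver using (solve-∀)
        arith : ∀ u e → u ℤ.- (u ℤ.- e) ≡ e
        arith = solve-∀
      λₕ : ℕ → ℤ
      λₕ h = + numStressedHyperplanes (Matroid.rank M) h
      corrections : ∀ d → sumFromTo k n (λ h → λₕ h ℤ.* excess d h) ≡ sumFromTo k n (λ h → λₕ h ℤ.* (+ hA h d ℤ.- + hB h d))
      corrections d = sumFromTo-cong k n {λ h → λₕ h ℤ.* excess d h} {λ h → λₕ h ℤ.* (+ hA h d ℤ.- + hB h d)} (λ h le → cong (λ y → λₕ h ℤ.* y) (sym (difference d h le)))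
      equation : ∀ d → + hM d ≡ + hU d ℤ.- sumFromTo k n (λ h → λₕ h ℤ.* (+ hA h d ℤ.- + hB h d))
      equation d = begin
        + hM d                                                                                    ≡⟨ formula M lM p d ⟩
        uniformCount n d ℤ.- ∑ (allSubsets n) (λ H → when (PavingFacts.hyperplaneᵇ M p H) (excess d ∣ H ∣))  ≡⟨ cong (λ z → uniformCount n d ℤ.- z) (stressed-sum M p (excess d) (excess-diagonal d)) ⟨
        uniformCount n d ℤ.- sumFromTo k n (λ h → λₕ h ℤ.* excess d h)                              ≡⟨ cong (λ z → uniformCount n d ℤ.- z) (corrections d) ⟩
        uniformCount n d ℤ.- sumFromTo k n (λ h → λₕ h ℤ.* (+ hA h d ℤ.- + hB h d))                 ≡⟨ cong (λ z → z ℤ.- sumFromTo k n (λ h → λₕ h ℤ.* (+ hA h d ℤ.- + hB h d))) (uniform-series n (lU n) k≤n d) ⟨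
        + hU d ℤ.- sumFromTo k n (λ h → λₕ h ℤ.* (+ hA h d ℤ.- + hB h d))                           ∎
        where open ≡-Reasoning

  no-correction : ∀ a b {z} {f : ℕ → ℤ} → (∀ h → a ≤ h → f h ≡ 0ℤ) → z ≡ z ℤ.- sumFromTo a b f
  no-correction a b {z} f≡0 = sym (trans (cong (λ y → z ℤ.- y) (sumFromTo-0 a b f≡0)) (ℤP.+-identityʳ z))

  module _ {n k : ℕ} (M : Matroid n) (Series : ∀ {m} → RankFn m → (ℕ → ℕ) → Set) (g : ℕ → ℕ) (hA hB : ℕ → ℕ → ℕ)
    (sM : Series (Matroid.rank M) g) (sU : Series (uniformRank k n) g)
    (sAB : ∀ h → k ≤ h → Series (uniformRank k (suc h)) (hA h) × Series (uniformRank (k ∸ 1) h ⊕ uniformRank 1 1) (hB h)) where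

    private
      λₕ : ℕ → ℤ
      λₕ h = + numStressedHyperplanes (Matroid.rank M) h

    identity-unstressed : (∀ h → k ≤ h → λₕ h ≡ 0ℤ) → SeriesIdentity M k Series
    identity-unstressed none = g , g , hA , hB , sM , sU , sAB ,
      (λ d → no-correction k n (λ h le → trans (cong (ℤ._* (+ hA h d ℤ.- + hB h d)) (none h le)) (ℤP.*-zeroˡ (+ hA h d ℤ.- + hB h d))))

    identity-equal : (∀ h d → hA h d ≡ hB h d) → SeriesIdentity M k Series
    identity-equal same = g , g , hA , hB , sM , sU , sAB ,
      (λ d → no-correction k n (λ h le → trans (cong (λ y → λₕ h ℤ.* (+ y ℤ.- + hB h d)) (same h d)) (trans (cong (ℤ._*_ (λₕ h)) (ℤP.+-inverseʳ (+ hB h d))) (ℤP.*-zeroʳ (λₕ h)))))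

  looped-series : ∀ {n} (rk : RankFn n) i → rk ⁅ i ⁆ ≡ 0 → ChowSeries rk (λ _ → 0)
  looped-series {n} rk i e = chowSeries (subst (λ b → if b then (∀ d → 0 ≡ 0) else IsHilbertSeries (chowPresentation rk) (λ _ → 0))
    (sym (anyᵇ-true (isLoop rk) (∈-allFin i) (≡⇒≡ᵇ-true e))) (λ _ → refl))

  coloop-looped : ∀ h → ChowSeries (uniformRank 0 (suc h) ⊕ uniformRank 1 1) (λ _ → 0)
  coloop-looped h = looped-series (uniformRank 0 (suc h) ⊕ uniformRank 1 1) zero (cong (1 ⊓_) (drop-⊥ h))
    where
    drop-⊥ : ∀ h → ∣ drop h (⊥ₛ {h + 1}) ∣ ≡ 0
    drop-⊥ zero    = refl
    drop-⊥ (suc h) = drop-⊥ h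

  module RankOneCase {n : ℕ} (M : Matroid n) (rank⊤ : Matroid.rank M ⊤ ≡ 1) where
    open Matroid M
    open MatroidFacts M

    1≤n : 1 ≤ n
    1≤n = ℕP.≤-trans (ℕP.≤-reflexive (sym rank⊤)) (ℕP.≤-trans (rank-bound ⊤) (ℕP.≤-reflexive (SubP.∣⊤∣≡n n)))

    uniform-⊤ : ∀ m → 1 ≤ m → uniformRank 1 m ⊤ ≡ 1
    uniform-⊤ m 1≤m = trans (cong (1 ⊓_) (SubP.∣⊤∣≡n m)) (ℕP.m≤n⇒m⊓n≡m 1≤m)

    uniform-chow : ∀ m → 1 ≤ m → ChowSeries (uniformRank 1 m) pointChow
    uniform-chow m 1≤m = chowSeries (pointChow-series (uniformMatroid 1 m) (uniformRank 1 m) refl (uniform-⊤ m 1≤m) (uniform-loopless 0 m))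

    looped : ∀ h → 1 ≤ h → ChowSeries (uniformRank 0 h ⊕ uniformRank 1 1) (λ _ → 0)
    looped (suc h) _ = coloop-looped h

    -- In rank one this is the unique hyperplane, and it is stressed.
    loops : Subset n
    loops = tabulate (λ i → rank ⁅ i ⁆ ≡ᵇ 0)

    ∈loops⁻ : ∀ {i} → i ∈ₛ loops → rank ⁅ i ⁆ ≡ 0
    ∈loops⁻ {i} i∈ = ≡ᵇ-true⇒≡ (trans (sym (lookup∘tabulate _ i)) ([]=⇒lookup i∈))

    ∈loops⁺ : ∀ {i} → rank ⁅ i ⁆ ≡ 0 → i ∈ₛ loops
    ∈loops⁺ {i} e = lookup⇒[]= i loops (trans (lookup∘tabulate _ i) (≡⇒≡ᵇ-true e))

    rank-loops : rank loops ≡ 0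
    rank-loops = go (reach SubP.⊥⊆) (λ x → x)
      where
      go : ∀ {G} → Reach ⊥ₛ G → G ⊆ loops → rank G ≡ 0
      go start sub = rank-⊥
      go (step {G} i r) sub = ℕP.n≤0⇒n≡0 (ℕP.≤-trans (ℕP.m≤m+n _ _) (ℕP.≤-trans (rank-submod G ⁅ i ⁆)
        (ℕP.≤-reflexive (cong₂ _+_ (go r (λ x∈ → sub (SubP.p⊆p∪q ⁅ i ⁆ x∈))) (∈loops⁻ (sub (SubP.q⊆p∪q G ⁅ i ⁆ (SubP.x∈⁅x⁆ i))))))))

    loops-flat : isFlatIn rank ⊤ loops ≡ true
    loops-flat = isFlatIn⁺ rank ⊤ loops SubP.⊆⊤ (λ i _ i∉ e → i∉ (∈loops⁺ (ℕP.n≤0⇒n≡0 (ℕP.≤-trans (rank-mono (SubP.q⊆p∪q loops ⁅ i ⁆)) (ℕP.≤-reflexive (trans e rank-loops))))))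

    loops-rank+1 : rank loops + 1 ≡ rank ⊤
    loops-rank+1 = trans (cong (_+ 1) rank-loops) (sym rank⊤)

    loops-stressed : isStressedHyperplane rank loops ≡ true
    loops-stressed = cong₂ _∧_ (cong₂ _∧_ (isUniformOn⁺ rank loops uniform) (contraction-uniform M loops loops-flat loops-rank+1)) (cong₂ _∧_ loops-flat (≡⇒≡ᵇ-true loops-rank+1))
      where
      uniform : ∀ S → S ⊆ loops → rank S ≡ ∣ S ∣ ⊓ rank loops
      uniform S S⊆ = trans (ℕP.n≤0⇒n≡0 (ℕP.≤-trans (rank-mono S⊆) (ℕP.≤-reflexive rank-loops))) (sym (trans (cong (∣ S ∣ ⊓_) rank-loops) (ℕP.⊓-zeroʳ ∣ S ∣)))

    stressed-rank : ∀ {A} → isStressedHyperplane rank A ≡ true → rank A ≡ 0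
    stressed-rank {A} e = ℕP.suc-injective (trans (ℕP.+-comm 1 (rank A)) (trans (proj₂ (stressedHyperplane⁻ rank A e)) rank⊤))

    stressed-unique : ∀ {A} → isStressedHyperplane rank A ≡ true → A ≡ loops
    stressed-unique {A} e = SubP.⊆-antisym (λ i∈ → ∈loops⁺ (ℕP.n≤0⇒n≡0 (ℕP.≤-trans (rank-mono (⁅⁆-⊆ i∈)) (ℕP.≤-reflexive (stressed-rank e)))))
      (λ {i} i∈ → decidable-stable (i SubP.∈? A) (λ i∉ → proj₂ (isFlatIn⁻ rank ⊤ A (proj₁ (stressedHyperplane⁻ rank A e))) i SubP.∈⊤ i∉
        (ℕP.≤-antisym (ℕP.≤-trans (ℕP.m≤m+n _ _) (ℕP.≤-trans (rank-submod A ⁅ i ⁆) (ℕP.≤-reflexive (trans (cong (λ r → rank A + r) (∈loops⁻ i∈)) (ℕP.+-identityʳ (rank A)))))) (rank-mono {A} (SubP.p⊆p∪q ⁅ i ⁆)))))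

    -- The unique hyperplane is empty, and the sum starts at size 1.
    chow-loopless : Loopless M → SeriesIdentity M 1 ChowSeries
    chow-loopless loopless = identity-unstressed {k = 1} M ChowSeries f (λ _ → f) (λ _ _ → 0) (chowSeries (pointChow-series M rank refl rank⊤ loopless)) (uniform-chow n 1≤n)
        (λ h 1≤h → uniform-chow (suc h) (s≤s z≤n) , looped h 1≤h) (λ h 1≤h → numStressed-0 rank h (none h 1≤h))
      where
      f = pointChow
      none : ∀ h → 1 ≤ h → ∀ A → isStressedHyperplane rank A ≡ true → ∣ A ∣ ≢ h
      none h 1≤h A e size = contradiction (trans (trans (sym (SubP.∣⊥∣≡0 n)) (cong ∣_∣ (sym A≡⊥))) size) (ℕP.<⇒≢ 1≤h)
        where
        A≡⊥ : A ≡ ⊥ₛ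
        A≡⊥ = SubP.Empty-unique (λ (i , i∈) → contradiction (ℕP.≤-trans (loopless i) (ℕP.≤-trans (rank-mono (⁅⁆-⊆ i∈)) (ℕP.≤-reflexive (stressed-rank e)))) λ ())

    -- The series of the matroid is 0 by convention. The only correction comes from the set of
    -- loops; it is the full series of a uniform matroid of rank one, since U(0, h) ⊕ U(1, 1) has
    -- loops for h ≥ 1, and it cancels the series of U(1, n).
    chow-looped : ¬ Loopless M → SeriesIdentity M 1 ChowSeries
    chow-looped looped-M = (λ _ → 0) , f , (λ _ → f) , (λ _ _ → 0) , looped-series rank i (ℕP.n<1⇒n≡0 (ℕP.≰⇒> i-loop)) , uniform-chow n 1≤n ,
          (λ h 1≤h → uniform-chow (suc h) (s≤s z≤n) , looped h 1≤h) , equation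
      where
      f = pointChow
      i = proj₁ (FinP.¬∀⟶∃¬ n _ (λ i → 1 ℕP.≤? rank ⁅ i ⁆) looped-M)
      i-loop = proj₂ (FinP.¬∀⟶∃¬ n _ (λ i → 1 ℕP.≤? rank ⁅ i ⁆) looped-M)
      size : 1 ≤ ∣ loops ∣
      size = ℕP.≤-trans (ℕP.≤-reflexive (sym (SubP.∣⁅x⁆∣≡1 i))) (SubP.p⊆q⇒∣p∣≤∣q∣ (⁅⁆-⊆ (∈loops⁺ (ℕP.n<1⇒n≡0 (ℕP.≰⇒> i-loop)))))
      equation : ∀ d → + 0 ≡ + f d ℤ.- sumFromTo 1 n (λ h → + numStressedHyperplanes rank h ℤ.* (+ f d ℤ.- + 0))
      equation d = sym (trans (cong (λ z → + f d ℤ.- z) (trans (regroup-by-size rank 1 (λ _ → v))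
          (trans (∑ℤ.∑-unique g (unique-allSubsets n) (∈-allSubsets loops) (λ A A≢ → other A A≢ (isStressedHyperplane rank A) refl))
            (trans (cong (λ b → when b (inner loops)) loops-stressed) (trans (size-in-range rank 1 (λ _ → v) loops size) (ℤP.+-identityʳ (+ f d))))))) (ℤP.+-inverseʳ (+ f d)))
        where
        v = + f d ℤ.- + 0
        inner : Subset n → ℤ
        inner A = ∑ (upTo (suc n ∸ 1)) (λ i → when (∣ A ∣ ≡ᵇ (1 + i)) v)
        g : Subset n → ℤ
        g A = when (isStressedHyperplane rank A) (inner A)
        other : ∀ A → A ≢ loops → ∀ b → isStressedHyperplane rank A ≡ b → when b (inner A) ≡ 0ℤ
        other A A≢ false e = refl
        other A A≢ true  e = contradiction (stressed-unique e) A≢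

    chow : SeriesIdentity M 1 ChowSeries
    chow = cases (FinP.all? (λ i → 1 ℕP.≤? rank ⁅ i ⁆))
      where
      cases : Dec (Loopless M) → SeriesIdentity M 1 ChowSeries
      cases (yes loopless) = chow-loopless loopless
      cases (no looped-M)  = chow-looped looped-M

    module _ (Series : ∀ {m} → RankFn m → (ℕ → ℕ) → Set) (g : ℕ → ℕ)
      (series : ∀ {m} (M : Matroid m) rk → Matroid.rank M ≡ rk → rk ⊤ ≡ 1 → Series rk g) where

      equal-series : SeriesIdentity M 1 Series
      equal-series = identity-equal M Series g (λ _ → g) (λ _ → g) (series M rank refl rank⊤) (series (uniformMatroid 1 n) (uniformRank 1 n) refl (uniform-⊤ n 1≤n))
        (λ h _ → series (uniformMatroid 1 (suc h)) (uniformRank 1 (suc h)) refl (uniform-⊤ (suc h) (s≤s z≤n)) , series (coloopExtension 0 h) (uniformRank 0 h ⊕ uniformRank 1 1) refl (coloop-rank-⊤ 0 h z≤n))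
        (λ _ _ → refl)

    -- Augmented series ignore loops, so all matroids of rank one that occur here have the same
    -- series and every difference is 0.
    aug : SeriesIdentity M 1 AugSeries
    aug = equal-series AugSeries pointAug (λ M rk e e′ → augSeries (pointAug-series M rk e e′))

  module RankZeroCase {n : ℕ} (M : Matroid n) (rank⊤ : Matroid.rank M ⊤ ≡ 0) where
    open Matroid M

    -- A hyperplane would have to have rank -1.
    none : ∀ h → + numStressedHyperplanes rank h ≡ 0ℤ
    none h = numStressed-0 rank h (λ A e _ → ℕP.1+n≢0 (trans (ℕP.+-comm 1 (rank A)) (trans (proj₂ (stressedHyperplane⁻ rank A e)) rank⊤)))

    module _ (Series : ∀ {m} → RankFn m → (ℕ → ℕ) → Set) (g₀ g₁ : ℕ → ℕ)
      (series₀ : ∀ {m} (M : Matroid m) rk → Matroid.rank M ≡ rk → rk ⊤ ≡ 0 → Series rk g₀)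
      (series₁ : ∀ {m} (M : Matroid m) rk → Matroid.rank M ≡ rk → rk ⊤ ≡ 1 → Series rk g₁) where

      unstressed-series : SeriesIdentity M 0 Series
      unstressed-series = identity-unstressed M Series g₀ (λ _ → g₀) (λ _ → g₁) (series₀ M rank refl rank⊤) (series₀ (uniformMatroid 0 n) (uniformRank 0 n) refl refl)
        (λ h _ → series₀ (uniformMatroid 0 (suc h)) (uniformRank 0 (suc h)) refl refl , series₁ (coloopExtension 0 h) (uniformRank 0 h ⊕ uniformRank 1 1) refl (coloop-rank-⊤ 0 h z≤n))
        (λ h _ → none h)

    aug : SeriesIdentity M 0 AugSeries
    aug = unstressed-series AugSeries emptyAug pointAug (λ M rk e e′ → augSeries (emptyAug-series M rk e e′)) (λ M rk e e′ → augSeries (pointAug-series M rk e e′))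

  -- Here `k ∸ 1` is 0, so the second family is U(0, h) ⊕ U(1, 1): a point for `h` equal to 0, a
  -- matroid with loops otherwise. There is no hyperplane, and the two main series agree: both are 0
  -- because of loops, unless the ground set is empty.
  chow-rank-zero : ∀ {n} (M : Matroid n) → Matroid.rank M ⊤ ≡ 0 → SeriesIdentity M 0 ChowSeries
  chow-rank-zero {n} M rank⊤ = identity-unstressed {k = 0} M ChowSeries (proj₁ f) (λ _ _ → 0) hB (proj₁ (proj₂ f)) (proj₂ (proj₂ f))
      (λ h _ → looped-series (uniformRank 0 (suc h)) zero refl , hB-series h) (λ h _ → RankZeroCase.none M rank⊤ h)
    where
    hB : ℕ → ℕ → ℕ
    hB zero    = pointChow
    hB (suc h) = λ _ → 0
    hB-series : ∀ h → ChowSeries (uniformRank 0 h ⊕ uniformRank 1 1) (hB h)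
    hB-series zero    = chowSeries (pointChow-series (coloopExtension 0 0) (uniformRank 0 0 ⊕ uniformRank 1 1) refl refl (λ { zero → s≤s z≤n }))
    hB-series (suc h) = coloop-looped h
    both : ∀ {n} (M : Matroid n) → Matroid.rank M ⊤ ≡ 0 → ∃ λ f → ChowSeries (Matroid.rank M) f × ChowSeries (uniformRank 0 n) f
    both {zero}  M _ = emptyChow , chowSeries (emptyChow-series (Matroid.rank M)) , chowSeries (emptyChow-series (uniformRank 0 0))
    both {suc n} M e = (λ _ → 0) , looped-series (Matroid.rank M) zero (ℕP.n≤0⇒n≡0 (ℕP.≤-trans (Matroid.rank-mono M SubP.⊆⊤) (ℕP.≤-reflexive e))) , looped-series (uniformRank 0 (suc n)) zero refl
    f = both M rank⊤

  module _ where
    open Loopless-Polymatroids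

    chow-identity : ∀ {n k} (M : Matroid n) → IsPavingOfRank M k → SeriesIdentity M k ChowSeries
    chow-identity {k = zero} M (rank⊤ , _) = chow-rank-zero M rank⊤
    chow-identity {k = suc zero} M (rank⊤ , _) = RankOneCase.chow M rank⊤
    chow-identity {k = suc (suc k′)} M P =
      General.identity k′ 0 ChowSeries chowPolymatroid (λ M l → chowSeries (LooplessSeries.chowSeries M l)) (λ _ _ _ _ → refl) chow-flat⁺ chow-flat⁻ M (paving-record M P)

    aug-identity : ∀ {n k} (M : Matroid n) → IsPavingOfRank M k → SeriesIdentity M k AugSeries
    aug-identity {k = zero} M (rank⊤ , _) = RankZeroCase.aug M rank⊤
    aug-identity {k = suc zero} M (rank⊤ , _) = RankOneCase.aug M rank⊤
    aug-identity {k = suc (suc k′)} M P =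
      General.identity k′ 1 AugSeries augPolymatroid (λ M l → augSeries (LooplessSeries.augSeries M l)) (λ M l S → augRank-≢⊥ M l {S}) aug-flat⁺ aug-flat⁻ M (paving-record M P)

  chow-pair : ∀ {a b} (r : RankFn a) f (s : RankFn b) g → ChowSeries r f × ChowSeries s g → IsChowHilbertSeries r f × IsChowHilbertSeries s g
  chow-pair r f s g (chowSeries p , chowSeries q) = p , q

  chow-unwrap : ∀ {n k} (M : Matroid n) → SeriesIdentity M k ChowSeries → SeriesIdentity M k IsChowHilbertSeries
  chow-unwrap {n} {k} M (hM , hU , hA , hB , chowSeries sM , chowSeries sU , sAB , e) = hM , hU , hA , hB , sM , sU , sAB′ , e
    where
    sAB′ : ∀ h → k ≤ h → IsChowHilbertSeries (uniformRank k (suc h)) (hA h) × IsChowHilbertSeries (uniformRank (k ∸ 1) h ⊕ uniformRank 1 1) (hB h)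
    sAB′ h le = chow-pair (uniformRank k (suc h)) (hA h) (uniformRank (k ∸ 1) h ⊕ uniformRank 1 1) (hB h) (sAB h le)

  aug-pair : ∀ {a b} (r : RankFn a) f (s : RankFn b) g → AugSeries r f × AugSeries s g → IsAugChowHilbertSeries r f × IsAugChowHilbertSeries s g
  aug-pair r f s g (augSeries p , augSeries q) = p , q

  aug-unwrap : ∀ {n k} (M : Matroid n) → SeriesIdentity M k AugSeries → SeriesIdentity M k IsAugChowHilbertSeries
  aug-unwrap {n} {k} M (hM , hU , hA , hB , augSeries sM , augSeries sU , sAB , e) = hM , hU , hA , hB , sM , sU , sAB′ , e
    where
    sAB′ : ∀ h → k ≤ h → IsAugChowHilbertSeries (uniformRank k (suc h)) (hA h) × IsAugChowHilbertSeries (uniformRank (k ∸ 1) h ⊕ uniformRank 1 1) (hB h)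
    sAB′ h le = aug-pair (uniformRank k (suc h)) (hA h) (uniformRank (k ∸ 1) h ⊕ uniformRank 1 1) (hB h) (sAB h le)

open import Defs
open import Data.Nat using (ℕ; suc; _≤_; _∸_)
open import Data.Integer using (ℤ; +_; _+_; _-_; _*_)
open import Data.Product using (Σ; _×_; _,_)
open import Relation.Binary.PropositionalEquality using (_≡_)
open Identities using (chow-unwrap; chow-identity; aug-unwrap; aug-identity)

theorem3p31 : ∀ {n k} (M : Matroid n) → IsPavingOfRank M k →
    (Σ (ℕ → ℕ) λ hM → Σ (ℕ → ℕ) λ hU → Σ (ℕ → ℕ → ℕ) λ hA → Σ (ℕ → ℕ → ℕ) λ hB →
    IsChowHilbertSeries (Matroid.rank M) hM
    × IsChowHilbertSeries (uniformRank k n) hU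
    × (∀ h → k ≤ h →
    IsChowHilbertSeries (uniformRank k (suc h)) (hA h)
    × IsChowHilbertSeries (uniformRank (k ∸ 1) h ⊕ uniformRank 1 1) (hB h))
    × (∀ d → + hM d ≡ + hU d - sumFromTo k n (λ h →
    + numStressedHyperplanes (Matroid.rank M) h * (+ hA h d - + hB h d))))
    × (Σ (ℕ → ℕ) λ hM → Σ (ℕ → ℕ) λ hU → Σ (ℕ → ℕ → ℕ) λ hA → Σ (ℕ → ℕ → ℕ) λ hB →
    IsAugChowHilbertSeries (Matroid.rank M) hM
    × IsAugChowHilbertSeries (uniformRank k n) hU
    × (∀ h → k ≤ h →
    IsAugChowHilbertSeries (uniformRank k (suc h)) (hA h)
    × IsAugChowHilbertSeries (uniformRank (k ∸ 1) h ⊕ uniformRank 1 1) (hB h))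
    × (∀ d → + hM d ≡ + hU d - sumFromTo k n (λ h →
    + numStressedHyperplanes (Matroid.rank M) h * (+ hA h d - + hB h d))))
theorem3p31 {k = k} M P = chow-unwrap {k = k} M (chow-identity M P) , aug-unwrap {k = k} M (aug-identity M P)
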